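{- Let $K_{3,3}^{i,j}$ be as defined in the context. Then: (a) The family of graphs $\{K_{3,3},K_{3,3}^{0,1},K_{3,3}^{0,2},K_{3,3}^{1,1}\}$ is $2$-rounded (in the class of all graphs). (b) The family of graphs $\{K_{3,3},K_{3,3}^{0,1},K_{3,3}^{0,2},K_{3,3}^{1,1},K_5\}$ is $2$-rounded (in the class of all graphs). (c) The family of matroids $\{M(K_{3,3}),M(K_{3,3}^{0,1}),M(K_{3,3}^{0,2}),M(K_{3,3}^{1,1})\}$ is $2$-rounded in the class of regular matroids. (d) The family of matroids $\{M(K_{3,3}),M(K_{3,3}^{0,1}),M(K_{3,3}^{0,2}),M(K_{3,3}^{1,1}),M(K_5)\}$ is $2$-rounded in the class of regular matroids.
   Context: Graphs may have loops and multiple edges; $M(G)$ denotes the cycle matroid of $G$. Let $U$ and $V$ be the two maximal stable sets (colour classes) of $K_{3,3}$. For $i,j\in\{0,1,2,3\}$, $K_{3,3}^{i,j}$ denotes the simple graph obtained from $K_{3,3}$ by adding $i$ edges each joining a pair of vertices of $U$ and $j$ edges each joining a pair of vertices of $V$ (well defined up to isomorphism). For a family $\mathcal{F}$, an "$\mathcal{F}$-minor" is a minor isomorphic to some member of $\mathcal{F}$. A family $\mathcal{F}$ of graphs (resp. matroids) is $k$-rounded in a minor-closed class $\mathcal{N}$ of graphs (resp. matroids) if every member of $\mathcal{F}$ is $(k+1)$-connected and, for every $(k+1)$-connected graph (resp. matroid) $M$ in $\mathcal{N}$ having an $\mathcal{F}$-minor and every $k$-element subset $X\subseteq E(M)$,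 $M$ has an $\mathcal{F}$-minor whose edge set (resp. ground set) contains $X$. When $\mathcal{N}$ is not mentioned it is the class of all graphs (resp. matroids). -}

module Defs where

open import Level using (0ℓ)
open import Data.Nat using (ℕ; zero; suc; _+_; _<_; _≤_)
open import Data.Bool using (Bool; true; false; _∧_; _∨_)
open import Data.Fin using (Fin; #_; _≟_)
open import Data.Fin.Subset using (Subset; _∈_; _∉_; _⊆_; ⁅_⁆; ∁; _∪_; _-_; ∣_∣; ⊤; ⊥)
open import Data.Vec using (tabulate)
open import Data.Maybe using (Maybe; just; nothing)
open import Data.Product using (Σ; ∃; ∃-syntax; _×_; _,_; proj₁; proj₂)
open import Data.Sum using (_⊎_)
open import Data.List using (List; []; _∷_; length; lookup)
open import Data.List.Membership.Propositional using () renaming (_∈_ to _∈ₗ_)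
open import Relation.Binary.PropositionalEquality using (_≡_)
open import Relation.Binary.Construct.Closure.ReflexiveTransitive using (Star)
open import Relation.Nullary using (¬_; does)
open import Function.Base using (_∘_)
open import Function.Definitions using (Injective)
open import Function.Bundles using (_⇔_)
open import Algebra.Bundles using (CommutativeRing)

-- Graphs (loops and multiple edges allowed): vertices Fin nV, edges Fin nE,
-- each edge has an (ordered, but used as unordered) pair of ends.

record Graph : Set where
  field
    nV   : ℕ
    nE   : ℕ
    ends : Fin nE → Fin nV × Fin nV

open Graph public

end₁ end₂ : (G : Graph) → Fin (nE G) → Fin (nV G)
end₁ G e = proj₁ (ends G e)
end₂ G e = proj₂ (ends G e)

AdjVia : (G : Graph) → (Fin (nE G) → Set) → Fin (nV G) → Fin (nV G) → Set
AdjVia G P u w = ∃[ e ] (P e × ((ends G e ≡ (u , w)) ⊎ (ends G e ≡ (w , u))))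

ReachVia : (G : Graph) → (Fin (nE G) → Set) → Fin (nV G) → Fin (nV G) → Set
ReachVia G P = Star (AdjVia G P)

Reach : (G : Graph) → Subset (nE G) → Fin (nV G) → Fin (nV G) → Set
Reach G S = ReachVia G (_∈ S)

Simple : Graph → Set
Simple G =
  (∀ e → ¬ (end₁ G e ≡ end₂ G e)) ×
  (∀ e f → ((ends G e ≡ ends G f) ⊎ (ends G e ≡ (end₂ G f , end₁ G f))) → e ≡ f)

ConnectedAvoiding : (G : Graph) → Subset (nV G) → Set
ConnectedAvoiding G T =
  ∀ u w → u ∉ T → w ∉ T →
    ReachVia G (λ e → end₁ G e ∉ T × end₂ G e ∉ T) u w

-- n-connected graph: simple, more than n vertices, and no set of fewer
-- than n vertices whose deletion disconnects the graph.
-- (Only used with n = 3, where simplicity is part of 3-connectivity.)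
ConnectedGraph : ℕ → Graph → Set
ConnectedGraph n G =
  Simple G × n < nV G × (∀ (T : Subset (nV G)) → ∣ T ∣ < n → ConnectedAvoiding G T)

-- H is isomorphic to a minor G / C \ D (minus some isolated vertices)
-- of G, by an isomorphism whose edge map is ψ.
-- β sends each vertex of G to the vertex of H its contracted class becomes,
-- or to nothing when that class is deleted.
record MinorModel (G H : Graph) : Set where
  field
    C     : Subset (nE G)
    β     : Fin (nV G) → Maybe (Fin (nV H))
    ψ     : Fin (nE H) → Fin (nE G)
    ψ-inj : Injective _≡_ _≡_ ψ
    ψ∉C   : ∀ x → ψ x ∉ C
    β-onto  : ∀ u → ∃[ g ] (β g ≡ just u)
    C-closed : ∀ c → c ∈ C → β (end₁ G c) ≡ β (end₂ G c)
    C-conn  : ∀ g g' u → β g ≡ just u → β g' ≡ just u → Reach G C g g'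
    ψ-ends  : ∀ x →
      ((β (end₁ G (ψ x)) ≡ just (end₁ H x)) × (β (end₂ G (ψ x)) ≡ just (end₂ H x))) ⊎
      ((β (end₁ G (ψ x)) ≡ just (end₂ H x)) × (β (end₂ G (ψ x)) ≡ just (end₁ H x)))

HasMinorContaining : (G H : Graph) → Subset (nE G) → Set
HasMinorContaining G H X =
  Σ (MinorModel G H) λ m → ∀ g → g ∈ X → ∃[ x ] (MinorModel.ψ m x ≡ g)

HasFamilyMinorContaining : (G : Graph) → List Graph → Subset (nE G) → Set
HasFamilyMinorContaining G 𝓕 X = ∃[ H ] (H ∈ₗ 𝓕 × HasMinorContaining G H X)

HasFamilyMinor : (G : Graph) → List Graph → Set
HasFamilyMinor G 𝓕 = HasFamilyMinorContaining G 𝓕 ⊥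

GraphRounded : ℕ → List Graph → Set
GraphRounded k 𝓕 =
  (∀ H → H ∈ₗ 𝓕 → ConnectedGraph (suc k) H) ×
  (∀ (G : Graph) → ConnectedGraph (suc k) G → HasFamilyMinor G 𝓕 →
     ∀ (X : Subset (nE G)) → ∣ X ∣ ≡ k → HasFamilyMinorContaining G 𝓕 X)

IndepPred : ℕ → Set₁
IndepPred n = Subset n → Set

record Matroid (n : ℕ) : Set₁ where
  field
    Indep      : IndepPred n
    indep-∅    : Indep ⊥
    indep-⊆    : ∀ {X Y} → Y ⊆ X → Indep X → Indep Y
    indep-aug  : ∀ {X Y} → Indep X → Indep Y → ∣ X ∣ < ∣ Y ∣ →
                 ∃[ e ] (e ∈ Y × e ∉ X × Indep (⁅ e ⁆ ∪ X))

RankIs : ∀ {n} → IndepPred n → Subset n → ℕ → Set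
RankIs I X k =
  (∃[ Y ] (Y ⊆ X × I Y × ∣ Y ∣ ≡ k)) × (∀ Y → Y ⊆ X → I Y → ∣ Y ∣ ≤ k)

Separation : ∀ {n} → IndepPred n → ℕ → Subset n → Set
Separation I j X =
  j ≤ ∣ X ∣ × j ≤ ∣ ∁ X ∣ ×
  (∀ a b c → RankIs I X a → RankIs I (∁ X) b → RankIs I ⊤ c → a + b < c + j)

ConnectedMatroid : ∀ {n} → ℕ → IndepPred n → Set
ConnectedMatroid m I = ∀ j → 1 ≤ j → j < m → ∀ X → ¬ Separation I j X

anyFin : ∀ {m} → (Fin m → Bool) → Bool
anyFin {zero}  f = false
anyFin {suc m} f = f Fin.zero ∨ anyFin (f ∘ Fin.suc)
  where import Data.Fin as Fin

image : ∀ {m n} → (Fin m → Fin n) → Subset m → Subset n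
image {m} ψ Y = tabulate λ i → anyFin λ j → Data.Vec.lookup Y j ∧ does (ψ j ≟ i)
  where import Data.Vec

-- Z (disjoint from C) is independent in M / C :  r(Z ∪ C) = |Z| + r(C)
IndepContract : ∀ {n} → IndepPred n → Subset n → Subset n → Set
IndepContract I C Z = ∀ a b → RankIs I (Z ∪ C) a → RankIs I C b → a ≡ ∣ Z ∣ + b

-- M (indep. pred. I on Fin n) has a minor M / C \ D isomorphic to the
-- matroid N (indep. pred. J on Fin m), via ψ : E(N) → E(M), whose ground set
-- (the image of ψ) contains X.
HasMatroidMinorContaining : ∀ {n m} → IndepPred n → IndepPred m → Subset n → Set
HasMatroidMinorContaining {n} {m} I J X =
  ∃[ C ] ∃[ ψ ] (Injective _≡_ _≡_ ψ × (∀ x → ψ x ∉ C) ×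
    (∀ g → g ∈ X → ∃[ x ] (ψ x ≡ g)) ×
    (∀ (Y : Subset m) → J Y ⇔ IndepContract I C (image ψ Y)))

-- Cycle matroid M(G): independent sets are the edge sets of forests,
-- i.e. sets Y such that no edge e ∈ Y has its ends joined by a path in Y - e
-- (so in particular Y contains no loop).
Forest : (G : Graph) → IndepPred (nE G)
Forest G Y = ∀ e → e ∈ Y → ¬ Reach G (Y - e) (end₁ G e) (end₂ G e)

IndepSystem : Set₁
IndepSystem = Σ ℕ IndepPred

M[_] : Graph → IndepSystem
M[ G ] = nE G , Forest G

HasMatroidFamilyMinorContaining : ∀ {n} → IndepPred n → List IndepSystem → Subset n → Set₁
HasMatroidFamilyMinorContaining I 𝓕 X =
  ∃[ N ] (N ∈ₗ 𝓕 × HasMatroidMinorContaining I (proj₂ N) X)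

MatroidRounded : ℕ → (∀ {n} → Matroid n → Set₁) → List IndepSystem → Set₁
MatroidRounded k 𝓝 𝓕 =
  (∀ N → N ∈ₗ 𝓕 → ConnectedMatroid (suc k) (proj₂ N)) ×
  (∀ n (M : Matroid n) → 𝓝 M → ConnectedMatroid (suc k) (Matroid.Indep M) →
     HasMatroidFamilyMinorContaining (Matroid.Indep M) 𝓕 ⊥ →
     ∀ (X : Subset n) → ∣ X ∣ ≡ k →
       HasMatroidFamilyMinorContaining (Matroid.Indep M) 𝓕 X)

record Field : Set₁ where
  field
    commRing : CommutativeRing 0ℓ 0ℓ
  open CommutativeRing commRing public
  field
    1≉0     : ¬ (1# ≈ 0#)
    inverse : ∀ x → ¬ (x ≈ 0#) → ∃[ y ] (x * y ≈ 1#)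

LinIndep : (F : Field) → ∀ {r n} → (Fin r → Fin n → Field.Carrier F) → Subset n → Set
LinIndep F {r} {n} A X =
  ∀ (c : Fin n → Carrier) → (∀ j → j ∉ X → c j ≈ 0#) →
    (∀ i → sum (λ j → c j * A i j) ≈ 0#) → ∀ j → c j ≈ 0#
  where
  open Field F
  open import Algebra.Definitions.RawMonoid +-rawMonoid using (sum)

RepresentableOver : (F : Field) → ∀ {n} → Matroid n → Set
RepresentableOver F {n} M =
  ∃[ r ] ∃[ A ] (∀ X → Matroid.Indep M X ⇔ LinIndep F {r} {n} A X)

Regular : ∀ {n} → Matroid n → Set₁
Regular M = ∀ (F : Field) → RepresentableOver F M

-- The specific graphs.  U = {0,1,2}, V = {3,4,5}.

mkGraph : (v : ℕ) → List (Fin v × Fin v) → Graph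
mkGraph v es = record { nV = v ; nE = length es ; ends = lookup es }

K33edges : List (Fin 6 × Fin 6)
K33edges =
  (# 0 , # 3) ∷ (# 0 , # 4) ∷ (# 0 , # 5) ∷
  (# 1 , # 3) ∷ (# 1 , # 4) ∷ (# 1 , # 5) ∷
  (# 2 , # 3) ∷ (# 2 , # 4) ∷ (# 2 , # 5) ∷ []

K33 K33⁰¹ K33⁰² K33¹¹ K5 : Graph
K33   = mkGraph 6 K33edges
K33⁰¹ = mkGraph 6 ((# 3 , # 4) ∷ K33edges)
K33⁰² = mkGraph 6 ((# 3 , # 4) ∷ (# 4 , # 5) ∷ K33edges)
K33¹¹ = mkGraph 6 ((# 0 , # 1) ∷ (# 3 , # 4) ∷ K33edges)
K5 = mkGraph 5
  ((# 0 , # 1) ∷ (# 0 , # 2) ∷ (# 0 , # 3) ∷ (# 0 , # 4) ∷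
   (# 1 , # 2) ∷ (# 1 , # 3) ∷ (# 1 , # 4) ∷
   (# 2 , # 3) ∷ (# 2 , # 4) ∷ (# 3 , # 4) ∷ [])

-- All four parts are statements about binary matroids, given here by their
-- cycle spaces.  Let K be 3-connected with a minor N = K33, K33⁰¹ or K5 that
-- contains e, and let f be another element.  Elements outside N ∪ f are
-- contracted or deleted one at a time, following Tutte's linking theorem, such
-- that {e , f} stays connected to N - e with connectivity two; e and f may
-- change places in the minor.  If this gets stuck at an element, it lies in a
-- triad or triangle with e and f, and two stuck elements allow a further
-- reduction, so that at last f and at most one more element extend N.  These
-- extensions are finitely many, and each has a member of the family containing
-- e and f, or the Fano plane, as a minor.  The Fano plane is not ternary, hence
-- it is not a minor of a regular matroid.  Each member of the family contains
-- one of the three graphs N through any given edge, and so e and then f can be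
-- brought in.
--
-- The cycle matroid of a 3-connected graph is 3-connected, since a partition
-- of the edges with three vertices incident with both sides is crossed by two
-- independent cycles.  If the cycle matroid of G has a minor isomorphic to that
-- of a member H of the family, then H is a minor of G: a cut of H that meets
-- certain circuits at most twice is the star of a vertex, and the vertices of
-- the contraction of G provide such cuts.

module Submission where

open import Defs
open import Data.Bool using (Bool; true; false; _∧_; _∨_; not; _xor_; if_then_else_; T)
open import Data.Bool.ListAction using (all; any)
import Data.Bool.Properties as Boolₚ
open import Data.Empty using () renaming (⊥ to Empty; ⊥-elim to absurd)
open import Data.Fin using (Fin; zero; suc; #_) renaming (_≟_ to _≟F_)
import Data.Fin.Properties as Finₚ
open import Data.Fin.Subset using (Subset; _∈_; _∉_; _⊆_; ⁅_⁆; ∁; _∪_; _∩_; _-_; _─_; ∣_∣; ⊤; ⊥)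
import Data.Fin.Subset.Properties as Subₚ
open import Data.List using (List; []; _∷_; _++_; length; map; filter; allFin)
import Data.List
import Data.List.Properties as Listₚ
import Data.List.Membership.DecPropositional as DecMembership
open import Data.List.Membership.Propositional using () renaming (_∈_ to _∈ₗ_)
import Data.List.Membership.Propositional.Properties as Memₚ
open import Data.List.Relation.Binary.Permutation.Propositional using (_↭_; ↭-sym) renaming (refl to ↭refl; prep to ↭prep; swap to ↭swap; trans to ↭trans)
import Data.List.Relation.Binary.Permutation.Propositional.Properties as Permₚ
open import Data.List.Relation.Unary.Any using (here; there)
open import Data.Maybe using (Maybe; just; nothing)
open import Data.Maybe.Properties using (just-injective)
open import Data.Nat using (ℕ; zero; suc; _+_; _∸_; _^_; _≤_; _<_; z≤n; s≤s; _≤ᵇ_; _≡ᵇ_; _≤?_; _<?_)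
open import Data.Nat.DivMod using (_/_; _%_; _mod_)
open import Data.Nat.Properties using (≤-refl; ≤-trans; ≤-reflexive; ≤-antisym; ≤ᵇ⇒≤; +-mono-≤; +-monoʳ-≤; +-monoˡ-≤; +-comm; +-assoc; +-identityʳ; +-cancelˡ-≤; +-cancelʳ-≤; +-cancelˡ-≡; +-cancelʳ-≡; m≤n+m; m+n∸n≡m; m+[n∸m]≡n; ≰⇒>; <⇒≱; n≤0⇒n≡0; +-suc; suc-injective; ≤-pred)
open import Data.Nat.Solver using (module +-*-Solver)
open import Data.Product using (Σ; ∃; ∃-syntax; _×_; _,_; proj₁; proj₂)
open import Data.Sum using (_⊎_; inj₁; inj₂)
open import Data.Unit using (tt)
open import Data.Vec using (Vec; []; _∷_; lookup; tabulate; zipWith)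
import Data.Vec.Properties as Vecₚ
open import Function.Base using (_∘_; id)
open import Function.Bundles using (mk⇔; Equivalence)
open import Function.Definitions using (Injective)
open import Relation.Binary.Construct.Closure.ReflexiveTransitive using (ε; _◅_; _◅◅_)
open import Relation.Binary.PropositionalEquality using (_≡_; _≢_; refl; sym; trans; cong; cong₂; subst; subst₂; isEquivalence; module ≡-Reasoning)
open import Relation.Nullary using (¬_; Dec; yes; no; does)
open import Relation.Nullary.Decidable using (_×-dec_; _⊎-dec_; _→-dec_; ¬?; map′; from-yes; decidable-stable)
import Data.List.Relation.Unary.All as All
import Data.List.Relation.Unary.AllPairs as Unique
import Data.List.Relation.Unary.Unique.Propositional as Unique
import Data.List.Relation.Unary.Unique.Propositional.Properties as Uniqueₚ
import Data.List.Relation.Unary.All.Properties as Allₚ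

-- The reduction never handles the minor through its cycles. The minor is held fixed through its
-- rank function, so that keeping it, while `e` and `f` exchange roles and other elements change
-- between contraction and deletion, amounts to equations between ranks. These equations and all
-- connectivity claims are linear consequences of the rank axioms. Colouring the ground set by a
-- finite type turns every set that occurs into a Boolean function of the colour; a proof is then a
-- list of known inequalities, and evaluation checks that their sum yields the goal. That the
-- matroid is binary matters at the two ends of this process: afterwards the cycle space of the
-- minor is recovered from its independent sets, and an extension of `N` by one or two elements is
-- described by a few bits, which makes the extensions a finite table. Each table entry is a
-- certificate whose check is linear algebra on generators, without enumeration of the cycles of the
-- extension.

_∈ₗ?_ : ∀ {n} (i : Fin n) (l : List (Fin n)) → Dec (i ∈ₗ l)
_∈ₗ?_ {n} = DecMembership._∈?_ (_≟F_ {n})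

-- Binary matroids and their rank functions

infixl 6 _⊕_
_⊕_ : ∀ {n} → Subset n → Subset n → Subset n
_⊕_ = zipWith _xor_

-- A binary matroid is given by its cycle space.
record Binary (n : ℕ) : Set₁ where
  field
    Cycle   : Subset n → Set
    cycle-⊥ : Cycle ⊥
    cycle-⊕ : ∀ {c d} → Cycle c → Cycle d → Cycle (c ⊕ d)
    cycle?  : ∀ c → Dec (Cycle c)

open Binary public

lookup-⊕ : ∀ {n} (c d : Subset n) i → lookup (c ⊕ d) i ≡ lookup c i xor lookup d i
lookup-⊕ c d i = Vecₚ.lookup-zipWith _xor_ i c d

xor-true : ∀ a b → a xor b ≡ true → a ≡ true ⊎ b ≡ true
xor-true true  b _ = inj₁ refl
xor-true false b e = inj₂ e

bool-split : ∀ b → b ≡ true ⊎ b ≡ false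
bool-split true  = inj₁ refl
bool-split false = inj₂ refl

false≢true : ∀ {b} → b ≡ true → b ≡ false → Empty
false≢true refl ()

infix 4 _⊑_
_⊑_ : ∀ {n} → Subset n → List (Fin n) → Set
c ⊑ l = ∀ i → lookup c i ≡ true → i ∈ₗ l

_⊆ₗ_ : ∀ {n} → List (Fin n) → List (Fin n) → Set
l ⊆ₗ l′ = ∀ {i} → i ∈ₗ l → i ∈ₗ l′

module Closure {n} (K : Binary n) where

  Spans : List (Fin n) → Fin n → Set
  Spans l j = j ∈ₗ l ⊎ (∃[ c ] (Cycle K c × lookup c j ≡ true × c ⊑ (j ∷ l)))

  spans? : ∀ l j → Dec (Spans l j)
  spans? l j = (j ∈ₗ? l) ⊎-dec Subₚ.anySubset? λ c →
    cycle? K c ×-dec (lookup c j Boolₚ.≟ true) ×-dec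
    Finₚ.all? λ i → (lookup c i Boolₚ.≟ true) →-dec (i ∈ₗ? (j ∷ l))

  ∷-mono : ∀ {l l′} {j : Fin n} → l ⊆ₗ l′ → (j ∷ l) ⊆ₗ (j ∷ l′)
  ∷-mono s (here e)  = here e
  ∷-mono s (there m) = there (s m)

  spans-mono : ∀ {l l′ j} → l ⊆ₗ l′ → Spans l j → Spans l′ j
  spans-mono s (inj₁ m) = inj₁ (s m)
  spans-mono s (inj₂ (c , cc , cj , sup)) = inj₂ (c , cc , cj , λ i e → ∷-mono s (sup i e))

  -- The cycle that witnesses `Spans l i` is added in order to cancel `i`. It avoids `j`, unless `j`
  -- is `i` or already belongs to `l`, and in these cases the claim is immediate.
  spans-cut : ∀ {l i j} → Spans (i ∷ l) j → Spans l i → Spans l j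
  spans-cut (inj₁ (here refl)) q = q
  spans-cut (inj₁ (there m))   q = inj₁ m
  spans-cut {l} {i} {j} (inj₂ (c , cc , cj , sup)) q with bool-split (lookup c i)
  ... | inj₂ ci = inj₂ (c , cc , cj , λ k e → drop k e (sup k e))
    where
    drop : ∀ k → lookup c k ≡ true → k ∈ₗ (j ∷ i ∷ l) → k ∈ₗ (j ∷ l)
    drop k e (here p)            = here p
    drop k e (there (here refl)) = absurd (false≢true e ci)
    drop k e (there (there m))   = there m
  ... | inj₁ ci = eliminate q
    where
    drop : (k : Fin n) → i ∈ₗ l → k ∈ₗ (j ∷ i ∷ l) → k ∈ₗ (j ∷ l)
    drop k m (here p)            = here p
    drop k m (there (here refl)) = there m
    drop k m (there (there m′))  = there m′
    eliminate : Spans l i → Spans l j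
    eliminate (inj₁ m) = inj₂ (c , cc , cj , λ k e → drop k m (sup k e))
    eliminate (inj₂ (d , dc , di , sup′)) with bool-split (lookup d j)
    ... | inj₁ dj with sup′ j dj
    ... | here refl = inj₂ (d , dc , di , sup′)
    ... | there m   = inj₁ m
    eliminate (inj₂ (d , dc , di , sup′)) | inj₂ dj =
      inj₂ (c ⊕ d , cycle-⊕ K cc dc , trans (lookup-⊕ c d j) (cong₂ _xor_ cj dj) , sup″)
      where
      here-i : ∀ {A : Set} → lookup (c ⊕ d) i ≡ true → A
      here-i e = absurd (false≢true e (trans (lookup-⊕ c d i) (cong₂ _xor_ ci di)))
      sup″ : (c ⊕ d) ⊑ (j ∷ l)
      sup″ k e with xor-true (lookup c k) (lookup d k) (trans (sym (lookup-⊕ c d k)) e)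
      sup″ k e | inj₁ ck with sup k ck
      ... | here p            = here p
      ... | there (here refl) = here-i e
      ... | there (there m)   = there m
      sup″ k e | inj₂ dk with sup′ k dk
      ... | here refl = here-i e
      ... | there m   = there m

  spans-exchange : ∀ {l i j} → Spans (j ∷ l) i → ¬ Spans l i → Spans (i ∷ l) j
  spans-exchange (inj₁ (here refl)) _ = inj₁ (here refl)
  spans-exchange (inj₁ (there m)) ns  = absurd (ns (inj₁ m))
  spans-exchange {l} {i} {j} (inj₂ (c , cc , ci , sup)) ns with bool-split (lookup c j)
  ... | inj₁ cj = inj₂ (c , cc , cj , λ k e → flip (sup k e))
    where
    flip : ∀ {k} → k ∈ₗ (i ∷ j ∷ l) → k ∈ₗ (j ∷ i ∷ l)
    flip (here p)          = there (here p)
    flip (there (here p))  = here p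
    flip (there (there m)) = there (there m)
  ... | inj₂ cj = absurd (ns (inj₂ (c , cc , ci , λ k e → drop k e (sup k e))))
    where
    drop : ∀ k → lookup c k ≡ true → k ∈ₗ (i ∷ j ∷ l) → k ∈ₗ (i ∷ l)
    drop k e (here p)            = here p
    drop k e (there (here refl)) = absurd (false≢true e cj)
    drop k e (there (there m))   = there m

  cost : ∀ {A : Set} → Dec A → ℕ
  cost (yes _) = 0
  cost (no _)  = 1

  gain : List (Fin n) → Fin n → ℕ
  gain l j = cost (spans? l j)

  cost-yes : ∀ {A : Set} (d : Dec A) → A → cost d ≡ 0
  cost-yes (yes _) _ = refl
  cost-yes (no na) a = absurd (na a)

  cost-no : ∀ {A : Set} (d : Dec A) → ¬ A → cost d ≡ 1
  cost-no (yes a) na = absurd (na a)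
  cost-no (no _)  _  = refl

  cost≡0 : ∀ {A : Set} (d : Dec A) → cost d ≡ 0 → A
  cost≡0 (yes a) _ = a

  cost≤1 : ∀ {A : Set} (d : Dec A) → cost d ≤ 1
  cost≤1 (yes _) = z≤n
  cost≤1 (no _)  = ≤-refl

  gain-spanned : ∀ {l j} → Spans l j → gain l j ≡ 0
  gain-spanned {l} {j} = cost-yes (spans? l j)

  gain-free : ∀ {l j} → ¬ Spans l j → gain l j ≡ 1
  gain-free {l} {j} = cost-no (spans? l j)

  gain≤1 : ∀ l j → gain l j ≤ 1
  gain≤1 l j = cost≤1 (spans? l j)

  gain≡0⇒spans : ∀ {l j} → gain l j ≡ 0 → Spans l j
  gain≡0⇒spans {l} {j} = cost≡0 (spans? l j)

  cost-anti : ∀ {A B : Set} (d : Dec A) (e : Dec B) → (A → B) → cost e ≤ cost d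
  cost-anti d       (yes _) _ = z≤n
  cost-anti (no _)  (no _)  _ = ≤-refl
  cost-anti (yes a) (no nb) f = absurd (nb (f a))

  gain-anti : ∀ {l l′} j → l ⊆ₗ l′ → gain l′ j ≤ gain l j
  gain-anti {l} {l′} j s = cost-anti (spans? l j) (spans? l′ j) (spans-mono s)

  -- Both sides are the rank of `i` and `j` over `l`. If `l` spans neither, exchange makes each
  -- spanned over the other exactly when the other is. This symmetry is what makes the greedy `rk`
  -- independent of the order of the list.
  gain-swap : ∀ l i j → gain (j ∷ l) i + gain l j ≡ gain (i ∷ l) j + gain l i
  gain-swap l i j = go (spans? l i) (spans? l j)
    where
    go : Dec (Spans l i) → Dec (Spans l j) → gain (j ∷ l) i + gain l j ≡ gain (i ∷ l) j + gain l i
    go (yes p) (yes q) = cong₂ _+_ (trans (gain-spanned (spans-mono there p)) (sym (gain-spanned (spans-mono there q))))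
                                   (trans (gain-spanned q) (sym (gain-spanned p)))
    go (yes p) (no nq) = trans (cong₂ _+_ (gain-spanned (spans-mono there p)) (gain-free nq))
                          (sym (cong₂ _+_ (gain-free λ s → nq (spans-cut s p)) (gain-spanned p)))
    go (no np) (yes q) = trans (cong₂ _+_ (gain-free λ s → np (spans-cut s q)) (gain-spanned q))
                          (sym (cong₂ _+_ (gain-spanned (spans-mono there q)) (gain-free np)))
    go (no np) (no nq) = cong₂ _+_
      (≤-antisym (cost-anti (spans? (i ∷ l) j) (spans? (j ∷ l) i) (λ s → spans-exchange s nq))
                 (cost-anti (spans? (j ∷ l) i) (spans? (i ∷ l) j) (λ s → spans-exchange s np)))
      (trans (gain-free nq) (sym (gain-free np)))

  rk : List (Fin n) → ℕ
  rk []      = 0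
  rk (j ∷ l) = gain l j + rk l

  gain-↭ : ∀ {l l′} j → l ↭ l′ → gain l j ≡ gain l′ j
  gain-↭ j p = ≤-antisym (gain-anti j (Permₚ.∈-resp-↭ (↭-sym p))) (gain-anti j (Permₚ.∈-resp-↭ p))

  rk-↭ : ∀ {l l′} → l ↭ l′ → rk l ≡ rk l′
  rk-↭ ↭refl = refl
  rk-↭ {j ∷ l} {_ ∷ l′} (↭prep _ p) = cong₂ _+_ (gain-↭ j p) (rk-↭ p)
  rk-↭ {i ∷ j ∷ l} {_ ∷ _ ∷ l′} (↭swap _ _ p) = begin
    gain (j ∷ l) i + (gain l j + rk l)    ≡⟨ sym (+-assoc (gain (j ∷ l) i) _ _) ⟩
    gain (j ∷ l) i + gain l j + rk l      ≡⟨ cong (_+ rk l) (gain-swap l i j) ⟩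
    gain (i ∷ l) j + gain l i + rk l      ≡⟨ +-assoc (gain (i ∷ l) j) _ _ ⟩
    gain (i ∷ l) j + (gain l i + rk l)    ≡⟨ cong₂ _+_ (gain-↭ j (↭prep i p)) (cong₂ _+_ (gain-↭ i p) (rk-↭ p)) ⟩
    gain (i ∷ l′) j + (gain l′ i + rk l′) ∎
    where open ≡-Reasoning
  rk-↭ (↭trans p q) = trans (rk-↭ p) (rk-↭ q)

  rk-absorb : ∀ l {l′} → l ⊆ₗ l′ → rk (l ++ l′) ≡ rk l′
  rk-absorb [] s = refl
  rk-absorb (j ∷ l) s = cong₂ _+_ (gain-spanned (inj₁ (Memₚ.∈-++⁺ʳ l (s (here refl))))) (rk-absorb l (s ∘ there))

  rk≤rk-++ : ∀ l l′ → rk l′ ≤ rk (l ++ l′)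
  rk≤rk-++ [] l′ = ≤-refl
  rk≤rk-++ (j ∷ l) l′ = ≤-trans (rk≤rk-++ l l′) (m≤n+m _ (gain (l ++ l′) j))

  rk-mono : ∀ {l l′} → l ⊆ₗ l′ → rk l ≤ rk l′
  rk-mono {l} {l′} s = ≤-trans (rk≤rk-++ l′ l) (≤-reflexive (trans (rk-↭ (Permₚ.++-comm l′ l)) (rk-absorb l s)))

  ++-monoʳ : ∀ l {m m′ : List (Fin n)} → m ⊆ₗ m′ → (l ++ m) ⊆ₗ (l ++ m′)
  ++-monoʳ l s x with Memₚ.∈-++⁻ l x
  ... | inj₁ y = Memₚ.∈-++⁺ˡ y
  ... | inj₂ y = Memₚ.∈-++⁺ʳ l (s y)

  -- Submodularity as diminishing returns: along `l` every single gain over `m′` is at most the gain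
  -- over `m`.
  rk-submod : ∀ l {m m′} → m ⊆ₗ m′ → rk (l ++ m′) + rk m ≤ rk (l ++ m) + rk m′
  rk-submod [] {m} {m′} s = ≤-reflexive (+-comm (rk m′) (rk m))
  rk-submod (j ∷ l) {m} {m′} s = ≤-trans (≤-reflexive (+-assoc (gain (l ++ m′) j) _ _))
    (≤-trans (+-mono-≤ (gain-anti j (++-monoʳ l s)) (rk-submod l s))
             (≤-reflexive (sym (+-assoc (gain (l ++ m) j) _ _))))

-- Polymatroids of binary matroids.

elements : ∀ {n} → (Fin n → Bool) → List (Fin n)
elements p = filter (λ i → p i Boolₚ.≟ true) (allFin _)

∈-elements⁺ : ∀ {n} (p : Fin n → Bool) {i} → p i ≡ true → i ∈ₗ elements p
∈-elements⁺ p e = Memₚ.∈-filter⁺ (λ i → p i Boolₚ.≟ true) (Memₚ.∈-allFin _) e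

∈-elements⁻ : ∀ {n} (p : Fin n → Bool) {i} → i ∈ₗ elements p → p i ≡ true
∈-elements⁻ p m = proj₂ (Memₚ.∈-filter⁻ (λ i → p i Boolₚ.≟ true) {xs = allFin _} m)

-- Subsets of a ground set are given by characteristic functions, so that
-- the sets cut out by a colouring are definitionally stable under recolouring.
record Polymatroid (n : ℕ) : Set where
  field
    R      : (Fin n → Bool) → ℕ
    R-∅    : ∀ {p} → (∀ i → p i ≡ false) → R p ≡ 0
    R-mono : ∀ {p q} → (∀ i → p i ≡ true → q i ≡ true) → R p ≤ R q
    R-unit : ∀ g → R (λ i → does (i ≟F g)) ≤ 1
    R-sub  : ∀ p q → R (λ i → p i ∧ q i) + R (λ i → p i ∨ q i) ≤ R p + R q

∧-true : ∀ {a b} → a ∧ b ≡ true → a ≡ true × b ≡ true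
∧-true {true} e = refl , e
∧-true {false} ()

∨-true : ∀ {a b} → a ∨ b ≡ true → a ≡ true ⊎ b ≡ true
∨-true {true} e = inj₁ refl
∨-true {false} e = inj₂ e

∨-left : ∀ {a b} → a ≡ true → a ∨ b ≡ true
∨-left refl = refl

∨-right : ∀ {a b} → b ≡ true → a ∨ b ≡ true
∨-right {true}  _ = refl
∨-right {false} e = e

∧-both : ∀ {a b} → a ≡ true → b ≡ true → a ∧ b ≡ true
∧-both refl refl = refl

binary⇒polymatroid : ∀ {n} → Binary n → Polymatroid n
binary⇒polymatroid K = record
  { R      = λ p → rk (elements p)
  ; R-∅    = λ {p} e → n≤0⇒n≡0 (rk-mono {elements p} {[]} λ {i} m → absurd (false≢true (∈-elements⁻ p m) (e i)))
  ; R-mono = λ {p} {q} s → rk-mono λ {i} m → ∈-elements⁺ q (s i (∈-elements⁻ p m))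
  ; R-unit = λ g → ≤-trans (rk-mono {elements (λ i → does (i ≟F g))} {g ∷ []} (single g)) (≤-trans (≤-reflexive (+-identityʳ _)) (gain≤1 [] g))
  ; R-sub  = submod
  }
  where
  open Closure K
  single : ∀ g → elements (λ i → does (i ≟F g)) ⊆ₗ (g ∷ [])
  single g {i} m with i ≟F g | ∈-elements⁻ (λ i → does (i ≟F g)) m
  ... | yes e | _ = here e
  submod : ∀ p q → rk (elements (λ i → p i ∧ q i)) + rk (elements (λ i → p i ∨ q i)) ≤ rk (elements p) + rk (elements q)
  submod p q = ≤-trans (≤-trans (≤-reflexive (+-comm (rk A) _)) (+-monoˡ-≤ (rk A) (rk-mono left)))
    (≤-trans (rk-submod (elements p) inter) (+-monoˡ-≤ (rk (elements q)) (rk-mono right)))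
    where
    A = elements (λ i → p i ∧ q i)
    inter : A ⊆ₗ elements q
    inter m = ∈-elements⁺ q (proj₂ (∧-true (∈-elements⁻ (λ i → p i ∧ q i) m)))
    left : elements (λ i → p i ∨ q i) ⊆ₗ (elements p ++ elements q)
    left m with ∨-true (∈-elements⁻ (λ i → p i ∨ q i) m)
    ... | inj₁ e = Memₚ.∈-++⁺ˡ (∈-elements⁺ p e)
    ... | inj₂ e = Memₚ.∈-++⁺ʳ (elements p) (∈-elements⁺ q e)
    right : (elements p ++ A) ⊆ₗ elements p
    right m with Memₚ.∈-++⁻ (elements p) m
    ... | inj₁ e = e
    ... | inj₂ e = ∈-elements⁺ p (proj₁ (∧-true (∈-elements⁻ (λ i → p i ∧ q i) e)))

-- Linear consequences of submodularity

record Finite (A : Set) : Set where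
  field
    enum     : List A
    complete : ∀ a → a ∈ₗ enum

open Finite {{...}} public

instance
  finite-Bool : Finite Bool
  finite-Bool = record { enum = true ∷ false ∷ [] ; complete = λ { true → here refl ; false → there (here refl) } }

  finite-× : ∀ {A B : Set} {{_ : Finite A}} {{_ : Finite B}} → Finite (A × B)
  finite-× = record
    { enum     = Data.List.cartesianProduct enum enum
    ; complete = λ (a , b) → Memₚ.∈-cartesianProduct⁺ (complete a) (complete b)
    }

  finite-Fin : ∀ {n} → Finite (Fin n)
  finite-Fin = record { enum = allFin _ ; complete = Memₚ.∈-allFin }

infixl 6 _⊞_
infix 4 _≼_

-- A colouring `s : Fin n → A` makes a Boolean function on `A` a subset of the ground set. Equality
-- and inclusion of such sets follow from a test on the finitely many colours, which is how `iff`
-- and `allTrue` are used below.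
data Form (A : Set) : Set where
  rank : (A → Bool) → Form A
  num  : ℕ → Form A
  _⊞_  : Form A → Form A → Form A

record Ineq (A : Set) : Set where
  constructor _≼_
  field
    lhs rhs : Form A

open Ineq public

_on_ : ∀ {A B : Set} → Form B → (A → B) → Form A
rank p on t  = rank (λ a → p (t a))
num k on t   = num k
(f ⊞ g) on t = (f on t) ⊞ (g on t)

_along_ : ∀ {A B : Set} → Ineq B → (A → B) → Ineq A
(a ≼ b) along t = (a on t) ≼ (b on t)

negate : ∀ {A} → Ineq A → Ineq A
negate (a ≼ b) = num 1 ⊞ b ≼ a

allTrue : ∀ {A : Set} {{_ : Finite A}} → (A → Bool) → Bool
allTrue p = all p enum

T-∧ : ∀ {a b} → T (a ∧ b) → T a × T b
T-∧ {true} t = tt , t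

T⇒≡ : ∀ {b} → T b → b ≡ true
T⇒≡ {true} _ = refl

≡⇒T : ∀ {b} → b ≡ true → T b
≡⇒T refl = tt

T-all : ∀ {A : Set} (p : A → Bool) xs → T (all p xs) → ∀ {a} → a ∈ₗ xs → T (p a)
T-all p (x ∷ xs) t (here refl) = proj₁ (T-∧ {p x} t)
T-all p (x ∷ xs) t (there m)   = T-all p xs (proj₂ (T-∧ {p x} t)) m

allTrue⇒ : ∀ {A : Set} {{_ : Finite A}} (p : A → Bool) → T (allTrue p) → ∀ a → p a ≡ true
allTrue⇒ p t a = T⇒≡ (T-all p enum t (complete a))

everywhere : ∀ {A : Set} {{_ : Finite A}} {P : A → Set} (P? : ∀ a → Dec (P a)) {_ : T (allTrue (does ∘ P?))} → ∀ a → P a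
everywhere P? {t} a = from (P? a) (allTrue⇒ (does ∘ P?) t a)
  where
  from : ∀ {X : Set} (d : Dec X) → does d ≡ true → X
  from (yes x) _ = x

bool-law : ∀ {A : Set} {{_ : Finite A}} (f g : A → Bool) {_ : T (allTrue λ a → does (f a Boolₚ.≟ g a))} → ∀ a → f a ≡ g a
bool-law f g {t} = everywhere (λ a → f a Boolₚ.≟ g a) {t}

iff : Bool → Bool → Bool
iff true  b = b
iff false b = not b

iff⇒≡ : ∀ a b → iff a b ≡ true → a ≡ b
iff⇒≡ true  true  _ = refl
iff⇒≡ false false _ = refl

module Linear {n} (P : Polymatroid n) where
  open Polymatroid P public

  R-cong : ∀ {p q} → (∀ i → p i ≡ q i) → R p ≡ R q
  R-cong e = ≤-antisym (R-mono λ i t → trans (sym (e i)) t) (R-mono λ i t → trans (e i) t)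

  module _ {A : Set} (s : Fin n → A) where

    ⟦_⟧ : Form A → ℕ
    ⟦ rank p ⟧ = R (λ i → p (s i))
    ⟦ num k ⟧  = k
    ⟦ f ⊞ g ⟧  = ⟦ f ⟧ + ⟦ g ⟧

    Holds : Ineq A → Set
    Holds (a ≼ b) = ⟦ a ⟧ ≤ ⟦ b ⟧

    holds? : ∀ I → Holds I ⊎ Holds (negate I)
    holds? (a ≼ b) with ⟦ a ⟧ ≤? ⟦ b ⟧
    ... | yes h = inj₁ h
    ... | no ¬h = inj₂ (≰⇒> ¬h)

  ⟦⟧-cong : ∀ {A : Set} {s t : Fin n → A} → (∀ i → s i ≡ t i) → ∀ f → ⟦_⟧ s f ≡ ⟦_⟧ t f
  ⟦⟧-cong e (rank p) = R-cong λ i → cong p (e i)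
  ⟦⟧-cong e (num k)  = refl
  ⟦⟧-cong e (f ⊞ g)  = cong₂ _+_ (⟦⟧-cong e f) (⟦⟧-cong e g)

  Holds-cong : ∀ {A : Set} {s t : Fin n → A} → (∀ i → s i ≡ t i) → ∀ I → Holds s I → Holds t I
  Holds-cong e (a ≼ b) h = subst₂ _≤_ (⟦⟧-cong e a) (⟦⟧-cong e b) h

  -- Failure of an inequality for some set `u` yields that set as data. In the applications it is a
  -- cut of too small connectivity, and the argument continues with it.
  allSplits? : ∀ {A : Set} (s : Fin n → A) (I : Ineq (A × Bool)) →
    (∃ λ (u : Fin n → Bool) → Holds (λ i → s i , u i) (negate I)) ⊎ (∀ (u : Fin n → Bool) → Holds (λ i → s i , u i) I)
  allSplits? s I@(a ≼ b) with Subₚ.anySubset? (λ u → suc (⟦_⟧ (λ i → s i , lookup u i) b) ≤? ⟦_⟧ (λ i → s i , lookup u i) a)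
  ... | yes (u , h) = inj₁ (lookup u , h)
  ... | no none = inj₂ good
    where
    good : ∀ u → Holds (λ i → s i , u i) I
    good u with holds? (λ i → s i , lookup (tabulate u) i) I
    ... | inj₁ h = Holds-cong (λ i → cong (s i ,_) (Vecₚ.lookup∘tabulate u i)) I h
    ... | inj₂ h = absurd (none (tabulate u , h))

  module _ {A : Set} {{fin : Finite A}} (s : Fin n → A) where

    record Fact : Set where
      constructor fact
      field
        ineq  : Ineq A
        holds : Holds s ineq

    open Fact

    sub : (p q : A → Bool) → Fact
    sub p q = fact (rank (λ a → p a ∧ q a) ⊞ rank (λ a → p a ∨ q a) ≼ rank p ⊞ rank q) (R-sub _ _)

    mono : (p q : A → Bool) {_ : T (allTrue λ a → not (p a) ∨ q a)} → Fact
    mono p q {t} = fact (rank p ≼ rank q) (R-mono λ i e → implies e (allTrue⇒ _ t (s i)))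
      where
      implies : ∀ {a b} → a ≡ true → not a ∨ b ≡ true → b ≡ true
      implies refl e = e

    ranks : Form A → List (A → Bool) → List (A → Bool)
    ranks (rank p) ps = p ∷ ps
    ranks (num _)  ps = ps
    ranks (f ⊞ g)  ps = ranks f (ranks g ps)

    nums : Form A → ℕ
    nums (rank _) = 0
    nums (num k)  = k
    nums (f ⊞ g)  = nums f + nums g

    total : List (A → Bool) → ℕ
    total []       = 0
    total (p ∷ ps) = R (λ i → p (s i)) + total ps

    open +-*-Solver using (solve; _:+_; _:=_)

    form-split : ∀ f ps → ⟦_⟧ s f + total ps ≡ nums f + total (ranks f ps)
    form-split (rank p) ps = refl
    form-split (num k) ps = refl
    form-split (f ⊞ g) ps = trans (solve 3 (λ a b c → a :+ b :+ c := b :+ c :+ a) refl (⟦_⟧ s f) (⟦_⟧ s g) (total ps))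
      (trans (cong (_+ ⟦_⟧ s f) (form-split g ps))
      (trans (solve 3 (λ a b c → a :+ b :+ c := a :+ (c :+ b)) refl (nums g) (total (ranks g ps)) (⟦_⟧ s f))
      (trans (cong (nums g +_) (form-split f (ranks g ps)))
      (solve 3 (λ a b c → a :+ (b :+ c) := b :+ a :+ c) refl (nums g) (nums f) (total (ranks f (ranks g ps)))))))

    sumL sumR : List Fact → Form A → Form A
    sumL [] g = g
    sumL (h ∷ hs) g = lhs (ineq h) ⊞ sumL hs g
    sumR [] g = g
    sumR (h ∷ hs) g = rhs (ineq h) ⊞ sumR hs g

    remove : (A → Bool) → List (A → Bool) → Maybe (List (A → Bool))
    remove p [] = nothing
    remove p (q ∷ qs) = if allTrue (λ a → iff (p a) (q a)) then just qs else cons q (remove p qs)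
      where
      cons : (A → Bool) → Maybe (List (A → Bool)) → Maybe (List (A → Bool))
      cons q (just qs) = just (q ∷ qs)
      cons q nothing   = nothing

    remove-total : ∀ p qs {qs′} → remove p qs ≡ just qs′ → total qs ≡ R (λ i → p (s i)) + total qs′
    remove-total p (q ∷ qs) e with allTrue (λ a → iff (p a) (q a)) in t
    remove-total p (q ∷ qs) refl | true = cong (_+ total qs)
      (R-cong λ i → sym (iff⇒≡ _ _ (allTrue⇒ (λ a → iff (p a) (q a)) (≡⇒T t) (s i))))
    remove-total p (q ∷ qs) e | false with remove p qs in f
    remove-total p (q ∷ qs) refl | false | just qs′ = trans (cong (R (λ i → q (s i)) +_) (remove-total p qs f))
      (solve 3 (λ a b c → a :+ (b :+ c) := b :+ (a :+ c)) refl (R (λ i → q (s i))) (R (λ i → p (s i))) (total qs′))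

    cancel : List (A → Bool) → List (A → Bool) → Bool
    cancelled : List (A → Bool) → Maybe (List (A → Bool)) → Bool
    cancel [] qs = true
    cancel (p ∷ ps) qs = cancelled ps (remove p qs)
    cancelled ps nothing   = false
    cancelled ps (just qs) = cancel ps qs

    cancel-total : ∀ ps qs → T (cancel ps qs) → total ps ≤ total qs
    cancel-total [] qs t = z≤n
    cancel-total (p ∷ ps) qs t with remove p qs in e
    ... | just qs′ = ≤-trans (+-monoʳ-≤ (R (λ i → p (s i))) (cancel-total ps qs′ t)) (≤-reflexive (sym (remove-total p qs e)))

    -- The sides are crossed on purpose. The facts give that the sum of their left sides is at most
    -- the sum of their right sides, so it suffices that `a` plus all right sides is at most `b`
    -- plus all left sides. That is tested term by term: constants are compared, and every rank on
    -- the left must have its own partner on the right.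
    follows : List Fact → Ineq A → Bool
    follows hs (a ≼ b) = (nums (sumR hs a) ≤ᵇ nums (sumL hs b)) ∧ cancel (ranks (sumR hs a) []) (ranks (sumL hs b) [])

    sums-≤ : ∀ hs → (∀ g → ⟦_⟧ s (sumL hs g) ≤ ⟦_⟧ s (sumR hs g))
    sums-≤ [] g = ≤-refl
    sums-≤ (h ∷ hs) g = +-mono-≤ (holds h) (sums-≤ hs g)

    sumR-shift : ∀ hs g → ⟦_⟧ s (sumR hs g) ≡ ⟦_⟧ s (sumR hs (num 0)) + ⟦_⟧ s g
    sumR-shift [] g = refl
    sumR-shift (h ∷ hs) g = trans (cong (⟦_⟧ s (rhs (ineq h)) +_) (sumR-shift hs g)) (sym (+-assoc (⟦_⟧ s (rhs (ineq h))) _ _))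

    -- The facts add up to an inequality from which the goal results by
    -- cancelling common terms.
    lin : ∀ I (hs : List Fact) {_ : T (follows hs I)} → Holds s I
    lin I@(a ≼ b) hs {t} = +-cancelˡ-≤ (⟦_⟧ s (sumR hs (num 0))) _ _
      (≤-trans (≤-reflexive (sym (sumR-shift hs a)))
      (≤-trans whole (≤-trans (sums-≤ hs b) (≤-reflexive (sumR-shift hs b)))))
      where
      parts = T-∧ {nums (sumR hs a) ≤ᵇ nums (sumL hs b)} t
      whole : ⟦_⟧ s (sumR hs a) ≤ ⟦_⟧ s (sumL hs b)
      whole = ≤-trans (≤-reflexive (trans (sym (+-identityʳ _)) (form-split (sumR hs a) [])))
        (≤-trans (+-mono-≤ (≤ᵇ⇒≤ (nums (sumR hs a)) (nums (sumL hs b)) (proj₁ parts))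
                           (cancel-total (ranks (sumR hs a) []) (ranks (sumL hs b) []) (proj₂ parts)))
                 (≤-reflexive (trans (sym (form-split (sumL hs b) [])) (+-identityʳ _))))

-- Tutte's linking theorem

Zone : Set
Zone = Fin 5

pattern left  = zero
pattern right = suc zero
pattern con   = suc (suc zero)
pattern del   = suc (suc (suc zero))
pattern free  = suc (suc (suc (suc zero)))

present contracted : Zone → Bool
present del    = false
present _      = true
contracted con = true
contracted _   = false

near far : Zone × Bool → Bool
near (left , _) = true
near (con , _)  = true
near (free , u) = u
near _          = false
far (right , _) = true
far (con , _)   = true
far (free , u)  = not u
far _           = false

-- In the minor that contracts con and deletes del, the set left ∪ U with
-- U ⊆ free has connectivity at least two.
linkable : Ineq (Zone × Bool)
linkable = num 2 ⊞ rank (present ∘ proj₁) ⊞ rank (contracted ∘ proj₁) ≼ rank near ⊞ rank far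

assign : Zone → Zone → Bool → Zone
assign a free true = a
assign a z    _    = z

settle : Zone → Bool → Zone
settle free true  = con
settle free false = del
settle z    _     = z

point : ∀ {n} → Fin n → Fin n → Bool
point g i = does (i ≟F g)

point⇒≡ : ∀ {n} {g i : Fin n} → point g i ≡ true → i ≡ g
point⇒≡ {g = g} {i} e with i ≟F g
... | yes p = p

point-refl : ∀ {n} (g : Fin n) → point g g ≡ true
point-refl g with g ≟F g
... | yes _ = refl
... | no ne = absurd (ne refl)

module Linking {n} (P : Polymatroid n) where
  open Linear P public

  Linked : (Fin n → Zone) → Set
  Linked ζ = ∀ (u : Fin n → Bool) → Holds (λ i → ζ i , u i) linkable

  Linked-cong : ∀ {ζ ζ′} → (∀ i → ζ i ≡ ζ′ i) → Linked ζ → Linked ζ′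
  Linked-cong e h u = Holds-cong (λ i → cong (_, u i) (e i)) linkable (h u)

  -- Uncrossing. If a cut `u₁` fails after deletion of `g` and a cut `u₂` fails after its
  -- contraction, their intersection without `g` and their union with `g` are cuts before the step.
  -- Submodularity on both sides of the cuts, with `g` of rank at most one, contradicts linkedness
  -- of these two.
  link-step : ∀ ζ g → Linked ζ →
    Linked (λ i → assign del (ζ i) (point g i)) ⊎ Linked (λ i → assign con (ζ i) (point g i))
  link-step ζ g h = choose (allSplits? (λ i → assign del (ζ i) (point g i)) linkable)
                           (allSplits? (λ i → assign con (ζ i) (point g i)) linkable)
    where
    A = Zone × Bool × Bool × Bool
    meet join : A → Bool
    meet (_ , γ , a , b) = a ∧ b ∧ not γ
    join (_ , γ , a , b) = a ∨ b ∨ γ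
    -- `near` with the bit true and `far` with the bit false hold together only for `free` and
    -- `con`, so `g∩free` is `g` if its zone is `free` and empty otherwise.
    g∩free inC : A → Bool
    g∩free (z , γ , _) = γ ∧ present z ∧ near (z , true) ∧ far (z , false) ∧ not (contracted z)
    inC (z , _) = contracted z
    delZ conZ : A → Zone × Bool
    delZ (z , γ , a , _) = assign del z γ , a
    conZ (z , γ , _ , b) = assign con z γ , b
    clash : ∀ u₁ u₂ → Holds (λ i → assign del (ζ i) (point g i) , u₁ i) (negate linkable) →
      Holds (λ i → assign con (ζ i) (point g i) , u₂ i) (negate linkable) → 1 ≤ 0
    clash u₁ u₂ h₁ h₂ = let s = λ i → ζ i , point g i , u₁ i , u₂ i in lin s (num 1 ≼ num 0)
      ( fact (negate linkable along delZ) h₁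
      ∷ fact (negate linkable along conZ) h₂
      ∷ fact (linkable along (λ a → proj₁ a , meet a)) (h (meet ∘ s))
      ∷ fact (linkable along (λ a → proj₁ a , join a)) (h (join ∘ s))
      ∷ sub s (near ∘ delZ) (near ∘ conZ)
      ∷ sub s (far ∘ delZ) (far ∘ conZ)
      ∷ mono s (present ∘ proj₁ ∘ delZ) (present ∘ proj₁)
      ∷ sub s inC g∩free
      ∷ mono s g∩free (λ (_ , γ , _) → γ)
      ∷ fact (rank (λ (_ , γ , _) → γ) ≼ num 1) (R-unit g)
      ∷ [] )
    choose : ∀ {X Y : Set} → (∃ λ u → Holds (λ i → assign del (ζ i) (point g i) , u i) (negate linkable)) ⊎ X →
      (∃ λ u → Holds (λ i → assign con (ζ i) (point g i) , u i) (negate linkable)) ⊎ Y → X ⊎ Y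
    choose (inj₂ x) _ = inj₁ x
    choose (inj₁ _) (inj₂ y) = inj₂ y
    choose (inj₁ (u₁ , h₁)) (inj₁ (u₂ , h₂)) = absurd (<⇒≱ (clash u₁ u₂ h₁ h₂) z≤n)

  link : ∀ l ζ → (∀ i → ζ i ≡ free → i ∈ₗ l) → Linked ζ → ∃ λ (w : Fin n → Bool) → Linked (λ i → settle (ζ i) (w i))
  link [] ζ none h = (λ _ → false) , Linked-cong settled h
    where
    settled : ∀ i → ζ i ≡ settle (ζ i) false
    settled i with ζ i | none i
    ... | left  | _ = refl
    ... | right | _ = refl
    ... | con   | _ = refl
    ... | del   | _ = refl
    ... | free  | f with f refl
    ... | ()
  link (g ∷ l) ζ inl h = choose (link-step ζ g h)
    where
    rest : ∀ a → a ≢ free → ∀ i → assign a (ζ i) (point g i) ≡ free → i ∈ₗ l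
    rest a a≢ i e with ζ i | i ≟F g | inl i
    rest a a≢ i e | free | yes _ | f = absurd (a≢ e)
    rest a a≢ i e | free | no ne | f with f refl
    ... | here p  = absurd (ne p)
    ... | there m = m
    choose : Linked (λ i → assign del (ζ i) (point g i)) ⊎ Linked (λ i → assign con (ζ i) (point g i)) →
      ∃ λ (w : Fin n → Bool) → Linked (λ i → settle (ζ i) (w i))
    choose (inj₁ h′) = let (w , k) = link l _ (rest del λ ()) h′ in (λ i → not (point g i) ∧ w i) , Linked-cong
      (λ i → everywhere (λ (z , γ , b) → settle (assign del z γ) b ≟F settle z (not γ ∧ b)) (ζ i , point g i , w i)) k
    choose (inj₂ h′) = let (w , k) = link l _ (rest con λ ()) h′ in (λ i → point g i ∨ w i) , Linked-cong
      (λ i → everywhere (λ (z , γ , b) → settle (assign con z γ) b ≟F settle z (γ ∨ b)) (ζ i , point g i , w i)) k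

  agree : ∀ {A : Set} {{_ : Finite A}} (s : Fin n → A) (p q : A → Bool) {_ : T (allTrue λ a → iff (p a) (q a))} →
    R (λ i → p (s i)) ≡ R (λ i → q (s i))
  agree s p q {t} = R-cong λ i → iff⇒≡ _ _ (allTrue⇒ (λ a → iff (p a) (q a)) t (s i))

-- Two-separations and their basepoints.

infixr 5 _∪ᵇ_
_∪ᵇ_ : ∀ {C : Set} → (C → Bool) → (C → Bool) → C → Bool
(p ∪ᵇ q) c = p c ∨ q c

Atoms : Set
Atoms = Bool × Bool × Bool × Bool × Bool

setO setA setB setP₀ setP₁ setX : Atoms → Bool
setO  (o , _) = o
setA  (o , a , _) = o ∨ a
setB  (o , a , b , _) = o ∨ not a ∧ b
setP₀ (o , a , b , p , x) = o ∨ a ∧ p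
setP₁ (o , a , b , p , x) = o ∨ a ∧ (p ∨ x)
setX  (o , a , b , p , x) = a ∧ x

-- All four are to be read after contraction of `O`. The connectivity of `A` and `B` is at most one;
-- `P₀` is skew to `B`; `P₁` is not skew to `B`; and `P₁` exceeds `P₀` by a set of rank at most one.
separation avoids meets single : Ineq Atoms
separation = rank setA ⊞ rank setB ≼ rank (setA ∪ᵇ setB) ⊞ rank setO ⊞ num 1
avoids     = rank setP₀ ⊞ rank setB ≼ rank (setP₀ ∪ᵇ setB) ⊞ rank setO
meets      = num 1 ⊞ rank (setP₁ ∪ᵇ setB) ⊞ rank setO ≼ rank setP₁ ⊞ rank setB
single     = rank setX ≼ num 1

-- Ranks across a 2-separation (A , B).  The sets P₀ ⊆ P₁ ⊆ A are such that
-- P₁ spans the basepoint of the 2-sum and P₀ does not.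
module TwoSum {n} (P : Polymatroid n) (s : Fin n → Atoms)
  (sep : Linking.Holds P s separation) (avd : Linking.Holds P s avoids)
  (mts : Linking.Holds P s meets) (sgl : Linking.Holds P s single) where
  open Linking P

  raise : R (setP₁ ∘ s) ≡ R (setP₀ ∘ s) + 1
  raise = ≤-antisym
    (lin s (rank setP₁ ≼ rank setP₀ ⊞ num 1) (sub s setP₀ setX ∷ fact single sgl ∷ []))
    (lin s (rank setP₀ ⊞ num 1 ≼ rank setP₁)
      (fact avoids avd ∷ mono s (setP₀ ∪ᵇ setB) (setP₁ ∪ᵇ setB) ∷ fact meets mts ∷ []))

  module _ (y : Fin n → Bool) where
    private
      s′ : Fin n → Atoms × Bool
      s′ i = s i , y i
      O A B P₀ P₁ : Atoms × Bool → Bool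
      O  = setO ∘ proj₁
      A  = setA ∘ proj₁
      B  = setB ∘ proj₁
      P₀ = setP₀ ∘ proj₁
      P₁ = setP₁ ∘ proj₁

    setS : Atoms × Bool → Bool
    setS ((o , a , b , _) , y) = o ∨ not a ∧ b ∧ y

    -- In `direct` and `across` the choice of `P₀` and `P₁` inside `A` enters only through their own
    -- ranks. Hence the ranks of sets `S` on the side of `B`, taken over `P₀` or over `P₁`, are the
    -- same for all such choices up to a constant, and one choice can replace another without
    -- changing the minor.
    direct : R ((P₀ ∪ᵇ setS) ∘ s′) + R (setO ∘ s) ≡ R (setP₀ ∘ s) + R (setS ∘ s′)
    direct = ≤-antisym
      (lin s′ (rank (P₀ ∪ᵇ setS) ⊞ rank O ≼ rank P₀ ⊞ rank setS) (sub s′ P₀ setS ∷ []))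
      (lin s′ (rank P₀ ⊞ rank setS ≼ rank (P₀ ∪ᵇ setS) ⊞ rank O)
        (fact (avoids along proj₁) avd ∷ sub s′ (P₀ ∪ᵇ setS) B ∷ []))

    across : R ((P₁ ∪ᵇ setS) ∘ s′) + R (setA ∘ s) ≡ R (setP₁ ∘ s) + R ((A ∪ᵇ setS) ∘ s′)
    across = ≤-antisym
      (lin s′ (rank (P₁ ∪ᵇ setS) ⊞ rank A ≼ rank P₁ ⊞ rank (A ∪ᵇ setS))
        (fact (separation along proj₁) sep ∷ fact (meets along proj₁) mts ∷ sub s′ (P₁ ∪ᵇ B) (A ∪ᵇ setS) ∷ []))
      (lin s′ (rank P₁ ⊞ rank (A ∪ᵇ setS) ≼ rank (P₁ ∪ᵇ setS) ⊞ rank A) (sub s′ A (P₁ ∪ᵇ setS) ∷ []))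

-- Reductions that keep a fixed minor

-- The minor consists of the core elements and the entry; the spare element is
-- the one that is to be brought in.  Elements coloured conC or delC have been
-- contracted or deleted for good, and those coloured toCon or toDel still have
-- to be contracted or deleted to arrive at the minor.
Colour : Set
Colour = Fin 7

pattern core  = zero
pattern entry = suc zero
pattern spare = suc (suc zero)
pattern conC  = suc (suc (suc zero))
pattern delC  = suc (suc (suc (suc zero)))
pattern toCon = suc (suc (suc (suc (suc zero))))
pattern toDel = suc (suc (suc (suc (suc (suc zero)))))

isCore isEntry isSpare isConC isDelC isToCon isToDel isRest : Colour → Bool
isCore core    = true
isCore _       = false
isEntry entry  = true
isEntry _      = false
isSpare spare  = true
isSpare _      = false
isConC conC    = true
isConC _       = false
isDelC delC    = true
isDelC _       = false
isToCon toCon  = true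
isToCon _      = false
isToDel toDel  = true
isToDel _      = false
isRest k       = isToCon k ∨ isToDel k

zone : Colour → Zone
zone core  = right
zone entry = left
zone spare = left
zone conC  = con
zone delC  = del
zone toCon = free
zone toDel = free

drop : Colour → Bool → Colour
drop toCon true = conC
drop toDel true = delC
drop k     _    = k

swapEnds : Colour → Colour
swapEnds entry = spare
swapEnds spare = entry
swapEnds k     = k

-- The set that is contracted in the minor, and the sets y ∩ core without
-- and with the entry, each enlarged by that set; z tells whether the spare
-- element is contracted.
pivot : Colour → Bool → Bool
pivot k z = isConC k ∨ isToCon k ∨ (z ∧ isSpare k)

minor₀ minor₁ : Colour → Bool → Bool → Bool
minor₀ k y z = (isCore k ∧ y) ∨ pivot k z
minor₁ k y z = isEntry k ∨ minor₀ k y z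

-- At (false , false), (false , true) and (true , true) this is pivot, minor₀
-- and minor₁ by computation, so that the three are treated at once.
section : Bool × Bool → Colour → Bool → Bool → Bool
section (a , b) k y z = (a ∧ isEntry k) ∨ (b ∧ isCore k ∧ y) ∨ pivot k z

Origin : Set
Origin = Fin 4

pattern inside = zero
pattern first  = suc zero
pattern second = suc (suc zero)
pattern other  = suc (suc (suc zero))

-- `first` is the element at which the minor is rooted and `second` the one to be brought in. The
-- flag records whether these two have exchanged the colours `entry` and `spare`.
origin : Bool → Colour → Origin
origin _     core  = inside
origin true  entry = second
origin false entry = first
origin true  spare = first
origin false spare = second
origin _     _     = other

-- The minor is recorded by the ranks `ρ₀` and `ρ₁` of the subsets of the core without and with the
-- entry. `ρ-entry` says that the entry is not a loop of the minor, and `ρ-core` that it is not a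
-- coloop.
module Reduction {n} (P : Polymatroid n) (source : Fin n → Origin) (ρ₀ ρ₁ : (Fin n → Bool) → ℕ)
  (ρ-entry : ρ₁ (λ _ → false) ≡ 1) (ρ-core : ρ₁ (λ _ → true) ≡ ρ₀ (λ _ → true)) where
  open Linking P

  -- `linked` refers to the matroid in which only `conC` has been contracted and `delC` deleted:
  -- there every set that contains both ends and no core element has connectivity at least two.
  -- `rel₀` and `rel₁` refer to the minor reached when `toCon` and `toDel` are carried out as well.
  record State : Set where
    field
      colour  : Fin n → Colour
      z       : Bool
      swapped : Bool
      keeps   : ∀ i → origin swapped (colour i) ≡ source i
      linked  : Linked (zone ∘ colour)
      entry≤1 : R (isEntry ∘ colour) ≤ 1
      spare≤1 : R (isSpare ∘ colour) ≤ 1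
      rel₀    : ∀ y → R (λ i → minor₀ (colour i) (y i) z) ≡ R (λ i → pivot (colour i) z) + ρ₀ y
      rel₁    : ∀ y → R (λ i → minor₁ (colour i) (y i) z) ≡ R (λ i → pivot (colour i) z) + ρ₁ y

    live : 1 + R (λ i → pivot (colour i) z) ≤ R (λ i → minor₁ (colour i) false z)
    live = ≤-reflexive (sym (trans (rel₁ _) (trans (cong (_ +_) ρ-entry) (+-comm _ 1))))

    span : R (λ i → minor₁ (colour i) true z) ≤ R (λ i → minor₀ (colour i) true z)
    span = ≤-reflexive (trans (rel₁ _) (trans (cong (_ +_) ρ-core) (sym (rel₀ _))))

    size : ℕ
    size = ∣ tabulate (isRest ∘ colour) ∣

  open State

  -- Since `g` has a single colour, one of the two sets is empty.
  R-unit-split : ∀ (κ : Fin n → Colour) g →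
    R (λ i → isToCon (κ i) ∧ point g i) + R (λ i → isToDel (κ i) ∧ point g i) ≤ 1
  R-unit-split κ g = cases (bool-split (isToDel (κ g)))
    where
    at-most : ∀ (t : Colour → Bool) → R (λ i → t (κ i) ∧ point g i) ≤ 1
    at-most t = ≤-trans (R-mono λ i e → proj₂ (∧-true {t (κ i)} e)) (R-unit g)
    none : ∀ (t : Colour → Bool) → t (κ g) ≡ false → R (λ i → t (κ i) ∧ point g i) ≡ 0
    none t e = R-∅ λ i → off i (bool-split (point g i))
      where
      off : ∀ i → point g i ≡ true ⊎ point g i ≡ false → t (κ i) ∧ point g i ≡ false
      off i (inj₁ p) = cong (_∧ point g i) (trans (cong (t ∘ κ) (point⇒≡ p)) e)
      off i (inj₂ p) = trans (cong (t (κ i) ∧_) p) (Boolₚ.∧-zeroʳ _)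
    exclusive : ∀ k → isToDel k ≡ true → isToCon k ≡ false
    exclusive toDel _ = refl
    cases : isToDel (κ g) ≡ true ⊎ isToDel (κ g) ≡ false → _
    cases (inj₁ e) = +-mono-≤ (≤-reflexive (none isToCon (exclusive (κ g) e))) (at-most isToDel)
    cases (inj₂ e) = +-mono-≤ (at-most isToCon) (≤-reflexive (none isToDel e))

  shrinks : ∀ (κ κ′ : Fin n → Colour) → (∀ i → isRest (κ′ i) ≡ true → isRest (κ i) ≡ true) →
    ∀ i → isRest (κ i) ≡ true → isRest (κ′ i) ≡ false → ∣ tabulate (isRest ∘ κ′) ∣ < ∣ tabulate (isRest ∘ κ) ∣
  shrinks κ κ′ s i e e′ = Subₚ.p⊂q⇒∣p∣<∣q∣ {p = tabulate (isRest ∘ κ′)} {q = tabulate (isRest ∘ κ)}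
    ( (λ {j} m → inSet κ j (s j (trans (sym (Vecₚ.lookup∘tabulate (isRest ∘ κ′) j)) (Vecₚ.[]=⇒lookup m))))
    , i , inSet κ i e
    , λ m → false≢true (trans (sym (Vecₚ.lookup∘tabulate (isRest ∘ κ′) i)) (Vecₚ.[]=⇒lookup m)) e′)
    where
    inSet : ∀ (κ : Fin n → Colour) j → isRest (κ j) ≡ true → j ∈ tabulate (isRest ∘ κ)
    inSet κ j e = Vecₚ.lookup⇒[]= j _ (trans (Vecₚ.lookup∘tabulate (isRest ∘ κ) j) e)

  Smaller : State → Set
  Smaller st = Σ State λ st′ → size st′ < size st

  drop-origin : ∀ b k γ → origin b (drop k γ) ≡ origin b k
  drop-origin b k γ = everywhere (λ (b , k , γ) → origin b (drop k γ) ≟F origin b k) (b , k , γ)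

  drop-rest : ∀ k γ → isRest (drop k γ) ≡ true → isRest k ≡ true
  drop-rest toCon _ _ = refl
  drop-rest toDel _ _ = refl

  drop-gone : ∀ k → isRest (drop k true) ≡ false
  drop-gone = everywhere λ k → isRest (drop k true) Boolₚ.≟ false

  removeElement : ∀ st g → isRest (colour st g) ≡ true →
    Linked (λ i → zone (drop (colour st i) (point g i))) → Smaller st
  removeElement st g rg h = record
    { colour  = λ i → drop (κ i) (point g i)
    ; z       = z st
    ; swapped = swapped st
    ; keeps   = λ i → trans (drop-origin (swapped st) (κ i) (point g i)) (keeps st i)
    ; linked  = h
    ; entry≤1 = ≤-trans (≤-reflexive (agree s (λ (k , γ) → isEntry (drop k γ)) (λ (k , γ) → isEntry k))) (entry≤1 st)
    ; spare≤1 = ≤-trans (≤-reflexive (agree s (λ (k , γ) → isSpare (drop k γ)) (λ (k , γ) → isSpare k))) (spare≤1 st)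
    ; rel₀    = λ y → trans (agree (s₂ y) (λ (k , γ , y , z) → minor₀ (drop k γ) y z) (λ (k , γ , y , z) → minor₀ k y z))
                        (trans (rel₀ st y) (cong (_+ ρ₀ y) (same-pivot y)))
    ; rel₁    = λ y → trans (agree (s₂ y) (λ (k , γ , y , z) → minor₁ (drop k γ) y z) (λ (k , γ , y , z) → minor₁ k y z))
                        (trans (rel₁ st y) (cong (_+ ρ₁ y) (same-pivot y)))
    } , shrinks κ (λ i → drop (κ i) (point g i)) (λ i → drop-rest (κ i) (point g i)) g rg (trans (cong (isRest ∘ drop (κ g)) (point-refl g)) (drop-gone (κ g)))
    where
    κ = colour st
    s : Fin n → Colour × Bool
    s i = κ i , point g i
    s₂ : (Fin n → Bool) → Fin n → Colour × Bool × Bool × Bool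
    s₂ y i = κ i , point g i , y i , z st
    same-pivot : ∀ y → R (λ i → pivot (κ i) (z st)) ≡ R (λ i → pivot (drop (κ i) (point g i)) (z st))
    same-pivot y = agree (s₂ y) (λ (k , γ , y , z) → pivot k z) (λ (k , γ , y , z) → pivot (drop k γ) z)

  -- The equations of `direct` make `a - b` equal to `s₁ - s₀`, in which `p` no longer occurs; the
  -- primed values satisfy the same. `transfer₁` is the corresponding elimination with `across` for
  -- `a`, where the difference between `q` and `p` is one in both situations.
  transfer₀ : ∀ {a b a′ b′ o p p′ s₀ s₁ ρ} → a + o ≡ p + s₁ → b + o ≡ p + s₀ →
    a′ + o ≡ p′ + s₁ → b′ + o ≡ p′ + s₀ → a ≡ b + ρ → a′ ≡ b′ + ρ
  transfer₀ {a} {b} {a′} {b′} {o} {p} {p′} {s₀} {s₁} {ρ} e₁ e₂ e₃ e₄ refl =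
    +-cancelʳ-≡ (p + o) a′ (b′ + ρ) (begin
      a′ + (p + o)   ≡⟨ solve 3 (λ a p o → a :+ (p :+ o) := (a :+ o) :+ p) refl a′ p o ⟩
      a′ + o + p     ≡⟨ cong (_+ p) e₃ ⟩
      p′ + s₁ + p    ≡⟨ solve 3 (λ a b c → a :+ b :+ c := a :+ (c :+ b)) refl p′ s₁ p ⟩
      p′ + (p + s₁)  ≡⟨ cong (p′ +_) (sym e₁) ⟩
      p′ + (b + ρ + o) ≡⟨ solve 4 (λ p b r o → p :+ (b :+ r :+ o) := p :+ r :+ (b :+ o)) refl p′ b ρ o ⟩
      p′ + ρ + (b + o) ≡⟨ cong (p′ + ρ +_) e₂ ⟩
      p′ + ρ + (p + s₀) ≡⟨ solve 4 (λ q r p s → q :+ r :+ (p :+ s) := (q :+ s) :+ (r :+ p)) refl p′ ρ p s₀ ⟩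
      p′ + s₀ + (ρ + p) ≡⟨ cong (_+ (ρ + p)) (sym e₄) ⟩
      b′ + o + (ρ + p) ≡⟨ solve 4 (λ b o r p → b :+ o :+ (r :+ p) := b :+ r :+ (p :+ o)) refl b′ o ρ p ⟩
      b′ + ρ + (p + o) ∎)
    where
    open ≡-Reasoning
    open +-*-Solver using (solve; _:+_; _:=_)

  transfer₁ : ∀ {a b a′ b′ o A p p′ q q′ s₀ s₁ ρ} → a + A ≡ q + s₁ → b + o ≡ p + s₀ → q ≡ p + 1 →
    a′ + A ≡ q′ + s₁ → b′ + o ≡ p′ + s₀ → q′ ≡ p′ + 1 → a ≡ b + ρ → a′ ≡ b′ + ρ
  transfer₁ {a} {b} {a′} {b′} {o} {A} {p} {p′} {_} {_} {s₀} {s₁} {ρ} e₁ e₂ refl e₃ e₄ refl refl =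
    +-cancelʳ-≡ (p + 1 + o + A) a′ (b′ + ρ) (begin
      a′ + (p + 1 + o + A)         ≡⟨ solve 5 (λ a p u o A → a :+ (p :+ u :+ o :+ A) := (a :+ A) :+ (p :+ u :+ o)) refl a′ p 1 o A ⟩
      a′ + A + (p + 1 + o)         ≡⟨ cong (_+ (p + 1 + o)) e₃ ⟩
      p′ + 1 + s₁ + (p + 1 + o)    ≡⟨ solve 5 (λ q u s p o → q :+ u :+ s :+ (p :+ u :+ o) := (q :+ u :+ o) :+ (p :+ u :+ s)) refl p′ 1 s₁ p o ⟩
      p′ + 1 + o + (p + 1 + s₁)    ≡⟨ cong (p′ + 1 + o +_) (sym e₁) ⟩
      p′ + 1 + o + (b + ρ + A)     ≡⟨ solve 6 (λ q u o b r A → q :+ u :+ o :+ (b :+ r :+ A) := (b :+ o) :+ (q :+ u :+ (r :+ A))) refl p′ 1 o b ρ A ⟩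
      b + o + (p′ + 1 + (ρ + A))   ≡⟨ cong (_+ (p′ + 1 + (ρ + A))) e₂ ⟩
      p + s₀ + (p′ + 1 + (ρ + A))  ≡⟨ solve 6 (λ p s q u r A → p :+ s :+ (q :+ u :+ (r :+ A)) := (q :+ s) :+ (p :+ u :+ (r :+ A))) refl p s₀ p′ 1 ρ A ⟩
      p′ + s₀ + (p + 1 + (ρ + A))  ≡⟨ cong (_+ (p + 1 + (ρ + A))) (sym e₄) ⟩
      b′ + o + (p + 1 + (ρ + A))   ≡⟨ solve 6 (λ b o p u r A → b :+ o :+ (p :+ u :+ (r :+ A)) := b :+ r :+ (p :+ u :+ o :+ A)) refl b′ o p 1 ρ A ⟩
      b′ + ρ + (p + 1 + o + A)     ∎)
    where
    open ≡-Reasoning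
    open +-*-Solver using (solve; _:+_; _:=_)

  Fine : Set
  Fine = Colour × Bool × Bool × Bool × Bool × Bool

  -- With U the uncommitted elements on the near side of the separation.
  zoneU : Colour → Bool → Bool → Zone
  zoneU k γ u = if isRest k then (if not γ ∧ u then free else right) else zone k

  recolour : Colour → Bool → Bool → Bool → Colour
  recolour k γ u w = if isRest k ∧ not γ ∧ u then (if w then conC else delC) else k

  recolour-origin : ∀ b k γ u w → origin b (recolour k γ u w) ≡ origin b k
  recolour-origin b k γ u w = everywhere (λ (b , k , γ , u , w) → origin b (recolour k γ u w) ≟F origin b k) (b , k , γ , u , w)

  swap-origin : ∀ b k → origin (not b) (swapEnds k) ≡ origin b k
  swap-origin b k = everywhere (λ (b , k) → origin (not b) (swapEnds k) ≟F origin b k) (b , k)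

  swap-zone : ∀ k → zone k ≡ zone (swapEnds k)
  swap-zone = everywhere λ k → zone k ≟F zone (swapEnds k)

  -- Carrying out the fate of `g` would leave a separation of connectivity at most one, with the
  -- ends and a nonempty set `U` of uncommitted elements on the near side. That side acts on the
  -- core only through a basepoint, so `U` can be resolved afresh, provided that the basepoint is
  -- still represented. The element `g` itself remains uncommitted.
  module Rearrange (st : State) (g : Fin n) (u : Fin n → Bool)
    (sep : Holds (λ i → zone (drop (colour st i) (point g i)) , u i) (negate linkable))
    (i₀ : Fin n) (i₀-rest : isRest (colour st i₀) ≡ true) (i₀-u : (not (point g i₀) ∧ u i₀) ≡ true) where

    κ = colour st

    s₄ : (Fin n → Bool) → Fin n → Colour × Bool × Bool × Bool
    s₄ u′ i = κ i , point g i , u i , u′ i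

    ζ : Fin n → Zone
    ζ i = zoneU (κ i) (point g i) (u i)

    linkedU : Linked ζ
    linkedU u′ = lin (s₄ u′) (linkable along λ (k , γ , u , u′) → zoneU k γ u , u′)
      (fact (linkable along λ (k , γ , u , u′) → zone k , (not γ ∧ u ∧ u′)) (linked st (λ i → not (point g i) ∧ u i ∧ u′ i)) ∷ [])

    -- The linking theorem is applied to `U` alone: `g` and the other uncommitted elements are
    -- placed on the far side together with the core.
    relinked : ∃ λ (w : Fin n → Bool) → Linked (λ i → settle (ζ i) (w i))
    relinked = link (allFin n) ζ (λ i _ → Memₚ.∈-allFin i) linkedU

    w = proj₁ relinked

    s : (Fin n → Bool) → Fin n → Fine
    s y i = κ i , point g i , u i , w i , y i , z st

    s₀ = s (λ _ → false)

    settled : Ineq Fine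
    settled = linkable along λ (k , γ , u , w , y , z) → settle (zoneU k γ u) w , false

    split : Ineq Fine
    split = negate linkable along λ (k , γ , u , w , y , z) → zone (drop k γ) , u

    E Z F U W C′ Gc Gd bar base : Fine → Bool
    E (k , _)  = isEntry k
    Z (k , _)  = isSpare k
    F (k , _)  = isCore k
    U (k , γ , u , _) = isRest k ∧ not γ ∧ u
    W (k , γ , u , _) = isRest k ∧ not γ ∧ not u
    C′ a@(k , γ , u , w , _) = U a ∧ w
    Gc (k , γ , _) = isToCon k ∧ γ
    Gd (k , γ , _) = isToDel k ∧ γ
    base (k , _) = isConC k
    bar = base ∪ᵇ Gc

    A B : Fine → Bool
    A = bar ∪ᵇ E ∪ᵇ Z ∪ᵇ U
    B = bar ∪ᵇ F ∪ᵇ W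

    settled-holds : ∀ y → Holds (s y) settled
    settled-holds y = proj₂ relinked (λ _ → false)

    unit-g : Ineq Fine
    unit-g = rank Gc ⊞ rank Gd ≼ num 1

    -- A cut `v` of the new state is uncrossed with the separation. The unions and intersections
    -- that arise are the two sides of the cut `U ∪ v` in the old state and the two sides of the cut
    -- provided by `relinked`, and both of these have connectivity at least two.
    new-linked : Linked (λ i → zone (recolour (κ i) (point g i) (u i) (w i)))
    new-linked v = lin (s v) (linkable along λ (k , γ , u , w , v , z) → zone (recolour k γ u w) , v)
      ( fact split sep
      ∷ fact settled (settled-holds v)
      ∷ fact (linkable along λ a@(k , γ , u , w , v , z) → zone k , (U a ∨ v)) (linked st (λ i → U (s v i) ∨ v i))
      ∷ sub (s v) (base ∪ᵇ E ∪ᵇ Z ∪ᵇ U) (λ (k , γ , u , w , v , z) → near (zone (recolour k γ u w) , v))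
      ∷ sub (s v) (base ∪ᵇ F ∪ᵇ W ∪ᵇ Gc ∪ᵇ Gd) (λ (k , γ , u , w , v , z) → far (zone (recolour k γ u w) , v))
      ∷ mono (s v) (base ∪ᵇ E ∪ᵇ Z ∪ᵇ U) A
      ∷ sub (s v) B Gd
      ∷ mono (s v) (A ∪ᵇ B) (λ (k , _) → not (isDelC k))
      ∷ sub (s v) base Gc
      ∷ fact unit-g (R-unit-split κ g)
      ∷ [] )

    O₀ O₁ S : Fine → Bool
    O₀ a@(k , γ , u , w , y , z) = bar a ∨ (U a ∧ isToCon k) ∨ (z ∧ isSpare k)
    O₁ = O₀ ∪ᵇ E
    S a@(k , γ , u , w , y , z) = bar a ∨ (W a ∧ isToCon k)

    separated : Ineq Fine
    separated = rank A ⊞ rank B ≼ rank (A ∪ᵇ B) ⊞ rank bar ⊞ num 1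

    separated-holds : Holds s₀ separated
    separated-holds = lin s₀ separated (fact split sep ∷ [])

    old-grows : Ineq Fine
    old-grows = num 1 ⊞ rank O₀ ⊞ rank (O₁ ∪ᵇ B) ≼ rank O₁ ⊞ rank (O₀ ∪ᵇ B)

    -- By `live` the entry raises the rank of `O₀`, and by `span` it no longer does so in the
    -- presence of `B`. With the separation this says that `O₀` misses the basepoint and that `O₀`
    -- with the entry spans it.
    old-grows-holds : Holds s₀ old-grows
    old-grows-holds = lin s₀ old-grows
      ( sub s₀ O₁ (O₀ ∪ᵇ S)
      ∷ fact (num 1 ⊞ rank (λ (k , γ , u , w , y , z) → pivot k z) ≼ rank (λ (k , γ , u , w , y , z) → minor₁ k false z)) (live st)
      ∷ sub s₀ (O₁ ∪ᵇ S ∪ᵇ F) (O₀ ∪ᵇ B)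
      ∷ fact (rank (λ (k , γ , u , w , y , z) → minor₁ k true z) ≼ rank (λ (k , γ , u , w , y , z) → minor₀ k true z)) (span st)
      ∷ [] )

    atoms : (p x : Fine → Bool) → Fine → Atoms
    atoms p x a = bar a , (E ∪ᵇ Z ∪ᵇ U) a , (F ∪ᵇ W) a , p a , x a

    old : Fine → Atoms
    old = atoms O₀ E

    old-avoids : Holds s₀ (avoids along old)
    old-avoids = lin s₀ (avoids along old)
      (fact old-grows old-grows-holds ∷ fact separated separated-holds ∷ sub s₀ A (O₁ ∪ᵇ B) ∷ [])

    old-meets : Holds s₀ (meets along old)
    old-meets = lin s₀ (meets along old) (fact old-grows old-grows-holds ∷ sub s₀ O₀ B ∷ [])

    sum-holds : ∀ (p x : Fine → Bool) → Holds s₀ (separation along atoms p x)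
    sum-holds p x = lin s₀ (separation along old) (fact separated separated-holds ∷ [])

    E-single : ∀ p → Holds s₀ (single along atoms p E)
    E-single p = lin s₀ (single along old) (mono s₀ (setX ∘ old) E ∷ fact (rank E ≼ num 1) (entry≤1 st) ∷ [])

    Z-single : ∀ p → Holds s₀ (single along atoms p Z)
    Z-single p = lin s₀ (single along atoms O₀ Z) (mono s₀ (setX ∘ atoms O₀ Z) Z ∷ fact (rank Z ≼ num 1) (spare≤1 st) ∷ [])

    new-grows : Ineq Fine
    new-grows = num 1 ⊞ rank (bar ∪ᵇ C′) ⊞ rank (C′ ∪ᵇ E ∪ᵇ Z ∪ᵇ B) ≼ rank (bar ∪ᵇ C′ ∪ᵇ E ∪ᵇ Z) ⊞ rank (C′ ∪ᵇ B)

    new-grows-holds : Holds s₀ new-grows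
    new-grows-holds = lin s₀ new-grows
      ( fact settled (settled-holds (λ _ → false))
      ∷ sub s₀ (C′ ∪ᵇ B) Gd
      ∷ mono s₀ (C′ ∪ᵇ E ∪ᵇ Z ∪ᵇ B) (C′ ∪ᵇ E ∪ᵇ Z ∪ᵇ B ∪ᵇ Gd)
      ∷ mono s₀ (base ∪ᵇ C′ ∪ᵇ E ∪ᵇ Z) (bar ∪ᵇ C′ ∪ᵇ E ∪ᵇ Z)
      ∷ sub s₀ (base ∪ᵇ C′) Gc
      ∷ fact unit-g (R-unit-split κ g)
      ∷ [] )

    new₁ new₂ new₃ : Fine → Atoms
    new₁ = atoms C′ E
    new₂ = atoms C′ Z
    new₃ = atoms (C′ ∪ᵇ Z) E

    new-avoids : Holds s₀ (avoids along new₁)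
    new-avoids = lin s₀ (avoids along new₁)
      ( fact new-grows new-grows-holds ∷ fact separated separated-holds
      ∷ sub s₀ A (C′ ∪ᵇ E ∪ᵇ Z ∪ᵇ B) ∷ [] )

    module Old = TwoSum P (old ∘ s₀) (sum-holds O₀ E) old-avoids old-meets (E-single O₀)

    κ′ : Fin n → Colour
    κ′ i = recolour (κ i) (point g i) (u i) (w i)

    smaller : ∣ tabulate (isRest ∘ κ′) ∣ < size st
    smaller = shrinks κ κ′ (λ i → still (κ i) (point g i) (u i) (w i)) i₀ i₀-rest (gone (κ i₀) (point g i₀) (u i₀) (w i₀) i₀-u)
      where
      still : ∀ k γ u w → isRest (recolour k γ u w) ≡ true → isRest k ≡ true
      still toCon _ _ _ _ = refl
      still toDel _ _ _ _ = refl
      gone : ∀ k γ u w → (not γ ∧ u) ≡ true → isRest (recolour k γ u w) ≡ false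
      gone k γ u w = everywhere (λ (k , γ , u , w) → ((not γ ∧ u) Boolₚ.≟ true) →-dec (isRest (recolour k γ u w) Boolₚ.≟ false)) (k , γ , u , w)

    swap-rest : ∀ k → isRest (swapEnds k) ≡ isRest k
    swap-rest = everywhere λ k → isRest (swapEnds k) Boolₚ.≟ isRest k

    far₀ far₁ : Fine → Bool
    far₀ a@(k , _) = W a ∧ isToCon k
    far₁ a@(k , γ , u , w , y , z) = far₀ a ∨ (F a ∧ y)

    recoloured : Fine → Colour
    recoloured (k , γ , u , w , y , z) = recolour k γ u w

    yOf : Fine → Bool
    yOf (k , γ , u , w , y , z) = y

    P₀S P₁S : (Fine → Atoms) → (Fine → Bool) → Fine → Bool
    P₀S t f a = (setP₀ ∘ t) a ∨ (setO (t a) ∨ not (proj₁ (proj₂ (t a))) ∧ proj₁ (proj₂ (proj₂ (t a))) ∧ f a)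
    P₁S t f a = (setP₁ ∘ t) a ∨ (setO (t a) ∨ not (proj₁ (proj₂ (t a))) ∧ proj₁ (proj₂ (proj₂ (t a))) ∧ f a)

    old₀ : ∀ y → R (P₀S old far₁ ∘ s y) ≡ R (P₀S old far₀ ∘ s y) + ρ₀ y
    old₀ y = trans (agree (s y) (P₀S old far₁) (λ (k , γ , u , w , y , z) → minor₀ k y z))
      (trans (rel₀ st y) (cong (_+ ρ₀ y) (agree (s y) (λ (k , γ , u , w , y , z) → pivot k z) (P₀S old far₀))))

    old₁ : ∀ y → R (P₁S old far₁ ∘ s y) ≡ R (P₀S old far₀ ∘ s y) + ρ₁ y
    old₁ y = trans (agree (s y) (P₁S old far₁) (λ (k , γ , u , w , y , z) → minor₁ k y z))
      (trans (rel₁ st y) (cong (_+ ρ₁ y) (agree (s y) (λ (k , γ , u , w , y , z) → pivot k z) (P₀S old far₀))))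

    Cut : Set
    Cut = Colour × Bool × Bool × Bool

    cut : Fine → Cut
    cut (k , γ , u , w , y , z) = k , γ , u , w

    module New (p₄ x₄ : Cut → Bool) (avd : Holds s₀ (avoids along atoms (p₄ ∘ cut) (x₄ ∘ cut)))
      (mts : Holds s₀ (meets along atoms (p₄ ∘ cut) (x₄ ∘ cut)))
      (sgl : Holds s₀ (single along atoms (p₄ ∘ cut) (x₄ ∘ cut))) where
      p x : Fine → Bool
      p = p₄ ∘ cut
      x = x₄ ∘ cut
      module T = TwoSum P (atoms p x ∘ s₀) (sum-holds p x) avd mts sgl

      new₀ : ∀ y → R (P₀S (atoms p x) far₁ ∘ s y) ≡ R (P₀S (atoms p x) far₀ ∘ s y) + ρ₀ y
      new₀ y = transfer₀ {o = R (setO ∘ old ∘ s₀)} {p = R (setP₀ ∘ old ∘ s₀)} {p′ = R (setP₀ ∘ atoms p x ∘ s₀)}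
        (Old.direct (far₁ ∘ s y)) (Old.direct (far₀ ∘ s y)) (T.direct (far₁ ∘ s y)) (T.direct (far₀ ∘ s y)) (old₀ y)

      new₁′ : ∀ y → R (P₁S (atoms p x) far₁ ∘ s y) ≡ R (P₀S (atoms p x) far₀ ∘ s y) + ρ₁ y
      new₁′ y = transfer₁ {b = R (P₀S old far₀ ∘ s y)} {b′ = R (P₀S (atoms p x) far₀ ∘ s y)} {o = R (setO ∘ old ∘ s₀)}
        {A = R (setA ∘ old ∘ s₀)} {p = R (setP₀ ∘ old ∘ s₀)} {p′ = R (setP₀ ∘ atoms p x ∘ s₀)} {ρ = ρ₁ y}
        (Old.across (far₁ ∘ s y)) (Old.direct (far₀ ∘ s y)) Old.raise
        (T.across (far₁ ∘ s y)) (T.direct (far₀ ∘ s y)) T.raise (old₁ y)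

    C₄ E₄ Z₄ : Cut → Bool
    C₄ (k , γ , u , w) = (isRest k ∧ not γ ∧ u) ∧ w
    E₄ (k , _) = isEntry k
    Z₄ (k , _) = isSpare k

    result₁ : Holds s₀ (meets along new₁) → Smaller st
    result₁ mts = record
      { colour = κ′ ; z = false ; swapped = swapped st
      ; keeps = λ i → trans (recolour-origin (swapped st) (κ i) (point g i) (u i) (w i)) (keeps st i)
      ; linked = new-linked
      ; entry≤1 = ≤-trans (≤-reflexive (agree s₀ (isEntry ∘ recoloured) E)) (entry≤1 st)
      ; spare≤1 = ≤-trans (≤-reflexive (agree s₀ (isSpare ∘ recoloured) Z)) (spare≤1 st)
      ; rel₀ = λ y → trans (agree (s y) (λ a → minor₀ (recoloured a) (yOf a) false) (P₀S new₁ far₁))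
                 (trans (N.new₀ y) (cong (_+ ρ₀ y) (agree (s y) (P₀S new₁ far₀) (λ a → pivot (recoloured a) false))))
      ; rel₁ = λ y → trans (agree (s y) (λ a → minor₁ (recoloured a) (yOf a) false) (P₁S new₁ far₁))
                 (trans (N.new₁′ y) (cong (_+ ρ₁ y) (agree (s y) (P₀S new₁ far₀) (λ a → pivot (recoloured a) false))))
      } , smaller
      where module N = New C₄ E₄ new-avoids mts (E-single C′)

    result₂ : Holds s₀ (meets along new₂) → Smaller st
    result₂ mts = record
      { colour = swapEnds ∘ κ′ ; z = false ; swapped = not (swapped st)
      ; keeps = λ i → trans (swap-origin (swapped st) (κ′ i)) (trans (recolour-origin (swapped st) (κ i) (point g i) (u i) (w i)) (keeps st i))
      ; linked = Linked-cong (λ i → swap-zone (κ′ i)) new-linked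
      ; entry≤1 = ≤-trans (≤-reflexive (agree s₀ (isEntry ∘ swapEnds ∘ recoloured) Z)) (spare≤1 st)
      ; spare≤1 = ≤-trans (≤-reflexive (agree s₀ (isSpare ∘ swapEnds ∘ recoloured) E)) (entry≤1 st)
      ; rel₀ = λ y → trans (agree (s y) (λ a → minor₀ (swapEnds (recoloured a)) (yOf a) false) (P₀S new₂ far₁))
                 (trans (N.new₀ y) (cong (_+ ρ₀ y) (agree (s y) (P₀S new₂ far₀) (λ a → pivot (swapEnds (recoloured a)) false))))
      ; rel₁ = λ y → trans (agree (s y) (λ a → minor₁ (swapEnds (recoloured a)) (yOf a) false) (P₁S new₂ far₁))
                 (trans (N.new₁′ y) (cong (_+ ρ₁ y) (agree (s y) (P₀S new₂ far₀) (λ a → pivot (swapEnds (recoloured a)) false))))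
      } , ≤-trans (s≤s (≤-reflexive (cong ∣_∣ (Vecₚ.tabulate-cong λ i → swap-rest (κ′ i))))) smaller
      where module N = New C₄ Z₄ new-avoids mts (Z-single C′)

    result₃ : Holds s₀ (avoids along new₃) → Holds s₀ (meets along new₃) → Smaller st
    result₃ avd mts = record
      { colour = κ′ ; z = true ; swapped = swapped st
      ; keeps = λ i → trans (recolour-origin (swapped st) (κ i) (point g i) (u i) (w i)) (keeps st i)
      ; linked = new-linked
      ; entry≤1 = ≤-trans (≤-reflexive (agree s₀ (isEntry ∘ recoloured) E)) (entry≤1 st)
      ; spare≤1 = ≤-trans (≤-reflexive (agree s₀ (isSpare ∘ recoloured) Z)) (spare≤1 st)
      ; rel₀ = λ y → trans (agree (s y) (λ a → minor₀ (recoloured a) (yOf a) true) (P₀S new₃ far₁))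
                 (trans (N.new₀ y) (cong (_+ ρ₀ y) (agree (s y) (P₀S new₃ far₀) (λ a → pivot (recoloured a) true))))
      ; rel₁ = λ y → trans (agree (s y) (λ a → minor₁ (recoloured a) (yOf a) true) (P₁S new₃ far₁))
                 (trans (N.new₁′ y) (cong (_+ ρ₁ y) (agree (s y) (P₀S new₃ far₀) (λ a → pivot (recoloured a) true))))
      } , smaller
      where module N = New (C₄ ∪ᵇ Z₄) E₄ avd mts (E-single (C′ ∪ᵇ Z))

    meets₃ : Holds s₀ (meets along new₃)
    meets₃ = lin s₀ (meets along new₃) (fact new-grows new-grows-holds ∷ sub s₀ (bar ∪ᵇ C′) B ∷ [])

    -- Modulo the contracted part of `U` the two ends span the basepoint. If the entry alone does,
    -- it keeps its place and the spare element is deleted; if the spare element does, the two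
    -- exchange places. Otherwise both ends are needed, and contracting the spare element makes the
    -- entry represent the basepoint.
    choose : Holds s₀ (meets along new₁) ⊎ Holds s₀ (negate (meets along new₁)) →
             Holds s₀ (meets along new₂) ⊎ Holds s₀ (negate (meets along new₂)) → Smaller st
    choose (inj₁ h) _ = result₁ h
    choose (inj₂ _) (inj₁ h) = result₂ h
    choose (inj₂ _) (inj₂ h) = result₃ (lin s₀ (avoids along new₃) (fact (negate (meets along new₂)) h ∷ [])) meets₃

    rearrange : Smaller st
    rearrange = choose (holds? s₀ (meets along new₁)) (holds? s₀ (meets along new₂))

-- Elements in a triangle or triad with the two ends.

module Reduce {n} (P : Polymatroid n) (source : Fin n → Origin) (ρ₀ ρ₁ : (Fin n → Bool) → ℕ)
  (ρ-entry : ρ₁ (λ _ → false) ≡ 1) (ρ-core : ρ₁ (λ _ → true) ≡ ρ₀ (λ _ → true)) where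
  open Linking P
  open Reduction P source ρ₀ ρ₁ ρ-entry ρ-core public
  open State public

  -- The failing cut consists of the two ends alone. If `g` is to be deleted, the ends with `g`
  -- behave as a triad, and if it is to be contracted, as a triangle.
  Tri : State → Fin n → Set
  Tri st g = Holds (λ i → zone (drop (colour st i) (point g i)) , false) (negate linkable)

  -- A failing cut with a further uncommitted element on the near side can be rearranged. Without
  -- such an element it is the pair of ends.
  step : ∀ st g → isRest (colour st g) ≡ true → Smaller st ⊎ Tri st g
  step st g rg = split (allSplits? (λ i → zone (drop (κ i) (point g i))) linkable)
    where
    κ = colour st
    V : Colour × Bool × Bool → Bool
    V (k , γ , u) = isRest k ∧ not γ ∧ u
    tri : ∀ u → Holds (λ i → zone (drop (κ i) (point g i)) , u i) (negate linkable) →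
      ¬ (∃ λ i → V (κ i , point g i , u i) ≡ true) → Tri st g
    tri u sep none = Holds-cong (λ i → cong (zone (drop (κ i) (point g i)) ,_) (off i (bool-split _))) (negate linkable)
      (lin s (negate linkable along λ a@(k , γ , u) → zone (drop k γ) , V a)
        (fact (negate linkable along λ (k , γ , u) → zone (drop k γ) , u) sep ∷ []))
      where
      s : Fin n → Colour × Bool × Bool
      s i = κ i , point g i , u i
      off : ∀ i → V (s i) ≡ true ⊎ V (s i) ≡ false → V (s i) ≡ false
      off i (inj₁ e) = absurd (none (i , e))
      off i (inj₂ e) = e
    part : ∀ u → Holds (λ i → zone (drop (κ i) (point g i)) , u i) (negate linkable) →
      Dec (∃ λ i → V (κ i , point g i , u i) ≡ true) → Smaller st ⊎ Tri st g
    part u sep (yes (i , e)) = inj₁ (Rearrange.rearrange st g u sep i (proj₁ (∧-true e)) (proj₂ (∧-true {isRest (κ i)} e)))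
    part u sep (no none) = inj₂ (tri u sep none)
    split : (∃ λ (u : Fin n → Bool) → Holds (λ i → zone (drop (κ i) (point g i)) , u i) (negate linkable)) ⊎
      Linked (λ i → zone (drop (κ i) (point g i))) → Smaller st ⊎ Tri st g
    split (inj₁ (u , sep)) = part u sep (Finₚ.any? λ i → V (κ i , point g i , u i) Boolₚ.≟ true)
    split (inj₂ h) = inj₁ (removeElement st g rg h)

  at-point : ∀ {X : Set} (κ : Fin n → Colour) g (f h : Colour → Bool → X) → (∀ k → f k false ≡ h k false) →
    f (κ g) true ≡ h (κ g) true → ∀ i → f (κ i) (point g i) ≡ h (κ i) (point g i)
  at-point κ g f h off on i = go (bool-split (point g i))
    where
    go : point g i ≡ true ⊎ point g i ≡ false → f (κ i) (point g i) ≡ h (κ i) (point g i)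
    go (inj₁ e) rewrite e = subst (λ j → f (κ j) true ≡ h (κ j) true) (sym (point⇒≡ e)) on
    go (inj₂ e) rewrite e = off (κ i)

  Marked : Set
  Marked = Colour × Bool

  dropDel dropCon flipDel flipCon : Colour → Bool → Colour
  dropDel toDel true = delC
  dropDel k     _    = k
  dropCon toCon true = conC
  dropCon k     _    = k
  flipDel toDel true = conC
  flipDel k     _    = k
  flipCon toCon true = delC
  flipCon k     _    = k

  cE cZ cC cX cG cD cAll : Marked → Bool
  cE (k , _)   = isEntry k
  cZ (k , _)   = isSpare k
  cC (k , _)   = isConC k
  cX (k , _)   = isEntry k ∨ isSpare k
  cAll (k , _) = not (isDelC k)
  cD (k , γ)   = isToDel k ∧ γ
  cG (k , γ)   = isToCon k ∧ γ

  infixl 5 _∖_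
  _∖_ : ∀ {A : Set} → (A → Bool) → (A → Bool) → A → Bool
  (p ∖ q) a = p a ∧ not (q a)

  -- The pair of ends is independent and coindependent in the current matroid. The inequalities
  -- after these describe the triad, for `g` in `cD`, and the triangle, for `g` in `cG`, relative to
  -- this pair.
  ends-free ends-cofree : Ineq Marked
  ends-free   = num 2 ⊞ rank cC ≼ rank (cC ∪ᵇ cX)
  ends-cofree = rank cAll ≼ rank (cAll ∖ cX)

  del-coloop del-keeps : Ineq Marked
  del-coloop = num 1 ⊞ rank (cAll ∖ cX ∖ cD) ≼ rank cAll
  del-keeps  = rank cAll ≼ rank (cAll ∖ cD)

  con-flat con-loop con-free : Ineq Marked
  con-flat = rank (cC ∪ᵇ cG ∪ᵇ cX) ≼ rank cC ⊞ num 2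
  con-loop = rank (cC ∪ᵇ cG ∪ᵇ cX) ≼ rank (cC ∪ᵇ cG) ⊞ num 1
  con-free = num 1 ⊞ rank cC ≼ rank (cC ∪ᵇ cG)

  module Facts (st : State) (g : Fin n) where
    κ = colour st

    s : Fin n → Marked
    s i = κ i , point g i

    linked-∅ : Holds s (linkable along λ (k , γ) → zone k , false)
    linked-∅ = linked st (λ _ → false)

    endsFree : Holds s ends-free
    endsFree = lin s ends-free (fact (linkable along λ (k , γ) → zone k , false) linked-∅ ∷ mono s (cAll ∖ cX) cAll ∷ [])

    endsCofree : Holds s ends-cofree
    endsCofree = lin s ends-cofree
      ( fact (linkable along λ (k , γ) → zone k , false) linked-∅
      ∷ sub s cC cX ∷ sub s cE cZ ∷ fact (rank cE ≼ num 1) (entry≤1 st) ∷ fact (rank cZ ≼ num 1) (spare≤1 st) ∷ [] )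

    module Del (isDel : colour st g ≡ toDel) (tri : Tri st g) where
      tri-del : Holds s (negate linkable along λ (k , γ) → zone (dropDel k γ) , false)
      tri-del = Holds-cong (λ i → cong (λ k → zone k , false) (at-point κ g drop dropDel
          (everywhere λ k → drop k false ≟F dropDel k false)
          (subst (λ k → drop k true ≡ dropDel k true) (sym isDel) refl) i)) (negate linkable) tri

      D≤1 : Holds s (rank cD ≼ num 1)
      D≤1 = ≤-trans (R-mono λ i e → proj₂ (∧-true {isToDel (κ i)} e)) (R-unit g)

      coloop : Holds s del-coloop
      coloop = lin s del-coloop
        ( fact (negate linkable along λ (k , γ) → zone (dropDel k γ) , false) tri-del
        ∷ fact ends-free endsFree ∷ mono s (cAll ∖ cD) cAll ∷ [] )

      stays : Holds s del-keeps
      stays = lin s del-keeps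
        ( fact (negate linkable along λ (k , γ) → zone (dropDel k γ) , false) tri-del
        ∷ fact ends-free endsFree ∷ fact ends-cofree endsCofree
        ∷ sub s (cAll ∖ cX ∖ cD) cD ∷ fact (rank cD ≼ num 1) D≤1 ∷ [] )

      -- One of deletion and contraction preserves linkedness by `link-step`, and here deletion does
      -- not. So a stuck element may always meet the opposite fate; the remaining question is
      -- whether the minor survives this.
      flip-linked : Linked (λ i → zone (flipDel (κ i) (point g i)))
      flip-linked = pick (link-step (zone ∘ κ) g (linked st))
        where
        pick : _ → _
        pick (inj₁ h) = absurd (<⇒≱ tri-del (Holds-cong (λ i → cong (_, false) (at-point κ g
          (λ k γ → assign del (zone k) γ) (λ k γ → zone (dropDel k γ)) (everywhere λ k → assign del (zone k) false ≟F zone (dropDel k false)) (subst (λ k → assign del (zone k) true ≡ zone (dropDel k true)) (sym isDel) refl) i))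
          linkable (h (λ _ → false))))
        pick (inj₂ h) = Linked-cong (at-point κ g
          (λ k γ → assign con (zone k) γ) (λ k γ → zone (flipDel k γ)) (everywhere λ k → assign con (zone k) false ≟F zone (flipDel k false)) (subst (λ k → assign con (zone k) true ≡ zone (flipDel k true)) (sym isDel) refl)) h

    module Con (isCon : colour st g ≡ toCon) (tri : Tri st g) where
      tri-con : Holds s (negate linkable along λ (k , γ) → zone (dropCon k γ) , false)
      tri-con = Holds-cong (λ i → cong (λ k → zone k , false) (at-point κ g drop dropCon
          (everywhere λ k → drop k false ≟F dropCon k false)
          (subst (λ k → drop k true ≡ dropCon k true) (sym isCon) refl) i)) (negate linkable) tri

      G≤1 : Holds s (rank cG ≼ num 1)
      G≤1 = ≤-trans (R-mono λ i e → proj₂ (∧-true {isToCon (κ i)} e)) (R-unit g)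

      loop : Holds s con-loop
      loop = lin s con-loop
        ( fact (negate linkable along λ (k , γ) → zone (dropCon k γ) , false) tri-con ∷ fact ends-cofree endsCofree ∷ [] )

      flat : Holds s con-flat
      flat = lin s con-flat (fact con-loop loop ∷ sub s cC cG ∷ fact (rank cG ≼ num 1) G≤1 ∷ [])

      gFree : Holds s con-free
      gFree = lin s con-free (fact con-loop loop ∷ mono s (cC ∪ᵇ cX) (cC ∪ᵇ cG ∪ᵇ cX) ∷ fact ends-free endsFree ∷ [])

      flip-linked : Linked (λ i → zone (flipCon (κ i) (point g i)))
      flip-linked = pick (link-step (zone ∘ κ) g (linked st))
        where
        pick : _ → _
        pick (inj₂ h) = absurd (<⇒≱ tri-con (Holds-cong (λ i → cong (_, false) (at-point κ g
          (λ k γ → assign con (zone k) γ) (λ k γ → zone (dropCon k γ)) (everywhere λ k → assign con (zone k) false ≟F zone (dropCon k false)) (subst (λ k → assign con (zone k) true ≡ zone (dropCon k true)) (sym isCon) refl) i))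
          linkable (h (λ _ → false))))
        pick (inj₁ h) = Linked-cong (at-point κ g
          (λ k γ → assign del (zone k) γ) (λ k γ → zone (flipCon k γ)) (everywhere λ k → assign del (zone k) false ≟F zone (flipCon k false)) (subst (λ k → assign del (zone k) true ≡ zone (flipCon k true)) (sym isCon) refl)) h

  flipped : ∀ st g → isRest (colour st g) ≡ true → (f : Colour → Bool → Colour) → f ≡ flipDel ⊎ f ≡ flipCon →
    isRest (f (colour st g) true) ≡ false →
    Linked (λ i → zone (f (colour st i) (point g i))) → ∀ z′ →
    (∀ y → R (λ i → minor₀ (f (colour st i) (point g i)) (y i) z′) ≡ R (λ i → pivot (f (colour st i) (point g i)) z′) + ρ₀ y) →
    (∀ y → R (λ i → minor₁ (f (colour st i) (point g i)) (y i) z′) ≡ R (λ i → pivot (f (colour st i) (point g i)) z′) + ρ₁ y) →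
    Smaller st
  flipped st g rg f isF gone lk z′ r₀ r₁ = record
    { colour  = κ′
    ; z       = z′
    ; swapped = swapped st
    ; keeps   = λ i → trans (same-origin isF (swapped st) (κ i) (point g i)) (keeps st i)
    ; linked  = lk
    ; entry≤1 = ≤-trans (≤-reflexive (R-cong λ i → proj₁ (same-ends isF (κ i) (point g i)))) (entry≤1 st)
    ; spare≤1 = ≤-trans (≤-reflexive (R-cong λ i → proj₂ (same-ends isF (κ i) (point g i)))) (spare≤1 st)
    ; rel₀    = r₀
    ; rel₁    = r₁
    } , shrinks κ κ′ (λ i → still isF (κ i) (point g i)) g rg (trans (cong (isRest ∘ f (κ g)) (point-refl g)) gone)
    where
    κ = colour st
    κ′ : Fin n → Colour
    κ′ i = f (κ i) (point g i)
    same-origin : ∀ {f} → f ≡ flipDel ⊎ f ≡ flipCon → ∀ b k γ → origin b (f k γ) ≡ origin b k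
    same-origin (inj₁ refl) b k γ = everywhere (λ (b , k , γ) → origin b (flipDel k γ) ≟F origin b k) (b , k , γ)
    same-origin (inj₂ refl) b k γ = everywhere (λ (b , k , γ) → origin b (flipCon k γ) ≟F origin b k) (b , k , γ)
    same-ends : ∀ {f} → f ≡ flipDel ⊎ f ≡ flipCon → ∀ k γ → isEntry (f k γ) ≡ isEntry k × isSpare (f k γ) ≡ isSpare k
    same-ends (inj₁ refl) k γ = everywhere (λ (k , γ) → (isEntry (flipDel k γ) Boolₚ.≟ isEntry k) ×-dec (isSpare (flipDel k γ) Boolₚ.≟ isSpare k)) (k , γ)
    same-ends (inj₂ refl) k γ = everywhere (λ (k , γ) → (isEntry (flipCon k γ) Boolₚ.≟ isEntry k) ×-dec (isSpare (flipCon k γ) Boolₚ.≟ isSpare k)) (k , γ)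
    still : ∀ {f} → f ≡ flipDel ⊎ f ≡ flipCon → ∀ k γ → isRest (f k γ) ≡ true → isRest k ≡ true
    still (inj₁ refl) toCon _ _ = refl
    still (inj₁ refl) toDel _ _ = refl
    still (inj₂ refl) toCon _ _ = refl
    still (inj₂ refl) toDel _ _ = refl

  bump : ∀ {a a′ b b′ ρ} → a′ ≡ suc a → b′ ≡ suc b → a ≡ b + ρ → a′ ≡ b′ + ρ
  bump refl refl refl = refl

  same : ∀ {a a′ b b′ ρ : ℕ} → a′ ≡ a → b′ ≡ b → a ≡ b + ρ → a′ ≡ b′ + ρ
  same refl refl e = e

  rest-toDel : ∀ {k} → k ≡ toDel → isRest k ≡ true
  rest-toDel refl = refl

  rest-toCon : ∀ {k} → k ≡ toCon → isRest k ≡ true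
  rest-toCon refl = refl

  -- The marks of g and h are followed by the bits y and z.
  Pair : Set
  Pair = Colour × Bool × Bool × Bool × Bool

  module Two (st : State) (g h : Fin n) (g≢h : g ≢ h) where
    κ = colour st

    apart : ∀ i → point h i ≡ point h i ∧ not (point g i)
    apart i = go (bool-split (point g i)) (bool-split (point h i))
      where
      go : point g i ≡ true ⊎ point g i ≡ false → point h i ≡ true ⊎ point h i ≡ false → point h i ≡ point h i ∧ not (point g i)
      go (inj₁ e) (inj₁ e′) = absurd (g≢h (trans (sym (point⇒≡ {g = g} {i} e)) (point⇒≡ {g = h} {i} e′)))
      go (inj₁ e) (inj₂ e′) rewrite e′ = refl
      go (inj₂ e) _ rewrite e = sym (Boolₚ.∧-identityʳ _)

    s : (Fin n → Bool) → Fin n → Pair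
    s y i = κ i , point g i , point h i , y i , z st

    atG atH : Pair → Marked
    atG (k , γ , δ , _) = k , γ
    atH (k , γ , δ , _) = k , (δ ∧ not γ)

    factH : ∀ I → Holds (Facts.s st h) I → Holds (λ i → κ i , (point h i ∧ not (point g i))) I
    factH I = Holds-cong (λ i → cong (κ i ,_) (apart i)) I

    pv mx fx fc : Pair → Bool
    pv (k , γ , δ , y , z) = pivot k z
    mx (k , γ , δ , y , z) = minor₁ k false z
    fx (k , γ , δ , y , z) = minor₁ k true z
    fc (k , γ , δ , y , z) = minor₀ k true z

    liveI spanI : Ineq Pair
    liveI = num 1 ⊞ rank pv ≼ rank mx
    spanI = rank fx ≼ rank fc

    E Z X All C Dg Dh Gg Gh : Pair → Bool
    E   = cE ∘ atG
    Z   = cZ ∘ atG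
    X   = cX ∘ atG
    All = cAll ∘ atG
    C   = cC ∘ atG
    Dg  = cD ∘ atG
    Dh  = cD ∘ atH
    Gg  = cG ∘ atG
    Gh  = cG ∘ atH

    -- Two triads through both ends put `g` and `h` in series, except when deleting both makes the
    -- entry a coloop, which `span` excludes. As `h` is going to be deleted, `g` becomes a coloop,
    -- and contracting it has the same effect as deleting it; all ranks rise by one.
    seriesDel : colour st g ≡ toDel → colour st h ≡ toDel → Tri st g → Tri st h → Smaller st
    seriesDel dg dh tg th = flipped st g (rest-toDel dg) flipDel (inj₁ refl) (subst (λ k → isRest (flipDel k true) ≡ false) (sym dg) refl)
      G.flip-linked (z st)
      (λ y → bump (up (false , true) y) (up (false , false) y) (rel₀ st y)) (λ y → bump (up (true , true) y) (up (false , false) y) (rel₁ st y))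
      where
      module G = Facts.Del st g dg tg
      module H = Facts.Del st h dh th
      serial : Ineq Pair
      serial = num 1 ⊞ rank (All ∖ Dg ∖ Dh) ≼ rank (All ∖ Dh)
      serial-holds : ∀ y → Holds (s y) serial
      serial-holds y = lin (s y) serial
        ( fact (del-coloop along atG) G.coloop ∷ fact (del-coloop along atH) (factH del-coloop H.coloop)
        ∷ sub (s y) (All ∖ X ∖ Dg) (All ∖ X ∖ Dh)
        ∷ fact (ends-cofree along atG) (Facts.endsCofree st g)
        ∷ fact spanI (span st) ∷ sub (s y) fx (All ∖ E ∖ Dg ∖ Dh)
        ∷ sub (s y) (All ∖ X ∖ Dg ∖ Dh) Z ∷ fact (rank Z ≼ num 1) (spare≤1 st)
        ∷ fact (del-keeps along atH) (factH del-keeps H.stays)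
        ∷ [] )
      new old : Pair × Bool × Bool → Bool
      new ((k , γ , δ , y , z) , ab) = section ab (flipDel k γ) y z
      old ((k , γ , δ , y , z) , ab) = section ab k y z
      up : ∀ ab y → R (λ i → section ab (flipDel (κ i) (point g i)) (y i) (z st)) ≡ suc (R (λ i → section ab (κ i) (y i) (z st)))
      up ab y = ≤-antisym
        (lin t (rank new ≼ num 1 ⊞ rank old) (sub t old (Dg ∘ proj₁) ∷ fact (rank (Dg ∘ proj₁) ≼ num 1) G.D≤1 ∷ []))
        (lin t (num 1 ⊞ rank old ≼ rank new) (fact (serial along proj₁) (serial-holds y) ∷ sub t new ((All ∖ Dg ∖ Dh) ∘ proj₁) ∷ []))
        where
        t : Fin n → Pair × Bool × Bool
        t i = s y i , ab

    -- Dually, `g` and `h` are parallel, except when contracting both makes the entry a loop, which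
    -- `live` excludes. After contraction of `h`, the loop `g` may be deleted.
    seriesCon : colour st g ≡ toCon → colour st h ≡ toCon → Tri st g → Tri st h → Smaller st
    seriesCon dg dh tg th = flipped st g (rest-toCon dg) flipCon (inj₂ refl) (subst (λ k → isRest (flipCon k true) ≡ false) (sym dg) refl)
      G.flip-linked (z st)
      (λ y → same (eq (false , true) y) (eq (false , false) y) (rel₀ st y)) (λ y → same (eq (true , true) y) (eq (false , false) y) (rel₁ st y))
      where
      module G = Facts.Con st g dg tg
      module H = Facts.Con st h dh th
      serial : Ineq Pair
      serial = rank (C ∪ᵇ Gg ∪ᵇ Gh) ≼ rank (C ∪ᵇ Gh)
      serial-holds : ∀ y → Holds (s y) serial
      serial-holds y = lin (s y) serial
        ( fact (con-flat along atG) G.flat ∷ fact (con-flat along atH) (factH con-flat H.flat)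
        ∷ sub (s y) (C ∪ᵇ Gg ∪ᵇ X) (C ∪ᵇ Gh ∪ᵇ X)
        ∷ fact (ends-free along atG) (Facts.endsFree st g)
        ∷ fact liveI (live st) ∷ sub (s y) (C ∪ᵇ Gg ∪ᵇ Gh ∪ᵇ E) pv
        ∷ mono (s y) (C ∪ᵇ Gg ∪ᵇ Gh ∪ᵇ E) (C ∪ᵇ Gg ∪ᵇ Gh ∪ᵇ X)
        ∷ fact (con-free along atH) (factH con-free H.gFree)
        ∷ [] )
      new old : Pair × Bool × Bool → Bool
      new ((k , γ , δ , y , z) , ab) = section ab (flipCon k γ) y z
      old ((k , γ , δ , y , z) , ab) = section ab k y z
      eq : ∀ ab y → R (λ i → section ab (flipCon (κ i) (point g i)) (y i) (z st)) ≡ R (λ i → section ab (κ i) (y i) (z st))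
      eq ab y = ≤-antisym
        (lin t (rank new ≼ rank old) (mono t new old ∷ []))
        (lin t (rank old ≼ rank new) (fact (serial along proj₁) (serial-holds y) ∷ sub t new ((C ∪ᵇ Gg ∪ᵇ Gh) ∘ proj₁) ∷ []))
        where
        t : Fin n → Pair × Bool × Bool
        t i = s y i , ab

    -- With `h` contracted and `g` deleted, the pair of ends has rank at most one and is not spanned
    -- by the other elements. However the spare element is then removed, the entry becomes a loop or
    -- a coloop, against `live` and `span`.
    clash : colour st g ≡ toDel → colour st h ≡ toCon → Tri st g → Tri st h → Empty
    clash dg dh tg th = go (z st) (live st) (span st)
      where
      module G = Facts.Del st g dg tg
      module H = Facts.Con st h dh th
      go : ∀ z → 1 + R (λ i → pivot (κ i) z) ≤ R (λ i → minor₁ (κ i) false z) →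
        R (λ i → minor₁ (κ i) true z) ≤ R (λ i → minor₀ (κ i) true z) → Empty
      go true lv sp = <⇒≱ (lin t (num 1 ≼ num 0)
        ( fact (del-coloop along atG) G.coloop ∷ fact (del-keeps along atG) G.stays
        ∷ fact (con-loop along atH) (factH con-loop H.loop)
        ∷ fact (num 1 ⊞ rank (λ (k , _) → pivot k true) ≼ rank (λ (k , _) → minor₁ k false true)) lv
        ∷ fact (rank (λ (k , _) → minor₁ k true true) ≼ rank (λ (k , _) → minor₀ k true true)) sp
        ∷ sub t (C ∪ᵇ Gh ∪ᵇ X) (λ (k , _) → pivot k true)
        ∷ sub t (C ∪ᵇ Gh ∪ᵇ Z) (All ∖ X ∖ Dg)
        ∷ sub t (λ (k , _) → minor₁ k true true) (All ∖ E ∖ Dg)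
        ∷ [] )) z≤n
        where t = s (λ _ → false)
      go false lv sp = <⇒≱ (lin t (num 1 ≼ num 0)
        ( fact (del-coloop along atG) G.coloop ∷ fact (del-keeps along atG) G.stays
        ∷ fact (con-loop along atH) (factH con-loop H.loop)
        ∷ fact (num 1 ⊞ rank (λ (k , _) → pivot k false) ≼ rank (λ (k , _) → minor₁ k false false)) lv
        ∷ fact (rank (λ (k , _) → minor₁ k true false) ≼ rank (λ (k , _) → minor₀ k true false)) sp
        ∷ sub t (C ∪ᵇ Gh ∪ᵇ E) (λ (k , _) → pivot k false)
        ∷ sub t (C ∪ᵇ Gh ∪ᵇ X) (All ∖ Z ∖ Dg)
        ∷ sub t (λ (k , _) → minor₁ k true false) (All ∖ X ∖ Dg)
        ∷ [] )) z≤n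
        where t = s (λ _ → false)

  not-coloop not-loop : Ineq Marked
  not-coloop = rank (cAll ∖ cD) ≼ rank (cAll ∖ cD ∖ cZ)
  not-loop   = num 1 ⊞ rank (cC ∪ᵇ cG) ≼ rank (cC ∪ᵇ cG ∪ᵇ cZ)

  module One (st : State) (g : Fin n) where
    open Facts st g

    Section : Set
    Section = Marked × Bool × Bool × Bool

    t : Bool × Bool → (Fin n → Bool) → Fin n → Section
    t ab y i = s i , y i , ab

    module LastDel (dg : colour st g ≡ toDel) (tg : Tri st g) where
      module G = Del dg tg

      spare-contracted : Holds s not-coloop → z st ≡ true
      spare-contracted nc = go (z st) refl (span st)
        where
        go : ∀ b → z st ≡ b → R (λ i → minor₁ (κ i) true b) ≤ R (λ i → minor₀ (κ i) true b) → z st ≡ true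
        go true  e _  = e
        go false _ sp = absurd (<⇒≱ (lin s (num 1 ≼ num 0)
          ( fact not-coloop nc ∷ fact del-coloop G.coloop ∷ fact del-keeps G.stays
          ∷ fact (rank (λ (k , _) → minor₁ k true false) ≼ rank (λ (k , _) → minor₀ k true false)) sp
          ∷ sub s (λ (k , _) → minor₁ k true false) (cAll ∖ cX ∖ cD) ∷ [] )) z≤n)

      -- If the spare element is a coloop after deletion of `g`, it is in series with `g`. Deleting
      -- `g` and removing the spare element in either way then gives the same minor as contracting
      -- `g` and deleting the spare element.
      contract : Holds s (negate not-coloop) → Smaller st
      contract cl = flipped st g (rest-toDel dg) flipDel (inj₁ refl) (subst (λ k → isRest (flipDel k true) ≡ false) (sym dg) refl)
        G.flip-linked false
        (λ y → bump (up (false , true) y) (up (false , false) y) (drop-z (false , true) y (z st) (rel₀ st y)))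
        (λ y → bump (up (true , true) y) (up (false , false) y) (drop-z (true , true) y (z st) (rel₁ st y)))
        where
        D Z old new full stop : Section → Bool
        D    = cD ∘ proj₁
        Z    = cZ ∘ proj₁
        stop = (cAll ∖ cD ∖ cZ) ∘ proj₁
        old ((k , γ) , y , ab)  = section ab k y false
        full ((k , γ) , y , ab) = section ab k y true
        new ((k , γ) , y , ab)  = section ab (flipDel k γ) y false
        up : ∀ ab y → R (new ∘ t ab y) ≡ suc (R (old ∘ t ab y))
        up ab y = ≤-antisym
          (lin (t ab y) (rank new ≼ num 1 ⊞ rank old) (sub (t ab y) old D ∷ fact (rank D ≼ num 1) G.D≤1 ∷ []))
          (lin (t ab y) (num 1 ⊞ rank old ≼ rank new)
            ( sub (t ab y) new stop ∷ fact (negate not-coloop along proj₁) cl ∷ fact (ends-cofree along proj₁) endsCofree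
            ∷ mono (t ab y) ((cAll ∖ cX) ∘ proj₁) ((cAll ∖ cZ) ∘ proj₁) ∷ mono (t ab y) ((cAll ∖ cD) ∘ proj₁) (cAll ∘ proj₁) ∷ [] ))
        out : ∀ ab y → R (full ∘ t ab y) ≡ suc (R (old ∘ t ab y))
        out ab y = ≤-antisym
          (lin (t ab y) (rank full ≼ num 1 ⊞ rank old) (sub (t ab y) old Z ∷ fact (rank Z ≼ num 1) (spare≤1 st) ∷ []))
          (lin (t ab y) (num 1 ⊞ rank old ≼ rank full) (sub (t ab y) full stop ∷ fact (negate not-coloop along proj₁) cl ∷ []))
        drop-z : ∀ ab y {ρ} z → R (λ i → section ab (κ i) (y i) z) ≡ R (λ i → pivot (κ i) z) + ρ →
          R (λ i → section ab (κ i) (y i) false) ≡ R (λ i → pivot (κ i) false) + ρ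
        drop-z ab y false e = e
        drop-z ab y true  e = suc-injective (trans (sym (out ab y)) (trans e (cong (_+ _) (out (false , false) y))))

    module LastCon (dg : colour st g ≡ toCon) (tg : Tri st g) where
      module G = Con dg tg

      spare-deleted : Holds s not-loop → z st ≡ false
      spare-deleted nl = go (z st) refl (live st)
        where
        go : ∀ b → z st ≡ b → 1 + R (λ i → pivot (κ i) b) ≤ R (λ i → minor₁ (κ i) false b) → z st ≡ false
        go false e _  = e
        go true  _ lv = absurd (<⇒≱ (lin s (num 1 ≼ num 0)
          ( fact not-loop nl ∷ fact con-loop G.loop
          ∷ fact (num 1 ⊞ rank (λ (k , _) → pivot k true) ≼ rank (λ (k , _) → minor₁ k false true)) lv
          ∷ sub s (cC ∪ᵇ cG ∪ᵇ cX) (λ (k , _) → pivot k true) ∷ [] )) z≤n)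

      -- The dual situation: the spare element is parallel to `g`, so that it is contracted in place
      -- of `g`, which is deleted. Hence the new value of `z` is `true`.
      delete : Holds s (negate not-loop) → Smaller st
      delete lp = flipped st g (rest-toCon dg) flipCon (inj₂ refl) (subst (λ k → isRest (flipCon k true) ≡ false) (sym dg) refl)
        G.flip-linked true
        (λ y → same (eq (false , true) y (z st)) (eq (false , false) y (z st)) (rel₀ st y))
        (λ y → same (eq (true , true) y (z st)) (eq (false , false) y (z st)) (rel₁ st y))
        where
        C G′ Z E CGZ old new full : Section → Bool
        C   = cC ∘ proj₁
        G′  = cG ∘ proj₁
        Z   = cZ ∘ proj₁
        E   = cE ∘ proj₁
        CGZ = C ∪ᵇ G′ ∪ᵇ Z
        old ((k , γ) , y , ab)  = section ab k y false
        full ((k , γ) , y , ab) = section ab k y true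
        new ((k , γ) , y , ab)  = section ab (flipCon k γ) y true
        fs : ∀ ab y → List (Fact (t ab y))
        fs ab y = sub (t ab y) new CGZ ∷ fact (negate not-loop along proj₁) lp ∷ sub (t ab y) C G′ ∷ fact (rank G′ ≼ num 1) G.G≤1
          ∷ fact (ends-free along proj₁) endsFree ∷ sub (t ab y) (C ∪ᵇ Z) E ∷ fact (rank E ≼ num 1) (entry≤1 st) ∷ []
        eq : ∀ ab y z → R (new ∘ t ab y) ≡ R (λ i → section ab (κ i) (y i) z)
        eq ab y false = ≤-antisym
          (lin (t ab y) (rank new ≼ rank old) (mono (t ab y) new full ∷ sub (t ab y) old CGZ ∷ fact (negate not-loop along proj₁) lp ∷ []))
          (lin (t ab y) (rank old ≼ rank new) (mono (t ab y) old full ∷ fs ab y))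
        eq ab y true = ≤-antisym
          (lin (t ab y) (rank new ≼ rank full) (mono (t ab y) new full ∷ []))
          (lin (t ab y) (rank full ≼ rank new) (fs ab y))

  -- With `none`, only the spare element extends the minor, by deletion or contraction according to
  -- `z`. With `oneDel` the ends form a triad with the deleted `g` and the spare element is
  -- contracted; with `oneCon` they form a triangle with the contracted `g` and the spare element is
  -- deleted.
  data Outcome : Set where
    none   : (st : State) → (∀ i → isRest (colour st i) ≡ true → Empty) → Outcome
    oneDel : (st : State) (g : Fin n) → colour st g ≡ toDel → (∀ i → isRest (colour st i) ≡ true → i ≡ g) →
             Tri st g → z st ≡ true → Holds (Facts.s st g) not-coloop → Outcome
    oneCon : (st : State) (g : Fin n) → colour st g ≡ toCon → (∀ i → isRest (colour st i) ≡ true → i ≡ g) →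
             Tri st g → z st ≡ false → Holds (Facts.s st g) not-loop → Outcome

  rest-cases : ∀ k → isRest k ≡ true → k ≡ toDel ⊎ k ≡ toCon
  rest-cases toDel _ = inj₁ refl
  rest-cases toCon _ = inj₂ refl

  outcome : ∀ m st → size st ≤ m → Outcome
  outcome-step : ∀ m st → size st ≤ m → Outcome ⊎ Smaller st

  outcome m st le = next m le (outcome-step m st le)
    where
    next : ∀ m → size st ≤ m → Outcome ⊎ Smaller st → Outcome
    next m le (inj₁ o) = o
    next (suc m) le (inj₂ (st′ , lt)) = outcome m st′ (≤-pred (≤-trans lt le))
    next zero le (inj₂ (st′ , lt)) = absurd (<⇒≱ (≤-trans lt le) z≤n)

  outcome-step m st le = search (Finₚ.any? λ i → isRest (κ i) Boolₚ.≟ true)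
    where
    κ = colour st
    last : ∀ g → isRest (κ g) ≡ true → Tri st g → (∀ i → isRest (κ i) ≡ true → i ≡ g) → Outcome ⊎ Smaller st
    last g rg tg only = go (rest-cases (κ g) rg)
      where
      go : κ g ≡ toDel ⊎ κ g ≡ toCon → Outcome ⊎ Smaller st
      go (inj₁ dg) = pick (holds? (Facts.s st g) not-coloop)
        where
        pick : _ → Outcome ⊎ Smaller st
        pick (inj₁ h) = inj₁ (oneDel st g dg only tg (One.LastDel.spare-contracted st g dg tg h) h)
        pick (inj₂ h) = inj₂ (One.LastDel.contract st g dg tg h)
      go (inj₂ dg) = pick (holds? (Facts.s st g) not-loop)
        where
        pick : _ → Outcome ⊎ Smaller st
        pick (inj₁ h) = inj₁ (oneCon st g dg only tg (One.LastCon.spare-deleted st g dg tg h) h)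
        pick (inj₂ h) = inj₂ (One.LastCon.delete st g dg tg h)
    both : ∀ g h → isRest (κ g) ≡ true → isRest (κ h) ≡ true → g ≢ h → Tri st g → Tri st h → Smaller st
    both g h rg rh ne tg th = go (rest-cases (κ g) rg) (rest-cases (κ h) rh)
      where
      go : κ g ≡ toDel ⊎ κ g ≡ toCon → κ h ≡ toDel ⊎ κ h ≡ toCon → Smaller st
      go (inj₁ dg) (inj₁ dh) = Two.seriesDel st g h ne dg dh tg th
      go (inj₂ dg) (inj₂ dh) = Two.seriesCon st g h ne dg dh tg th
      go (inj₁ dg) (inj₂ dh) = absurd (Two.clash st g h ne dg dh tg th)
      go (inj₂ dg) (inj₁ dh) = absurd (Two.clash st h g (ne ∘ sym) dh dg th tg)
    second′ : ∀ g → isRest (κ g) ≡ true → Tri st g → Dec (∃ λ h → isRest (κ h) ≡ true × g ≢ h) → Outcome ⊎ Smaller st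
    second′ g rg tg (no alone) = last g rg tg λ i ri → decidable-stable (i ≟F g) λ ne → alone (i , ri , ne ∘ sym)
    second′ g rg tg (yes (h , rh , ne)) = go (step st h rh)
      where
      go : Smaller st ⊎ Tri st h → Outcome ⊎ Smaller st
      go (inj₁ s) = inj₂ s
      go (inj₂ th) = inj₂ (both g h rg rh ne tg th)
    search : Dec (∃ λ i → isRest (κ i) ≡ true) → Outcome ⊎ Smaller st
    search (no no-rest) = inj₁ (none st λ i e → no-rest (i , e))
    search (yes (g , rg)) = go (step st g rg)
      where
      go : Smaller st ⊎ Tri st g → Outcome ⊎ Smaller st
      go (inj₁ s) = inj₂ s
      go (inj₂ tg) = second′ g rg tg (Finₚ.any? λ h → (isRest (κ h) Boolₚ.≟ true) ×-dec ¬? (g ≟F h))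

-- Minors of binary matroids

anyFin⁺ : ∀ {m} {f : Fin m → Bool} j → f j ≡ true → anyFin f ≡ true
anyFin⁺ zero    e = ∨-left e
anyFin⁺ {f = f} (suc j) e = ∨-right {f zero} (anyFin⁺ j e)

anyFin⁻ : ∀ {m} (f : Fin m → Bool) → anyFin f ≡ true → ∃[ j ] (f j ≡ true)
anyFin⁻ {suc m} f e with ∨-true {f zero} e
... | inj₁ e₀ = zero , e₀
... | inj₂ e₁ with anyFin⁻ (f ∘ suc) e₁
... | j , ej = suc j , ej

bool-≡ : ∀ {a b} → (a ≡ true → b ≡ true) → (b ≡ true → a ≡ true) → a ≡ b
bool-≡ {true}  {b}     f g = sym (f refl)
bool-≡ {false} {true}  f g = g refl
bool-≡ {false} {false} f g = refl

not-false : ∀ {b} → ¬ (b ≡ false) → b ≡ true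
not-false {true}  _ = refl
not-false {false} n = absurd (n refl)

not-true : ∀ {b} → ¬ (b ≡ true) → b ≡ false
not-true {true}  n = absurd (n refl)
not-true {false} n = refl

img : ∀ {m n} → (Fin m → Fin n) → (Fin m → Bool) → Fin n → Bool
img ψ y i = anyFin λ x → y x ∧ does (ψ x ≟F i)

img⁺ : ∀ {m n} (ψ : Fin m → Fin n) y x → y x ≡ true → img ψ y (ψ x) ≡ true
img⁺ ψ y x e = anyFin⁺ x (∧-both e (point-refl (ψ x)))

img-at : ∀ {m n} (ψ : Fin m → Fin n) y x {i} → i ≡ ψ x → y x ≡ true → img ψ y i ≡ true
img-at ψ y x refl = img⁺ ψ y x

img⁻ : ∀ {m n} (ψ : Fin m → Fin n) y i → img ψ y i ≡ true → ∃[ x ] (y x ≡ true × ψ x ≡ i)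
img⁻ ψ y i e with anyFin⁻ (λ x → y x ∧ does (ψ x ≟F i)) e
... | x , h with ∧-true {y x} h
... | yx , p with ψ x ≟F i
... | yes q = x , yx , q

ext : ∀ {n} {c d : Subset n} → (∀ i → lookup c i ≡ lookup d i) → c ≡ d
ext {c = c} {d} e = trans (sym (Vecₚ.tabulate∘lookup c)) (trans (Vecₚ.tabulate-cong e) (Vecₚ.tabulate∘lookup d))

lookup-⊥ : ∀ {n} (i : Fin n) → lookup (⊥ {n}) i ≡ false
lookup-⊥ i = Vecₚ.lookup-replicate i false

⊕-cancel : ∀ {n} (p q : Subset n) → p ≡ q ⊕ (p ⊕ q)
⊕-cancel p q = ext λ i → sym (trans (lookup-⊕ q (p ⊕ q) i) (trans (cong (lookup q i xor_) (lookup-⊕ p q i)) (flip-twice (lookup p i) (lookup q i))))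
  where
  flip-twice : ∀ a b → b xor (a xor b) ≡ a
  flip-twice true  true  = refl
  flip-twice true  false = refl
  flip-twice false true  = refl
  flip-twice false false = refl

⊕-self : ∀ {n} (p : Subset n) → p ⊕ p ≡ ⊥
⊕-self p = ext λ i → trans (lookup-⊕ p p i) (trans (Boolₚ.xor-same (lookup p i)) (sym (lookup-⊥ i)))

-- Cycles of a minor are the traces of cycles of `K` inside `C` and the image of `ψ`; all other
-- elements are thereby deleted. Two lifts of the same trace may differ by a cycle inside `C`.
record Lift {n m} (K : Binary n) (C : Fin n → Bool) (ψ : Fin m → Fin n) (y : Subset m) : Set where
  constructor mkLift
  field
    lift    : Subset n
    cyc     : Cycle K lift
    extends : ∀ x → lookup lift (ψ x) ≡ lookup y x
    within  : ∀ i → lookup lift i ≡ true → C i ≡ true ⊎ (∃[ x ] (ψ x ≡ i))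

open Lift public

lift? : ∀ {n m} (K : Binary n) C (ψ : Fin m → Fin n) y → Dec (Lift K C ψ y)
lift? K C ψ y = map′ (λ (c , h , e , w) → mkLift c h e w) (λ l → lift l , cyc l , extends l , within l)
  (Subₚ.anySubset? λ c → cycle? K c ×-dec Finₚ.all? (λ x → lookup c (ψ x) Boolₚ.≟ lookup y x) ×-dec
    Finₚ.all? λ i → (lookup c i Boolₚ.≟ true) →-dec ((C i Boolₚ.≟ true) ⊎-dec Finₚ.any? λ x → ψ x ≟F i))

minor : ∀ {n m} → Binary n → (Fin n → Bool) → (Fin m → Fin n) → Binary m
minor K C ψ = record
  { Cycle   = Lift K C ψ
  ; cycle-⊥ = mkLift ⊥ (cycle-⊥ K) (λ x → trans (lookup-⊥ (ψ x)) (sym (lookup-⊥ x)))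
                (λ i e → absurd (false≢true e (lookup-⊥ i)))
  ; cycle-⊕ = λ {c} {d} a b → mkLift (lift a ⊕ lift b) (cycle-⊕ K (cyc a) (cyc b))
      (λ x → trans (lookup-⊕ (lift a) (lift b) (ψ x)) (trans (cong₂ _xor_ (extends a x) (extends b x)) (sym (lookup-⊕ c d x))))
      (λ i e → either a b i (xor-true (lookup (lift a) i) (lookup (lift b) i) (trans (sym (lookup-⊕ (lift a) (lift b) i)) e)))
  ; cycle?  = lift? K C ψ
  }
  where
  either : ∀ {c d} (a : Lift K C ψ c) (b : Lift K C ψ d) i → lookup (lift a) i ≡ true ⊎ lookup (lift b) i ≡ true → C i ≡ true ⊎ (∃[ x ] (ψ x ≡ i))
  either a b i (inj₁ e) = within a i e
  either a b i (inj₂ e) = within b i e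

_≅_ : ∀ {n} → Binary n → Binary n → Set
K ≅ L = ∀ c → (Cycle K c → Cycle L c) × (Cycle L c → Cycle K c)

record Minor {n m} (K : Binary n) (C : Fin n → Bool) (ψ : Fin m → Fin n) (L : Binary m) : Set where
  field
    inj  : Injective _≡_ _≡_ ψ
    off  : ∀ x → C (ψ x) ≡ false
    same : minor K C ψ ≅ L

open Minor public

restrict : ∀ {n m} → Subset n → (Fin m → Fin n) → Subset m
restrict c ψ = tabulate λ x → lookup c (ψ x)

lookup-restrict : ∀ {n m} (c : Subset n) (ψ : Fin m → Fin n) x → lookup (restrict c ψ) x ≡ lookup c (ψ x)
lookup-restrict c ψ x = Vecₚ.lookup∘tabulate (λ x → lookup c (ψ x)) x

compose : ∀ {n m k} {K : Binary n} {C} {ψ : Fin m → Fin n} {L : Binary m} {C′} {ψ′ : Fin k → Fin m} {L′ : Binary k} →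
  Minor K C ψ L → Minor L C′ ψ′ L′ → Minor K (λ i → C i ∨ img ψ C′ i) (ψ ∘ ψ′) L′
compose {n} {m} {k} {K} {C} {ψ} {L} {C′} {ψ′} {L′} M M′ = record
  { inj = λ e → inj M′ (inj M e)
  ; off = λ x → not-true λ e → off-both x (∨-true {C (ψ (ψ′ x))} e)
  ; same = λ y → (λ l → proj₁ (same M′ y) (down y l)) , (λ l → up y (proj₂ (same M′ y) l))
  }
  where
  off-both : ∀ x → C (ψ (ψ′ x)) ≡ true ⊎ img ψ C′ (ψ (ψ′ x)) ≡ true → Empty
  off-both x (inj₁ e) = false≢true e (off M (ψ′ x))
  off-both x (inj₂ e) with img⁻ ψ C′ _ e
  ... | x′ , cx , p = false≢true cx (trans (cong C′ (inj M p)) (off M′ x))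
  down : ∀ y → Lift K (λ i → C i ∨ img ψ C′ i) (ψ ∘ ψ′) y → Lift L C′ ψ′ y
  down y l = mkLift (restrict (lift l) ψ) (proj₁ (same M _) (mkLift (lift l) (cyc l) (λ x → sym (lookup-restrict (lift l) ψ x)) (λ i e → in₁ i (within l i e))))
    (λ x → trans (lookup-restrict (lift l) ψ (ψ′ x)) (extends l x))
    (λ x e → in₂ x (within l (ψ x) (trans (sym (lookup-restrict (lift l) ψ x)) e)))
    where
    in₁ : ∀ i → C i ∨ img ψ C′ i ≡ true ⊎ (∃[ x ] (ψ (ψ′ x) ≡ i)) → C i ≡ true ⊎ (∃[ x ] (ψ x ≡ i))
    in₁ i (inj₂ (x , p)) = inj₂ (ψ′ x , p)
    in₁ i (inj₁ e) with ∨-true {C i} e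
    ... | inj₁ c = inj₁ c
    ... | inj₂ c with img⁻ ψ C′ i c
    ... | x , _ , p = inj₂ (x , p)
    in₂ : ∀ x → C (ψ x) ∨ img ψ C′ (ψ x) ≡ true ⊎ (∃[ x′ ] (ψ (ψ′ x′) ≡ ψ x)) → C′ x ≡ true ⊎ (∃[ x′ ] (ψ′ x′ ≡ x))
    in₂ x (inj₂ (x′ , p)) = inj₂ (x′ , inj M p)
    in₂ x (inj₁ e) with ∨-true {C (ψ x)} e
    ... | inj₁ c = absurd (false≢true c (off M x))
    ... | inj₂ c with img⁻ ψ C′ (ψ x) c
    ... | x′ , c′ , p = inj₁ (trans (sym (cong C′ (inj M p))) c′)
  up : ∀ y → Lift L C′ ψ′ y → Lift K (λ i → C i ∨ img ψ C′ i) (ψ ∘ ψ′) y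
  up y l = mkLift (lift l′) (cyc l′) (λ x → trans (extends l′ (ψ′ x)) (extends l x)) sup
    where
    l′ : Lift K C ψ (lift l)
    l′ = proj₂ (same M (lift l)) (cyc l)
    sup : ∀ i → lookup (lift l′) i ≡ true → C i ∨ img ψ C′ i ≡ true ⊎ (∃[ x ] (ψ (ψ′ x) ≡ i))
    sup i e with within l′ i e
    ... | inj₁ c = inj₁ (∨-left c)
    ... | inj₂ (x , refl) with within l x (trans (sym (extends l′ x)) e)
    ... | inj₁ c = inj₁ (∨-right {C (ψ x)} (img⁺ ψ C′ x c))
    ... | inj₂ (x′ , refl) = inj₂ (x′ , refl)

Lift-cong : ∀ {n m} {K : Binary n} {C C′ : Fin n → Bool} {ψ ψ′ : Fin m → Fin n} {y} → (∀ i → C i ≡ C′ i) → (∀ x → ψ x ≡ ψ′ x) →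
  Lift K C ψ y → Lift K C′ ψ′ y
Lift-cong {C = C} {C′} {ψ} {ψ′} eC eψ l = mkLift (lift l) (cyc l) (λ x → trans (cong (lookup (lift l)) (sym (eψ x))) (extends l x)) λ i e → move i (within l i e)
  where
  move : ∀ i → C i ≡ true ⊎ (∃[ x ] (ψ x ≡ i)) → C′ i ≡ true ⊎ (∃[ x ] (ψ′ x ≡ i))
  move i (inj₁ e) = inj₁ (trans (sym (eC i)) e)
  move i (inj₂ (x , e)) = inj₂ (x , trans (sym (eψ x)) e)

Minor-cong : ∀ {n m} {K : Binary n} {C C′ : Fin n → Bool} {ψ ψ′ : Fin m → Fin n} {L} → (∀ i → C i ≡ C′ i) → (∀ x → ψ x ≡ ψ′ x) →
  Minor K C ψ L → Minor K C′ ψ′ L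
Minor-cong {C = C} {C′} {ψ} {ψ′} eC eψ M = record
  { inj = λ {x} {x′} e → inj M (trans (eψ x) (trans e (sym (eψ x′))))
  ; off = λ x → trans (sym (eC _)) (trans (cong C (sym (eψ x))) (off M x))
  ; same = λ y → (λ l → proj₁ (same M y) (Lift-cong (λ i → sym (eC i)) (λ x → sym (eψ x)) l))
               , (λ l → Lift-cong eC eψ (proj₂ (same M y) l)) }

Independent : ∀ {n} → Binary n → Subset n → Set
Independent K Y = ∀ c → Cycle K c → (∀ i → lookup c i ≡ true → lookup Y i ≡ true) → ∀ i → lookup c i ≡ false

module _ {n} (K : Binary n) where
  open Closure K
  open Polymatroid (binary⇒polymatroid K)

  Free : List (Fin n) → List (Fin n) → Set
  Free ys l = ∀ c → Cycle K c → c ⊑ (ys ++ l) → ∀ {i} → i ∈ₗ ys → lookup c i ≡ false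

  rk-++≤ : ∀ ys l → rk (ys ++ l) ≤ length ys + rk l
  rk-++≤ [] l = ≤-refl
  rk-++≤ (y ∷ ys) l = +-mono-≤ (gain≤1 (ys ++ l) y) (rk-++≤ ys l)

  full⇒free : ∀ ys l → length ys + rk l ≤ rk (ys ++ l) → Free ys l
  full⇒free (y ∷ ys) l h c cc sup = λ { (here refl) → top ; (there m) → full⇒free ys l rest c cc lower m }
    where
    g = gain (ys ++ l) y
    rest : length ys + rk l ≤ rk (ys ++ l)
    rest = ≤-pred (≤-trans h (+-monoˡ-≤ (rk (ys ++ l)) (gain≤1 (ys ++ l) y)))
    unspanned : ¬ Spans (ys ++ l) y
    unspanned s = <⇒≱ (≤-trans h (≤-reflexive (cong (_+ rk (ys ++ l)) (gain-spanned s)))) (rk-++≤ ys l)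
    top : lookup c y ≡ false
    top = not-true λ e → unspanned (inj₂ (c , cc , e , sup))
    lower : c ⊑ (ys ++ l)
    lower i e with sup i e
    ... | here refl = absurd (false≢true e top)
    ... | there m   = m

  free⇒full : ∀ ys l → Unique.Unique ys → (∀ {i} → i ∈ₗ ys → ¬ (i ∈ₗ l)) → Free ys l → length ys + rk l ≤ rk (ys ++ l)
  free⇒full [] l u d f = ≤-refl
  free⇒full (y ∷ ys) l (y∉ Unique.∷ u) d f = +-mono-≤ (≤-reflexive (sym (gain-free unspanned)))
    (free⇒full ys l u (d ∘ there) λ c cc sup m → f c cc (λ i e → there (sup i e)) (there m))
    where
    unspanned : ¬ Spans (ys ++ l) y
    unspanned (inj₁ m) with Memₚ.∈-++⁻ ys m
    ... | inj₁ m′ = All.lookup y∉ m′ refl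
    ... | inj₂ m′ = d (here refl) m′
    unspanned (inj₂ (c , cc , e , sup)) = false≢true e (f c cc sup (here refl))

  -- The way back from ranks to cycles: an element of `q` that does not raise the rank of `p` closes
  -- a cycle with `p`.
  closure-cycle : ∀ (p q : Fin n → Bool) → (∀ i → p i ≡ true → q i ≡ true) → R q ≤ R p → ∀ i → q i ≡ true → p i ≡ false →
    ∃[ c ] (Cycle K c × lookup c i ≡ true × (∀ j → lookup c j ≡ true → j ≡ i ⊎ p j ≡ true))
  closure-cycle p q p⊆q h i qi pi = found (gain≡0⇒spans (n≤0⇒n≡0 (+-cancelʳ-≤ (rk (elements p)) _ 0 (≤-trans (rk-mono sub′) h))))
    where
    sub′ : (i ∷ elements p) ⊆ₗ elements q
    sub′ (here refl) = ∈-elements⁺ q qi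
    sub′ (there m)   = ∈-elements⁺ q (p⊆q _ (∈-elements⁻ p m))
    found : Spans (elements p) i → _
    found (inj₁ m) = absurd (false≢true (∈-elements⁻ p m) pi)
    found (inj₂ (c , cc , ci , sup)) = c , cc , ci , λ j e → place j (sup j e)
      where
      place : ∀ j → j ∈ₗ (i ∷ elements p) → j ≡ i ⊎ p j ≡ true
      place j (here e)  = inj₁ e
      place j (there m) = inj₂ (∈-elements⁻ p m)

length-filter : ∀ {B : Set} n (f : Fin n → B) (p : B → Bool) (Y : Subset n) → (∀ i → p (f i) ≡ lookup Y i) →
  length (filter (λ b → p b Boolₚ.≟ true) (Data.List.tabulate f)) ≡ ∣ Y ∣
length-filter zero f p [] e = refl
length-filter (suc n) f p (y ∷ Y) e with p (f zero) | e zero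
length-filter (suc n) f p (true ∷ Y) e  | true  | refl = cong suc (length-filter n (f ∘ suc) p Y (e ∘ suc))
length-filter (suc n) f p (false ∷ Y) e | false | refl = length-filter n (f ∘ suc) p Y (e ∘ suc)

length-elements : ∀ {n} (Y : Subset n) → length (elements (lookup Y)) ≡ ∣ Y ∣
length-elements Y = length-filter _ id (lookup Y) Y λ _ → refl

elements-unique : ∀ {n} (p : Fin n → Bool) → Unique.Unique (elements p)
elements-unique p = Uniqueₚ.filter⁺ (λ i → p i Boolₚ.≟ true) (Uniqueₚ.allFin⁺ _)

module _ {n m} {K : Binary n} {C : Fin n → Bool} {ψ : Fin m → Fin n} {L : Binary m} (M : Minor K C ψ L) where
  open Closure K
  open Polymatroid (binary⇒polymatroid K)

  private
    ys : Subset m → List (Fin n)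
    ys Y = map ψ (elements (lookup Y))

    length-ys : ∀ Y → length (ys Y) ≡ ∣ Y ∣
    length-ys Y = trans (Listₚ.length-map ψ (elements (lookup Y))) (length-elements Y)

    rk-img : ∀ Y → rk (ys Y ++ elements C) ≡ R (λ i → img ψ (lookup Y) i ∨ C i)
    rk-img Y = ≤-antisym (rk-mono into) (rk-mono outof)
      where
      q : Fin n → Bool
      q i = img ψ (lookup Y) i ∨ C i
      into : (ys Y ++ elements C) ⊆ₗ elements q
      into {i} x with Memₚ.∈-++⁻ (ys Y) x
      ... | inj₂ x′ = ∈-elements⁺ q (∨-right {img ψ (lookup Y) i} (∈-elements⁻ C x′))
      ... | inj₁ x′ with Memₚ.∈-map⁻ ψ x′
      ... | j , j∈ , refl = ∈-elements⁺ q (∨-left (img⁺ ψ (lookup Y) j (∈-elements⁻ (lookup Y) j∈)))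
      outof : elements q ⊆ₗ (ys Y ++ elements C)
      outof {i} x with ∨-true {img ψ (lookup Y) i} (∈-elements⁻ q x)
      ... | inj₂ e = Memₚ.∈-++⁺ʳ (ys Y) (∈-elements⁺ C e)
      ... | inj₁ e with img⁻ ψ (lookup Y) i e
      ... | j , yj , refl = Memₚ.∈-++⁺ˡ (Memₚ.∈-map⁺ ψ (∈-elements⁺ (lookup Y) yj))

  rank⇒independent : ∀ Y → ∣ Y ∣ + R C ≤ R (λ i → img ψ (lookup Y) i ∨ C i) → Independent L Y
  rank⇒independent Y h c cc c⊆Y x = not-true λ e → false≢true (trans (extends l x) e)
    (full⇒free K (ys Y) (elements C) (≤-trans (≤-reflexive (cong (_+ R C) (length-ys Y))) (≤-trans h (≤-reflexive (sym (rk-img Y)))))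
      (lift l) (cyc l) sup (Memₚ.∈-map⁺ ψ (∈-elements⁺ (lookup Y) (c⊆Y x e))))
    where
    l : Lift K C ψ c
    l = proj₂ (same M c) cc
    sup : lift l ⊑ (ys Y ++ elements C)
    sup i e with within l i e
    ... | inj₁ ci = Memₚ.∈-++⁺ʳ (ys Y) (∈-elements⁺ C ci)
    ... | inj₂ (x′ , refl) = Memₚ.∈-++⁺ˡ (Memₚ.∈-map⁺ ψ (∈-elements⁺ (lookup Y) (c⊆Y x′ (trans (sym (extends l x′)) e))))

  independent⇒rank : ∀ Y → Independent L Y → ∣ Y ∣ + R C ≡ R (λ i → img ψ (lookup Y) i ∨ C i)
  independent⇒rank Y ind = ≤-antisym
    (≤-trans (≤-reflexive (cong (_+ R C) (sym (length-ys Y)))) (≤-trans full (≤-reflexive (rk-img Y))))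
    (≤-trans (≤-reflexive (sym (rk-img Y))) (≤-trans (rk-++≤ K (ys Y) (elements C)) (≤-reflexive (cong (_+ R C) (length-ys Y)))))
    where
    apart : ∀ {i} → i ∈ₗ ys Y → ¬ (i ∈ₗ elements C)
    apart x x′ with Memₚ.∈-map⁻ ψ x
    ... | j , _ , refl = false≢true (∈-elements⁻ C x′) (off M j)
    all-free : Free K (ys Y) (elements C)
    all-free c cc sup {i} x with Memₚ.∈-map⁻ ψ x
    ... | j , _ , refl = trans (sym (lookup-restrict c ψ j)) (ind (restrict c ψ) (proj₁ (same M _) l) inY j)
      where
      where-is : ∀ i → i ∈ₗ (ys Y ++ elements C) → C i ≡ true ⊎ (∃[ x ] (ψ x ≡ i × lookup Y x ≡ true))
      where-is i w with Memₚ.∈-++⁻ (ys Y) w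
      ... | inj₂ w′ = inj₁ (∈-elements⁻ C w′)
      ... | inj₁ w′ with Memₚ.∈-map⁻ ψ w′
      ... | j′ , j∈ , e = inj₂ (j′ , sym e , ∈-elements⁻ (lookup Y) j∈)
      l : Lift K C ψ (restrict c ψ)
      l = mkLift c cc (λ x → sym (lookup-restrict c ψ x)) λ i e → forget (where-is i (sup i e))
        where
        forget : ∀ {i} → C i ≡ true ⊎ (∃[ x ] (ψ x ≡ i × lookup Y x ≡ true)) → C i ≡ true ⊎ (∃[ x ] (ψ x ≡ i))
        forget (inj₁ a) = inj₁ a
        forget (inj₂ (x , p , _)) = inj₂ (x , p)
      inY : ∀ x → lookup (restrict c ψ) x ≡ true → lookup Y x ≡ true
      inY x e = go (where-is (ψ x) (sup (ψ x) (trans (sym (lookup-restrict c ψ x)) e)))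
        where
        go : C (ψ x) ≡ true ⊎ (∃[ x′ ] (ψ x′ ≡ ψ x × lookup Y x′ ≡ true)) → lookup Y x ≡ true
        go (inj₁ a) = absurd (false≢true a (off M x))
        go (inj₂ (x′ , p , yx)) = trans (cong (lookup Y) (sym (inj M p))) yx
    full : length (ys Y) + R C ≤ rk (ys Y ++ elements C)
    full = free⇒full K (ys Y) (elements C) (Uniqueₚ.map⁺ (inj M) (elements-unique (lookup Y))) apart all-free

SameIndependent : ∀ {m} → Binary m → Binary m → Set
SameIndependent K L = ∀ Y → (Independent K Y → Independent L Y) × (Independent L Y → Independent K Y)

-- A cycle y of K contains a nonzero cycle y′ of L; unless y′ = y, both y′
-- and y ⊕ y′ are smaller, so induction applies to them.
independent⇒cycles : ∀ {m} (K L : Binary m) → SameIndependent K L → ∀ k y → ∣ y ∣ ≤ k → Cycle K y → Cycle L y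
independent⇒cycles {m} K L si k y le cy = go (cycle? L y) (Subₚ.anySubset? λ y′ → cycle? L y′ ×-dec (Finₚ.all? λ i → (lookup y′ i Boolₚ.≟ true) →-dec (lookup y i Boolₚ.≟ true)) ×-dec Finₚ.any? λ i → lookup y′ i Boolₚ.≟ true)
  where
  smaller : ∀ (p : Subset m) → (∀ i → lookup p i ≡ true → lookup y i ≡ true) → ∀ i → lookup y i ≡ true → lookup p i ≡ false → ∣ p ∣ < ∣ y ∣
  smaller p s i yi pi = Subₚ.p⊂q⇒∣p∣<∣q∣ {p = p} {q = y}
    ((λ {j} x → Vecₚ.lookup⇒[]= j y (s j (Vecₚ.[]=⇒lookup x))) , i , Vecₚ.lookup⇒[]= i y yi , λ x → false≢true (Vecₚ.[]=⇒lookup x) pi)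
  recurse : ∀ k → ∣ y ∣ ≤ k → ∀ y′ → Cycle L y′ → (∀ i → lookup y′ i ≡ true → lookup y i ≡ true) → ∀ i → lookup y′ i ≡ true →
    ∀ j → lookup y j ≡ true → lookup y′ j ≡ false → Cycle L y
  recurse zero le y′ c s i yi′ j yj nj = absurd (<⇒≱ (≤-trans (smaller y′ s j yj nj) le) z≤n)
  recurse (suc k) le y′ c s i yi′ j yj nj = subst (Cycle L) (sym (⊕-cancel y y′))
    (cycle-⊕ L c (independent⇒cycles K L si k (y ⊕ y′) (≤-pred (≤-trans (smaller (y ⊕ y′) s′ i (s i yi′) at-i) le))
      (cycle-⊕ K cy (independent⇒cycles L K (λ Y → proj₂ (si Y) , proj₁ (si Y)) k y′ (≤-pred (≤-trans (smaller y′ s j yj nj) le)) c))))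
    where
    s′ : ∀ i → lookup (y ⊕ y′) i ≡ true → lookup y i ≡ true
    s′ i e with xor-true (lookup y i) (lookup y′ i) (trans (sym (lookup-⊕ y y′ i)) e)
    ... | inj₁ a = a
    ... | inj₂ a = s i a
    at-i : lookup (y ⊕ y′) i ≡ false
    at-i = trans (lookup-⊕ y y′ i) (cong₂ _xor_ (s i yi′) yi′)
  go : Dec (Cycle L y) → Dec (∃[ y′ ] (Cycle L y′ × (∀ i → lookup y′ i ≡ true → lookup y i ≡ true) × (∃[ i ] (lookup y′ i ≡ true)))) → Cycle L y
  go (yes c) _ = c
  go (no nc) (no none) = subst (Cycle L) (ext λ i → trans (lookup-⊥ i) (sym (zero-y i))) (cycle-⊥ L)
    where
    zero-y : ∀ i → lookup y i ≡ false
    zero-y = proj₂ (si y) (λ c cc s i → not-true λ e → none (c , cc , s , i , e)) y cy (λ _ e → e)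
  go (no nc) (yes (y′ , c , s , i , yi′)) = compare (Finₚ.any? λ j → (lookup y j Boolₚ.≟ true) ×-dec (lookup y′ j Boolₚ.≟ false))
    where
    compare : Dec (∃[ j ] (lookup y j ≡ true × lookup y′ j ≡ false)) → Cycle L y
    compare (yes (j , yj , nj)) = recurse k le y′ c s i yi′ j yj nj
    compare (no eq) = subst (Cycle L) (ext λ j → bool-≡ (s j) λ e → cover j e (bool-split (lookup y′ j))) c
      where
      cover : ∀ j → lookup y j ≡ true → lookup y′ j ≡ true ⊎ lookup y′ j ≡ false → lookup y′ j ≡ true
      cover j e (inj₁ p) = p
      cover j e (inj₂ p) = absurd (eq (j , e , p))

same-cycles : ∀ {m} (K L : Binary m) → SameIndependent K L → K ≅ L
same-cycles K L si c = independent⇒cycles K L si _ c ≤-refl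
                     , independent⇒cycles L K (λ Y → proj₂ (si Y) , proj₁ (si Y)) _ c ≤-refl

-- Spaces given by equations and by generators

parity : ∀ {n} → (Fin n → Bool) → Bool
parity {zero}  f = false
parity {suc n} f = f zero xor parity (f ∘ suc)

parity-cong : ∀ {n} {f g : Fin n → Bool} → (∀ i → f i ≡ g i) → parity f ≡ parity g
parity-cong {zero}  e = refl
parity-cong {suc n} e = cong₂ _xor_ (e zero) (parity-cong (e ∘ suc))

parity-⊕ : ∀ {n} (f g : Fin n → Bool) → parity (λ i → f i xor g i) ≡ parity f xor parity g
parity-⊕ {zero}  f g = refl
parity-⊕ {suc n} f g = trans (cong ((f zero xor g zero) xor_) (parity-⊕ (f ∘ suc) (g ∘ suc))) (bits (f zero) (g zero) _ _)
  where
  bits : ∀ a b c d → (a xor b) xor (c xor d) ≡ (a xor c) xor (b xor d)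
  bits true  true  true  d = refl
  bits true  true  false d = sym (Boolₚ.not-involutive _)
  bits true  false true  d = Boolₚ.not-involutive _
  bits true  false false d = refl
  bits false true  true  d = refl
  bits false true  false d = refl
  bits false false c     d = refl

parity-false : ∀ {n} (f : Fin n → Bool) → (∀ i → f i ≡ false) → parity f ≡ false
parity-false {zero}  f e = refl
parity-false {suc n} f e = cong₂ _xor_ (e zero) (parity-false (f ∘ suc) (e ∘ suc))

parity-remove : ∀ {n} (f : Fin n → Bool) j → parity f ≡ f j xor parity (λ i → f i ∧ not (point j i))
parity-remove {suc n} f zero = cong (f zero xor_)
  (trans (parity-cong {f = f ∘ suc} λ i → sym (Boolₚ.∧-identityʳ (f (suc i)))) (sym (cong (_xor parity (λ i → f (suc i) ∧ true)) (Boolₚ.∧-zeroʳ (f zero)))))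
parity-remove {suc n} f (suc j) = trans (cong (f zero xor_) (parity-remove (f ∘ suc) j))
  (trans (rotate (f zero) (f (suc j)) _) (cong (λ b → f (suc j) xor (b xor parity (λ i → f (suc i) ∧ not (point j i)))) (sym (Boolₚ.∧-identityʳ (f zero)))))
  where
  rotate : ∀ a b c → a xor (b xor c) ≡ b xor (a xor c)
  rotate true  true  c = refl
  rotate true  false c = refl
  rotate false b     c = refl

parity-reindex : ∀ {n m} (ψ : Fin m → Fin n) → Injective _≡_ _≡_ ψ → (f : Fin n → Bool) →
  (∀ i → f i ≡ true → ∃[ x ] (ψ x ≡ i)) → parity f ≡ parity (f ∘ ψ)
parity-reindex {n} {zero} ψ inj f sup = parity-false f λ i → not-true λ e → no-index (proj₁ (sup i e))
  where
  no-index : Fin 0 → Empty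
  no-index ()
parity-reindex {n} {suc m} ψ inj f sup = trans (parity-remove f (ψ zero)) (cong (f (ψ zero) xor_)
  (trans (parity-reindex (ψ ∘ suc) (λ e → Finₚ.suc-injective (inj e)) f′ sup′)
         (parity-cong λ x → trans (cong (λ b → f (ψ (suc x)) ∧ not b) (apart x)) (Boolₚ.∧-identityʳ _))))
  where
  f′ : Fin n → Bool
  f′ i = f i ∧ not (point (ψ zero) i)
  apart : ∀ x → point (ψ zero) (ψ (suc x)) ≡ false
  apart x = not-true λ e → Finₚ.0≢1+n (sym (inj (point⇒≡ e)))
  sup′ : ∀ i → f′ i ≡ true → ∃[ x ] (ψ (suc x) ≡ i)
  sup′ i e with ∧-true {f i} e
  ... | fi , np with sup i fi
  ... | suc x , p = x , p
  ... | zero , refl = absurd (false≢true (trans (sym (cong not (point-refl (ψ zero)))) np) refl)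

dot : ∀ {n} → Subset n → Subset n → Bool
dot []      []      = false
dot (a ∷ p) (b ∷ q) = (a ∧ b) xor dot p q

dot-parity : ∀ {n} (p q : Subset n) → dot p q ≡ parity (λ i → lookup p i ∧ lookup q i)
dot-parity []      []      = refl
dot-parity (a ∷ p) (b ∷ q) = cong ((a ∧ b) xor_) (dot-parity p q)

∧-distrib-xor : ∀ a b c → a ∧ (b xor c) ≡ (a ∧ b) xor (a ∧ c)
∧-distrib-xor true  b c = refl
∧-distrib-xor false b c = refl

dot-⊕ : ∀ {n} (p c d : Subset n) → dot p (c ⊕ d) ≡ dot p c xor dot p d
dot-⊕ p c d = trans (dot-parity p (c ⊕ d)) (trans (parity-cong λ i → trans (cong (lookup p i ∧_) (lookup-⊕ c d i)) (∧-distrib-xor (lookup p i) _ _))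
  (trans (parity-⊕ (λ i → lookup p i ∧ lookup c i) (λ i → lookup p i ∧ lookup d i)) (sym (cong₂ _xor_ (dot-parity p c) (dot-parity p d)))))

dot-⊥ : ∀ {n} (p : Subset n) → dot p ⊥ ≡ false
dot-⊥ []      = refl
dot-⊥ (a ∷ p) = cong₂ _xor_ (Boolₚ.∧-zeroʳ a) (dot-⊥ p)

kernel : ∀ {n} → List (Subset n) → Binary n
kernel rows = record
  { Cycle   = λ c → All.All (λ q → dot q c ≡ false) rows
  ; cycle-⊥ = All.universal dot-⊥ rows
  ; cycle-⊕ = λ {c} {d} a b → All.zipWith (λ {q} (e , f) → trans (dot-⊕ q c d) (cong₂ _xor_ e f)) (a , b)
  ; cycle?  = λ c → All.all? (λ q → dot q c Boolₚ.≟ false) rows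
  }

comb : ∀ {n} → List (Subset n) → List Bool → Subset n
comb []       _           = ⊥
comb (g ∷ gs) []          = ⊥
comb (g ∷ gs) (true ∷ s)  = g ⊕ comb gs s
comb (g ∷ gs) (false ∷ s) = comb gs s

comb-cycle : ∀ {n} (K : Binary n) gs → All.All (Cycle K) gs → ∀ s → Cycle K (comb gs s)
comb-cycle K []       _ _ = cycle-⊥ K
comb-cycle K (g ∷ gs) _ [] = cycle-⊥ K
comb-cycle K (g ∷ gs) (c All.∷ cs) (true ∷ s)  = cycle-⊕ K c (comb-cycle K gs cs s)
comb-cycle K (g ∷ gs) (c All.∷ cs) (false ∷ s) = comb-cycle K gs cs s

comb-dot : ∀ {n} (q : Subset n) gs → All.All (λ g → dot q g ≡ false) gs → ∀ s → dot q (comb gs s) ≡ false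
comb-dot q gs h s = All.lookup (comb-cycle (kernel (q ∷ [])) gs (All.map (λ e → e All.∷ All.[]) h) s) (here refl)

Spanned : ∀ {n} → List (Subset n) → Subset n → Set
Spanned gs c = ∃[ s ] (c ≡ comb gs s)

T-∨ : ∀ {a b} → T (a ∨ b) → T a ⊎ T b
T-∨ {true}  t = inj₁ tt
T-∨ {false} t = inj₂ t

eqᵇ : ∀ {n} → Subset n → Subset n → Bool
eqᵇ []      []      = true
eqᵇ (a ∷ p) (b ∷ q) = iff a b ∧ eqᵇ p q

eqᵇ⇒≡ : ∀ {n} (p q : Subset n) → T (eqᵇ p q) → p ≡ q
eqᵇ⇒≡ []      []      _ = refl
eqᵇ⇒≡ (a ∷ p) (b ∷ q) t = cong₂ _∷_ (iff⇒≡ a b (T⇒≡ (proj₁ (T-∧ {iff a b} t)))) (eqᵇ⇒≡ p q (proj₂ (T-∧ {iff a b} t)))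

subsets : ∀ n → List (Subset n)
subsets zero    = [] ∷ []
subsets (suc n) = map (false ∷_) (subsets n) ++ map (true ∷_) (subsets n)

∈-subsets : ∀ {n} (p : Subset n) → p ∈ₗ subsets n
∈-subsets []          = here refl
∈-subsets (false ∷ p) = Memₚ.∈-++⁺ˡ (Memₚ.∈-map⁺ (false ∷_) (∈-subsets p))
∈-subsets (true ∷ p)  = Memₚ.∈-++⁺ʳ (map (false ∷_) (subsets _)) (Memₚ.∈-map⁺ (true ∷_) (∈-subsets p))

T-all⇒All : ∀ {A : Set} (p : A → Bool) xs → T (all p xs) → All.All (T ∘ p) xs
T-all⇒All p []       t = All.[]
T-all⇒All p (x ∷ xs) t = proj₁ (T-∧ {p x} t) All.∷ T-all⇒All p xs (proj₂ (T-∧ {p x} t))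

T-not : ∀ {b} → T (not b) → b ≡ false
T-not {false} _ = refl

kernelᵇ : ∀ {n} → List (Subset n) → Subset n → Bool
kernelᵇ rows c = all (λ q → not (dot q c)) rows

kernelᵇ⇒ : ∀ {n} rows (c : Subset n) → T (kernelᵇ rows c) → Cycle (kernel rows) c
kernelᵇ⇒ rows c t = All.map T-not (T-all⇒All (λ q → not (dot q c)) rows t)

kernel⇒ᵇ : ∀ {n} rows (c : Subset n) → Cycle (kernel rows) c → T (kernelᵇ rows c)
kernel⇒ᵇ []       c _ = tt
kernel⇒ᵇ (q ∷ rows) c (e All.∷ h) rewrite e = kernel⇒ᵇ rows c h

-- Encodings of tables by numbers, least significant digit first

bits : ∀ k → ℕ → Subset k
bits zero    n = []
bits (suc k) n = (n % 2 ≡ᵇ 1) ∷ bits k (n / 2)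

-- One hexadecimal digit gives the image of one element. The reduction modulo `suc M` serves
-- totality only, because every decoded map is checked afterwards.
digits : ∀ {M} k → ℕ → Vec (Fin (suc M)) k
digits zero    n = []
digits {M} (suc k) n = ((n % 16) mod (suc M)) ∷ digits k (n / 16)

shift : ℕ → ℕ → ℕ
shift zero    n = n
shift (suc k) n = shift k (n / 2)

bitLists : ℕ → ℕ → ℕ → List (List Bool)
bitLists zero    k n = []
bitLists (suc j) k n = Data.Vec.toList (bits k n) ∷ bitLists j k (shift k n)

bitVectors : ∀ {k} → ℕ → ℕ → List (Subset k)
bitVectors zero    n = []
bitVectors {k} (suc j) n = bits k n ∷ bitVectors j (shift k n)

-- Cycle spaces of the graphs of the families and of the Fano plane.

star : (G : Graph) → Fin (nV G) → Subset (nE G)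
star G v = tabulate λ e → does (v ≟F end₁ G e) xor does (v ≟F end₂ G e)

cycleSpace : (G : Graph) → Binary (nE G)
cycleSpace G = kernel (map (star G) (allFin (nV G)))

data Target : Set where
  t33 t01 t02 t11 t5 fano : Target

-- The Fano plane is not graphic. Its entry is a placeholder that supplies the number seven of
-- elements, while its cycle space comes from `rows`.
graphOf : Target → Graph
graphOf t33  = K33
graphOf t01  = K33⁰¹
graphOf t02  = K33⁰²
graphOf t11  = K33¹¹
graphOf t5   = K5
graphOf fano = record { nV = 1 ; nE = 7 ; ends = λ _ → zero , zero }

isFano isFive : Target → Bool
isFano fano = true
isFano _    = false
isFive t5   = true
isFive _    = false

edges : Target → ℕ
edges t = nE (graphOf t)

-- For a graph the rows are the stars of the vertices, as `graph-rows` confirms. For the Fano plane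
-- they form the matrix whose columns are the seven nonzero vectors of length three over the field
-- with two elements.
chords rowCodes basisCodes : Target → List ℕ
chords t33  = 4 ∷ 5 ∷ 7 ∷ 8 ∷ []
chords t01  = 2 ∷ 5 ∷ 6 ∷ 8 ∷ 9 ∷ []
chords t02  = 3 ∷ 4 ∷ 6 ∷ 7 ∷ 9 ∷ 10 ∷ []
chords t11  = 3 ∷ 5 ∷ 6 ∷ 7 ∷ 9 ∷ 10 ∷ []
chords t5   = 4 ∷ 5 ∷ 6 ∷ 7 ∷ 8 ∷ 9 ∷ []
chords fano = 3 ∷ 4 ∷ 5 ∷ 6 ∷ []
rowCodes t33  = 7 ∷ 56 ∷ 448 ∷ 73 ∷ 146 ∷ 292 ∷ []
rowCodes t01  = 14 ∷ 112 ∷ 896 ∷ 147 ∷ 293 ∷ 584 ∷ []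
rowCodes t02  = 28 ∷ 224 ∷ 1792 ∷ 293 ∷ 587 ∷ 1170 ∷ []
rowCodes t11  = 29 ∷ 225 ∷ 1792 ∷ 294 ∷ 586 ∷ 1168 ∷ []
rowCodes t5   = 15 ∷ 113 ∷ 402 ∷ 676 ∷ 840 ∷ []
rowCodes fano = 89 ∷ 106 ∷ 116 ∷ []
basisCodes t33  = 27 ∷ 45 ∷ 195 ∷ 325 ∷ []
basisCodes t01  = 7 ∷ 49 ∷ 90 ∷ 385 ∷ 650 ∷ []
basisCodes t02  = 13 ∷ 23 ∷ 97 ∷ 163 ∷ 769 ∷ 1283 ∷ []
basisCodes t11  = 14 ∷ 37 ∷ 71 ∷ 145 ∷ 770 ∷ 1300 ∷ []
basisCodes t5   = 19 ∷ 37 ∷ 73 ∷ 134 ∷ 266 ∷ 524 ∷ []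
basisCodes fano = 11 ∷ 21 ∷ 38 ∷ 71 ∷ []

rows basis : (t : Target) → List (Subset (edges t))
rows t  = map (bits (edges t)) (rowCodes t)
basis t = map (bits (edges t)) (basisCodes t)

space : (t : Target) → Binary (edges t)
space t = kernel (rows t)

nth : ∀ {n} → Subset n → ℕ → Bool
nth []      _       = false
nth (a ∷ p) zero    = a
nth (a ∷ p) (suc k) = nth p k

-- The basis consists of the fundamental cycles of the chords.
coordinates : (t : Target) → Subset (edges t) → List Bool
coordinates t c = map (nth c) (chords t)

basis-sound : ∀ t → All.All (Cycle (space t)) (basis t)
basis-sound t = All.map (λ {c} → kernelᵇ⇒ (rows t) c) (T-all⇒All (kernelᵇ (rows t)) (basis t) (ok t))
  where
  ok : ∀ t → T (all (kernelᵇ (rows t)) (basis t))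
  ok t33  = tt
  ok t01  = tt
  ok t02  = tt
  ok t11  = tt
  ok t5   = tt
  ok fano = tt

basis-complete : ∀ t c → Cycle (space t) c → c ≡ comb (basis t) (coordinates t c)
basis-complete t c h = eqᵇ⇒≡ c _ (fire (T-all (test t) (subsets _) (ok t) (∈-subsets c)) (kernel⇒ᵇ (rows t) c h))
  where
  test : ∀ t → Subset (edges t) → Bool
  test t c = not (kernelᵇ (rows t) c) ∨ eqᵇ c (comb (basis t) (coordinates t c))
  ok : ∀ t → T (all (test t) (subsets (edges t)))
  ok t33  = tt
  ok t01  = tt
  ok t02  = tt
  ok t11  = tt
  ok t5   = tt
  ok fano = tt
  fire : ∀ {a b} → T (not a ∨ b) → T a → T b
  fire {true} t _ = t

basis-spans : ∀ t c → Cycle (space t) c → Spanned (basis t) c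
basis-spans t c h = coordinates t c , basis-complete t c h

graph-rows : ∀ t → isFano t ≡ false → rows t ≡ map (star (graphOf t)) (allFin (nV (graphOf t)))
graph-rows t33 _ = refl
graph-rows t01 _ = refl
graph-rows t02 _ = refl
graph-rows t11 _ = refl
graph-rows t5  _ = refl

-- Certificates for minors of spanned spaces

record Cert : Set where
  constructor cert
  field
    target                              : Target
    mapCode conCode liftCode coCode : ℕ

allZip : ∀ {A B : Set} → (A → B → Bool) → List A → List B → Bool
allZip p []       _        = true
allZip p (x ∷ xs) []       = false
allZip p (x ∷ xs) (y ∷ ys) = p x y ∧ allZip p xs ys

allZip-∈ : ∀ {A B : Set} (p : A → B → Bool) xs ys → T (allZip p xs ys) → ∀ {x} → x ∈ₗ xs → ∃[ y ] T (p x y)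
allZip-∈ p (x ∷ xs) (y ∷ ys) t (here refl) = y , proj₁ (T-∧ {p x y} t)
allZip-∈ p (x ∷ xs) (y ∷ ys) t (there m)   = allZip-∈ p xs ys (proj₂ (T-∧ {p x y} t)) m

subᵇ disjointᵇ : ∀ {n} → Subset n → Subset n → Bool
subᵇ []      []      = true
subᵇ (a ∷ p) (b ∷ q) = (not a ∨ b) ∧ subᵇ p q
disjointᵇ []      []      = true
disjointᵇ (a ∷ p) (b ∷ q) = not (a ∧ b) ∧ disjointᵇ p q

subᵇ⇒ : ∀ {n} (p q : Subset n) → T (subᵇ p q) → ∀ i → lookup p i ≡ true → lookup q i ≡ true
subᵇ⇒ (true ∷ p) (true ∷ q) t zero e = refl
subᵇ⇒ (a ∷ p) (b ∷ q) t (suc i) e = subᵇ⇒ p q (proj₂ (T-∧ {not a ∨ b} t)) i e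

disjointᵇ⇒ : ∀ {n} (p q : Subset n) → T (disjointᵇ p q) → ∀ i → lookup p i ≡ true → lookup q i ≡ true → Empty
disjointᵇ⇒ (true ∷ p) (true ∷ q) () zero e f
disjointᵇ⇒ (a ∷ p) (b ∷ q) t (suc i) e f = disjointᵇ⇒ p q (proj₂ (T-∧ {not (a ∧ b)} t)) i e f

hits : ∀ {n m} → Vec (Fin n) m → Fin n → Bool
hits ψ i = anyFin λ x → does (lookup ψ x ≟F i)

hits⇒ : ∀ {n m} (ψ : Vec (Fin n) m) i → hits ψ i ≡ true → ∃[ x ] (lookup ψ x ≡ i)
hits⇒ ψ i e with anyFin⁻ (λ x → does (lookup ψ x ≟F i)) e
... | x , h with lookup ψ x ≟F i
... | yes p = x , p

distinctᵇ : ∀ {n m} → Vec (Fin n) m → Bool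
distinctᵇ ψ = all (λ x → all (λ y → does (x ≟F y) ∨ not (does (lookup ψ x ≟F lookup ψ y))) (allFin _)) (allFin _)

distinctᵇ⇒ : ∀ {n m} (ψ : Vec (Fin n) m) → T (distinctᵇ ψ) → Injective _≡_ _≡_ (lookup ψ)
distinctᵇ⇒ ψ t {x} {y} e = decide (T-all _ (allFin _) (T-all _ (allFin _) t (Memₚ.∈-allFin x)) (Memₚ.∈-allFin y))
  where
  decide : T (does (x ≟F y) ∨ not (does (lookup ψ x ≟F lookup ψ y))) → x ≡ y
  decide t with x ≟F y | lookup ψ x ≟F lookup ψ y
  ... | yes p | _ = p
  ... | no _ | no ne = absurd (ne e)

module _ {N m} (gens : List (Subset N)) (ψ : Vec (Fin N) m) (C : Subset N) where

  liftOK : Subset m → List Bool → Bool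
  liftOK y s = let c = comb gens s in eqᵇ (restrict c (lookup ψ)) y ∧ subᵇ c (tabulate λ i → lookup C i ∨ hits ψ i)

  functionalOK : Subset m → Subset N → Bool
  functionalOK r q = eqᵇ (restrict q (lookup ψ)) r ∧ disjointᵇ q C ∧ all (λ g → not (dot q g)) gens

  -- Both inclusions between the cycle spaces are checked on generators. Every basis cycle of the
  -- target has a lift that is a combination of `gens`. Every row of the target extends to a vector
  -- off `C`, supported on the minor where it matters, that is orthogonal to `gens`; it then
  -- annihilates the traces of all cycles.
  minorOK : List (Subset m) → List (Subset m) → List (List Bool) → List (Subset N) → Bool
  minorOK bs rs ss qs = distinctᵇ ψ ∧ all (λ x → not (lookup C (lookup ψ x))) (allFin m) ∧ allZip liftOK bs ss ∧ allZip functionalOK rs qs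

  module _ (L : Binary N) (in-L : All.All (Cycle L) gens) (spanned : ∀ c → Cycle L c → Spanned gens c) where

    liftOK⇒ : ∀ y s → T (liftOK y s) → Lift L (lookup C) (lookup ψ) y
    liftOK⇒ y s t = mkLift c (comb-cycle L gens in-L s)
      (λ x → trans (sym (lookup-restrict c (lookup ψ) x)) (cong (λ v → lookup v x) (eqᵇ⇒≡ (restrict c (lookup ψ)) y (proj₁ (T-∧ {eqᵇ (restrict c (lookup ψ)) y} t)))))
      (λ i e → place i (trans (sym (Vecₚ.lookup∘tabulate (λ i → lookup C i ∨ hits ψ i) i)) (subᵇ⇒ c _ (proj₂ (T-∧ {eqᵇ (restrict c (lookup ψ)) y} t)) i e)))
      where
      c = comb gens s
      place : ∀ i → lookup C i ∨ hits ψ i ≡ true → lookup C i ≡ true ⊎ (∃[ x ] (lookup ψ x ≡ i))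
      place i e with ∨-true {lookup C i} e
      ... | inj₁ a = inj₁ a
      ... | inj₂ a = inj₂ (hits⇒ ψ i a)

    functionalOK⇒ : Injective _≡_ _≡_ (lookup ψ) → ∀ r q → T (functionalOK r q) → ∀ y → Lift L (lookup C) (lookup ψ) y → dot r y ≡ false
    functionalOK⇒ inj r q t y l = begin
      dot r y                                           ≡⟨ cong₂ dot (sym q-r) (sym c-y) ⟩
      dot (restrict q (lookup ψ)) (restrict c (lookup ψ)) ≡⟨ dot-parity (restrict q (lookup ψ)) (restrict c (lookup ψ)) ⟩
      parity (λ x → lookup (restrict q (lookup ψ)) x ∧ lookup (restrict c (lookup ψ)) x)
        ≡⟨ parity-cong (λ x → cong₂ _∧_ (lookup-restrict q (lookup ψ) x) (lookup-restrict c (lookup ψ) x)) ⟩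
      parity (λ x → lookup q (lookup ψ x) ∧ lookup c (lookup ψ x)) ≡⟨ sym (parity-reindex (lookup ψ) inj (λ i → lookup q i ∧ lookup c i) inside′) ⟩
      parity (λ i → lookup q i ∧ lookup c i)            ≡⟨ sym (dot-parity q c) ⟩
      dot q c                                           ≡⟨ cong (dot q) (proj₂ sp) ⟩
      dot q (comb gens (proj₁ sp))                      ≡⟨ comb-dot q gens (All.map T-not (T-all⇒All (λ g → not (dot q g)) gens (proj₂ t₂))) (proj₁ sp) ⟩
      false                                             ∎
      where
      open ≡-Reasoning
      c = lift l
      sp = spanned c (cyc l)
      t₁ = T-∧ {eqᵇ (restrict q (lookup ψ)) r} t
      t₂ = T-∧ {disjointᵇ q C} (proj₂ t₁)
      q-r : restrict q (lookup ψ) ≡ r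
      q-r = eqᵇ⇒≡ _ _ (proj₁ t₁)
      c-y : restrict c (lookup ψ) ≡ y
      c-y = ext λ x → trans (lookup-restrict c (lookup ψ) x) (extends l x)
      inside′ : ∀ i → lookup q i ∧ lookup c i ≡ true → ∃[ x ] (lookup ψ x ≡ i)
      inside′ i e with ∧-true {lookup q i} e
      ... | qi , ci with within l i ci
      ... | inj₁ a = absurd (disjointᵇ⇒ q C (proj₁ t₂) i qi a)
      ... | inj₂ a = a

    minorOK⇒ : ∀ bs rs ss qs → T (minorOK bs rs ss qs) → (∀ c → Cycle (kernel rs) c → Spanned bs c) →
      Minor L (lookup C) (lookup ψ) (kernel rs)
    minorOK⇒ bs rs ss qs t complete-bs = record
      { inj  = inj′
      ; off  = λ x → T-not (T-all _ (allFin m) (proj₁ t₂) (Memₚ.∈-allFin x))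
      ; same = λ y → (λ l → All.tabulate λ {r} r∈ → let (q , ok) = allZip-∈ functionalOK rs qs (proj₂ t₃) r∈ in functionalOK⇒ inj′ r q ok y l)
                   , (λ cy → let (s , e) = complete-bs y cy in subst (Lift L (lookup C) (lookup ψ)) (sym e)
                       (comb-cycle (minor L (lookup C) (lookup ψ)) bs
                         (All.tabulate λ {b} b∈ → let (s′ , ok) = allZip-∈ liftOK bs ss (proj₁ t₃) b∈ in liftOK⇒ b s′ ok) s))
      }
      where
      t₁ = T-∧ {distinctᵇ ψ} t
      t₂ = T-∧ {all (λ x → not (lookup C (lookup ψ x))) (allFin m)} (proj₂ t₁)
      t₃ = T-∧ {allZip liftOK bs ss} (proj₂ t₂)
      inj′ = distinctᵇ⇒ ψ (proj₁ t₁)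

certOK : ∀ {M} → List (Subset (suc M)) → List (Fin (suc M)) → Bool → Cert → Bool
certOK {M} gens need five (cert t a b c d) =
  (five ∨ not (isFive t)) ∧ (isFano t ∨ all (hits ψ) need) ∧
  minorOK gens ψ (bits (suc M) b) (basis t) (rows t) (bitLists (length (basisCodes t)) (length gens) c) (bitVectors (length (rowCodes t)) d)
  where ψ = digits (edges t) a

-- The Fano plane comes without a claim on `need`, since its occurrence is refuted later. `five`
-- tells whether `K5` is an admissible result.
data Result {n} (K : Binary n) (need : List (Fin n)) (five : Bool) : Set where
  result : ∀ t C (ψ : Fin (edges t) → Fin n) → Minor K C ψ (space t) →
           isFano t ≡ true ⊎ (∀ i → i ∈ₗ need → ∃[ x ] (ψ x ≡ i)) → T (five ∨ not (isFive t)) → Result K need five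

certOK⇒ : ∀ {M} (L : Binary (suc M)) gens → All.All (Cycle L) gens → (∀ c → Cycle L c → Spanned gens c) →
  ∀ need five k → T (certOK gens need five k) → Result L need five
certOK⇒ {M} L gens in-L spanned need five (cert t a b c d) ok = result t (lookup (bits (suc M) b)) (lookup ψ)
  (minorOK⇒ gens ψ (bits (suc M) b) L in-L spanned (basis t) (rows t) ss qs (proj₂ t₂) (basis-spans t))
  (needed (T-∨ {isFano t} (proj₁ t₂))) (proj₁ t₁)
  where
  ψ : Vec (Fin (suc M)) (edges t)
  ψ = digits (edges t) a
  ss = bitLists (length (basisCodes t)) (length gens) c
  qs : List (Subset (suc M))
  qs = bitVectors (length (rowCodes t)) d
  t₁ = T-∧ {five ∨ not (isFive t)} ok
  t₂ = T-∧ {isFano t ∨ all (hits ψ) need} (proj₂ t₁)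
  needed : T (isFano t) ⊎ T (all (hits ψ) need) → isFano t ≡ true ⊎ (∀ i → i ∈ₗ need → ∃[ x ] (lookup ψ x ≡ i))
  needed (inj₁ f) = inj₁ (T⇒≡ f)
  needed (inj₂ h) = inj₂ λ i i∈ → hits⇒ ψ i (T⇒≡ (T-all (hits ψ) need h i∈))

Result-compose : ∀ {n m} {K : Binary n} {C} {ψ : Fin m → Fin n} {L : Binary m} {need five} →
  Minor K C ψ L → Result L need five → Result K (map ψ need) five
Result-compose {n} {m} {K} {C} {ψ} {L} {need} {five} M (result t C′ ψ′ M′ h f) = result t _ (ψ ∘ ψ′) (compose M M′) (move h) f
  where
  move : isFano t ≡ true ⊎ (∀ i → i ∈ₗ need → ∃[ x ] (ψ′ x ≡ i)) → isFano t ≡ true ⊎ (∀ i → i ∈ₗ map ψ need → ∃[ x ] (ψ (ψ′ x) ≡ i))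
  move (inj₁ e) = inj₁ e
  move (inj₂ g) = inj₂ λ i i∈ → let (j , j∈ , e) = Memₚ.∈-map⁻ ψ i∈ ; (x , p) = g j j∈ in x , trans (cong ψ p) (sym e)

-- A table has one certificate for each vector that is not excluded, in the
-- order of the list of vectors.
tableOK : ∀ {A : Set} → (A → Bool) → (A → Cert → Bool) → List A → List Cert → Bool
tableRow : ∀ {A : Set} → (A → Bool) → (A → Cert → Bool) → Bool → A → List A → List Cert → Bool
tableOK ex ok []       ks = true
tableOK ex ok (a ∷ as) ks = tableRow ex ok (ex a) a as ks
tableRow ex ok true  a as ks       = tableOK ex ok as ks
tableRow ex ok false a as []       = false
tableRow ex ok false a as (k ∷ ks) = ok a k ∧ tableOK ex ok as ks

tableOK⇒ : ∀ {A : Set} (ex : A → Bool) (ok : A → Cert → Bool) as ks → T (tableOK ex ok as ks) → ∀ {a} → a ∈ₗ as → ex a ≡ false → ∃[ k ] T (ok a k)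
tableOK⇒ ex ok (a ∷ as) ks t m e with ex a in ea
tableOK⇒ ex ok (a ∷ as) ks t (here refl) e | true = absurd (false≢true ea e)
tableOK⇒ ex ok (a ∷ as) ks t (there m) e | true = tableOK⇒ ex ok as ks t m e
tableOK⇒ ex ok (a ∷ as) (k ∷ ks) t (here refl) e | false = k , proj₁ (T-∧ {ok a k} t)
tableOK⇒ ex ok (a ∷ as) (k ∷ ks) t (there m) e | false = tableOK⇒ ex ok as ks (proj₂ (T-∧ {ok a k} t)) m e

boolLists : ℕ → List (List Bool)
boolLists zero    = [] ∷ []
boolLists (suc n) = map (false ∷_) (boolLists n) ++ map (true ∷_) (boolLists n)

∈-boolLists : ∀ l → l ∈ₗ boolLists (length l)
∈-boolLists []          = here refl
∈-boolLists (false ∷ l) = Memₚ.∈-++⁺ˡ (Memₚ.∈-map⁺ (false ∷_) (∈-boolLists l))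
∈-boolLists (true ∷ l)  = Memₚ.∈-++⁺ʳ (map (false ∷_) (boolLists (length l))) (Memₚ.∈-map⁺ (true ∷_) (∈-boolLists l))

-- One-element and two-element extensions of a fixed minor

e₀ : ∀ {m} → Subset (suc m)
e₀ = true ∷ ⊥

dot-⊥ˡ : ∀ {n} (p : Subset n) → dot ⊥ p ≡ false
dot-⊥ˡ []      = refl
dot-⊥ˡ (a ∷ p) = dot-⊥ˡ p

xor-false⇒≡ : ∀ a b → a xor b ≡ false → a ≡ b
xor-false⇒≡ true  true  _ = refl
xor-false⇒≡ false false _ = refl

comb-linear : ∀ {n k} (f : Subset n → Subset k) → f ⊥ ≡ ⊥ → (∀ c d → f (c ⊕ d) ≡ f c ⊕ f d) →
  ∀ gs s → comb (map f gs) s ≡ f (comb gs s)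
comb-linear f f⊥ f⊕ []       _ = sym f⊥
comb-linear f f⊥ f⊕ (g ∷ gs) [] = sym f⊥
comb-linear f f⊥ f⊕ (g ∷ gs) (true ∷ s)  = trans (cong (f g ⊕_) (comb-linear f f⊥ f⊕ gs s)) (sym (f⊕ g (comb gs s)))
comb-linear f f⊥ f⊕ (g ∷ gs) (false ∷ s) = comb-linear f f⊥ f⊕ gs s

comb-zip : ∀ {n k} (h : Bool → Subset n → Subset k) → h false ⊥ ≡ ⊥ → (∀ a b c d → h (a xor b) (c ⊕ d) ≡ h a c ⊕ h b d) →
  ∀ l gs → length l ≡ length gs → ∀ s → ∃[ a ] (comb (Data.List.zipWith h l gs) s ≡ h a (comb gs s))
comb-zip h h⊥ h⊕ []      []       e s = false , sym h⊥
comb-zip h h⊥ h⊕ (b ∷ l) (g ∷ gs) e [] = false , sym h⊥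
comb-zip h h⊥ h⊕ (b ∷ l) (g ∷ gs) e (false ∷ s) = comb-zip h h⊥ h⊕ l gs (suc-injective e) s
comb-zip h h⊥ h⊕ (b ∷ l) (g ∷ gs) e (true ∷ s) =
  let (a , p) = comb-zip h h⊥ h⊕ l gs (suc-injective e) s in b xor a , trans (cong (h b g ⊕_) p) (sym (h⊕ b a g (comb gs s)))

choose-lifts : ∀ {n k} (h : Bool → Subset n → Subset k) (N : Binary n) (L : Binary k) → (∀ y → Cycle N y → ∃[ a ] Cycle L (h a y)) →
  ∀ gs → All.All (Cycle N) gs → ∃[ l ] (length l ≡ length gs × All.All (Cycle L) (Data.List.zipWith h l gs))
choose-lifts h N L up [] All.[] = [] , refl , All.[]
choose-lifts h N L up (g ∷ gs) (c All.∷ cs) =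
  let (a , ca) = up g c ; (l , e , cl) = choose-lifts h N L up gs cs in a ∷ l , cong suc e , ca All.∷ cl

span-cons : ∀ {n} {g c : Subset n} {gs} → Spanned gs (c ⊕ g) → Spanned (g ∷ gs) c
span-cons {g = g} {c} (s , e) = true ∷ s , trans (⊕-cancel c g) (cong (g ⊕_) e)

low₂ : ∀ {m} → Subset (2 + m)
low₂ = true ∷ true ∷ ⊥

low₃ : ∀ {m} → Subset (3 + m)
low₃ = true ∷ true ∷ true ∷ ⊥

tiny : ∀ {m} → Subset (suc m) → Bool
tiny x = eqᵇ x ⊥ ∨ eqᵇ x e₀

vanishes : ∀ {n} → Subset n → List (Subset n) → Bool
vanishes q gs = all (λ g → not (dot q g)) gs

vanishes⇒ : ∀ {n} (q : Subset n) gs {c} → Spanned gs c → vanishes q gs ≡ true → dot q c ≡ false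
vanishes⇒ q gs (s , refl) e = comb-dot q gs (All.map T-not (T-all⇒All (λ g → not (dot q g)) gs (≡⇒T e))) s

-- Element `zero` of `N` is the entry, and the additional elements are put in front. Modulo the
-- cycles generated by `B`, every vector is a combination of `tree`, so the column of a new element
-- has one of finitely many normal forms.
module Extension {m} (N : Binary (suc m)) (B : List (Subset (suc m))) (B⊆N : All.All (Cycle N) B)
  (complete-B : ∀ c → Cycle N c → Spanned B c) (tree : List (Subset (suc m)))
  (decompose : ∀ x → ∃[ s ] ∃[ t ] (length t ≡ length tree × x ⊕ comb B s ≡ comb tree t)) (five : Bool) where

  colGens : Subset (suc m) → List (Subset (2 + m))
  colGens x = (true ∷ x) ∷ map (false ∷_) B

  -- Contraction of the new element gives `N`, so each basis cycle of `N` lifts with one unknown bit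
  -- at that element.
  rowGens : List Bool → List (Subset (2 + m))
  rowGens b = Data.List.zipWith _∷_ b B

  -- The coordinates are `g`, the spare element, and then `N`. Every cycle meets the triad of the
  -- first three coordinates evenly, and this forces the second bit of each generator.
  triadGens : Subset (suc m) → List (Subset (3 + m))
  triadGens x = (true ∷ not (lookup x zero) ∷ x) ∷ map (λ y → false ∷ lookup y zero ∷ y) B

  -- The first generator is the triangle. Adding it clears the spare element from any cycle, so the
  -- other generators are the lifts of `B` with an unknown bit at the contracted `g`.
  triGens : List Bool → List (Subset (3 + m))
  triGens b = (true ∷ true ∷ e₀) ∷ Data.List.zipWith (λ a y → a ∷ false ∷ y) b B

  need₂ : List (Fin (2 + m))
  need₂ = zero ∷ suc zero ∷ []

  need₃ : List (Fin (3 + m))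
  need₃ = suc zero ∷ suc (suc zero) ∷ []

  -- A vector that vanishes on the generators is a cocycle. Excluded are cocycles consisting of the
  -- spare element alone or with the entry, and in the triangle case of `g` with exactly one end. A
  -- cycle through the first coordinate that avoids the relevant ends contradicts each of them.
  rowExcluded triExcluded : List Bool → Bool
  rowExcluded b = vanishes (true ∷ ⊥) (rowGens b) ∨ vanishes low₂ (rowGens b)
  triExcluded b = vanishes low₂ (triGens b) ∨ vanishes (true ∷ false ∷ true ∷ ⊥) (triGens b)

  colTable rowTable triadTable triTable : List Cert → Bool
  colTable   = tableOK (tiny ∘ comb tree) (λ t → certOK (colGens (comb tree t)) need₂ five) (boolLists (length tree))
  triadTable = tableOK (tiny ∘ comb tree) (λ t → certOK (triadGens (comb tree t)) need₃ five) (boolLists (length tree))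
  rowTable   = tableOK rowExcluded (λ b → certOK (rowGens b) need₂ five) (boolLists (length B))
  triTable   = tableOK triExcluded (λ b → certOK (triGens b) need₃ five) (boolLists (length B))

  private
    listed : ∀ {k} t → length t ≡ k → t ∈ₗ boolLists k
    listed t refl = ∈-boolLists t

    not-both : ∀ {a b} → ¬ T a → ¬ T b → a ∨ b ≡ false
    not-both {true}  na nb = absurd (na tt)
    not-both {false} {true} na nb = absurd (nb tt)
    not-both {false} {false} na nb = refl

    lookup-⊥-true : ∀ {n} {A : Set} (i : Fin n) → lookup (⊥ {n}) i ≡ true → A
    lookup-⊥-true i e = absurd (false≢true e (lookup-⊥ i))

    head-⊕ : ∀ (c d : Subset (suc m)) → lookup (c ⊕ d) zero ≡ lookup c zero xor lookup d zero
    head-⊕ c d = lookup-⊕ c d zero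

  colCase : ∀ ks → T (colTable ks) → (L : Binary (2 + m)) → (∀ y → Cycle N y → Cycle L (false ∷ y)) → (∀ y → Cycle L (false ∷ y) → Cycle N y) →
    ∀ x → Cycle L (true ∷ x) → Independent L low₂ → Result L need₂ five
  colCase ks ok L up down x cx ind = certOK⇒ L gens gens⊆L spanned need₂ five k k-ok
    where
    s = proj₁ (decompose x)
    t = proj₁ (proj₂ (decompose x))
    len = proj₁ (proj₂ (proj₂ (decompose x)))
    x′ = comb tree t
    cx′ : Cycle L (true ∷ x′)
    cx′ = subst (λ v → Cycle L (true ∷ v)) (proj₂ (proj₂ (proj₂ (decompose x)))) (cycle-⊕ L cx (up _ (comb-cycle N B B⊆N s)))
    gens = colGens x′
    gens⊆L : All.All (Cycle L) gens
    gens⊆L = cx′ All.∷ Allₚ.map⁺ (All.map (up _) B⊆N)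
    comb-B : ∀ s → comb (map (false ∷_) B) s ≡ false ∷ comb B s
    comb-B = comb-linear (false ∷_) refl (λ _ _ → refl) B
    span-false : ∀ y → Cycle L (false ∷ y) → Spanned (map (false ∷_) B) (false ∷ y)
    span-false y cy = let (s , e) = complete-B y (down y cy) in s , trans (cong (false ∷_) e) (sym (comb-B s))
    spanned : ∀ c → Cycle L c → Spanned gens c
    spanned (false ∷ y) cy = let (s , e) = span-false y cy in false ∷ s , e
    spanned (true ∷ y) cy = span-cons (span-false (y ⊕ x′) (cycle-⊕ L cy cx′))
    not-tiny : tiny x′ ≡ false
    not-tiny = not-both
      (λ e → contra (subst (λ v → Cycle L (true ∷ v)) (eqᵇ⇒≡ x′ ⊥ e) cx′) λ { zero _ → refl ; (suc i) e → lookup-⊥-true i e })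
      (λ e → contra (subst (λ v → Cycle L (true ∷ v)) (eqᵇ⇒≡ x′ e₀ e) cx′) λ _ e → e)
      where
      contra : ∀ {v} → Cycle L (true ∷ v) → (∀ i → lookup (true ∷ v) i ≡ true → lookup low₂ i ≡ true) → Empty
      contra c s = false≢true refl (ind _ c s zero)
    row = tableOK⇒ (tiny ∘ comb tree) (λ t → certOK (colGens (comb tree t)) need₂ five) (boolLists (length tree)) ks ok (listed t len) not-tiny
    k = proj₁ row
    k-ok = proj₂ row

  rowCase : ∀ ks → T (rowTable ks) → (L : Binary (2 + m)) → (∀ y → Cycle N y → ∃[ a ] Cycle L (a ∷ y)) → (∀ a y → Cycle L (a ∷ y) → Cycle N y) →
    ∀ x → Cycle L (true ∷ x) → lookup x zero ≡ false → Independent L low₂ → Result L need₂ five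
  rowCase ks ok L up down x cx x₀ ind = certOK⇒ L (rowGens b) gens⊆L spanned need₂ five k k-ok
    where
    chosen = choose-lifts _∷_ N L up B B⊆N
    b = proj₁ chosen
    len = proj₁ (proj₂ chosen)
    gens⊆L = proj₂ (proj₂ chosen)
    spanned : ∀ c → Cycle L c → Spanned (rowGens b) c
    spanned (a ∷ y) cy = s , sym (trans zipped (cong₂ _∷_ (sym a≡) (sym e)))
      where
      s = proj₁ (complete-B y (down a y cy))
      e = proj₂ (complete-B y (down a y cy))
      a′ = proj₁ (comb-zip _∷_ refl (λ _ _ _ _ → refl) b B len s)
      zipped = proj₂ (comb-zip _∷_ refl (λ _ _ _ _ → refl) b B len s)
      -- Two lifts of the same cycle differ at most in the new element. As this is not a loop, the
      -- bit is determined.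
      diff : Cycle L ((a xor a′) ∷ ⊥)
      diff = subst (Cycle L) (cong ((a xor a′) ∷_) (trans (cong (y ⊕_) (sym e)) (⊕-self y)))
        (cycle-⊕ L cy (subst (Cycle L) zipped (comb-cycle L (rowGens b) gens⊆L s)))
      a≡ : a ≡ a′
      a≡ = xor-false⇒≡ a a′ (ind _ diff (λ { zero _ → refl ; (suc i) e → lookup-⊥-true i e }) zero)
    witness : ∀ q → vanishes q (rowGens b) ≡ true → dot q (true ∷ x) ≡ false
    witness q = vanishes⇒ q (rowGens b) (spanned (true ∷ x) cx)
    not-excluded : rowExcluded b ≡ false
    not-excluded = not-both
      (λ e → false≢true (cong (true xor_) (dot-⊥ˡ x)) (witness (true ∷ ⊥) (T⇒≡ e)))
      (λ e → false≢true (on-low₂ x x₀) (witness low₂ (T⇒≡ e)))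
      where
      on-low₂ : ∀ (x : Subset (suc m)) → lookup x zero ≡ false → dot low₂ (true ∷ x) ≡ true
      on-low₂ (false ∷ x) _ = cong (λ b → true xor (false xor b)) (dot-⊥ˡ x)
    row = tableOK⇒ rowExcluded (λ b → certOK (rowGens b) need₂ five) (boolLists (length B)) ks ok (listed b len) not-excluded
    k = proj₁ row
    k-ok = proj₂ row

  triadCase : ∀ ks → T (triadTable ks) → (L : Binary (3 + m)) → (∀ y → Cycle N y → Cycle L (false ∷ lookup y zero ∷ y)) →
    (∀ b y → Cycle L (false ∷ b ∷ y) → Cycle N y × b ≡ lookup y zero) →
    ∀ x → Cycle L (true ∷ false ∷ x) → lookup x zero ≡ true → Independent L low₃ → Result L need₃ five
  triadCase ks ok L up down x cx x₀ ind = certOK⇒ L gens gens⊆L spanned need₃ five k k-ok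
    where
    s = proj₁ (decompose x)
    t = proj₁ (proj₂ (decompose x))
    len = proj₁ (proj₂ (proj₂ (decompose x)))
    x′ = comb tree t
    y₀ = comb B s
    x′≡ : x ⊕ y₀ ≡ x′
    x′≡ = proj₂ (proj₂ (proj₂ (decompose x)))
    g₀ : Subset (3 + m)
    g₀ = true ∷ not (lookup x′ zero) ∷ x′
    cx′ : Cycle L g₀
    cx′ = subst (Cycle L) (cong₂ (λ b v → true ∷ b ∷ v) heads x′≡) (cycle-⊕ L cx (up y₀ (comb-cycle N B B⊆N s)))
      where
      heads : lookup y₀ zero ≡ not (lookup x′ zero)
      heads = trans (sym (Boolₚ.not-involutive _)) (cong not (sym (trans (cong (λ v → lookup v zero) (sym x′≡)) (trans (head-⊕ x y₀) (cong (_xor lookup y₀ zero) x₀)))))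
    f : Subset (suc m) → Subset (3 + m)
    f y = false ∷ lookup y zero ∷ y
    gens = triadGens x′
    gens⊆L : All.All (Cycle L) gens
    gens⊆L = cx′ All.∷ Allₚ.map⁺ (All.map (up _) B⊆N)
    span-false : ∀ b y → Cycle L (false ∷ b ∷ y) → Spanned (map f B) (false ∷ b ∷ y)
    span-false b y cy = let (cN , e₁) = down b y cy ; (s , e) = complete-B y cN in
      s , trans (cong (λ b → false ∷ b ∷ y) e₁) (trans (cong f e) (sym (comb-linear f refl (λ c d → cong (λ b → false ∷ b ∷ (c ⊕ d)) (head-⊕ c d)) B s)))
    spanned : ∀ c → Cycle L c → Spanned gens c
    spanned (false ∷ b ∷ y) cy = let (s , e) = span-false b y cy in false ∷ s , e
    spanned (true ∷ b ∷ y) cy = span-cons (span-false _ (y ⊕ x′) (cycle-⊕ L cy cx′))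
    not-tiny : tiny x′ ≡ false
    not-tiny = not-both
      (λ e → contra (subst (λ v → Cycle L (true ∷ not (lookup v zero) ∷ v)) (eqᵇ⇒≡ x′ ⊥ e) cx′) λ { zero _ → refl ; (suc zero) _ → refl ; (suc (suc i)) e → lookup-⊥-true i e })
      (λ e → contra (subst (λ v → Cycle L (true ∷ not (lookup v zero) ∷ v)) (eqᵇ⇒≡ x′ e₀ e) cx′) λ { zero _ → refl ; (suc (suc i)) e → e })
      where
      contra : ∀ {v} → Cycle L (true ∷ v) → (∀ i → lookup (true ∷ v) i ≡ true → lookup low₃ i ≡ true) → Empty
      contra c s = false≢true refl (ind _ c s zero)
    row = tableOK⇒ (tiny ∘ comb tree) (λ t → certOK (triadGens (comb tree t)) need₃ five) (boolLists (length tree)) ks ok (listed t len) not-tiny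
    k = proj₁ row
    k-ok = proj₂ row

  triCase : ∀ ks → T (triTable ks) → (L : Binary (3 + m)) → (∀ y → Cycle N y → ∃[ a ] Cycle L (a ∷ false ∷ y)) →
    (∀ a y → Cycle L (a ∷ false ∷ y) → Cycle N y) → Cycle L (true ∷ true ∷ e₀) →
    ∀ x → Cycle L (true ∷ false ∷ x) → lookup x zero ≡ false → ¬ Cycle L (true ∷ false ∷ ⊥) → Result L need₃ five
  triCase ks ok L up down circuit x cx x₀ no-loop = certOK⇒ L (triGens b) gens⊆L spanned need₃ five k k-ok
    where
    h : Bool → Subset (suc m) → Subset (3 + m)
    h a y = a ∷ false ∷ y
    chosen = choose-lifts h N L up B B⊆N
    b = proj₁ chosen
    len = proj₁ (proj₂ chosen)
    gens⊆L : All.All (Cycle L) (triGens b)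
    gens⊆L = circuit All.∷ proj₂ (proj₂ chosen)
    span-false : ∀ a y → Cycle L (a ∷ false ∷ y) → Spanned (Data.List.zipWith h b B) (a ∷ false ∷ y)
    span-false a y cy = s , sym (trans zipped (cong₂ h (sym a≡) (sym e)))
      where
      s = proj₁ (complete-B y (down a y cy))
      e = proj₂ (complete-B y (down a y cy))
      a′ = proj₁ (comb-zip h refl (λ _ _ _ _ → refl) b B len s)
      zipped = proj₂ (comb-zip h refl (λ _ _ _ _ → refl) b B len s)
      diff : Cycle L ((a xor a′) ∷ false ∷ ⊥)
      diff = subst (Cycle L) (cong (λ v → (a xor a′) ∷ false ∷ v) (trans (cong (y ⊕_) (sym e)) (⊕-self y)))
        (cycle-⊕ L cy (subst (Cycle L) zipped (comb-cycle L (Data.List.zipWith h b B) (proj₂ (proj₂ chosen)) s)))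
      a≡ : a ≡ a′
      a≡ = xor-false⇒≡ a a′ (not-true λ e → no-loop (subst (λ v → Cycle L (v ∷ false ∷ ⊥)) e diff))
    spanned : ∀ c → Cycle L c → Spanned (triGens b) c
    spanned (a ∷ false ∷ y) cy = let (s , e) = span-false a y cy in false ∷ s , e
    spanned (a ∷ true ∷ y) cy = span-cons {c = a ∷ true ∷ y} (span-false (a xor true) (y ⊕ e₀) (cycle-⊕ L cy circuit))
    witness : ∀ q → vanishes q (triGens b) ≡ true → dot q (true ∷ false ∷ x) ≡ false
    witness q = vanishes⇒ q (triGens b) (spanned (true ∷ false ∷ x) cx)
    not-excluded : triExcluded b ≡ false
    not-excluded = not-both
      (λ e → false≢true (cong (λ b → true xor (false xor b)) (dot-⊥ˡ x)) (witness low₂ (T⇒≡ e)))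
      (λ e → false≢true (on-entry x x₀) (witness (true ∷ false ∷ true ∷ ⊥) (T⇒≡ e)))
      where
      on-entry : ∀ (x : Subset (suc m)) → lookup x zero ≡ false → dot (true ∷ false ∷ true ∷ ⊥) (true ∷ false ∷ x) ≡ true
      on-entry (false ∷ x) _ = cong (λ b → true xor (false xor (false xor b))) (dot-⊥ˡ x)
    row = tableOK⇒ triExcluded (λ b → certOK (triGens b) need₃ five) (boolLists (length B)) ks ok (listed b len) not-excluded
    k = proj₁ row
    k-ok = proj₂ row

-- Tables of certificates, found by computer search

-- `K33⁰¹` has to be a start because its additional edge lies in none of its `K33`-minors: both
-- graphs have rank five, so one edge is deleted, and only the edge between the two vertices of
-- degree four leaves a cubic graph.
data Start : Set where
  s33 s01 s5 : Start

targetOf : Start → Target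
targetOf s33 = t33
targetOf s01 = t01
targetOf s5  = t5

treeEdges : Start → List ℕ
treeEdges s33 = 0 ∷ 1 ∷ 2 ∷ 3 ∷ 6 ∷ []
treeEdges s01 = 0 ∷ 1 ∷ 3 ∷ 4 ∷ 7 ∷ []
treeEdges s5  = 0 ∷ 1 ∷ 2 ∷ 3 ∷ []

tree : (s : Start) → List (Subset (edges (targetOf s)))
tree s = map (λ k → bits _ (2 ^ k)) (treeEdges s)

-- Adding the fundamental cycles of the chords in `x` clears all chords and leaves edges of the
-- spanning tree.
decompose : ∀ s x → ∃[ a ] ∃[ b ] (length b ≡ length (tree s) × x ⊕ comb (basis (targetOf s)) a ≡ comb (tree s) b)
decompose s x = coordinates (targetOf s) x , map (nth (reduced s x)) (treeEdges s) ,
  trans (Listₚ.length-map (nth (reduced s x)) (treeEdges s)) (sym (Listₚ.length-map (λ k → bits _ (2 ^ k)) (treeEdges s))) ,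
  eqᵇ⇒≡ _ _ (T-all (test s) (subsets _) (ok s) (∈-subsets x))
  where
  reduced : ∀ s → Subset (edges (targetOf s)) → Subset (edges (targetOf s))
  reduced s x = x ⊕ comb (basis (targetOf s)) (coordinates (targetOf s) x)
  test : ∀ s → Subset (edges (targetOf s)) → Bool
  test s x = eqᵇ (reduced s x) (comb (tree s) (map (nth (reduced s x)) (treeEdges s)))
  ok : ∀ s → T (all (test s) (subsets (edges (targetOf s))))
  ok s33 = tt
  ok s01 = tt
  ok s5  = tt

colK33 : List Cert
colK33 =
    cert t33 0x639528410 0 0xAC569 0x1C00EE064849093
  ∷ cert t33 0x936825710 0 0xA9563 0xE000E1C64849093
  ∷ cert t01 0x3962851740 0 0x4A8961 0x3B811C64849092
  ∷ cert t33 0x879546210 0 0xCC4E5 0x49092927801C00F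
  ∷ cert fano 0x8697530 20 0x59A61 0x36272381
  ∷ cert fano 0x8694530 132 0x59A61 0x36256B13
  ∷ cert t33 0x549876210 0 0x9C5A5 0x49092926387200F
  ∷ cert t33 0x978645310 0 0xCA4E3 0x92092497801C00F
  ∷ cert fano 0x8697520 24 0x59A61 0x36271B81
  ∷ cert fano 0x8694520 136 0x59A61 0x36255313
  ∷ cert t33 0x648975310 0 0x6A663 0x9209249554A900F
  ∷ cert t01 0x7984651320 0 0x8C88E1 0x24A49497801C00E
  ∷ cert t33 0x529638410 0 0x9C5A9 0x1C00EE06A472093
  ∷ cert t33 0x826935710 0 0x69663 0xE000E1C5548E093
  ∷ cert fano 0x8697530 20 0x59A61 0x36272381
  ∷ cert t01 0x6935824710 0 0x488921 0x1C38103E4849092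
  ∷ cert t01 0x9638527410 0 0x102A061 0xE007103E4849092
  ∷ cert t33 0x396285710 0 0x2D46B 0x273121C64849093
  ∷ cert t01 0x8975642310 0 0x8888A1 0x4924924F801C00E
  ∷ cert t33 0x528417630 0 0x7A4A1 0x1C00EE052424A49
  ∷ cert t33 0x825714930 0 0xD8E21 0xE000E1C52424A49
  ∷ cert fano 0x7698430 34 0x922B 0x2D472381
  ∷ cert t01 0x9876543210 0 0x1049061 0x9212524F801C00E
  ∷ cert t33 0x639417520 0 0xBC461 0x1C00EE064824925
  ∷ cert t33 0x936714820 0 0xE9521 0xE000E1C64824925
  ∷ cert fano 0x7589420 66 0x8935 0x1B8A9381
  ∷ cert t33 0x798465310 0 0x4E467 0x27246497801C00F
  ∷ cert fano 0x7698430 34 0x19269 0x2D472381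
  ∷ cert fano 0x7695430 258 0x49323 0x2D43B2A5
  ∷ cert t33 0x468795310 0 0x4B473 0x2724649554A900F
  ∷ []

rowK33 : List Cert
rowK33 =
    cert t33 0x528417630 512 0xFCA8 0x1C00E6052424849
  ∷ cert t33 0x639417520 256 0xFC54 0x1C00EA064824825
  ∷ cert t33 0x639528410 128 0xA854 0x1C00EC064849013
  ∷ cert t33 0x825714930 64 0xF3A2 0xE000E0C52424A09
  ∷ cert t33 0x879546210 8 0xC832 0x49092907801C007
  ∷ cert fano 0x4958310 196 0x2834 0x238C4931
  ∷ cert fano 0x5947320 322 0x3C24 0x238A90B1
  ∷ cert t33 0x936714820 32 0xF351 0xE000E1464824905
  ∷ cert fano 0x7685310 532 0x82C1 0x1C8389A1
  ∷ cert t33 0x978645310 4 0xC431 0x92092487801C00B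
  ∷ cert fano 0x6874320 546 0x3C81 0x1C8550D1
  ∷ cert t33 0x936825710 16 0xA251 0xE000E1864849083
  ∷ cert fano 0x8674320 546 0xC381 0x1C855191
  ∷ cert fano 0x9547320 322 0xC324 0x238A9291
  ∷ []

triadK33 : List Cert
triadK33 =
    cert t01 0x47A3692108 32 0x11A2541 0xE1C2E0324124007
  ∷ cert t01 0x4A73962105 256 0x5A0D41 0xE6221C324124007
  ∷ cert t01 0x47A3692851 1 0x11AA561 0xE1C2C4524124124
  ∷ cert t01 0x89A5672104 8 0x11C14C1 0x92252923C0070007
  ∷ cert fano 0x97A8641 41 0x59A61 0x1B11C8706
  ∷ cert fano 0x97A5641 265 0x59A61 0x1B115A622
  ∷ cert t33 0x56A897210 8 0x8CCAD 0x922529231C1C8007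
  ∷ cert t01 0x8A95762103 16 0x9C0CC1 0x9248A493C0070007
  ∷ cert fano 0x97A8631 49 0x59A61 0x1B11C6706
  ∷ cert fano 0x97A5631 273 0x59A61 0x1B1154622
  ∷ cert t33 0x5798A6210 16 0x4B473 0x9248A492AA2A4007
  ∷ cert t01 0x89A5672431 1 0x11C94E1 0x92252915C007001C
  ∷ cert t33 0x36A479210 32 0x8CD2D 0xE1C2E03521C8007
  ∷ cert t33 0x3974A6210 256 0x2B473 0xE6221C2AA238007
  ∷ cert t33 0x56A897210 8 0x8CCAD 0x922529231C1C8007
  ∷ cert t01 0x47A3691208 32 0x11A2541 0xD1C4E0324124007
  ∷ cert t01 0x4A73961205 256 0x5A0D41 0xD6241C324124007
  ∷ cert t01 0x47A3691852 1 0x11AA561 0xD1C4C4924124122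
  ∷ cert t01 0x89A5671204 8 0x11C14C1 0x91254923C0070007
  ∷ cert fano 0x97A8642 41 0x59A61 0x1B09C8706
  ∷ cert fano 0x97A5642 265 0x59A61 0x1B0959624
  ∷ cert t33 0x65A987210 8 0x9C5A5 0x12A1229231C1C8007
  ∷ cert t01 0x8A95761203 16 0x9C0CC1 0x9148C493C0070007
  ∷ cert fano 0x97A8632 49 0x59A61 0x1B09C5706
  ∷ cert fano 0x97A5632 273 0x59A61 0x1B0954624
  ∷ cert t33 0x759A86210 16 0x6A663 0x246122492AA2A4007
  ∷ cert t01 0x89A5671432 1 0x11C94E1 0x91254919C007001A
  ∷ cert t33 0x63A749210 32 0x9C5A9 0xE201AE03521C8007
  ∷ cert t33 0x937A46210 256 0x69663 0x31201A1C2AA238007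
  ∷ cert t33 0x65A987210 8 0x9C5A5 0x12A1229231C1C8007
  ∷ []

triK33 : List Cert
triK33 =
    cert fano 0xA658432 642 0xC9888 0x11C2A4525
  ∷ cert fano 0x9785432 1090 0xC9A02 0xE4154325
  ∷ cert t01 0xA479368102 32 0x1422841 0x38001E18B24124103
  ∷ cert fano 0x7985432 1090 0x3E202 0xE41541A5
  ∷ cert t01 0xA897564102 8 0x1841841 0x24812648BC0070013
  ∷ cert fano 0x5A69420 392 0x240C8 0x11C313263
  ∷ cert fano 0x6A58431 644 0x3E0A9 0x11C2A4163
  ∷ cert fano 0x6A58432 642 0x3E088 0x11C2A4165
  ∷ cert fano 0x8796420 1064 0x81302 0xE40E3343
  ∷ cert t01 0xA897564201 8 0x1849861 0x248126487C0070015
  ∷ cert fano 0x7985431 1092 0x3E223 0xE41541A3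
  ∷ cert t01 0xA479368201 32 0x142A861 0x38001E18724124105
  ∷ cert fano 0x9785431 1092 0xC9A23 0xE4154323
  ∷ cert fano 0xA658431 644 0xC98A9 0x11C2A4523
  ∷ []

colK33⁰¹ : List Cert
colK33⁰¹ =
    cert t01 0x765432A901 0 0x29121091 0x24824A24E3800E701
  ∷ cert t01 0xA984327601 0 0x29409085 0x24824A24FC000E0E1
  ∷ cert t11 0x432A9876510 0 0x202A51044 0x24824A24C073808E1
  ∷ cert t01 0xA987650321 0 0x21409102 0x248A4A24DC007001D
  ∷ cert fano 0x896A531 129 0x2DB123 0xDC38E556
  ∷ cert fano 0x8967531 1025 0x8F310B 0xDC1C61C6
  ∷ cert t01 0x798A650321 0 0x9421102 0x248A4A24CE423801D
  ∷ cert t01 0xA987654301 0 0x21409103 0x24824A24FC007001D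
  ∷ cert t11 0x765A9843210 0 0x204851042 0x24824A24C3838081D
  ∷ cert t11 0xA9876543210 0 0x810245042 0x24824A24DC007081D
  ∷ cert fano 0x896A531 129 0xD312B 0xDC38E556
  ∷ cert t02 0x98A65732410 0 0xC613490C1 0x125127923C007001C
  ∷ cert t01 0x987654321 0 0x1408102 0x248A4A24DC047001C
  ∷ cert t01 0xA980654321 0 0x20401102 0x248A4A24DC007081C
  ∷ cert fano 0x89A3621 17 0x155942 0x1F81C65AA
  ∷ cert t01 0x756423A801 0 0x2D123081 0x2481264963800E701
  ∷ cert t01 0xA894237501 0 0x3940B081 0x248126497C000E0E1
  ∷ cert fano 0x89A3721 17 0x259A42 0x1F81B654A
  ∷ cert t01 0xA987653401 0 0x2340B101 0x24625624FC007001D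
  ∷ cert fano 0x896A521 129 0x259121 0xDC38E54A
  ∷ cert fano 0x8967521 1025 0x871109 0xDC1C61DA
  ∷ cert t01 0x789A560321 0 0x19425102 0x24893A4ACE423801D
  ∷ cert t01 0xA897564201 0 0x3140D101 0x248126497C007001D
  ∷ cert fano 0x896A541 129 0x259121 0xDB38E54A
  ∷ cert fano 0x8967541 1025 0x871109 0xDB1C81C6
  ∷ cert fano 0x896A521 129 0x51129 0xDC38E54A
  ∷ cert t02 0x89A56723410 0 0x87124D043 0x9324B923C007001C
  ∷ cert t01 0x7654329A01 0 0x191110A1 0x1C854A24E3800E701
  ∷ cert t01 0xA984326701 0 0x25405089 0x2382AA24FC000E0E1
  ∷ cert fano 0x89A3521 17 0x51842 0x1F81C654A
  ∷ []

rowK33⁰¹ : List Cert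
rowK33⁰¹ =
    cert t01 0x987654321 1024 0x1041041 0x48A4A24CC047001C
  ∷ cert t01 0x756423A801 512 0x1E16428 0x2481260963800E501
  ∷ cert t01 0x765432A901 256 0x1414028 0x24824A04E3800E601
  ∷ cert t01 0xA980654321 128 0x1041041 0x208A4A24DC003081C
  ∷ cert t01 0xA987650321 16 0x1041041 0x240A4A24DC007000D
  ∷ cert fano 0x5A69420 392 0x240E9 0x11C313261
  ∷ cert fano 0x6A58430 644 0x3E489 0x11C2A5161
  ∷ cert t01 0xA894237501 64 0x1E41C22 0x248126417C000E0A1
  ∷ cert fano 0x8796420 1064 0x81323 0xE40E3341
  ∷ cert t01 0x9A86750312 16 0x880881 0x120C8C24DC007000B
  ∷ cert fano 0x7985430 1092 0x3E603 0xE41551A1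
  ∷ cert t01 0xA984327601 32 0x1441022 0x24824A20FC000E0C1
  ∷ cert fano 0x9785430 1092 0xC9E03 0xE4155321
  ∷ cert fano 0xA658430 644 0xC9C89 0x11C2A5521
  ∷ cert t01 0x8A95760213 16 0x8C88E1 0x90C8C495C0070007
  ∷ cert t01 0xA897564201 8 0x1941C41 0x248126487C0070015
  ∷ cert fano 0x7985430 1092 0x3E603 0xE41551A3
  ∷ cert t01 0x9A83420615 128 0x8A0482 0x104C7024DC000E043
  ∷ cert fano 0x8796420 1064 0x81323 0xE40E3343
  ∷ cert fano 0xA658430 644 0xC9C89 0x11C2A5523
  ∷ cert t01 0xA987654301 4 0x1041041 0x24824A247C0070019
  ∷ cert t01 0x8A92430516 128 0x8F04E2 0x82C70495C000E023
  ∷ cert fano 0x9785430 1092 0xC9E03 0xE4155323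
  ∷ cert t01 0x6753420918 1024 0x2A0608 0x24B9024C3800E203
  ∷ cert t01 0x5762430819 1024 0x2F0728 0x12B904943800E103
  ∷ cert t01 0x765432A109 256 0x1454128 0x24824A44A3800E403
  ∷ cert fano 0x5A69420 392 0x240E9 0x11C313263
  ∷ cert fano 0x6A58430 644 0x3E489 0x11C2A5163
  ∷ cert t01 0xA984327106 32 0x1451062 0x24824A28BC000E083
  ∷ cert t01 0xA987654103 4 0x1049061 0x24824A253C0070013
  ∷ []

triadK33⁰¹ : List Cert
triadK33⁰¹ =
    cert t02 0x786453201A9 2048 0x5284A0401 0x49472124A1C0038007
  ∷ cert t02 0xAB945320176 256 0x528188101 0x4948E124AE00038007
  ∷ cert fano 0x97AB642 265 0xC646B 0x6E0A92E06
  ∷ cert t02 0xB9A86701254 8 0xC923860C2 0x921272494E001C0007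
  ∷ cert t01 0x5A9B430217 64 0x1521184 0x92149438A720918007
  ∷ cert t01 0x576843021A 512 0x1509490 0x921494C4A8E0918007
  ∷ cert t01 0x8A9B760214 8 0x94A1182 0x9214942727208E0007
  ∷ cert t02 0xAB978620143 32 0x4A0188081 0x49491924AE001C0007
  ∷ cert fano 0xA8B9742 97 0x5CE943 0xD8A718E06
  ∷ cert fano 0xA8B6742 545 0x5CE943 0xD8A552C4C
  ∷ cert t33 0x8A9B76521 1 0x250844 0x92049424A7188D803E
  ∷ cert t02 0xAB978645321 1 0x421109081 0x49492624AE001C0038
  ∷ cert t02 0x867534012BA 512 0xF14C92C50 0x921C4A4941C0038007
  ∷ cert t02 0xB9A53401287 64 0xF14386344 0x92138A494E00038007
  ∷ cert t01 0x8A9B760214 8 0x94A1182 0x9214942727208E0007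
  ∷ cert t02 0x786453102A9 2048 0x5284A0401 0x49272124C1C0038007
  ∷ cert t02 0xAB945310276 256 0x528188101 0x4928E124CE00038007
  ∷ cert fano 0x9AB4832 35 0x259A42 0xFC06D8A94
  ∷ cert t02 0xB9A86702154 8 0xC923860C2 0x921274492E001C0007
  ∷ cert t01 0x59AB340217 64 0x11523184 0x92138C492720918007
  ∷ cert t01 0x567834021A 512 0x550B490 0x921C4C4928E0918007
  ∷ cert t01 0x89AB670214 8 0x194A5182 0x9212744927208E0007
  ∷ cert t02 0xAB978610243 32 0x4A0188081 0x49291924CE001C0007
  ∷ cert fano 0x9A7B652 259 0x259121 0x6D8E38A94
  ∷ cert fano 0x9A78652 2051 0x871109 0x6D872038C
  ∷ cert t33 0x89AB67521 1 0x650944 0x92024C4927188D803E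
  ∷ cert t02 0x9BA68735421 1 0x43110D083 0x24C926492E001C0038
  ∷ cert t02 0x867534021BA 512 0xF14C92C50 0x921C4C4921C0038007
  ∷ cert t02 0xB9A53402187 64 0xF14386344 0x92138C492E00038007
  ∷ cert t01 0x89AB670214 8 0x194A5182 0x9212744927208E0007
  ∷ []

triK33⁰¹ : List Cert
triK33⁰¹ =
    cert t01 0x19A8765432 2048 0x31408102 0x12329544D6031C0038
  ∷ cert t02 0x867534A1092 2048 0xB04882401 0x72024E0951C0038403
  ∷ cert t02 0x876543910A2 2048 0xE04C02401 0x72049604D1C0038203
  ∷ cert t01 0xBA91675432 256 0x2040D102 0x82345528DE000C3038
  ∷ cert t01 0xB9A8671432 32 0x3140D102 0x90325548DE001C001B
  ∷ cert fano 0x6B7A530 784 0x220392 0x8E0C4E4C3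
  ∷ cert fano 0x7B69540 1288 0x3B2212 0x8E0A962C3
  ∷ cert t02 0xB9A53471062 256 0xE10282101 0x8E024E415E00038083
  ∷ cert fano 0x98A7530 2128 0x808C86 0x72038E683
  ∷ cert t02 0xB9A86742031 32 0xC513450C1 0x91824E483E001C0015
  ∷ cert fano 0x8A96540 2184 0x3B2806 0x720556343
  ∷ cert t02 0xBA954361072 256 0xB10302101 0x8E049620DE00038043
  ∷ cert fano 0xA896540 2184 0xC8E806 0x720556643
  ∷ cert fano 0xB769540 1288 0xC8E212 0x8E0A96A43
  ∷ cert t02 0xBA987632041 32 0x8D12C50C1 0x918496243E001C000D
  ∷ cert t02 0xB9A86741032 32 0xC10304081 0x91824E485E001C0013
  ∷ cert fano 0x8A96540 2184 0x3B2806 0x720556345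
  ∷ cert t02 0xB9A53472061 256 0xE512C3141 0x8E024E413E00038085
  ∷ cert fano 0x98A7530 2128 0x808C86 0x72038E685
  ∷ cert fano 0xB769540 1288 0xC8E212 0x8E0A96A45
  ∷ cert t02 0xBA987631042 32 0x890284081 0x918496245E001C000B
  ∷ cert t02 0xBA954362071 256 0xB51343141 0x8E049620BE00038045
  ∷ cert fano 0xA896540 2184 0xC8E806 0x720556645
  ∷ cert t02 0x867534A2091 2048 0xB458C3441 0x72024E0931C0038405
  ∷ cert t02 0x876543920A1 2048 0xE45C43441 0x72049604B1C0038205
  ∷ cert t01 0x29A8765431 2048 0x30448143 0x12529344B6051C0038
  ∷ cert fano 0x6B7A530 784 0x220392 0x8E0C4E4C5
  ∷ cert fano 0x7B69540 1288 0x3B2212 0x8E0A962C5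
  ∷ cert t01 0xBA92675431 256 0x2044C143 0x82545328BE000C5038
  ∷ cert t01 0xB9A8672431 32 0x3044C143 0x90525348BE001C001D
  ∷ []

colK5 : List Cert
colK5 =
    cert t5 0x865A973210 0 0x8040505089 0x54864838B4881F
  ∷ cert t5 0x975A864210 0 0x10080504885 0x69064838AA481F
  ∷ cert t5 0x5219748630 0 0xB1008C4681 0x3241C407B48D49
  ∷ cert t5 0xA769854310 0 0x20080884883 0x690A903899281F
  ∷ cert t5 0x631A748520 0 0xB100544581 0x5481C407B48B25
  ∷ cert t5 0x741A639520 0 0x15200584381 0x6901C407AA4B25
  ∷ cert fano 0x789A651 1 0x1E592C3 0xF62DA68E
  ∷ cert t5 0x832A946510 0 0xB040515181 0x54864807B488E3
  ∷ cert t5 0x942A837510 0 0x15080524981 0x69064807AA48E3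
  ∷ cert fano 0x789A652 1 0x1E592C3 0xF62D568E
  ∷ cert t5 0xA439827610 0 0x260808A4A81 0x690A90079928E3
  ∷ cert fano 0x789A653 1 0x1E592C3 0xF1ADA68E
  ∷ cert fano 0x789A654 1 0x1E592C3 0xF1AD5690
  ∷ cert fano 0x489A321 1 0x2410C1 0xF62DA672
  ∷ []

rowK5 : List Cert
rowK5 =
    cert t5 0x5219748630 1024 0x2C80B89A0 0x3241C407948949
  ∷ cert t5 0x631A748520 512 0x2C8078550 0x5481C407A48925
  ∷ cert t11 0xA976543281 0 0x43810A048 0x48D486498047101E
  ∷ cert t5 0x741A639520 256 0x5500782C8 0x6901C407A24A25
  ∷ cert t11 0xA867534291 0 0x238094050 0x24E906494047101E
  ∷ cert t11 0x98576243A1 0 0x2380640A0 0x12E90A90C047101E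
  ∷ cert t01 0x74A639521 0 0x10130081 0x3808E203C646A4324
  ∷ cert t5 0x832A946510 128 0x2C2066544 0x54864807B08863
  ∷ cert t11 0xA798543162 0 0x12640A042 0x108D481C52059201E
  ∷ cert t11 0x97A8642153 0 0x115809081 0x208B241C4A06A401E
  ∷ cert t5 0x865A973210 16 0x202060404 0x54864838B4080F
  ∷ cert fano 0xA967540 258 0xA512C4 0x19B3484C9
  ∷ cert fano 0x798A640 40 0x1932E0 0xF1B48581
  ∷ cert fano 0x7A89540 68 0x1632D0 0x16AB48381
  ∷ cert fano 0x9A67540 258 0x4692C4 0x19B3482C9
  ∷ cert t5 0x942A837510 64 0x5440662C2 0x69064807A848A3
  ∷ cert t11 0xA689534172 0 0xA6214044 0x84E901C51059201E
  ∷ cert fano 0xA789540 68 0x8C52D0 0x16AB48709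
  ∷ cert fano 0x798A640 40 0x1932E0 0xF1B48587
  ∷ cert t11 0x86A9732154 0 0x8B811101 0x204B241C45074801E
  ∷ cert t5 0x975A864210 8 0x404060202 0x69064838AA0817
  ∷ cert fano 0x6A98530 132 0xE5548 0x19CAA4341
  ∷ cert fano 0x8A76530 514 0x271542 0x16D2A41D1
  ∷ cert t11 0x76598143A2 0 0xA6070220 0x11E90A903059201E
  ∷ cert t01 0x94A837512 0 0x4424201 0x260B2403C946A40E2
  ∷ cert fano 0x9A67540 258 0x4692C4 0x19B3482C1
  ∷ cert fano 0x7A89540 68 0x1632D0 0x16AB48389
  ∷ cert fano 0x8A76530 514 0x271542 0x16D2A41C1
  ∷ cert fano 0x6A98530 132 0xE5548 0x19CAA4351
  ∷ cert t11 0x43298176A5 0 0xA00732E6 0x3E90A90065920E2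
  ∷ cert t01 0x97A864215 0 0x45622C1 0x20CB241C4A26A401E
  ∷ cert t5 0xA439827610 32 0x9840952C1 0x690A90079828C3
  ∷ cert fano 0x978A640 40 0x4C62E0 0xF1B48705
  ∷ cert t11 0x958A624173 0 0x55224084 0x82E901C4886A401E
  ∷ cert fano 0x7A89540 68 0x1632D0 0x16AB4838B
  ∷ cert t11 0x859A723164 0 0x4B422102 0x102D481C44874801E
  ∷ cert fano 0x6A98530 132 0xE5548 0x19CAA4353
  ∷ cert t5 0xA769854310 4 0x804090201 0x690A903899081B
  ∷ cert fano 0xA798430 68 0x806408 0x1A42D5721
  ∷ cert t11 0x756A814293 0 0x550B0210 0x21E90648286A401E
  ∷ cert fano 0x9A67540 258 0x4692C4 0x19B3482CD
  ∷ cert t01 0xA49827613 0 0x4814202 0x150D4803D0C5920E2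
  ∷ cert fano 0x798A640 40 0x1932E0 0xF1B48585
  ∷ cert fano 0x8975620 1026 0x2B2981 0xF61921A1
  ∷ cert t11 0x423A817596 0 0x500B32D5 0x5E90648056A40E2
  ∷ cert fano 0x6A98530 132 0xE5548 0x19CAA4343
  ∷ cert t01 0xA79854316 0 0x49912C2 0x10AD481C52159201E
  ∷ cert t11 0x657A913284 0 0x4B128408 0x41D486481874801E
  ∷ cert fano 0x8A76530 514 0x271542 0x16D2A41D5
  ∷ cert fano 0x8975620 1026 0x2B2981 0xF61921B9
  ∷ cert t11 0x324A916587 0 0x4812D54B 0x9D48648037480E2
  ∷ cert t01 0xA38926714 0 0x280A404 0xB0E9003D0A5920E2
  ∷ cert fano 0x798A640 40 0x1932E0 0xF1B48583
  ∷ cert fano 0x7A89540 68 0x1632D0 0x16AB48383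
  ∷ cert t01 0xA68953417 0 0x2989544 0x86E901C51159201E
  ∷ cert fano 0xA976430 258 0x818102 0x1A43364E1
  ∷ cert fano 0x8A76530 514 0x271542 0x16D2A41C5
  ∷ cert t01 0x7A90651328 0 0x14E012C8 0x49D48649A403881E
  ∷ cert fano 0x9A67540 258 0x4692C4 0x19B3482C5
  ∷ cert t01 0x6A80751429 0 0xAE01550 0x25E906495205481E
  ∷ cert t01 0x598076143A 0 0x9E029A0 0x13E90A90C906281E
  ∷ cert t33 0x83A517940 0 0xE20544 0x19201E98B52071255
  ∷ []

triadK5 : List Cert
triadK5 =
    cert t02 0x7B46A320185 0 0x6401480401 0x1C4D2103AA90648007
  ∷ cert t02 0x8B569320174 0 0x6400C40201 0x1C4A9103AD20648007
  ∷ cert fano 0x89AB763 5 0x1E592C3 0x7B0B52D1A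
  ∷ cert t02 0x8A579420163 0 0x5200C40101 0x1C464903AD20A90007
  ∷ cert fano 0x89AB764 5 0x1E592C3 0x78AB68D1A
  ∷ cert fano 0x89AB765 5 0x1E592C3 0x78AB52D20
  ∷ cert t01 0x9A287154B 0 0x21E012640 0x7B68CD86491C403A
  ∷ cert t02 0x7B46A310285 0 0x6401480401 0x1C2D2103CA90648007
  ∷ cert t02 0x8B569310274 0 0x6400C40201 0x1C2A9103CD20648007
  ∷ cert fano 0x89AB763 3 0x1E592C3 0x7B0B54D1C
  ∷ cert t02 0x8A579410263 0 0x5200C40101 0x1C264903CD20A90007
  ∷ cert fano 0x89AB764 3 0x1E592C3 0x78CB68D1C
  ∷ cert fano 0x89AB765 3 0x1E592C3 0x78CB54D20
  ∷ cert t01 0x9A187254B 0 0x21E012640 0x7B68CD86491C203C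
  ∷ []

triK5 : List Cert
triK5 =
    cert fano 0xBA87542 514 0x82C0404 0xD20CD89C5
  ∷ cert fano 0x9B87642 1026 0x258D584 0xB68A9038D
  ∷ cert t11 0x1BA57684392 0 0x14F01050110 0x123A90648C030E511D
  ∷ cert fano 0xAB78652 514 0x454CB88 0xCD8D2058D
  ∷ cert t11 0x1B9486753A2 0 0xAF008A0120 0x93D20648A031550AD
  ∷ cert t11 0x1A9387654B2 0 0x9F00520240 0x4BD20A9060318D075
  ∷ cert t01 0x158B74A632 0 0x291180202 0xE032E531D323A90648
  ∷ cert t02 0xB47A3681052 0 0x22044408401 0xD2003E0C5A90648103
  ∷ cert fano 0x9B87642 1026 0x258D584 0xB68A903AD
  ∷ cert fano 0x9A86732 2050 0x2996682 0x7B0648375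
  ∷ cert t02 0xB74A6351082 0 0x24045008401 0xD201C601DA90648023
  ∷ cert t02 0xB47A3681052 0 0x22044408401 0xD2003E2C5A90648303
  ∷ cert fano 0x8A9B750 80 0x1898B40 0x78ED20B03
  ∷ cert fano 0x8B9A650 136 0x1518B20 0xB56D20703
  ∷ cert t02 0xB74A6351082 0 0x24045008401 0xD201C621DA90648223
  ∷ cert t02 0xB5893671042 0 0x24082408201 0xA9003E145D20648083
  ∷ cert fano 0xAB78652 514 0x454CB88 0xCD8D2059D
  ∷ cert t02 0xB5893671042 0 0x24082408201 0xA9003E545D20648483
  ∷ cert fano 0x8A9B750 80 0x1898B40 0x78ED20B0D
  ∷ cert fano 0x9A86732 2050 0x2996682 0x7B0648345
  ∷ cert t02 0xB8596341072 0 0x22082808201 0xA901C602DD20648013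
  ∷ cert fano 0x7BA9640 264 0xD29510 0xCE6A90683
  ∷ cert t02 0xB8596341072 0 0x22082808201 0xA901C642DD20648413
  ∷ cert t02 0xA5894762031 0 0x14892A14181 0x64803E183D20A90045
  ∷ cert t02 0xA5894762031 0 0x14892A14181 0x64803E983D20A90845
  ∷ cert fano 0xAB78651 516 0x4748B89 0xCD8D20583
  ∷ cert fano 0x8B9A650 136 0x1518B20 0xB56D20713
  ∷ cert fano 0x9B87641 1028 0x2789585 0xB68A90383
  ∷ cert fano 0x7BA9640 264 0xD29510 0xCE6A906A3
  ∷ cert t02 0xA8597432061 0 0x11892614181 0x6481C6033D20A9000D
  ∷ cert t02 0xA8597432061 0 0x11892614181 0x6481C6833D20A9080D
  ∷ cert t02 0xA5894761032 0 0x14082810101 0x64803E185D20A90043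
  ∷ cert t02 0xA5894761032 0 0x14082810101 0x64803E985D20A90843
  ∷ cert fano 0xAB78652 514 0x454CB88 0xCD8D20585
  ∷ cert fano 0x8B9A650 136 0x1518B20 0xB56D20715
  ∷ cert fano 0x9B87642 1026 0x258D584 0xB68A90385
  ∷ cert fano 0x7BA9640 264 0xD29510 0xCE6A906A5
  ∷ cert t02 0xA8597431062 0 0x11082410101 0x6481C6035D20A9000B
  ∷ cert t02 0xA8597431062 0 0x11082410101 0x6481C6835D20A9080B
  ∷ cert t02 0xB5893672041 0 0x2489260C281 0xA9003E143D20648085
  ∷ cert fano 0xAB78651 516 0x4748B89 0xCD8D2059B
  ∷ cert t02 0xB5893672041 0 0x2489260C281 0xA9003E543D20648485
  ∷ cert fano 0x8A9B750 80 0x1898B40 0x78ED20B0B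
  ∷ cert fano 0x9A86731 2052 0x2B92683 0x7B0648343
  ∷ cert t02 0xB8596342071 0 0x22892A0C281 0xA901C602BD20648015
  ∷ cert fano 0x7BA9640 264 0xD29510 0xCE6A90685
  ∷ cert t02 0xB8596342071 0 0x22892A0C281 0xA901C642BD20648415
  ∷ cert t02 0xB47A3682051 0 0x2285460C481 0xD2003E0C3A90648105
  ∷ cert fano 0x9B87641 1028 0x2789585 0xB68A903AB
  ∷ cert fano 0x9A86731 2052 0x2B92683 0x7B0648373
  ∷ cert t02 0xB74A6352081 0 0x2485520C481 0xD201C601BA90648025
  ∷ cert t02 0xB47A3682051 0 0x2285460C481 0xD2003E2C3A90648305
  ∷ cert fano 0x8A9B750 80 0x1898B40 0x78ED20B05
  ∷ cert fano 0x8B9A650 136 0x1518B20 0xB56D20705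
  ∷ cert t02 0xB74A6352081 0 0x2485520C481 0xD201C621BA90648225
  ∷ cert fano 0xBA87541 516 0x82C0485 0xD20CD89C3
  ∷ cert fano 0x9B87641 1028 0x2789585 0xB68A9038B
  ∷ cert t11 0x2BA57684391 0 0x14701254190 0x125A90648C050E311B
  ∷ cert fano 0xAB78651 516 0x4748B89 0xCD8D2058B
  ∷ cert t11 0x2B9486753A1 0 0xA700AA41A0 0x95D20648A051530AB
  ∷ cert t11 0x2A9387654B1 0 0x97007242C0 0x4DD20A9060518B073
  ∷ cert t01 0x258B74A631 0 0x281380283 0xE052E331B325A90648
  ∷ []

colTable-K33 : T (Extension.colTable (space t33) (basis t33) (basis-sound t33) (basis-spans t33) (tree s33) (decompose s33) false colK33)
colTable-K33 = tt

rowTable-K33 : T (Extension.rowTable (space t33) (basis t33) (basis-sound t33) (basis-spans t33) (tree s33) (decompose s33) false rowK33)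
rowTable-K33 = tt

triadTable-K33 : T (Extension.triadTable (space t33) (basis t33) (basis-sound t33) (basis-spans t33) (tree s33) (decompose s33) false triadK33)
triadTable-K33 = tt

triTable-K33 : T (Extension.triTable (space t33) (basis t33) (basis-sound t33) (basis-spans t33) (tree s33) (decompose s33) false triK33)
triTable-K33 = tt

colTable-K33⁰¹ : T (Extension.colTable (space t01) (basis t01) (basis-sound t01) (basis-spans t01) (tree s01) (decompose s01) false colK33⁰¹)
colTable-K33⁰¹ = tt

rowTable-K33⁰¹ : T (Extension.rowTable (space t01) (basis t01) (basis-sound t01) (basis-spans t01) (tree s01) (decompose s01) false rowK33⁰¹)
rowTable-K33⁰¹ = tt

triadTable-K33⁰¹ : T (Extension.triadTable (space t01) (basis t01) (basis-sound t01) (basis-spans t01) (tree s01) (decompose s01) false triadK33⁰¹)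
triadTable-K33⁰¹ = tt

triTable-K33⁰¹ : T (Extension.triTable (space t01) (basis t01) (basis-sound t01) (basis-spans t01) (tree s01) (decompose s01) false triK33⁰¹)
triTable-K33⁰¹ = tt

colTable-K5 : T (Extension.colTable (space t5) (basis t5) (basis-sound t5) (basis-spans t5) (tree s5) (decompose s5) true colK5)
colTable-K5 = tt

rowTable-K5 : T (Extension.rowTable (space t5) (basis t5) (basis-sound t5) (basis-spans t5) (tree s5) (decompose s5) true rowK5)
rowTable-K5 = tt

triadTable-K5 : T (Extension.triadTable (space t5) (basis t5) (basis-sound t5) (basis-spans t5) (tree s5) (decompose s5) true triadK5)
triadTable-K5 = tt

triTable-K5 : T (Extension.triTable (space t5) (basis t5) (basis-sound t5) (basis-spans t5) (tree s5) (decompose s5) true triK5)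
triTable-K5 = tt

-- Bringing a further element into a minor

-- The absence of 2-separations. That both sides have at least two elements is witnessed by
-- elements, so that no cardinalities enter the rank calculus.
Connected₃ : ∀ {n} → Binary n → Set
Connected₃ {n} K = ∀ (p : Fin n → Bool) {a b c d} → a ≢ b → p a ≡ true → p b ≡ true → c ≢ d → p c ≡ false → p d ≡ false →
  2 + R (λ _ → true) ≤ R p + R (λ i → not (p i))
  where open Polymatroid (binary⇒polymatroid K)

module _ {n} (K : Binary n) where
  open Closure K
  open Polymatroid (binary⇒polymatroid K)

  cycle-rank : ∀ p c i → Cycle K c → lookup c i ≡ true → (∀ j → lookup c j ≡ true → j ≡ i ⊎ p j ≡ true) →
    ∀ q → (∀ j → q j ≡ true → j ≡ i ⊎ p j ≡ true) → R q ≤ R p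
  cycle-rank p c i cc ci sup q q⊆ = ≤-trans (rk-mono {elements q} {i ∷ elements p} λ {j} m → place (q⊆ j (∈-elements⁻ q m)))
    (≤-reflexive (cong (_+ R p) (gain-spanned {elements p} {i} (inj₂ (c , cc , ci , λ j e → place (sup j e))))))
    where
    place : ∀ {j} → j ≡ i ⊎ p j ≡ true → j ∈ₗ (i ∷ elements p)
    place (inj₁ e) = here e
    place (inj₂ e) = there (∈-elements⁺ p e)

∨-elim : ∀ {X : Set} a {b} → a ∨ b ≡ true → (a ≡ true → X) → (b ≡ true → X) → X
∨-elim true  _ f g = f refl
∨-elim false e f g = g e

minor-refl : ∀ {n m} {K : Binary n} {C} {ψ : Fin m → Fin n} → Injective _≡_ _≡_ ψ → (∀ x → C (ψ x) ≡ false) → Minor K C ψ (minor K C ψ)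
minor-refl i o = record { inj = i ; off = o ; same = λ y → id , id }

Minor-unique : ∀ {n m} {K : Binary n} {C} {ψ : Fin m → Fin n} {L L′ : Binary m} → Minor K C ψ L → Minor K C ψ L′ → L ≅ L′
Minor-unique M M′ c = (λ h → proj₁ (same M′ c) (proj₂ (same M c) h)) , (λ h → proj₁ (same M c) (proj₂ (same M′ c) h))

infixr 5 _∷ᶠ_
_∷ᶠ_ : ∀ {A : Set} {m} → A → (Fin m → A) → Fin (suc m) → A
(a ∷ᶠ ψ) zero    = a
(a ∷ᶠ ψ) (suc x) = ψ x

cons-inj : ∀ {n m} (a : Fin n) (ψ : Fin m → Fin n) → Injective _≡_ _≡_ ψ → (∀ x → ψ x ≢ a) → Injective _≡_ _≡_ (a ∷ᶠ ψ)
cons-inj a ψ i ne {zero}  {zero}  e = refl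
cons-inj a ψ i ne {zero}  {suc y} e = absurd (ne y (sym e))
cons-inj a ψ i ne {suc x} {zero}  e = absurd (ne x e)
cons-inj a ψ i ne {suc x} {suc y} e = cong suc (i e)

startColour : Origin → Bool → Colour
startColour inside c = core
startColour first  c = entry
startColour second c = spare
startColour other  c = if c then toCon else toDel

-- The minor is rooted at `ψ zero`, and `f` is to be brought in. Three elements of `N` are made
-- visible because besides the root two core elements are required for the far side of a cut.
module Step {m} (N : Binary (3 + m)) (B : List (Subset (3 + m))) (B⊆N : All.All (Cycle N) B)
  (complete-B : ∀ c → Cycle N c → Spanned B c) (trees : List (Subset (3 + m)))
  (decomposes : ∀ x → ∃[ s ] ∃[ t ] (length t ≡ length trees × x ⊕ comb B s ≡ comb trees t)) (five : Bool)
  (cols rws triads tris : List Cert) (col-ok : T (Extension.colTable N B B⊆N complete-B trees decomposes five cols)) (row-ok : T (Extension.rowTable N B B⊆N complete-B trees decomposes five rws))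
  (triad-ok : T (Extension.triadTable N B B⊆N complete-B trees decomposes five triads)) (tri-ok : T (Extension.triTable N B B⊆N complete-B trees decomposes five tris))
  (no-loop : Independent N e₀) (no-coloop : ∃[ y ] (Cycle N y × lookup y zero ≡ true))
  {n} (K : Binary n) (conn : Connected₃ K) {C : Fin n → Bool} {ψ : Fin (3 + m) → Fin n} (M : Minor K C ψ N)
  (f : Fin n) (f∉ψ : ∀ x → ψ x ≢ f) where

  module E = Extension N B B⊆N complete-B trees decomposes five

  P = binary⇒polymatroid K
  open Linking P

  φ : Fin (2 + m) → Fin n
  φ x = ψ (suc x)

  source′ : (i : Fin n) → Dec (i ≡ ψ zero) → Dec (i ≡ f) → Dec (∃[ x ] (φ x ≡ i)) → Origin
  source′ i (yes _) _       _       = first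
  source′ i (no _)  (yes _) _       = second
  source′ i (no _)  (no _)  (yes _) = inside
  source′ i (no _)  (no _)  (no _)  = other

  source : Fin n → Origin
  source i = source′ i (i ≟F ψ zero) (i ≟F f) (Finₚ.any? λ x → φ x ≟F i)

  φ≢ψ0 : ∀ x → φ x ≢ ψ zero
  φ≢ψ0 x e = Finₚ.0≢1+n (sym (inj M e))

  source-first : ∀ {i} → source i ≡ first → i ≡ ψ zero
  source-first {i} e with i ≟F ψ zero | i ≟F f | Finₚ.any? (λ x → φ x ≟F i)
  source-first e | yes p | _ | _ = p
  source-first () | no _ | yes _ | _
  source-first () | no _ | no _ | yes _
  source-first () | no _ | no _ | no _

  source-second : ∀ {i} → source i ≡ second → i ≡ f
  source-second {i} e with i ≟F ψ zero | i ≟F f | Finₚ.any? (λ x → φ x ≟F i)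
  source-second () | yes p | _ | _
  source-second e | no _ | yes p | _ = p
  source-second () | no _ | no _ | yes _
  source-second () | no _ | no _ | no _

  source-inside : ∀ {i} → source i ≡ inside → ∃[ x ] (φ x ≡ i)
  source-inside {i} e with i ≟F ψ zero | i ≟F f | Finₚ.any? (λ x → φ x ≟F i)
  source-inside () | yes p | _ | _
  source-inside () | no _ | yes p | _
  source-inside e | no _ | no _ | yes q = q
  source-inside () | no _ | no _ | no _

  source-ψ0 : source (ψ zero) ≡ first
  source-ψ0 with ψ zero ≟F ψ zero
  ... | yes _ = refl
  ... | no ne = absurd (ne refl)

  source-f : source f ≡ second
  source-f with f ≟F ψ zero | f ≟F f
  ... | yes p | _ = absurd (f∉ψ zero (sym p))
  ... | no _ | yes _ = refl
  ... | no _ | no ne = absurd (ne refl)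

  source-φ : ∀ x → source (φ x) ≡ inside
  source-φ x with φ x ≟F ψ zero | φ x ≟F f | Finₚ.any? (λ x′ → φ x′ ≟F φ x)
  ... | yes p | _ | _ = absurd (φ≢ψ0 x p)
  ... | no _ | yes p | _ = absurd (f∉ψ (suc x) p)
  ... | no _ | no _ | yes _ = refl
  ... | no _ | no _ | no ne = absurd (ne (x , refl))

  entryOf spareOf : Bool → Fin n
  entryOf true  = f
  entryOf false = ψ zero
  spareOf true  = ψ zero
  spareOf false = f

  entry≢spare : ∀ b → entryOf b ≢ spareOf b
  entry≢spare true  e = f∉ψ zero (sym e)
  entry≢spare false e = f∉ψ zero e

  φ≢entry : ∀ b x → φ x ≢ entryOf b
  φ≢entry true  x e = f∉ψ (suc x) e
  φ≢entry false x e = φ≢ψ0 x e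

  φ≢spare : ∀ b x → φ x ≢ spareOf b
  φ≢spare true  x e = φ≢ψ0 x e
  φ≢spare false x e = f∉ψ (suc x) e

  module Coloured (κ : Fin n → Colour) (b : Bool) (keeps′ : ∀ i → origin b (κ i) ≡ source i) where
    core⇒ : ∀ {i} → isCore (κ i) ≡ true → ∃[ x ] (φ x ≡ i)
    core⇒ {i} e = source-inside (trans (sym (keeps′ i)) (at (κ i) e))
      where
      at : ∀ k → isCore k ≡ true → origin b k ≡ inside
      at core _ = refl

    entry⇒ : ∀ {i} → isEntry (κ i) ≡ true → i ≡ entryOf b
    entry⇒ {i} e = go b (κ i) e (keeps′ i)
      where
      go : ∀ b k → isEntry k ≡ true → origin b k ≡ source i → i ≡ entryOf b
      go true  entry _ q = source-second (sym q)
      go false entry _ q = source-first (sym q)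

    spare⇒ : ∀ {i} → isSpare (κ i) ≡ true → i ≡ spareOf b
    spare⇒ {i} e = go b (κ i) e (keeps′ i)
      where
      go : ∀ b k → isSpare k ≡ true → origin b k ≡ source i → i ≡ spareOf b
      go true  spare _ q = source-first (sym q)
      go false spare _ q = source-second (sym q)

    κ-core : ∀ x → κ (φ x) ≡ core
    κ-core x = everywhere (λ (b , k) → (origin b k ≟F inside) →-dec (k ≟F core)) (b , κ (φ x)) (trans (keeps′ (φ x)) (source-φ x))

    κ-entry : κ (entryOf b) ≡ entry
    κ-entry = go b (κ (entryOf b)) (keeps′ (entryOf b))
      where
      go : ∀ b k → origin b k ≡ source (entryOf b) → k ≡ entry
      go true  k e = everywhere (λ k → (origin true k ≟F second) →-dec (k ≟F entry)) k (trans e source-f)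
      go false k e = everywhere (λ k → (origin false k ≟F first) →-dec (k ≟F entry)) k (trans e source-ψ0)

    κ-spare : κ (spareOf b) ≡ spare
    κ-spare = go b (κ (spareOf b)) (keeps′ (spareOf b))
      where
      go : ∀ b k → origin b k ≡ source (spareOf b) → k ≡ spare
      go true  k e = everywhere (λ k → (origin true k ≟F first) →-dec (k ≟F spare)) k (trans e source-ψ0)
      go false k e = everywhere (λ k → (origin false k ≟F second) →-dec (k ≟F spare)) k (trans e source-f)

    ψ′ : Fin (3 + m) → Fin n
    ψ′ = entryOf b ∷ᶠ φ

    ψ′-inj : Injective _≡_ _≡_ ψ′
    ψ′-inj = cons-inj (entryOf b) φ (λ e → Finₚ.suc-injective (inj M e)) (φ≢entry b)

    pivot-off : ∀ z x → pivot (κ (ψ′ x)) z ≡ false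
    pivot-off z zero    = trans (cong (λ k → pivot k z) κ-entry) (Boolₚ.∧-zeroʳ z)
    pivot-off z (suc x) = trans (cong (λ k → pivot k z) (κ-core x)) (Boolₚ.∧-zeroʳ z)

    isEntry≡ : ∀ i → isEntry (κ i) ≡ does (entryOf b ≟F i)
    isEntry≡ i = bool-≡ (λ e → subst (λ j → does (entryOf b ≟F j) ≡ true) (sym (entry⇒ {i} e)) (point-refl (entryOf b)))
                        (λ e → cong isEntry (trans (cong κ (sym (point⇒≡ {g = i} {entryOf b} e))) κ-entry))

    set₀ : ∀ (Y : Subset (2 + m)) z i → minor₀ (κ i) (img φ (lookup Y) i) z ≡ img ψ′ (lookup (false ∷ Y)) i ∨ pivot (κ i) z
    set₀ Y z i = cong (_∨ pivot (κ i) z) (bool-≡ (λ e → proj₂ (∧-true {isCore (κ i)} e))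
      (λ e → ∧-both (let (x , _ , p) = img⁻ φ (lookup Y) i e in trans (cong (isCore ∘ κ) (sym p)) (cong isCore (κ-core x))) e))

    set₁ : ∀ (Y : Subset (2 + m)) z i → minor₁ (κ i) (img φ (lookup Y) i) z ≡ img ψ′ (lookup (true ∷ Y)) i ∨ pivot (κ i) z
    set₁ Y z i = trans (cong₂ _∨_ (isEntry≡ i) (set₀ Y z i)) (sym (Boolₚ.∨-assoc (does (entryOf b ≟F i)) _ _))

  κ₀ : Fin n → Colour
  κ₀ i = startColour (source i) (C i)

  keeps₀ : ∀ i → origin false (κ₀ i) ≡ source i
  keeps₀ i = everywhere (λ (o , c) → origin false (startColour o c) ≟F o) (source i , C i)

  module C₀ = Coloured κ₀ false keeps₀

  con₀ : Fin n → Bool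
  con₀ i = pivot (κ₀ i) (C f)

  pivot₀ : ∀ i → C i ≡ con₀ i
  pivot₀ i = go (source i) refl
    where
    go : ∀ o → source i ≡ o → C i ≡ pivot (startColour o (C i)) (C f)
    go inside e = trans (let (x , p) = source-inside e in trans (cong C (sym p)) (off M (suc x))) (sym (Boolₚ.∧-zeroʳ (C f)))
    go first  e = trans (trans (cong C (source-first e)) (off M zero)) (sym (Boolₚ.∧-zeroʳ (C f)))
    go second e = trans (cong C (source-second e)) (sym (Boolₚ.∧-identityʳ (C f)))
    go other  e = bit (C i) (C f)
      where
      bit : ∀ c d → c ≡ pivot (if c then toCon else toDel) d
      bit true  d = refl
      bit false d = sym (Boolₚ.∧-zeroʳ d)

  M₀ : Minor K con₀ C₀.ψ′ N
  M₀ = Minor-cong pivot₀ (λ { zero → refl ; (suc x) → refl }) M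

  -- The truncated subtraction is exact, since the set in the first term contains `con₀`; this is
  -- the content of `rel-ρ₀` and `rel-ρ₁`.
  ρ₀ ρ₁ : (Fin n → Bool) → ℕ
  ρ₀ y = R (λ i → minor₀ (κ₀ i) (y i) (C f)) ∸ R con₀
  ρ₁ y = R (λ i → minor₁ (κ₀ i) (y i) (C f)) ∸ R con₀

  rel-ρ₀ : ∀ y → R (λ i → minor₀ (κ₀ i) (y i) (C f)) ≡ R con₀ + ρ₀ y
  rel-ρ₀ y = sym (m+[n∸m]≡n (R-mono λ i e → ∨-right {isCore (κ₀ i) ∧ y i} e))

  rel-ρ₁ : ∀ y → R (λ i → minor₁ (κ₀ i) (y i) (C f)) ≡ R con₀ + ρ₁ y
  rel-ρ₁ y = sym (m+[n∸m]≡n (R-mono λ i e → ∨-right {isEntry (κ₀ i)} (∨-right {isCore (κ₀ i) ∧ y i} e)))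

  ρ-entry : ρ₁ (λ _ → false) ≡ 1
  ρ-entry = trans (cong (_∸ R con₀) (trans (R-cong λ i → trans (cong (λ b → minor₁ (κ₀ i) b (C f)) (sym (img-∅ i))) (C₀.set₁ ⊥ (C f) i))
    (trans (sym (independent⇒rank M₀ e₀ no-loop)) (cong (λ k → suc k + R con₀) (Subₚ.∣⊥∣≡0 (2 + m)))))) (m+n∸n≡m 1 (R con₀))
    where
    img-∅ : ∀ i → img φ (lookup ⊥) i ≡ false
    img-∅ i = not-true λ e → let (x , y , _) = img⁻ φ (lookup ⊥) i e in false≢true y (lookup-⊥ x)

  ρ-core : ρ₁ (λ _ → true) ≡ ρ₀ (λ _ → true)
  ρ-core = cong (_∸ R con₀) (≤-antisym
    (cycle-rank K (λ i → minor₀ (κ₀ i) true (C f)) (lift l) (ψ zero) (cyc l) (trans (extends l zero) (proj₂ (proj₂ no-coloop)))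
      (λ j e → place j (within l j e)) (λ i → minor₁ (κ₀ i) true (C f)) (λ j e → split j (∨-true {isEntry (κ₀ j)} e)))
    (R-mono λ i e → ∨-right {isEntry (κ₀ i)} e))
    where
    l : Lift K con₀ C₀.ψ′ (proj₁ no-coloop)
    l = proj₂ (same M₀ _) (proj₁ (proj₂ no-coloop))
    place : ∀ j → pivot (κ₀ j) (C f) ≡ true ⊎ (∃[ x ] (C₀.ψ′ x ≡ j)) → j ≡ ψ zero ⊎ minor₀ (κ₀ j) true (C f) ≡ true
    place j (inj₁ e) = inj₂ (∨-right {isCore (κ₀ j) ∧ true} e)
    place j (inj₂ (zero , p)) = inj₁ (sym p)
    place j (inj₂ (suc x , refl)) = inj₂ (cong (λ k → minor₀ k true (C f)) (C₀.κ-core x))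
    split : ∀ j → isEntry (κ₀ j) ≡ true ⊎ minor₀ (κ₀ j) true (C f) ≡ true → j ≡ ψ zero ⊎ minor₀ (κ₀ j) true (C f) ≡ true
    split j (inj₁ e) = inj₁ (C₀.entry⇒ e)
    split j (inj₂ e) = inj₂ e

  open Reduce P source ρ₀ ρ₁ ρ-entry ρ-core

  start : State
  start = record
    { colour  = κ₀
    ; z       = C f
    ; swapped = false
    ; keeps   = keeps₀
    ; linked  = linked₀
    ; entry≤1 = ≤-trans (R-mono λ i e → trans (cong (point (ψ zero)) (C₀.entry⇒ {i} e)) (point-refl (ψ zero))) (R-unit (ψ zero))
    ; spare≤1 = ≤-trans (R-mono λ i e → trans (cong (point f) (C₀.spare⇒ {i} e)) (point-refl f)) (R-unit f)
    ; rel₀    = rel-ρ₀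
    ; rel₁    = rel-ρ₁
    }
    where
    -- Nothing has been contracted or deleted yet, so linkedness is the connectivity of `K`: the
    -- near side contains `ψ zero` and `f`, and the far side contains `φ zero` and `φ (suc zero)`.
    linked₀ : Linked (zone ∘ κ₀)
    linked₀ u = ≤-trans (≤-reflexive (cong₂ (λ a b → 2 + a + b) (R-cong λ i → present₀ (source i) (C i)) (R-∅ λ i → contracted₀ (source i) (C i))))
      (≤-trans (≤-reflexive (+-identityʳ _)) (≤-trans (conn p (λ e → f∉ψ zero e) (cong (λ k → near (zone k , u (ψ zero))) C₀.κ-entry) (cong (λ k → near (zone k , u f)) C₀.κ-spare)
        (λ e → Finₚ.0≢1+n (Finₚ.suc-injective (inj M e)))
        (cong (λ k → near (zone k , u (φ zero))) (C₀.κ-core zero)) (cong (λ k → near (zone k , u (φ (suc zero)))) (C₀.κ-core (suc zero))))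
        (≤-reflexive (cong (R p +_) (R-cong λ i → far₀ (source i) (C i) (u i))))))
      where
      p : Fin n → Bool
      p i = near (zone (κ₀ i) , u i)
      present₀ : ∀ o c → present (zone (startColour o c)) ≡ true
      present₀ o c = everywhere (λ (o , c) → present (zone (startColour o c)) Boolₚ.≟ true) (o , c)
      contracted₀ : ∀ o c → contracted (zone (startColour o c)) ≡ false
      contracted₀ o c = everywhere (λ (o , c) → contracted (zone (startColour o c)) Boolₚ.≟ false) (o , c)
      far₀ : ∀ o c v → not (near (zone (startColour o c) , v)) ≡ far (zone (startColour o c) , v)
      far₀ o c v = everywhere (λ (o , c , v) → not (near (zone (startColour o c) , v)) Boolₚ.≟ far (zone (startColour o c) , v)) (o , c , v)

  module At (st : State) where
    module Col = Coloured (colour st) (swapped st) (keeps st)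
    open Col public

    κ = colour st
    e* = entryOf (swapped st)
    z* = spareOf (swapped st)

    con′ : Fin n → Bool
    con′ i = pivot (κ i) (z st)

    transport : ∀ k {a b ρ c d} → c ≡ a + ρ → d ≡ b + ρ → k + a ≡ c → k + b ≡ d
    transport k {a} {b} refl refl e = trans (+-comm k b) (cong (b +_) (+-cancelˡ-≡ a k _ (trans (+-comm a k) e)))

    Full₀ Full : Subset (3 + m) → Set
    Full₀ Y = ∣ Y ∣ + R con₀ ≡ R (λ i → img C₀.ψ′ (lookup Y) i ∨ con₀ i)
    Full Y  = ∣ Y ∣ + R con′ ≡ R (λ i → img ψ′ (lookup Y) i ∨ con′ i)

    value₀ : ∀ Y → R (λ i → img C₀.ψ′ (lookup (false ∷ Y)) i ∨ con₀ i) ≡ R con₀ + ρ₀ (img φ (lookup Y))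
    value₀ Y = trans (sym (R-cong (C₀.set₀ Y (C f)))) (rel-ρ₀ _)

    value₁ : ∀ Y → R (λ i → img C₀.ψ′ (lookup (true ∷ Y)) i ∨ con₀ i) ≡ R con₀ + ρ₁ (img φ (lookup Y))
    value₁ Y = trans (sym (R-cong (C₀.set₁ Y (C f)))) (rel-ρ₁ _)

    value₀′ : ∀ Y → R (λ i → img ψ′ (lookup (false ∷ Y)) i ∨ con′ i) ≡ R con′ + ρ₀ (img φ (lookup Y))
    value₀′ Y = trans (sym (R-cong (set₀ Y (z st)))) (rel₀ st _)

    value₁′ : ∀ Y → R (λ i → img ψ′ (lookup (true ∷ Y)) i ∨ con′ i) ≡ R con′ + ρ₁ (img φ (lookup Y))
    value₁′ Y = trans (sym (R-cong (set₁ Y (z st)))) (rel₁ st _)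

    full⇒ : ∀ Y → Full₀ Y → Full Y
    full⇒ (false ∷ Y) e = transport ∣ false ∷ Y ∣ (value₀ Y) (value₀′ Y) e
    full⇒ (true ∷ Y)  e = transport ∣ true ∷ Y ∣ (value₁ Y) (value₁′ Y) e

    full⇐ : ∀ Y → Full Y → Full₀ Y
    full⇐ (false ∷ Y) e = transport ∣ false ∷ Y ∣ (value₀′ Y) (value₀ Y) e
    full⇐ (true ∷ Y)  e = transport ∣ true ∷ Y ∣ (value₁′ Y) (value₁ Y) e

    own : Minor K con′ ψ′ (minor K con′ ψ′)
    own = minor-refl ψ′-inj (pivot-off (z st))

    -- The reduction has preserved ranks only. These determine the independent sets of the minor,
    -- and a binary matroid is determined by its independent sets. The map `ψ′` may have `f` in the
    -- place of `ψ zero`.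
    kept-minor : Minor K con′ ψ′ N
    kept-minor = record { inj = ψ′-inj ; off = pivot-off (z st) ; same = same-cycles (minor K con′ ψ′) N λ Y →
        (λ i → rank⇒independent M₀ Y (≤-reflexive (full⇐ Y (independent⇒rank own Y i))))
      , (λ i → rank⇒independent own Y (≤-reflexive (full⇒ Y (independent⇒rank M₀ Y i)))) }

    conSet : Fin n → Bool
    conSet i = isConC (κ i)

    ψ′≢z* : ∀ x → ψ′ x ≢ z*
    ψ′≢z* zero    = entry≢spare (swapped st)
    ψ′≢z* (suc x) = φ≢spare (swapped st) x

    conSet-off : ∀ x → conSet (ψ′ x) ≡ false
    conSet-off zero    = cong isConC κ-entry
    conSet-off (suc x) = cong isConC (κ-core x)

    conSet-z* : conSet z* ≡ false
    conSet-z* = cong isConC κ-spare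

    sameEnds : ∀ i → i ∈ₗ (ψ zero ∷ f ∷ []) → i ∈ₗ (z* ∷ e* ∷ [])
    sameEnds i = go (swapped st)
      where
      go : ∀ b → i ∈ₗ (ψ zero ∷ f ∷ []) → i ∈ₗ (spareOf b ∷ entryOf b ∷ [])
      go true  m = m
      go false (here e) = there (here e)
      go false (there (here e)) = here e

  Goal : Set
  Goal = Result K (ψ zero ∷ f ∷ []) five

  reorder : ∀ {l} → (∀ i → i ∈ₗ (ψ zero ∷ f ∷ []) → i ∈ₗ l) → Result K l five → Goal
  reorder sub′ (result t C′ ψ″ M′ (inj₁ e) fv) = result t C′ ψ″ M′ (inj₁ e) fv
  reorder sub′ (result t C′ ψ″ M′ (inj₂ g) fv) = result t C′ ψ″ M′ (inj₂ λ i i∈ → g i (sub′ i i∈)) fv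

  project : ∀ {k} (D : Fin n → Bool) (χ : Fin k → Fin n) c → Cycle K c → (∀ i → lookup c i ≡ true → D i ≡ true ⊎ (∃[ x ] (χ x ≡ i))) → Lift K D χ (restrict c χ)
  project D χ c cc w = mkLift c cc (λ x → sym (lookup-restrict c χ x)) w

  module None (st : State) (no-rest : ∀ i → isRest (colour st i) ≡ true → Empty) where
    open At st
    open Facts st (spareOf (swapped st)) using (s; endsFree; endsCofree)

    ψ⁺ : Fin (4 + m) → Fin n
    ψ⁺ = z* ∷ᶠ ψ′

    L : Binary (4 + m)
    L = minor K conSet ψ⁺

    M⁺ : Minor K conSet ψ⁺ L
    M⁺ = minor-refl (cons-inj z* ψ′ ψ′-inj ψ′≢z*) λ { zero → conSet-z* ; (suc x) → conSet-off x }

    T⁺ : Fin (4 + m) → Bool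
    T⁺ = z st ∷ᶠ λ _ → false

    pivot≡ : ∀ i → conSet i ∨ img ψ⁺ T⁺ i ≡ con′ i
    pivot≡ i = bool-≡ (λ e → from (∨-true {conSet i} e)) (λ e → to (∨-true {conSet i} e))
      where
      from : conSet i ≡ true ⊎ img ψ⁺ T⁺ i ≡ true → con′ i ≡ true
      from (inj₁ e) = ∨-left e
      from (inj₂ e) = at (img⁻ ψ⁺ T⁺ i e)
        where
        at : ∃[ x ] (T⁺ x ≡ true × ψ⁺ x ≡ i) → con′ i ≡ true
        at (zero , zt , refl) = ∨-right {conSet z*} (∨-right {isToCon (κ z*)} (∧-both zt (cong isSpare κ-spare)))
      to : conSet i ≡ true ⊎ (isToCon (κ i) ∨ (z st ∧ isSpare (κ i))) ≡ true → conSet i ∨ img ψ⁺ T⁺ i ≡ true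
      to (inj₁ e) = ∨-left e
      to (inj₂ e) = ∨-elim (isToCon (κ i)) e (λ r → absurd (no-rest i (∨-left r))) λ r → ∨-right {conSet i} (img-at ψ⁺ T⁺ zero (spare⇒ (proj₂ (∧-true {z st} r))) (proj₁ (∧-true r)))

    lifts : minor L T⁺ suc ≅ N
    lifts = Minor-unique (Minor-cong pivot≡ (λ x → refl) (compose M⁺ (minor-refl Finₚ.suc-injective (λ x → refl)))) kept-minor

    independent : Independent L low₂
    independent = rank⇒independent M⁺ low₂ (≤-trans (≤-reflexive (cong (λ k → 2 + k + R conSet) (Subₚ.∣⊥∣≡0 (2 + m)))) (≤-trans endsFree
      (R-mono λ i e → go i (∨-true {conSet i} e))))
      where
      go : ∀ i → conSet i ≡ true ⊎ (isEntry (κ i) ∨ isSpare (κ i)) ≡ true → img ψ⁺ (lookup low₂) i ∨ conSet i ≡ true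
      go i (inj₁ e) = ∨-right {img ψ⁺ (lookup low₂) i} e
      go i (inj₂ e) = ∨-elim (isEntry (κ i)) e (λ r → ∨-left (img-at ψ⁺ (lookup low₂) (suc zero) (entry⇒ r) refl)) λ r → ∨-left (img-at ψ⁺ (lookup low₂) zero (spare⇒ r) refl)

    -- Coindependence of the ends puts the spare element in the closure of the elements other than
    -- the ends. The resulting cycle avoids the entry, which rules out the excluded rows of the
    -- table.
    through : ∃[ x ] (Cycle L (true ∷ x) × lookup x zero ≡ false)
    through = tail , subst (λ b → Cycle L (b ∷ tail)) cz (project conSet ψ⁺ c cc (λ i e → place i (sup i e))) , trans (lookup-restrict c ψ′ zero) entry-off
      where
      p : Fin n → Bool
      p i = (cAll ∖ cX) (s i)
      found = closure-cycle K p (λ i → cAll (s i)) (λ i e → proj₁ (∧-true e)) endsCofree z* (cong (not ∘ isDelC) κ-spare) (cong (λ k → not (isDelC k) ∧ not (isEntry k ∨ isSpare k)) κ-spare)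
      c = proj₁ found
      cc = proj₁ (proj₂ found)
      cz = proj₁ (proj₂ (proj₂ found))
      sup = proj₂ (proj₂ (proj₂ found))
      tail : Subset (3 + m)
      tail = restrict c ψ′
      entry-off : lookup c e* ≡ false
      entry-off = not-true λ e → impossible (sup e* e)
        where
        impossible : e* ≡ z* ⊎ p e* ≡ true → Empty
        impossible (inj₁ q) = entry≢spare (swapped st) q
        impossible (inj₂ q) = false≢true q (cong (λ k → not (isDelC k) ∧ not (isEntry k ∨ isSpare k)) κ-entry)
      place : ∀ i → i ≡ z* ⊎ p i ≡ true → conSet i ≡ true ⊎ (∃[ x ] (ψ⁺ x ≡ i))
      place i (inj₁ refl) = inj₂ (zero , refl)
      place i (inj₂ e) = go (κ i) refl e
        where
        go : ∀ k → κ i ≡ k → not (isDelC k) ∧ not (isEntry k ∨ isSpare k) ≡ true → conSet i ≡ true ⊎ (∃[ x ] (ψ⁺ x ≡ i))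
        go core q _ = let (x , r) = core⇒ {i} (cong isCore q) in inj₂ (suc (suc x) , r)
        go conC q _ = inj₁ (cong isConC q)
        go toCon q _ = absurd (no-rest i (cong isRest q))
        go toDel q _ = absurd (no-rest i (cong isRest q))

    lift-tail : ∀ {y} (l : Lift L T⁺ suc y) → ∃[ a ] (lift l ≡ a ∷ y)
    lift-tail {y} l = go (lift l) (extends l)
      where
      go : ∀ v → (∀ x → lookup v (suc x) ≡ lookup y x) → ∃[ a ] (v ≡ a ∷ y)
      go (a ∷ v) e = a , cong (a ∷_) (ext e)

    up : ∀ y → Cycle N y → ∃[ a ] (Cycle L (a ∷ y) × (z st ≡ false → a ≡ false))
    up y cy = a , subst (Cycle L) e (cyc l) , λ zf → not-true λ at → impossible zf (within l zero (trans (cong (λ v → lookup v zero) e) at))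
      where
      l : Lift L T⁺ suc y
      l = proj₂ (lifts y) cy
      a = proj₁ (lift-tail l)
      e = proj₂ (lift-tail l)
      impossible : z st ≡ false → T⁺ zero ≡ true ⊎ (∃[ x ] (suc x ≡ zero)) → Empty
      impossible zf (inj₁ t) = false≢true t zf
      impossible zf (inj₂ (x , ()))

    down : ∀ a y → Cycle L (a ∷ y) → (z st ≡ false → a ≡ false) → Cycle N y
    down a y cy za = proj₁ (lifts y) (mkLift (a ∷ y) cy (λ x → refl) λ { zero e → inj₁ (zt e) ; (suc x) e → inj₂ (x , refl) })
      where
      zt : a ≡ true → z st ≡ true
      zt e = not-false λ t → false≢true e (za t)

    conclude : Result L E.need₂ five → Goal
    conclude r = reorder sameEnds (Result-compose M⁺ r)

    done : Goal
    done = conclude (cases (bool-split (z st)))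
      where
      cases : z st ≡ true ⊎ z st ≡ false → Result L E.need₂ five
      cases (inj₂ zf) = E.colCase cols col-ok L
        (λ y cy → let (a , ca , za) = up y cy in subst (λ b → Cycle L (b ∷ y)) (za zf) ca)
        (λ y cy → down false y cy λ _ → refl) (proj₁ through) (proj₁ (proj₂ through)) independent
      cases (inj₁ zt) = E.rowCase rws row-ok L (λ y cy → let (a , ca , _) = up y cy in a , ca)
        (λ a y cy → down a y cy λ zf → absurd (false≢true zt zf)) (proj₁ through) (proj₁ (proj₂ through)) (proj₂ (proj₂ through)) independent

  module Single (st : State) (g : Fin n) (g-rest : isRest (colour st g) ≡ true) (only : ∀ i → isRest (colour st i) ≡ true → i ≡ g) where
    open At st
    open Facts st g using (s; endsFree; endsCofree)

    g≢ψ′ : ∀ x → ψ′ x ≢ g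
    g≢ψ′ zero    e = false≢true g-rest (cong isRest (trans (cong κ (sym e)) κ-entry))
    g≢ψ′ (suc x) e = false≢true g-rest (cong isRest (trans (cong κ (sym e)) (κ-core x)))

    g≢z* : z* ≢ g
    g≢z* e = false≢true g-rest (cong isRest (trans (cong κ (sym e)) κ-spare))

    conSet-g : conSet g ≡ false
    conSet-g = go (κ g) g-rest
      where
      go : ∀ k → isRest k ≡ true → isConC k ≡ false
      go toCon _ = refl
      go toDel _ = refl

    ψ⁺ : Fin (5 + m) → Fin n
    ψ⁺ = g ∷ᶠ z* ∷ᶠ ψ′

    L : Binary (5 + m)
    L = minor K conSet ψ⁺

    M⁺ : Minor K conSet ψ⁺ L
    M⁺ = minor-refl (cons-inj g (z* ∷ᶠ ψ′) (cons-inj z* ψ′ ψ′-inj ψ′≢z*) λ { zero → g≢z* ; (suc x) → g≢ψ′ x })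
      λ { zero → conSet-g ; (suc zero) → conSet-z* ; (suc (suc x)) → conSet-off x }

    shift₂ : Fin (3 + m) → Fin (5 + m)
    shift₂ x = suc (suc x)

    shift₂-inj : Injective _≡_ _≡_ shift₂
    shift₂-inj e = Finₚ.suc-injective (Finₚ.suc-injective e)

    place : ∀ i → not (isDelC (κ i)) ≡ true → conSet i ≡ true ⊎ (∃[ x ] (ψ⁺ x ≡ i))
    place i e = go (κ i) refl e
      where
      go : ∀ k → κ i ≡ k → not (isDelC k) ≡ true → conSet i ≡ true ⊎ (∃[ x ] (ψ⁺ x ≡ i))
      go core q _  = let (x , r) = core⇒ {i} (cong isCore q) in inj₂ (suc (suc (suc x)) , r)
      go entry q _ = inj₂ (suc (suc zero) , sym (entry⇒ {i} (cong isEntry q)))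
      go spare q _ = inj₂ (suc zero , sym (spare⇒ {i} (cong isSpare q)))
      go conC q _  = inj₁ (cong isConC q)
      go toCon q _ = inj₂ (zero , sym (only i (cong isRest q)))
      go toDel q _ = inj₂ (zero , sym (only i (cong isRest q)))

    toL : ∀ c → Cycle K c → (∀ i → lookup c i ≡ true → not (isDelC (κ i)) ≡ true) → Cycle L (lookup c g ∷ lookup c z* ∷ restrict c ψ′)
    toL c cc w = project conSet ψ⁺ c cc λ i e → place i (w i e)

    conclude : Result L E.need₃ five → Goal
    conclude r = reorder sameEnds (Result-compose M⁺ r)

    lift-tail : ∀ {T⁺ y} (l : Lift L T⁺ shift₂ y) → ∃[ a ] ∃[ b ] (lift l ≡ a ∷ b ∷ y)
    lift-tail {y = y} l = go (lift l) (extends l)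
      where
      go : ∀ v → (∀ x → lookup v (suc (suc x)) ≡ lookup y x) → ∃[ a ] ∃[ b ] (v ≡ a ∷ b ∷ y)
      go (a ∷ b ∷ v) e = a , b , cong (λ v → a ∷ b ∷ v) (ext e)

    within-con : ∀ (v : Subset (5 + m)) (l : Lift K conSet ψ⁺ v) i → lookup (lift l) i ≡ true → conSet i ≡ true ⊎ (∃[ x ] (ψ⁺ x ≡ i × lookup v x ≡ true))
    within-con v l i e = go (within l i e)
      where
      go : conSet i ≡ true ⊎ (∃[ x ] (ψ⁺ x ≡ i)) → conSet i ≡ true ⊎ (∃[ x ] (ψ⁺ x ≡ i × lookup v x ≡ true))
      go (inj₁ a) = inj₁ a
      go (inj₂ (x , p)) = inj₂ (x , p , trans (sym (extends l x)) (trans (cong (lookup (lift l)) p) e))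

    module ForDel (dg : colour st g ≡ toDel) (tri : Tri st g) (zt : z st ≡ true) (nc : Holds s not-coloop) where
      open Facts.Del st g dg tri

      T⁺ : Fin (5 + m) → Bool
      T⁺ = false ∷ᶠ true ∷ᶠ λ _ → false

      pivot≡ : ∀ i → conSet i ∨ img ψ⁺ T⁺ i ≡ con′ i
      pivot≡ i = bool-≡ (λ e → from (∨-true {conSet i} e)) (λ e → to (∨-true {conSet i} e))
        where
        from : conSet i ≡ true ⊎ img ψ⁺ T⁺ i ≡ true → con′ i ≡ true
        from (inj₁ e) = ∨-left e
        from (inj₂ e) = at (img⁻ ψ⁺ T⁺ i e)
          where
          at : ∃[ x ] (T⁺ x ≡ true × ψ⁺ x ≡ i) → con′ i ≡ true
          at (suc zero , _ , refl) = ∨-right {conSet z*} (∨-right {isToCon (κ z*)} (∧-both zt (cong isSpare κ-spare)))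
        to : conSet i ≡ true ⊎ (isToCon (κ i) ∨ (z st ∧ isSpare (κ i))) ≡ true → conSet i ∨ img ψ⁺ T⁺ i ≡ true
        to (inj₁ e) = ∨-left e
        to (inj₂ e) = ∨-elim (isToCon (κ i)) e (λ r → absurd (false≢true r (cong isToCon (trans (cong κ (only i (∨-left r))) dg)))) λ r → ∨-right {conSet i} (img-at ψ⁺ T⁺ (suc zero) (spare⇒ (proj₂ (∧-true {z st} r))) refl)

      lifts : minor L T⁺ shift₂ ≅ N
      lifts = Minor-unique (Minor-cong pivot≡ (λ x → refl) (compose M⁺ (minor-refl shift₂-inj (λ x → refl)))) kept-minor

      p : Fin n → Bool
      p i = (cAll ∖ cX ∖ cD) (s i)

      entry-free : Holds s (num 1 ⊞ rank (cAll ∖ cX ∖ cD) ≼ rank (cAll ∖ cD ∖ cZ))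
      entry-free = lin s (num 1 ⊞ rank (cAll ∖ cX ∖ cD) ≼ rank (cAll ∖ cD ∖ cZ)) (fact not-coloop nc ∷ fact del-keeps stays ∷ fact del-coloop coloop ∷ [])

      spare-free : Holds s (num 1 ⊞ rank (cAll ∖ cX ∖ cD) ≼ rank (cAll ∖ cD ∖ cE))
      spare-free = go (z st) zt (span st)
        where
        go : ∀ b → b ≡ true → R (λ i → minor₁ (κ i) true b) ≤ R (λ i → minor₀ (κ i) true b) → Holds s (num 1 ⊞ rank (cAll ∖ cX ∖ cD) ≼ rank (cAll ∖ cD ∖ cE))
        go true _ sp = lin s (num 1 ⊞ rank (cAll ∖ cX ∖ cD) ≼ rank (cAll ∖ cD ∖ cE))
          ( fact (rank (λ (k , _) → minor₁ k true true) ≼ rank (λ (k , _) → minor₀ k true true)) sp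
          ∷ sub s (λ (k , _) → minor₁ k true true) (cAll ∖ cD ∖ cE) ∷ fact del-keeps stays ∷ fact del-coloop coloop ∷ [] )

      p-off : ∀ i → not (isDelC (κ i)) ≡ true → isEntry (κ i) ≡ false → isSpare (κ i) ≡ false → isToDel (κ i) ∧ point g i ≡ false → p i ≡ true
      p-off i a b c d = ∧-both (∧-both a (cong₂ (λ x y → not (x ∨ y)) b c)) (cong not d)

      p-con : ∀ i → conSet i ≡ true → p i ≡ true
      p-con i e = go (κ i) e
        where
        go : ∀ k → isConC k ≡ true → ((not (isDelC k) ∧ not (isEntry k ∨ isSpare k)) ∧ not (isToDel k ∧ point g i)) ≡ true
        go conC _ = refl

      p-core : ∀ x → p (φ x) ≡ true
      p-core x = cong (λ k → (not (isDelC k) ∧ not (isEntry k ∨ isSpare k)) ∧ not (isToDel k ∧ point g (φ x))) (κ-core x)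

      no-spare : ∀ y → lookup y zero ≡ false → Cycle L (false ∷ true ∷ y) → Empty
      no-spare y y₀ l = <⇒≱ spare-free (cycle-rank K p (lift l) z* (cyc l) (extends l (suc zero)) (λ j e → where-is j (within-con _ l j e)) (λ j → (cAll ∖ cD ∖ cE) (s j)) split)
        where
        where-is : ∀ j → conSet j ≡ true ⊎ (∃[ x ] (ψ⁺ x ≡ j × lookup (false ∷ true ∷ y) x ≡ true)) → j ≡ z* ⊎ p j ≡ true
        where-is j (inj₁ e) = inj₂ (p-con j e)
        where-is j (inj₂ (suc zero , e , _)) = inj₁ (sym e)
        where-is j (inj₂ (suc (suc zero) , e , v)) = absurd (false≢true v y₀)
        where-is j (inj₂ (suc (suc (suc x)) , refl , _)) = inj₂ (p-core x)
        split : ∀ j → (cAll ∖ cD ∖ cE) (s j) ≡ true → j ≡ z* ⊎ p j ≡ true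
        split j e = go (bool-split (isSpare (κ j)))
          where
          go : isSpare (κ j) ≡ true ⊎ isSpare (κ j) ≡ false → j ≡ z* ⊎ p j ≡ true
          go (inj₁ r) = inj₁ (spare⇒ r)
          go (inj₂ r) = let (ad , ne) = ∧-true {(cAll ∖ cD) (s j)} e ; (a , d) = ∧-true {cAll (s j)} ad in
            inj₂ (p-off j a (Boolₚ.not-injective ne) r (Boolₚ.not-injective d))

      no-entry : ∀ y → lookup y zero ≡ true → Cycle L (false ∷ false ∷ y) → Empty
      no-entry y y₀ l = <⇒≱ entry-free (cycle-rank K p (lift l) e* (cyc l) (trans (extends l (suc (suc zero))) y₀) (λ j e → where-is j (within-con _ l j e)) (λ j → (cAll ∖ cD ∖ cZ) (s j)) split)
        where
        where-is : ∀ j → conSet j ≡ true ⊎ (∃[ x ] (ψ⁺ x ≡ j × lookup (false ∷ false ∷ y) x ≡ true)) → j ≡ e* ⊎ p j ≡ true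
        where-is j (inj₁ e) = inj₂ (p-con j e)
        where-is j (inj₂ (suc (suc zero) , e , v)) = inj₁ (sym e)
        where-is j (inj₂ (suc (suc (suc x)) , refl , _)) = inj₂ (p-core x)
        split : ∀ j → (cAll ∖ cD ∖ cZ) (s j) ≡ true → j ≡ e* ⊎ p j ≡ true
        split j e = go (bool-split (isEntry (κ j)))
          where
          go : isEntry (κ j) ≡ true ⊎ isEntry (κ j) ≡ false → j ≡ e* ⊎ p j ≡ true
          go (inj₁ r) = inj₁ (entry⇒ r)
          go (inj₂ r) = let (ad , ne) = ∧-true {(cAll ∖ cD) (s j)} e ; (a , d) = ∧-true {cAll (s j)} ad in
            inj₂ (p-off j a r (Boolₚ.not-injective ne) (Boolₚ.not-injective d))

      -- Once `g` is deleted, neither end is spanned without the other one, by `entry-free` and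
      -- `spare-free`. So a cycle that avoids `g` contains both ends or none.
      series : ∀ b y → Cycle L (false ∷ b ∷ y) → b ≡ lookup y zero
      series b y cy = go b (bool-split (lookup y zero)) cy
        where
        go : ∀ b → lookup y zero ≡ true ⊎ lookup y zero ≡ false → Cycle L (false ∷ b ∷ y) → b ≡ lookup y zero
        go true  (inj₁ e) _ = sym e
        go true  (inj₂ e) c = absurd (no-spare y e c)
        go false (inj₁ e) c = absurd (no-entry y e c)
        go false (inj₂ e) _ = sym e

      up : ∀ y → Cycle N y → Cycle L (false ∷ lookup y zero ∷ y)
      up y cy = subst₂ (λ a b → Cycle L (a ∷ b ∷ y)) a≡ (series b y (subst (λ a → Cycle L (a ∷ b ∷ y)) a≡ cl)) cl
        where
        l : Lift L T⁺ shift₂ y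
        l = proj₂ (lifts y) cy
        a = proj₁ (lift-tail l)
        b = proj₁ (proj₂ (lift-tail l))
        e = proj₂ (proj₂ (lift-tail l))
        cl : Cycle L (a ∷ b ∷ y)
        cl = subst (Cycle L) e (cyc l)
        a≡ : a ≡ false
        a≡ = not-true λ at → impossible (within l zero (trans (cong (λ v → lookup v zero) e) at))
          where
          impossible : T⁺ zero ≡ true ⊎ (∃[ x ] (shift₂ x ≡ zero)) → Empty
          impossible (inj₁ ())
          impossible (inj₂ (x , ()))

      down : ∀ b y → Cycle L (false ∷ b ∷ y) → Cycle N y × b ≡ lookup y zero
      down b y cy = proj₁ (lifts y) (mkLift (false ∷ b ∷ y) cy (λ x → refl) λ { (suc zero) _ → inj₁ refl ; (suc (suc x)) _ → inj₂ (x , refl) }) , series b y cy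

      independent : Independent L low₃
      independent = rank⇒independent M⁺ low₃ (≤-trans (≤-reflexive (cong (λ k → 3 + k + R conSet) (Subₚ.∣⊥∣≡0 (2 + m)))) (≤-trans three
        (R-mono λ i e → go i (∨-true {conSet i} e))))
        where
        three : Holds s (num 3 ⊞ rank cC ≼ rank (cC ∪ᵇ cX ∪ᵇ cD))
        three = lin s (num 3 ⊞ rank cC ≼ rank (cC ∪ᵇ cX ∪ᵇ cD))
          (fact (linkable along λ a@(k , γ) → zone k , cD a) (linked st (λ i → cD (s i))) ∷ fact del-coloop coloop ∷ [])
        go : ∀ i → conSet i ≡ true ⊎ ((isEntry (κ i) ∨ isSpare (κ i)) ∨ (isToDel (κ i) ∧ point g i)) ≡ true → img ψ⁺ (lookup low₃) i ∨ conSet i ≡ true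
        go i (inj₁ e) = ∨-right {img ψ⁺ (lookup low₃) i} e
        go i (inj₂ e) = ∨-elim (isEntry (κ i) ∨ isSpare (κ i)) e (λ q → ∨-elim (isEntry (κ i)) q (λ r → ∨-left (img-at ψ⁺ (lookup low₃) (suc (suc zero)) (entry⇒ r) refl)) λ r → ∨-left (img-at ψ⁺ (lookup low₃) (suc zero) (spare⇒ r) refl)) λ r → ∨-left (subst (λ j → img ψ⁺ (lookup low₃) j ≡ true) (sym (point⇒≡ (proj₂ (∧-true {isToDel (κ i)} r)))) (img⁺ ψ⁺ (lookup low₃) zero refl))

      through : ∃[ x ] (Cycle L (true ∷ false ∷ x) × lookup x zero ≡ true)
      through = tail , subst₂ (λ a b → Cycle L (a ∷ b ∷ tail)) g-on spare-off inL , tail₀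
        where
        q : Fin n → Bool
        q i = (cAll ∖ cX) (s i)
        found = closure-cycle K q (λ i → cAll (s i)) (λ i e → proj₁ (∧-true e)) endsCofree e* (cong (not ∘ isDelC) κ-entry) (cong (λ k → not (isDelC k) ∧ not (isEntry k ∨ isSpare k)) κ-entry)
        c = proj₁ found
        sup = proj₂ (proj₂ (proj₂ found))
        tail : Subset (3 + m)
        tail = restrict c ψ′
        spare-off : lookup c z* ≡ false
        spare-off = not-true λ e → impossible (sup z* e)
          where
          impossible : z* ≡ e* ⊎ q z* ≡ true → Empty
          impossible (inj₁ r) = entry≢spare (swapped st) (sym r)
          impossible (inj₂ r) = false≢true r (cong (λ k → not (isDelC k) ∧ not (isEntry k ∨ isSpare k)) κ-spare)
        tail₀ : lookup tail zero ≡ true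
        tail₀ = trans (lookup-restrict c ψ′ zero) (proj₁ (proj₂ (proj₂ found)))
        inL : Cycle L (lookup c g ∷ lookup c z* ∷ tail)
        inL = toL c (proj₁ (proj₂ found)) λ i e → present-at i (sup i e)
          where
          present-at : ∀ i → i ≡ e* ⊎ q i ≡ true → not (isDelC (κ i)) ≡ true
          present-at i (inj₁ refl) = cong (not ∘ isDelC) κ-entry
          present-at i (inj₂ r) = proj₁ (∧-true r)
        g-on : lookup c g ≡ true
        g-on = not-false λ e → no-entry tail tail₀ (subst₂ (λ a b → Cycle L (a ∷ b ∷ tail)) e spare-off inL)

      done : Goal
      done = conclude (E.triadCase triads triad-ok L up down (proj₁ through) (proj₁ (proj₂ through)) (proj₂ (proj₂ through)) independent)

    module ForCon (dg : colour st g ≡ toCon) (tri : Tri st g) (zf : z st ≡ false) (nl : Holds s not-loop) where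
      open Facts.Con st g dg tri

      T⁺ : Fin (5 + m) → Bool
      T⁺ = true ∷ᶠ λ _ → false

      pivot≡ : ∀ i → conSet i ∨ img ψ⁺ T⁺ i ≡ con′ i
      pivot≡ i = bool-≡ (λ e → from (∨-true {conSet i} e)) (λ e → to (∨-true {conSet i} e))
        where
        from : conSet i ≡ true ⊎ img ψ⁺ T⁺ i ≡ true → con′ i ≡ true
        from (inj₁ e) = ∨-left e
        from (inj₂ e) = at (img⁻ ψ⁺ T⁺ i e)
          where
          at : ∃[ x ] (T⁺ x ≡ true × ψ⁺ x ≡ i) → con′ i ≡ true
          at (zero , _ , refl) = ∨-right {conSet g} (∨-left (cong isToCon dg))
        to : conSet i ≡ true ⊎ (isToCon (κ i) ∨ (z st ∧ isSpare (κ i))) ≡ true → conSet i ∨ img ψ⁺ T⁺ i ≡ true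
        to (inj₁ e) = ∨-left e
        to (inj₂ e) = ∨-elim (isToCon (κ i)) e (λ r → ∨-right {conSet i} (img-at ψ⁺ T⁺ zero (only i (∨-left r)) refl)) λ r → absurd (false≢true (proj₁ (∧-true r)) zf)

      lifts : minor L T⁺ shift₂ ≅ N
      lifts = Minor-unique (Minor-cong pivot≡ (λ x → refl) (compose M⁺ (minor-refl shift₂-inj (λ x → refl)))) kept-minor

      up : ∀ y → Cycle N y → ∃[ a ] Cycle L (a ∷ false ∷ y)
      up y cy = a , subst (λ b → Cycle L (a ∷ b ∷ y)) b≡ (subst (Cycle L) e (cyc l))
        where
        l : Lift L T⁺ shift₂ y
        l = proj₂ (lifts y) cy
        a = proj₁ (lift-tail l)
        b = proj₁ (proj₂ (lift-tail l))
        e = proj₂ (proj₂ (lift-tail l))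
        b≡ : b ≡ false
        b≡ = not-true λ at → impossible (within l (suc zero) (trans (cong (λ v → lookup v (suc zero)) e) at))
          where
          impossible : T⁺ (suc zero) ≡ true ⊎ (∃[ x ] (shift₂ x ≡ suc zero)) → Empty
          impossible (inj₁ ())
          impossible (inj₂ (x , ()))

      down : ∀ a y → Cycle L (a ∷ false ∷ y) → Cycle N y
      down a y cy = proj₁ (lifts y) (mkLift (a ∷ false ∷ y) cy (λ x → refl) λ { zero _ → inj₁ refl ; (suc (suc x)) _ → inj₂ (x , refl) })

      g-not-loop : ¬ Cycle L (true ∷ false ∷ ⊥)
      g-not-loop l = <⇒≱ gFree (cycle-rank K conSet (lift l) g (cyc l) (extends l zero) (λ j e → where-is j (within-con _ l j e)) (λ j → (cC ∪ᵇ cG) (s j)) split)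
        where
        where-is : ∀ j → conSet j ≡ true ⊎ (∃[ x ] (ψ⁺ x ≡ j × lookup (true ∷ false ∷ ⊥) x ≡ true)) → j ≡ g ⊎ conSet j ≡ true
        where-is j (inj₁ e) = inj₂ e
        where-is j (inj₂ (zero , e , _)) = inj₁ (sym e)
        where-is j (inj₂ (suc (suc x) , _ , v)) = absurd (false≢true v (lookup-⊥ x))
        split : ∀ j → (cC ∪ᵇ cG) (s j) ≡ true → j ≡ g ⊎ conSet j ≡ true
        split j e = ∨-elim (conSet j) e (λ r → inj₂ r) λ r → inj₁ (point⇒≡ (proj₂ (∧-true {isToCon (κ j)} r)))

      through : ∃[ x ] (Cycle L (true ∷ false ∷ x) × lookup x zero ≡ false)
      through = tail , subst₂ (λ a b → Cycle L (a ∷ b ∷ tail)) (proj₁ (proj₂ (proj₂ found))) (end-off z* g≢z* (cong (λ k → isEntry k ∨ isSpare k) κ-spare)) inL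
              , trans (lookup-restrict c ψ′ zero) (end-off e* (g≢ψ′ zero) (cong (λ k → isEntry k ∨ isSpare k) κ-entry))
        where
        q : Fin n → Bool
        q i = (cAll ∖ cX ∖ cG) (s i)
        spans-all : Holds s (rank cAll ≼ rank (cAll ∖ cX ∖ cG))
        spans-all = lin s (rank cAll ≼ rank (cAll ∖ cX ∖ cG))
          (fact (linkable along λ a@(k , γ) → zone k , cG a) (linked st (λ i → cG (s i))) ∷ fact con-flat flat ∷ [])
        found = closure-cycle K q (λ i → cAll (s i)) (λ i e → proj₁ (∧-true (proj₁ (∧-true {(cAll ∖ cX) (s i)} e)))) spans-all g
          (cong (not ∘ isDelC) dg) (trans (cong (λ b → (cAll ∖ cX) (s g) ∧ not b) (∧-both (cong isToCon dg) (point-refl g))) (Boolₚ.∧-zeroʳ _))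
        c = proj₁ found
        sup = proj₂ (proj₂ (proj₂ found))
        tail : Subset (3 + m)
        tail = restrict c ψ′
        end-off : ∀ j → j ≢ g → isEntry (κ j) ∨ isSpare (κ j) ≡ true → lookup c j ≡ false
        end-off j ne x = not-true λ e → impossible (sup j e)
          where
          impossible : j ≡ g ⊎ q j ≡ true → Empty
          impossible (inj₁ r) = ne r
          impossible (inj₂ r) = false≢true (proj₂ (∧-true {cAll (s j)} (proj₁ (∧-true {(cAll ∖ cX) (s j)} r)))) (cong not x)
        inL : Cycle L (lookup c g ∷ lookup c z* ∷ tail)
        inL = toL c (proj₁ (proj₂ found)) λ i e → present-at i (sup i e)
          where
          present-at : ∀ i → i ≡ g ⊎ q i ≡ true → not (isDelC (κ i)) ≡ true
          present-at i (inj₁ refl) = cong (not ∘ isDelC) dg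
          present-at i (inj₂ r) = proj₁ (∧-true (proj₁ (∧-true {(cAll ∖ cX) (s i)} r)))

      -- The entry is spanned by the contracted set with `g` and the spare element. The cycle that
      -- shows this passes through `g`, because the ends are independent, and through the spare
      -- element, because by `live` the entry is not a loop after contraction of `g`.
      circuit : Cycle L (true ∷ true ∷ e₀)
      circuit = subst (Cycle L) (cong₂ (λ a v → a ∷ v) g-on (cong₂ _∷_ z-on tail≡)) inL
        where
        q : Fin n → Bool
        q i = (cC ∪ᵇ cG ∪ᵇ cZ) (s i)
        flat′ : Holds s (rank (cC ∪ᵇ cG ∪ᵇ cX) ≼ rank (cC ∪ᵇ cG ∪ᵇ cZ))
        flat′ = lin s (rank (cC ∪ᵇ cG ∪ᵇ cX) ≼ rank (cC ∪ᵇ cG ∪ᵇ cZ)) (fact con-loop loop ∷ fact not-loop nl ∷ [])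
        grow : ∀ a b e z → a ∨ b ∨ z ≡ true → a ∨ b ∨ (e ∨ z) ≡ true
        grow a b e z = everywhere (λ (a , b , e , z) → ((a ∨ b ∨ z) Boolₚ.≟ true) →-dec ((a ∨ b ∨ (e ∨ z)) Boolₚ.≟ true)) (a , b , e , z)
        found = closure-cycle K q (λ i → (cC ∪ᵇ cG ∪ᵇ cX) (s i)) (λ i → grow (cC (s i)) (cG (s i)) (isEntry (κ i)) (isSpare (κ i))) flat′ e*
          (∨-right {cC (s e*)} (∨-right {cG (s e*)} (∨-left (cong isEntry κ-entry))))
          (cong (λ k → isConC k ∨ (isToCon k ∧ point g e*) ∨ isSpare k) κ-entry)
        c = proj₁ found
        ce = proj₁ (proj₂ (proj₂ found))
        sup = proj₂ (proj₂ (proj₂ found))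
        sets : ∀ i → i ≡ e* ⊎ q i ≡ true → i ≡ e* ⊎ conSet i ≡ true ⊎ i ≡ g ⊎ i ≡ z*
        sets i (inj₁ e) = inj₁ e
        sets i (inj₂ e) = ∨-elim (conSet i) e (λ r → inj₂ (inj₁ r)) λ r → ∨-elim (cG (s i)) r (λ r′ → inj₂ (inj₂ (inj₁ (point⇒≡ (proj₂ (∧-true {isToCon (κ i)} r′)))))) λ r′ → inj₂ (inj₂ (inj₂ (spare⇒ r′)))
        tail : Subset (3 + m)
        tail = restrict c ψ′
        tail≡ : tail ≡ e₀
        tail≡ = ext go
          where
          go : ∀ x → lookup tail x ≡ lookup e₀ x
          go zero = trans (lookup-restrict c ψ′ zero) ce
          go (suc x) = trans (lookup-restrict c ψ′ (suc x)) (trans (not-true λ e → impossible (sets (φ x) (sup (φ x) e))) (sym (lookup-⊥ x)))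
            where
            impossible : φ x ≡ e* ⊎ conSet (φ x) ≡ true ⊎ φ x ≡ g ⊎ φ x ≡ z* → Empty
            impossible (inj₁ r) = φ≢entry (swapped st) x r
            impossible (inj₂ (inj₁ r)) = false≢true r (conSet-off (suc x))
            impossible (inj₂ (inj₂ (inj₁ r))) = g≢ψ′ (suc x) r
            impossible (inj₂ (inj₂ (inj₂ r))) = φ≢spare (swapped st) x r
        inL : Cycle L (lookup c g ∷ lookup c z* ∷ tail)
        inL = toL c (proj₁ (proj₂ found)) λ i e → present-at i (sets i (sup i e))
          where
          present-at : ∀ i → i ≡ e* ⊎ conSet i ≡ true ⊎ i ≡ g ⊎ i ≡ z* → not (isDelC (κ i)) ≡ true
          present-at i (inj₁ refl) = cong (not ∘ isDelC) κ-entry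
          present-at i (inj₂ (inj₁ r)) = at (κ i) r
            where
            at : ∀ k → isConC k ≡ true → not (isDelC k) ≡ true
            at conC _ = refl
          present-at i (inj₂ (inj₂ (inj₁ refl))) = cong (not ∘ isDelC) dg
          present-at i (inj₂ (inj₂ (inj₂ refl))) = cong (not ∘ isDelC) κ-spare
        z-on : lookup c z* ≡ true
        z-on = not-false λ e → <⇒≱ grows (cycle-rank K (λ i → (cC ∪ᵇ cG) (s i)) c e* (proj₁ (proj₂ found)) ce (λ j h → where-is e j (sets j (sup j h)) h)
            (λ i → (cC ∪ᵇ cG ∪ᵇ cE) (s i)) λ j h → split j h)
          where
          grows : Holds s (num 1 ⊞ rank (cC ∪ᵇ cG) ≼ rank (cC ∪ᵇ cG ∪ᵇ cE))
          grows = go (z st) zf (live st)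
            where
            go : ∀ b → b ≡ false → 1 + R (λ i → pivot (κ i) b) ≤ R (λ i → minor₁ (κ i) false b) → Holds s (num 1 ⊞ rank (cC ∪ᵇ cG) ≼ rank (cC ∪ᵇ cG ∪ᵇ cE))
            go false _ lv = lin s (num 1 ⊞ rank (cC ∪ᵇ cG) ≼ rank (cC ∪ᵇ cG ∪ᵇ cE))
              ( fact (num 1 ⊞ rank (λ (k , _) → pivot k false) ≼ rank (λ (k , _) → minor₁ k false false)) lv
              ∷ sub s (cC ∪ᵇ cG ∪ᵇ cE) (λ (k , _) → pivot k false) ∷ [] )
          where-is : lookup c z* ≡ false → ∀ j → j ≡ e* ⊎ conSet j ≡ true ⊎ j ≡ g ⊎ j ≡ z* → lookup c j ≡ true → j ≡ e* ⊎ (cC ∪ᵇ cG) (s j) ≡ true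
          where-is e j (inj₁ r) _ = inj₁ r
          where-is e j (inj₂ (inj₁ r)) _ = inj₂ (∨-left r)
          where-is e j (inj₂ (inj₂ (inj₁ refl))) _ = inj₂ (∨-right {cC (s j)} (∧-both (cong isToCon dg) (point-refl g)))
          where-is e j (inj₂ (inj₂ (inj₂ refl))) h = absurd (false≢true h e)
          split : ∀ j → (cC ∪ᵇ cG ∪ᵇ cE) (s j) ≡ true → j ≡ e* ⊎ (cC ∪ᵇ cG) (s j) ≡ true
          split j h = ∨-elim (conSet j) h (λ r → inj₂ (∨-left r)) λ r → ∨-elim (cG (s j)) r (λ r′ → inj₂ (∨-right {conSet j} r′)) λ r′ → inj₁ (entry⇒ r′)
        g-on : lookup c g ≡ true
        g-on = not-false λ e → <⇒≱ grows (cycle-rank K (λ i → (cC ∪ᵇ cZ) (s i)) c e* (proj₁ (proj₂ found)) ce (λ j h → where-is e j (sets j (sup j h)) h)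
            (λ i → (cC ∪ᵇ cX) (s i)) λ j h → split j h)
          where
          grows : Holds s (num 1 ⊞ rank (cC ∪ᵇ cZ) ≼ rank (cC ∪ᵇ cX))
          grows = lin s (num 1 ⊞ rank (cC ∪ᵇ cZ) ≼ rank (cC ∪ᵇ cX))
            (fact ends-free endsFree ∷ sub s cC cZ ∷ fact (rank cZ ≼ num 1) (spare≤1 st) ∷ [])
          where-is : lookup c g ≡ false → ∀ j → j ≡ e* ⊎ conSet j ≡ true ⊎ j ≡ g ⊎ j ≡ z* → lookup c j ≡ true → j ≡ e* ⊎ (cC ∪ᵇ cZ) (s j) ≡ true
          where-is e j (inj₁ r) _ = inj₁ r
          where-is e j (inj₂ (inj₁ r)) _ = inj₂ (∨-left r)
          where-is e j (inj₂ (inj₂ (inj₁ refl))) h = absurd (false≢true h e)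
          where-is e j (inj₂ (inj₂ (inj₂ refl))) _ = inj₂ (∨-right {cC (s j)} (cong isSpare κ-spare))
          split : ∀ j → (cC ∪ᵇ cX) (s j) ≡ true → j ≡ e* ⊎ (cC ∪ᵇ cZ) (s j) ≡ true
          split j h = ∨-elim (conSet j) h (λ r → inj₂ (∨-left r)) λ r → ∨-elim (isEntry (κ j)) r (λ r′ → inj₁ (entry⇒ r′)) λ r′ → inj₂ (∨-right {conSet j} r′)

      done : Goal
      done = conclude (E.triCase tris tri-ok L up down circuit (proj₁ through) (proj₁ (proj₂ through)) (proj₂ (proj₂ through)) g-not-loop)

  finish : Outcome → Goal
  finish (none st no-rest) = None.done st no-rest
  finish (oneDel st g dg only tri zt nc) = Single.ForDel.done st g (rest-toDel dg) only dg tri zt nc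
  finish (oneCon st g dg only tri zf nl) = Single.ForCon.done st g (rest-toCon dg) only dg tri zf nl

  both-ends : Result K (ψ zero ∷ f ∷ []) five
  both-ends = from-start start
    where
    from-start : State → Goal
    from-start st = finish (outcome (size st) st ≤-refl)

-- Independence predicates that come from binary matroids

Represents : ∀ {n} → IndepPred n → Binary n → Set
Represents I K = ∀ X → (I X → Independent K X) × (Independent K X → I X)

∈⇒true : ∀ {n} {i : Fin n} {X} → i ∈ X → lookup X i ≡ true
∈⇒true = Vecₚ.[]=⇒lookup

true⇒∈ : ∀ {n} {i : Fin n} {X} → lookup X i ≡ true → i ∈ X
true⇒∈ {i = i} {X} e = Vecₚ.lookup⇒[]= i X e

∉⇒false : ∀ {n} {i : Fin n} {X} → i ∉ X → lookup X i ≡ false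
∉⇒false n = not-true λ e → n (true⇒∈ e)

lookup-∪ : ∀ {n} (X Y : Subset n) i → lookup (X ∪ Y) i ≡ lookup X i ∨ lookup Y i
lookup-∪ X Y i = Vecₚ.lookup-zipWith _∨_ i X Y

lookup-∁ : ∀ {n} (X : Subset n) i → lookup (∁ X) i ≡ not (lookup X i)
lookup-∁ X i = Vecₚ.lookup-map i not X

lookup-⊤ : ∀ {n} (i : Fin n) → lookup (⊤ {n}) i ≡ true
lookup-⊤ i = Vecₚ.lookup-replicate i true

lookup-image : ∀ {m n} (ψ : Fin m → Fin n) Y i → lookup (image ψ Y) i ≡ img ψ (lookup Y) i
lookup-image ψ Y i = Vecₚ.lookup∘tabulate (λ i → anyFin λ j → lookup Y j ∧ does (ψ j ≟F i)) i

identity-minor : ∀ {n} (K : Binary n) → Minor K (λ _ → false) id K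
identity-minor K = record { inj = id ; off = λ _ → refl ; same = λ y →
    (λ l → subst (Cycle K) (ext (extends l)) (cyc l)) , (λ c → mkLift y c (λ x → refl) λ i _ → inj₂ (i , refl)) }

module Ranks {n} (K : Binary n) where
  open Linear (binary⇒polymatroid K) public

  r : Subset n → ℕ
  r X = R (lookup X)

  R-never : R (λ _ → false) ≡ 0
  R-never = R-∅ λ _ → refl

  img-id : ∀ (X : Subset n) i → img id (lookup X) i ∨ false ≡ lookup X i
  img-id X i = trans (Boolₚ.∨-identityʳ _) (bool-≡ (λ e → let (x , p , q) = img⁻ id (lookup X) i e in subst (λ j → lookup X j ≡ true) q p) (img⁺ id (lookup X) i))

  independent⇒size : ∀ X → Independent K X → ∣ X ∣ ≡ r X
  independent⇒size X ind = trans (sym (trans (cong (∣ X ∣ +_) R-never) (+-identityʳ _))) (trans (independent⇒rank (identity-minor K) X ind) (R-cong (img-id X)))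

  basis-of : ∀ k X → ∣ X ∣ ≤ k → ∃[ Y ] (Y ⊆ X × Independent K Y × ∣ Y ∣ ≡ r X)
  basis-of k X le = go k le (Subₚ.anySubset? λ c → cycle? K c ×-dec Finₚ.all? (λ i → (lookup c i Boolₚ.≟ true) →-dec (lookup X i Boolₚ.≟ true)) ×-dec Finₚ.any? λ i → lookup c i Boolₚ.≟ true)
    where
    go : ∀ k → ∣ X ∣ ≤ k → Dec (∃[ c ] (Cycle K c × (∀ i → lookup c i ≡ true → lookup X i ≡ true) × (∃[ i ] (lookup c i ≡ true)))) → ∃[ Y ] (Y ⊆ X × Independent K Y × ∣ Y ∣ ≡ r X)
    go k le (no none) = X , (λ x → x) , ind , independent⇒size X ind
      where
      ind : Independent K X
      ind c cc s i = not-true λ e → none (c , cc , s , i , e)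
    go k le (yes (c , cc , s , i , e)) = recurse k le
      where
      X-i : Fin n → Bool
      X-i j = lookup X j ∧ not (point i j)
      Z : Subset n
      Z = tabulate X-i
      Z⊆X : ∀ {j} → j ∈ Z → j ∈ X
      Z⊆X {j} m = true⇒∈ (proj₁ (∧-true (trans (sym (Vecₚ.lookup∘tabulate X-i j)) (∈⇒true m))))
      smaller : ∣ Z ∣ < ∣ X ∣
      smaller = Subₚ.p⊂q⇒∣p∣<∣q∣ {p = Z} {q = X} (Z⊆X , i , true⇒∈ (s i e) , λ m →
        false≢true (proj₂ (∧-true {lookup X i} (trans (sym (Vecₚ.lookup∘tabulate X-i i)) (∈⇒true m)))) (cong not (point-refl i)))
      near-i : ∀ j → lookup X j ≡ true → j ≡ i ⊎ X-i j ≡ true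
      near-i j h = at (bool-split (point i j))
        where
        at : point i j ≡ true ⊎ point i j ≡ false → j ≡ i ⊎ X-i j ≡ true
        at (inj₁ p) = inj₁ (point⇒≡ p)
        at (inj₂ p) = inj₂ (∧-both h (cong not p))
      same-rank : r Z ≡ r X
      same-rank = trans (R-cong (Vecₚ.lookup∘tabulate X-i)) (≤-antisym (R-mono λ j h → proj₁ (∧-true h))
        (cycle-rank K X-i c i cc e (λ j h → near-i j (s j h)) (lookup X) near-i))
      recurse : ∀ k → ∣ X ∣ ≤ k → ∃[ Y ] (Y ⊆ X × Independent K Y × ∣ Y ∣ ≡ r X)
      recurse zero le = absurd (<⇒≱ (≤-trans smaller le) z≤n)
      recurse (suc k) le = let (Y , s′ , ind , q) = basis-of k Z (≤-pred (≤-trans smaller le)) in Y , (λ m → Z⊆X (s′ m)) , ind , trans q same-rank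

  module _ {I : IndepPred n} (rep : Represents I K) where

    rank-is : ∀ X → RankIs I X (r X)
    rank-is X = (let (Y , s , ind , e) = basis-of ∣ X ∣ X ≤-refl in Y , s , proj₂ (rep Y) ind , e)
              , λ Y s i → ≤-trans (≤-reflexive (independent⇒size Y (proj₁ (rep Y) i))) (R-mono λ j e → ∈⇒true (s (true⇒∈ e)))

    rank-unique : ∀ {X a} → RankIs I X a → a ≡ r X
    rank-unique {X} {a} ((Y , s , i , refl) , max) = ≤-antisym (proj₂ (rank-is X) Y s i)
      (let (Y′ , s′ , i′ , e) = proj₁ (rank-is X) in ≤-trans (≤-reflexive (sym e)) (max Y′ s′ i′))

    contract⇒ : ∀ {C Z} → IndepContract I C Z → r (Z ∪ C) ≡ ∣ Z ∣ + r C
    contract⇒ {C} {Z} h = h _ _ (rank-is (Z ∪ C)) (rank-is C)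

    contract⇐ : ∀ {C Z} → r (Z ∪ C) ≡ ∣ Z ∣ + r C → IndepContract I C Z
    contract⇐ {C} {Z} e a b ra rb = trans (rank-unique ra) (trans e (cong (∣ Z ∣ +_) (sym (rank-unique rb))))

-- Rank is cardinality here, so `∣image∣` obtains the size of an injective image from the rank
-- formula for minors.
freeMatroid : ∀ n → Binary n
freeMatroid n = record
  { Cycle   = _≡ ⊥
  ; cycle-⊥ = refl
  ; cycle-⊕ = λ { refl refl → ⊕-self ⊥ }
  ; cycle?  = λ c → Vecₚ.≡-dec Boolₚ._≟_ c ⊥
  }

∣image∣ : ∀ {m n} (ψ : Fin m → Fin n) → Injective _≡_ _≡_ ψ → ∀ Y → ∣ image ψ Y ∣ ≡ ∣ Y ∣
∣image∣ {m} {n} ψ i Y = trans (Ranks.independent⇒size (freeMatroid n) (image ψ Y) (λ c e _ j → trans (cong (λ v → lookup v j) e) (lookup-⊥ j)))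
  (trans (R-cong λ j → trans (lookup-image ψ Y j) (sym (Boolₚ.∨-identityʳ _))) (trans (sym (independent⇒rank M Y all-independent)) (trans (cong (∣ Y ∣ +_) R-never) (+-identityʳ _))))
  where
  open Ranks (freeMatroid n)
  M : Minor (freeMatroid n) (λ _ → false) ψ (minor (freeMatroid n) (λ _ → false) ψ)
  M = minor-refl i λ _ → refl
  all-independent : Independent (minor (freeMatroid n) (λ _ → false) ψ) Y
  all-independent c l _ x = trans (sym (extends l x)) (trans (cong (λ v → lookup v (ψ x)) (cyc l)) (lookup-⊥ (ψ x)))

module _ {n m} {I : IndepPred n} {J : IndepPred m} {K : Binary n} {L : Binary m} (repI : Represents I K) (repJ : Represents J L) where
  open Ranks K

  private
    sets : ∀ (ψ : Fin m → Fin n) (C : Subset n) Y → r (image ψ Y ∪ C) ≡ R (λ i → img ψ (lookup Y) i ∨ lookup C i)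
    sets ψ C Y = R-cong λ i → trans (lookup-∪ (image ψ Y) C i) (cong (_∨ lookup C i) (lookup-image ψ Y i))

  matroid-minor⇒ : ∀ {X} → HasMatroidMinorContaining I J X →
    ∃[ C ] ∃[ ψ ] (Minor K C ψ L × (∀ g → lookup X g ≡ true → ∃[ x ] (ψ x ≡ g)))
  matroid-minor⇒ {X} (C , ψ , ψ-inj , off′ , contains , iso) = lookup C , ψ , record
    { inj = ψ-inj ; off = off″ ; same = same-cycles (minor K (lookup C) ψ) L λ Y →
        (λ i → proj₁ (repJ Y) (Equivalence.from (iso Y) (contract⇐ repI (trans (sets ψ C Y) (trans (sym (independent⇒rank M Y i)) (cong (_+ r C) (sym (∣image∣ ψ ψ-inj Y))))))))
      , (λ i → rank⇒independent M Y (≤-reflexive (trans (cong (_+ r C) (sym (∣image∣ ψ ψ-inj Y))) (trans (sym (contract⇒ repI (Equivalence.to (iso Y) (proj₂ (repJ Y) i)))) (sets ψ C Y)))))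
    } , λ g e → contains g (true⇒∈ e)
    where
    off″ : ∀ x → lookup C (ψ x) ≡ false
    off″ x = ∉⇒false (off′ x)
    M : Minor K (lookup C) ψ (minor K (lookup C) ψ)
    M = minor-refl ψ-inj off″

  matroid-minor⇐ : ∀ {X C ψ} → Minor K C ψ L → (∀ g → g ∈ X → ∃[ x ] (ψ x ≡ g)) → HasMatroidMinorContaining I J X
  matroid-minor⇐ {X} {C} {ψ} M contains = tabulate C , ψ , inj M , (λ x m → false≢true (trans (sym (Vecₚ.lookup∘tabulate C (ψ x))) (∈⇒true m)) (off M x)) , contains , λ Y → mk⇔
    (λ j → contract⇐ repI (trans (value Y) (trans (sym (independent⇒rank M Y (proj₁ (repJ Y) j))) (cong₂ _+_ (sym (∣image∣ ψ (inj M) Y)) rC))))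
    (λ h → proj₂ (repJ Y) (rank⇒independent M Y (≤-reflexive (trans (cong₂ _+_ (sym (∣image∣ ψ (inj M) Y)) rC) (trans (sym (contract⇒ repI h)) (value Y))))))
    where
    rC : R C ≡ r (tabulate C)
    rC = R-cong λ i → sym (Vecₚ.lookup∘tabulate C i)
    value : ∀ Y → r (image ψ Y ∪ tabulate C) ≡ R (λ i → img ψ (lookup Y) i ∨ C i)
    value Y = trans (sets ψ (tabulate C) Y) (R-cong λ i → cong (img ψ (lookup Y) i ∨_) (Vecₚ.lookup∘tabulate C i))

two-elements : ∀ {n} {X : Subset n} {a b} → a ≢ b → lookup X a ≡ true → lookup X b ≡ true → 2 ≤ ∣ X ∣
two-elements {X = X} {a} {b} ne ea eb = ≤-trans (≤-reflexive (cong suc (sym (Subₚ.∣⁅x⁆∣≡1 a)))) (Subₚ.p⊂q⇒∣p∣<∣q∣ {p = ⁅ a ⁆} {q = X}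
  ((λ m → subst (_∈ X) (sym (Subₚ.x∈⁅y⁆⇒x≡y a m)) (true⇒∈ ea)) , b , true⇒∈ eb , λ m → ne (sym (Subₚ.x∈⁅y⁆⇒x≡y a m))))

module _ {n} {I : IndepPred n} {K : Binary n} (rep : Represents I K) where
  open Ranks K

  connected⇒ : ConnectedMatroid 3 I → Connected₃ K
  connected⇒ conn p {a} {b} {c} {d} ab pa pb cd pc pd = decide (2 + R (λ _ → true) ≤? R p + R (λ i → not (p i)))
    where
    X : Subset n
    X = tabulate p
    X≡ : ∀ i → lookup X i ≡ p i
    X≡ = Vecₚ.lookup∘tabulate p
    ∁X≡ : ∀ i → lookup (∁ X) i ≡ not (p i)
    ∁X≡ i = trans (lookup-∁ X i) (cong not (X≡ i))
    decide : Dec (2 + R (λ _ → true) ≤ R p + R (λ i → not (p i))) → 2 + R (λ _ → true) ≤ R p + R (λ i → not (p i))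
    decide (yes h) = h
    decide (no ¬h) = absurd (conn 2 (s≤s z≤n) ≤-refl X
      ( two-elements {X = X} ab (trans (X≡ a) pa) (trans (X≡ b) pb)
      , two-elements {X = ∁ X} cd (trans (∁X≡ c) (cong not pc)) (trans (∁X≡ d) (cong not pd))
      , λ x y w rx ry rw → ≤-trans (s≤s (≤-reflexive (cong₂ _+_ (trans (rank-unique rep rx) (R-cong X≡)) (trans (rank-unique rep ry) (R-cong ∁X≡)))))
          (≤-trans (≰⇒> ¬h) (≤-reflexive (trans (+-comm 2 _) (cong (_+ 2) (trans (R-cong (λ i → sym (lookup-⊤ i))) (sym (rank-unique rep rw)))))))))

  connected⇐ : (∀ (p : Fin n → Bool) → (∃[ a ] (p a ≡ true)) → (∃[ b ] (p b ≡ false)) → 1 + R (λ _ → true) ≤ R p + R (λ i → not (p i))) →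
    Connected₃ K → ConnectedMatroid 3 I
  connected⇐ one two j 1≤j j<3 X (jX , j∁X , small) = <⇒≱ (small _ _ _ (rank-is rep X) (rank-is rep (∁ X)) (rank-is rep ⊤)) (bound j 1≤j j<3 jX j∁X)
    where
    members : ∀ k (Y : Subset n) → 1 + k ≤ ∣ Y ∣ → ∃[ a ] (lookup Y a ≡ true)
    members k Y le with Finₚ.any? (λ i → lookup Y i Boolₚ.≟ true)
    ... | yes h = h
    ... | no none = absurd (<⇒≱ (≤-trans (s≤s z≤n) (≤-trans le (≤-reflexive (trans (cong ∣_∣ (ext {c = Y} {⊥} λ i → trans (not-true λ e → none (i , e)) (sym (lookup-⊥ i)))) (Subₚ.∣⊥∣≡0 n))))) z≤n)
    pairs : ∀ (Y : Subset n) → 2 ≤ ∣ Y ∣ → ∃[ a ] ∃[ b ] (a ≢ b × lookup Y a ≡ true × lookup Y b ≡ true)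
    pairs Y le with members 1 Y le
    ... | a , ea with Finₚ.any? (λ b → ¬? (a ≟F b) ×-dec (lookup Y b Boolₚ.≟ true))
    ... | yes (b , ne , eb) = a , b , ne , ea , eb
    ... | no none = absurd (<⇒≱ le (≤-trans (Subₚ.p⊆q⇒∣p∣≤∣q∣ {p = Y} {q = ⁅ a ⁆} λ {b} m → inside′ b (a ≟F b) m) (≤-reflexive (Subₚ.∣⁅x⁆∣≡1 a))))
      where
      inside′ : ∀ b → Dec (a ≡ b) → b ∈ Y → b ∈ ⁅ a ⁆
      inside′ b (yes refl) m = Subₚ.x∈⁅x⁆ b
      inside′ b (no ne) m = absurd (none (b , ne , ∈⇒true m))
    off-X : ∀ {a} → lookup (∁ X) a ≡ true → lookup X a ≡ false
    off-X {a} e = Boolₚ.not-injective (trans (sym (lookup-∁ X a)) e)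
    convert : ∀ k → k + R (λ _ → true) ≤ R (lookup X) + R (λ i → not (lookup X i)) → r ⊤ + k ≤ r X + r (∁ X)
    convert k h = ≤-trans (≤-reflexive (trans (+-comm _ k) (cong (k +_) (R-cong lookup-⊤)))) (≤-trans h (≤-reflexive (cong (r X +_) (R-cong λ i → sym (lookup-∁ X i)))))
    bound : ∀ j → 1 ≤ j → j < 3 → j ≤ ∣ X ∣ → j ≤ ∣ ∁ X ∣ → r ⊤ + j ≤ r X + r (∁ X)
    bound 1 _ _ x y = convert 1 (one (lookup X) (members 0 X x) (let (b , e) = members 0 (∁ X) y in b , off-X e))
    bound 2 _ _ x y = let (a , b , ne , ea , eb) = pairs X x ; (c , d , ne′ , ec , ed) = pairs (∁ X) y in
      convert 2 (two (lookup X) ne ea eb ne′ (off-X ec) (off-X ed))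
    bound (suc (suc (suc _))) _ (s≤s (s≤s (s≤s ()))) _ _

-- Representations over the fields with two and three elements

F₂ : Field
F₂ = record
  { commRing = Boolₚ.xor-∧-commutativeRing
  ; 1≉0      = λ ()
  ; inverse  = λ { true _ → true , refl ; false n → absurd (n refl) }
  }

module FieldSums (F : Field) where
  open Field F
  open import Algebra.Properties.Semiring.Sum semiring public

rowsOf : ∀ {r n} → (Fin r → Fin n → Bool) → List (Subset n)
rowsOf {r} A = map (λ i → tabulate (A i)) (allFin r)

parity-sum : ∀ {n} (f : Fin n → Bool) → parity f ≡ FieldSums.sum F₂ f
parity-sum {zero}  f = refl
parity-sum {suc n} f = cong (f zero xor_) (parity-sum (f ∘ suc))

dot-sum : ∀ {n} (a : Fin n → Bool) (c : Subset n) → dot (tabulate a) c ≡ FieldSums.sum F₂ (λ j → lookup c j ∧ a j)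
dot-sum a c = trans (dot-parity (tabulate a) c) (trans (parity-cong λ j → trans (cong (_∧ lookup c j) (Vecₚ.lookup∘tabulate a j)) (Boolₚ.∧-comm (a j) (lookup c j)))
  (parity-sum λ j → lookup c j ∧ a j))

represents₂ : ∀ {r n} (A : Fin r → Fin n → Bool) → Represents (LinIndep F₂ A) (kernel (rowsOf A))
represents₂ {r} {n} A X = to , from
  where
  to : LinIndep F₂ A X → Independent (kernel (rowsOf A)) X
  to li c cc s = li (lookup c) (λ j j∉ → not-true λ e → j∉ (true⇒∈ (s j e)))
    λ i → trans (sym (dot-sum (A i) c)) (All.lookup cc (Memₚ.∈-map⁺ (λ i → tabulate (A i)) (Memₚ.∈-allFin i)))
  from : Independent (kernel (rowsOf A)) X → LinIndep F₂ A X
  from ind c off′ eqs j = trans (sym (Vecₚ.lookup∘tabulate c j)) (ind (tabulate c)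
    (Allₚ.map⁺ (All.universal (λ i → trans (dot-sum (A i) (tabulate c)) (trans (FieldSums.sum-cong-≗ F₂ λ k → cong (_∧ A i k) (Vecₚ.lookup∘tabulate c k)) (eqs i))) (allFin r)))
    (λ k e → keep k (bool-split (lookup X k)) e) j)
    where
    keep : ∀ k → lookup X k ≡ true ⊎ lookup X k ≡ false → lookup (tabulate c) k ≡ true → lookup X k ≡ true
    keep k (inj₁ t) _ = t
    keep k (inj₂ f) e = absurd (false≢true (trans (sym (Vecₚ.lookup∘tabulate c k)) e) (off′ k λ m → false≢true (∈⇒true m) f))

Z₃ : Set
Z₃ = Fin 3

pattern 𝟎 = zero
pattern 𝟏 = suc zero
pattern 𝟐 = suc (suc zero)

infixl 6 _+₃_
infixl 7 _*₃_

_+₃_ _*₃_ : Z₃ → Z₃ → Z₃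
𝟎 +₃ y = y
𝟏 +₃ 𝟎 = 𝟏
𝟏 +₃ 𝟏 = 𝟐
𝟏 +₃ 𝟐 = 𝟎
𝟐 +₃ 𝟎 = 𝟐
𝟐 +₃ 𝟏 = 𝟎
𝟐 +₃ 𝟐 = 𝟏
𝟎 *₃ y = 𝟎
𝟏 *₃ y = y
𝟐 *₃ 𝟎 = 𝟎
𝟐 *₃ 𝟏 = 𝟐
𝟐 *₃ 𝟐 = 𝟏

-₃_ : Z₃ → Z₃
-₃ 𝟎 = 𝟎
-₃ 𝟏 = 𝟐
-₃ 𝟐 = 𝟏

law : ∀ {A : Set} {{_ : Finite A}} (f g : A → Z₃) {_ : T (allTrue λ a → does (f a ≟F g a))} → ∀ a → f a ≡ g a
law f g {t} = everywhere (λ a → f a ≟F g a) {t}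

F₃ : Field
F₃ = record
  { commRing = record
    { Carrier = Z₃ ; _≈_ = _≡_ ; _+_ = _+₃_ ; _*_ = _*₃_ ; -_ = -₃_ ; 0# = 𝟎 ; 1# = 𝟏
    ; isCommutativeRing = record
      { isRing = record
        { +-isAbelianGroup = record
          { isGroup = record
            { isMonoid = record
              { isSemigroup = record
                { isMagma = record { isEquivalence = isEquivalence ; ∙-cong = cong₂ _+₃_ }
                ; assoc = λ x y z → law (λ (x , y , z) → (x +₃ y) +₃ z) (λ (x , y , z) → x +₃ (y +₃ z)) (x , y , z) }
              ; identity = (λ x → refl) , law (_+₃ 𝟎) id }
            ; inverse = law (λ x → (-₃ x) +₃ x) (λ _ → 𝟎) , law (λ x → x +₃ (-₃ x)) (λ _ → 𝟎)
            ; ⁻¹-cong = cong -₃_ }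
          ; comm = λ x y → law (λ (x , y) → x +₃ y) (λ (x , y) → y +₃ x) (x , y) }
        ; *-cong = cong₂ _*₃_
        ; *-assoc = λ x y z → law (λ (x , y , z) → (x *₃ y) *₃ z) (λ (x , y , z) → x *₃ (y *₃ z)) (x , y , z)
        ; *-identity = (λ x → refl) , law (_*₃ 𝟏) id
        ; distrib = (λ x y z → law (λ (x , y , z) → x *₃ (y +₃ z)) (λ (x , y , z) → x *₃ y +₃ x *₃ z) (x , y , z))
                  , (λ x y z → law (λ (x , y , z) → (y +₃ z) *₃ x) (λ (x , y , z) → y *₃ x +₃ z *₃ x) (x , y , z)) }
      ; *-comm = λ x y → law (λ (x , y) → x *₃ y) (λ (x , y) → y *₃ x) (x , y) } }
  ; 1≉0     = λ ()
  ; inverse = λ { 𝟎 n → absurd (n refl) ; 𝟏 _ → 𝟏 , refl ; 𝟐 _ → 𝟐 , refl }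
  }

-- The Fano plane is not ternary

-- An element of a cycle inside `C` is a loop after contraction of the rest of `C`, so it may be
-- deleted instead. Adding that cycle to a lift removes the element from the lift.
independent-contraction : ∀ {n k} {K : Binary n} {ψ : Fin k → Fin n} {L : Binary k} s C → ∣ tabulate C ∣ ≤ s → Minor K C ψ L →
  ∃[ C′ ] (Minor K C′ ψ L × Independent K (tabulate C′))
independent-contraction {n} {k} {K} {ψ} {L} s C le M =
  go s le (Subₚ.anySubset? λ c → cycle? K c ×-dec Finₚ.all? (λ i → (lookup c i Boolₚ.≟ true) →-dec (C i Boolₚ.≟ true)) ×-dec Finₚ.any? λ i → lookup c i Boolₚ.≟ true)
  where
  go : ∀ s → ∣ tabulate C ∣ ≤ s → Dec (∃[ c ] (Cycle K c × (∀ i → lookup c i ≡ true → C i ≡ true) × (∃[ i ] (lookup c i ≡ true)))) →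
    ∃[ C′ ] (Minor K C′ ψ L × Independent K (tabulate C′))
  go s le (no none) = C , M , λ c cc sup i → not-true λ e → none (c , cc , (λ j h → trans (sym (Vecₚ.lookup∘tabulate C j)) (sup j h)) , i , e)
  go s le (yes (d , dc , d⊆C , i , di)) = recurse s le
    where
    C′ : Fin n → Bool
    C′ j = C j ∧ not (point i j)
    smaller : ∣ tabulate C′ ∣ < ∣ tabulate C ∣
    smaller = Subₚ.p⊂q⇒∣p∣<∣q∣ {p = tabulate C′} {q = tabulate C}
      ( (λ {j} x → true⇒∈ (trans (Vecₚ.lookup∘tabulate C j) (proj₁ (∧-true (trans (sym (Vecₚ.lookup∘tabulate C′ j)) (∈⇒true x))))))
      , i , true⇒∈ (trans (Vecₚ.lookup∘tabulate C i) (d⊆C i di))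
      , λ x → false≢true (proj₂ (∧-true {C i} (trans (sym (Vecₚ.lookup∘tabulate C′ i)) (∈⇒true x)))) (cong not (point-refl i)))
    shrink : ∀ j → C j ≡ true → j ≢ i → C′ j ≡ true
    shrink j cj ne = ∧-both cj (cong not (not-true λ e → ne (point⇒≡ e)))
    avoid : ∀ {y} (c : Subset n) → Cycle K c → lookup c i ≡ false → (∀ x → lookup c (ψ x) ≡ lookup y x) → (∀ j → lookup c j ≡ true → C j ≡ true ⊎ (∃[ x ] (ψ x ≡ j))) → Lift K C′ ψ y
    avoid c cc ci ex w = mkLift c cc ex λ j e → at j e (w j e)
      where
      at : ∀ j → lookup c j ≡ true → C j ≡ true ⊎ (∃[ x ] (ψ x ≡ j)) → C′ j ≡ true ⊎ (∃[ x ] (ψ x ≡ j))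
      at j e (inj₂ h) = inj₂ h
      at j e (inj₁ h) = inj₁ (shrink j h λ { refl → false≢true e ci })
    down : ∀ y → Lift K C ψ y → Lift K C′ ψ y
    down y l = pick (bool-split (lookup (lift l) i))
      where
      pick : lookup (lift l) i ≡ true ⊎ lookup (lift l) i ≡ false → Lift K C′ ψ y
      pick (inj₂ f) = avoid (lift l) (cyc l) f (extends l) (within l)
      pick (inj₁ t) = avoid (lift l ⊕ d) (cycle-⊕ K (cyc l) dc) (trans (lookup-⊕ (lift l) d i) (cong₂ _xor_ t di))
        (λ x → trans (lookup-⊕ (lift l) d (ψ x)) (trans (cong (lookup (lift l) (ψ x) xor_) (not-true λ e → false≢true (d⊆C (ψ x) e) (off M x))) (trans (Boolₚ.xor-identityʳ _) (extends l x))))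
        λ j e → either j (xor-true (lookup (lift l) j) (lookup d j) (trans (sym (lookup-⊕ (lift l) d j)) e))
        where
        either : ∀ j → lookup (lift l) j ≡ true ⊎ lookup d j ≡ true → C j ≡ true ⊎ (∃[ x ] (ψ x ≡ j))
        either j (inj₁ h) = within l j h
        either j (inj₂ h) = inj₁ (d⊆C j h)
    up : ∀ y → Lift K C′ ψ y → Lift K C ψ y
    up y l = mkLift (lift l) (cyc l) (extends l) λ j e → at j (within l j e)
      where
      at : ∀ j → C′ j ≡ true ⊎ (∃[ x ] (ψ x ≡ j)) → C j ≡ true ⊎ (∃[ x ] (ψ x ≡ j))
      at j (inj₁ h) = inj₁ (proj₁ (∧-true h))
      at j (inj₂ h) = inj₂ h
    M′ : Minor K C′ ψ L
    M′ = record { inj = inj M ; off = λ x → cong (_∧ not (point i (ψ x))) (off M x) ; same = λ y → (λ l → proj₁ (same M y) (up y l)) , (λ c → down y (proj₂ (same M y) c)) }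
    recurse : ∀ s → ∣ tabulate C ∣ ≤ s → ∃[ C′ ] (Minor K C′ ψ L × Independent K (tabulate C′))
    recurse zero le = absurd (<⇒≱ (≤-trans smaller le) z≤n)
    recurse (suc s) le = independent-contraction s C′ (≤-pred (≤-trans smaller le)) M′

FanoVec : Set
FanoVec = Vec Z₃ 7

-- Clears the coordinate `x` of `w` by a multiple of `v`. The product replaces a quotient because
-- the nonzero elements of `Z₃` are their own inverses.
eliminate : Fin 7 → FanoVec → FanoVec → FanoVec
eliminate x v w = zipWith (λ a b → b +₃ (-₃ (lookup w x *₃ lookup v x)) *₃ a) v w

sign : Bool → Z₃
sign true  = 𝟏
sign false = 𝟐

-- the seven lines, normalised to have 1 at their first point
l₁ l₂ l₃ l₄ l₅ l₆ l₇ : Bool → Bool → FanoVec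
l₁ s t = 𝟏 ∷ sign s ∷ 𝟎 ∷ sign t ∷ 𝟎 ∷ 𝟎 ∷ 𝟎 ∷ []
l₂ s t = 𝟏 ∷ 𝟎 ∷ sign s ∷ 𝟎 ∷ sign t ∷ 𝟎 ∷ 𝟎 ∷ []
l₃ s t = 𝟎 ∷ 𝟏 ∷ sign s ∷ 𝟎 ∷ 𝟎 ∷ sign t ∷ 𝟎 ∷ []
l₄ s t = 𝟏 ∷ 𝟎 ∷ 𝟎 ∷ 𝟎 ∷ 𝟎 ∷ sign s ∷ sign t ∷ []
l₅ s t = 𝟎 ∷ 𝟏 ∷ 𝟎 ∷ 𝟎 ∷ sign s ∷ 𝟎 ∷ sign t ∷ []
l₆ s t = 𝟎 ∷ 𝟎 ∷ 𝟏 ∷ sign s ∷ 𝟎 ∷ 𝟎 ∷ sign t ∷ []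
l₇ s t = 𝟎 ∷ 𝟎 ∷ 𝟎 ∷ 𝟏 ∷ sign s ∷ sign t ∷ 𝟎 ∷ []

zeroᵇ : ∀ {n} → Vec Z₃ n → Bool
zeroᵇ []      = true
zeroᵇ (a ∷ v) = does (a ≟F 𝟎) ∧ zeroᵇ v

zeroᵇ⇒ : ∀ {n} (v : Vec Z₃ n) → (∀ x → lookup v x ≡ 𝟎) → zeroᵇ v ≡ true
zeroᵇ⇒ []      h = refl
zeroᵇ⇒ (a ∷ v) h = ∧-both (cong (λ a → does (a ≟F 𝟎)) (h zero)) (zeroᵇ⇒ v (h ∘ suc))

offBasis : FanoVec → Bool
offBasis (_ ∷ _ ∷ _ ∷ v) = zeroᵇ v

Signs : Set
Signs = (Bool × Bool) × (Bool × Bool) × (Bool × Bool) × (Bool × Bool)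

w₁ w₂ w₃ : Signs → FanoVec
w₁ ((s₁ , t₁) , (s₂ , t₂) , (s₃ , t₃) , (s₇ , t₇)) = eliminate (# 3) (l₁ s₁ t₁) (eliminate (# 4) (l₂ s₂ t₂) (eliminate (# 5) (l₃ s₃ t₃) (l₇ s₇ t₇)))
w₂ ((s₂ , t₂) , (s₃ , t₃) , (s₄ , t₄) , (s₅ , t₅)) = eliminate (# 4) (l₂ s₂ t₂) (eliminate (# 5) (l₃ s₃ t₃) (eliminate (# 6) (l₅ s₅ t₅) (l₄ s₄ t₄)))
w₃ ((s₁ , t₁) , (s₃ , t₃) , (s₄ , t₄) , (s₆ , t₆)) = eliminate (# 3) (l₁ s₁ t₁) (eliminate (# 5) (l₃ s₃ t₃) (eliminate (# 6) (l₆ s₆ t₆) (l₄ s₄ t₄)))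

implied : ∀ {a b} → not a ∨ b ≡ true → a ≡ true → b ≡ true
implied e refl = e

-- w₁ = 0 forces s₁ s₂ s₃ = -1, while w₂ = 0 and w₃ = 0 give two expressions
-- for s₄ whose comparison is s₁ s₂ s₃ = 1.
w₁-zero : ∀ a → offBasis (w₁ a) ≡ true × (zeroᵇ (w₁ a) ≡ true → let ((s₁ , _) , (s₂ , _) , (s₃ , _) , _) = a in s₁ xor s₂ xor s₃ ≡ false)
w₁-zero a = proj₁ both , λ z → Boolₚ.not-injective (implied (proj₂ both) z)
  where
  test : Signs → Bool
  test a@((s₁ , _) , (s₂ , _) , (s₃ , _) , _) = offBasis (w₁ a) ∧ (not (zeroᵇ (w₁ a)) ∨ not (s₁ xor s₂ xor s₃))
  both = ∧-true {offBasis (w₁ a)} (allTrue⇒ test tt a)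

w₂-zero : ∀ a → offBasis (w₂ a) ≡ true × (zeroᵇ (w₂ a) ≡ true → let ((s₂ , _) , (s₃ , t₃) , (s₄ , _) , _) = a in s₂ xor s₃ xor t₃ xor s₄ ≡ true)
w₂-zero a = proj₁ both , implied (proj₂ both)
  where
  test : Signs → Bool
  test a@((s₂ , _) , (s₃ , t₃) , (s₄ , _) , _) = offBasis (w₂ a) ∧ (not (zeroᵇ (w₂ a)) ∨ (s₂ xor s₃ xor t₃ xor s₄))
  both = ∧-true {offBasis (w₂ a)} (allTrue⇒ test tt a)

w₃-zero : ∀ a → offBasis (w₃ a) ≡ true × (zeroᵇ (w₃ a) ≡ true → let ((s₁ , _) , (s₃ , t₃) , (s₄ , _) , _) = a in s₁ xor t₃ xor s₄ ≡ false)
w₃-zero a = proj₁ both , λ z → Boolₚ.not-injective (implied (proj₂ both) z)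
  where
  test : Signs → Bool
  test a@((s₁ , _) , (s₃ , t₃) , (s₄ , _) , _) = offBasis (w₃ a) ∧ (not (zeroᵇ (w₃ a)) ∨ not (s₁ xor t₃ xor s₄))
  both = ∧-true {offBasis (w₃ a)} (allTrue⇒ test tt a)

indepᵇ : Subset 7 → Bool
indepᵇ Y = all (λ c → not (kernelᵇ (rows fano) c) ∨ not (subᵇ c Y) ∨ eqᵇ c ⊥) (subsets 7)

⊆⇒subᵇ : ∀ {n} (c Y : Subset n) → (∀ i → lookup c i ≡ true → lookup Y i ≡ true) → T (subᵇ c Y)
⊆⇒subᵇ [] [] h = tt
⊆⇒subᵇ (true ∷ c) (b ∷ Y) h rewrite h zero refl = ⊆⇒subᵇ c Y (h ∘ suc)
⊆⇒subᵇ (false ∷ c) (b ∷ Y) h = ⊆⇒subᵇ c Y (h ∘ suc)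

indepᵇ⇒ : ∀ Y → T (indepᵇ Y) → Independent (space fano) Y
indepᵇ⇒ Y t c cc s i = trans (cong (λ v → lookup v i) (eqᵇ⇒≡ c ⊥ (fire (T-all test (subsets 7) t (∈-subsets c)) (kernel⇒ᵇ (rows fano) c cc) (⊆⇒subᵇ c Y s)))) (lookup-⊥ i)
  where
  test : Subset 7 → Bool
  test c = not (kernelᵇ (rows fano) c) ∨ not (subᵇ c Y) ∨ eqᵇ c ⊥
  fire : ∀ {a b c} → T (not a ∨ not b ∨ c) → T a → T b → T c
  fire {true} {true} t _ _ = t

among : Fin 7 → Fin 7 → Fin 7 → Subset 7
among a b c = tabulate λ x → point a x ∨ point b x ∨ point c x

-- The three points are distinct, dependent, and pairwise independent. A pair is written as `among`
-- with a repeated point.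
lineOK : Fin 7 → Fin 7 → Fin 7 → Bool
lineOK a b c = kernelᵇ (rows fano) (among a b c) ∧ indepᵇ (among b b c) ∧ indepᵇ (among a a c) ∧ indepᵇ (among a a b) ∧ not (point a b) ∧ not (point a c) ∧ not (point b c)

lineVec : Fin 7 → Fin 7 → Fin 7 → Bool → Bool → FanoVec
lineVec a b c s t = tabulate λ x → if point a x then 𝟏 else (if point b x then sign s else (if point c x then sign t else 𝟎))

module NoFano {r n} (A : Fin r → Fin n → Z₃) {I : IndepPred n} {K : Binary n} (rep₂ : Represents I K)
  (rep₃ : ∀ X → (I X → LinIndep F₃ A X) × (LinIndep F₃ A X → I X))
  {C : Fin n → Bool} {ψ : Fin 7 → Fin n} (M : Minor K C ψ (space fano)) (C-ind : Independent K (tabulate C)) where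
  open FieldSums F₃

  -- Since the contracted set is independent, independence of `Y` in the minor is independence of
  -- `S Y` in `K`, which transfers to the columns of `A`.
  S : Subset 7 → Subset n
  S Y = tabulate λ i → img ψ (lookup Y) i ∨ C i

  S≡ : ∀ Y i → lookup (S Y) i ≡ img ψ (lookup Y) i ∨ C i
  S≡ Y = Vecₚ.lookup∘tabulate λ i → img ψ (lookup Y) i ∨ C i

  independent⇒S : ∀ Y → Independent (space fano) Y → Independent K (S Y)
  independent⇒S Y ind c cc s = C-ind c cc λ i e → ∨-elim (img ψ (lookup Y) i) (trans (sym (S≡ Y i)) (s i e))
    (λ q → let (x , _ , r) = img⁻ ψ (lookup Y) i q in absurd (false≢true (trans (cong (lookup c) r) e) (zero-ψ x)))
    (λ q → trans (Vecₚ.lookup∘tabulate C i) q)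
    where
    zero-ψ : ∀ x → lookup c (ψ x) ≡ false
    zero-ψ x = trans (sym (lookup-restrict c ψ x)) (ind (restrict c ψ) (proj₁ (same M _) (mkLift c cc (λ x → sym (lookup-restrict c ψ x)) λ i e →
      ∨-elim (img ψ (lookup Y) i) (trans (sym (S≡ Y i)) (s i e)) (λ q → let (x , _ , r) = img⁻ ψ (lookup Y) i q in inj₂ (x , r)) inj₁))
      (λ x e → inY x (trans (sym (lookup-restrict c ψ x)) e)) x)
      where
      inY : ∀ x → lookup c (ψ x) ≡ true → lookup Y x ≡ true
      inY x e = ∨-elim (img ψ (lookup Y) (ψ x)) (trans (sym (S≡ Y (ψ x))) (s (ψ x) e))
        (λ q → let (x′ , y , r) = img⁻ ψ (lookup Y) (ψ x) q in subst (λ z → lookup Y z ≡ true) (inj M r) y) (λ q → absurd (false≢true q (off M x)))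

  S⇒independent : ∀ Y → Independent K (S Y) → Independent (space fano) Y
  S⇒independent Y ind c cc s x = trans (sym (extends l x)) (ind (lift l) (cyc l) (λ i e → trans (S≡ Y i) (at i e (within l i e))) (ψ x))
    where
    l : Lift K C ψ c
    l = proj₂ (same M c) cc
    at : ∀ i → lookup (lift l) i ≡ true → C i ≡ true ⊎ (∃[ x ] (ψ x ≡ i)) → img ψ (lookup Y) i ∨ C i ≡ true
    at i e (inj₁ q) = ∨-right {img ψ (lookup Y) i} q
    at i e (inj₂ (x , refl)) = ∨-left (img⁺ ψ (lookup Y) x (s x (trans (sym (extends l x)) e)))

  Rel : (Fin n → Z₃) → Set
  Rel c = ∀ i → sum (λ j → c j *₃ A i j) ≡ 𝟎

  -- A relation between the columns that represent the seven points, taken modulo the span of the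
  -- contracted columns: its coefficients on `C` are unrestricted, and elsewhere outside the minor
  -- they vanish.
  record In (v : FanoVec) : Set where
    field
      vec  : Fin n → Z₃
      rel  : Rel vec
      onψ  : ∀ x → vec (ψ x) ≡ lookup v x
      offψ : ∀ i → C i ≡ false → (∀ x → ψ x ≢ i) → vec i ≡ 𝟎

  open In

  Rel-add : ∀ k c d → Rel c → Rel d → Rel (λ j → d j +₃ k *₃ c j)
  Rel-add k c d rc rd i = begin
    sum (λ j → (d j +₃ k *₃ c j) *₃ A i j)
      ≡⟨ sum-cong-≗ (λ j → law (λ (d , k , c , a) → (d +₃ k *₃ c) *₃ a) (λ (d , k , c , a) → d *₃ a +₃ k *₃ (c *₃ a)) (d j , k , c j , A i j)) ⟩
    sum (λ j → d j *₃ A i j +₃ k *₃ (c j *₃ A i j)) ≡⟨ ∑-distrib-+ (λ j → d j *₃ A i j) (λ j → k *₃ (c j *₃ A i j)) ⟩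
    sum (λ j → d j *₃ A i j) +₃ sum (λ j → k *₃ (c j *₃ A i j)) ≡⟨ cong₂ _+₃_ (rd i) (sym (*-distribˡ-sum k (λ j → c j *₃ A i j))) ⟩
    k *₃ sum (λ j → c j *₃ A i j) ≡⟨ cong (k *₃_) (rc i) ⟩
    k *₃ 𝟎 ≡⟨ law (_*₃ 𝟎) (λ _ → 𝟎) k ⟩
    𝟎 ∎
    where open ≡-Reasoning

  In-add : ∀ k {v w u} → (∀ x → lookup u x ≡ lookup w x +₃ k *₃ lookup v x) → In v → In w → In u
  In-add k e a b = record
    { vec  = λ j → vec b j +₃ k *₃ vec a j
    ; rel  = Rel-add k (vec a) (vec b) (rel a) (rel b)
    ; onψ  = λ x → trans (cong₂ (λ y z → z +₃ k *₃ y) (onψ a x) (onψ b x)) (sym (e x))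
    ; offψ = λ i ci ni → trans (cong₂ (λ y z → z +₃ k *₃ y) (offψ a i ci ni) (offψ b i ci ni)) (law (_*₃ 𝟎) (λ _ → 𝟎) k)
    }

  In-eliminate : ∀ x {v w} → In v → In w → In (eliminate x v w)
  In-eliminate x {v} {w} = In-add (-₃ (lookup w x *₃ lookup v x)) λ y → Vecₚ.lookup-zipWith (λ a b → b +₃ (-₃ (lookup w x *₃ lookup v x)) *₃ a) y v w

  LinIndep-S : ∀ Y → Independent (space fano) Y → LinIndep F₃ A (S Y)
  LinIndep-S Y ind = proj₁ (rep₃ (S Y)) (proj₂ (rep₂ (S Y)) (independent⇒S Y ind))

  off-S : ∀ Y {v} (a : In v) → (∀ x → lookup Y x ≡ false → lookup v x ≡ 𝟎) → ∀ j → j ∉ S Y → vec a j ≡ 𝟎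
  off-S Y {v} a h j j∉ = at (Finₚ.any? λ x → ψ x ≟F j)
    where
    j-off : img ψ (lookup Y) j ∨ C j ≡ false
    j-off = trans (sym (S≡ Y j)) (∉⇒false j∉)
    at : Dec (∃[ x ] (ψ x ≡ j)) → vec a j ≡ 𝟎
    at (yes (x , refl)) = trans (onψ a x) (h x (not-true λ e → false≢true (∨-left (img⁺ ψ (lookup Y) x e)) j-off))
    at (no none) = offψ a j (not-true λ e → false≢true (∨-right {img ψ (lookup Y) j} e) j-off) λ x e → none (x , e)

  vanish : ∀ Y → Independent (space fano) Y → ∀ {v} → In v → (∀ x → lookup Y x ≡ false → lookup v x ≡ 𝟎) → ∀ x → lookup v x ≡ 𝟎
  vanish Y ind a h x = trans (sym (onψ a x)) (LinIndep-S Y ind (vec a) (off-S Y a h) (rel a) (ψ x))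

  scale : ∀ k {v} → In v → In (Data.Vec.map (k *₃_) v)
  scale k {v} a = record
    { vec  = λ j → k *₃ vec a j
    ; rel  = λ i → trans (sum-cong-≗ λ j → law (λ (k , c , a) → (k *₃ c) *₃ a) (λ (k , c , a) → k *₃ (c *₃ a)) (k , vec a j , A i j))
               (trans (sym (*-distribˡ-sum k (λ j → vec a j *₃ A i j))) (trans (cong (k *₃_) (rel a i)) (law (_*₃ 𝟎) (λ _ → 𝟎) k)))
    ; onψ  = λ x → trans (cong (k *₃_) (onψ a x)) (sym (Vecₚ.lookup-map x (k *₃_) v))
    ; offψ = λ i ci ni → trans (cong (k *₃_) (offψ a i ci ni)) (law (_*₃ 𝟎) (λ _ → 𝟎) k)
    }

  nonzero : ∀ {k} → k ≢ 𝟎 → ∃[ s ] (k ≡ sign s)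
  nonzero {𝟎} n = absurd (n refl)
  nonzero {𝟏} n = true , refl
  nonzero {𝟐} n = false , refl

  product-nonzero : ∀ {a b} → a ≢ 𝟎 → b ≢ 𝟎 → a *₃ b ≢ 𝟎
  product-nonzero {𝟎} na nb = absurd (na refl)
  product-nonzero {𝟏} na nb = nb
  product-nonzero {𝟐} {𝟎} na nb = absurd (nb refl)
  product-nonzero {𝟐} {𝟏} na nb = λ ()
  product-nonzero {𝟐} {𝟐} na nb = λ ()

  square : ∀ {a} → a ≢ 𝟎 → a *₃ a ≡ 𝟏
  square {𝟎} n = absurd (n refl)
  square {𝟏} n = refl
  square {𝟐} n = refl

  -- Dependence only refutes linear independence and produces no relation, hence the double
  -- negation; this suffices for a goal `Empty`. A relation that vanishes at one of the points
  -- vanishes at all of them, as the other two are independent. Otherwise multiplication by its own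
  -- value at `a` makes that value one.
  line : ∀ a b c → T (lineOK a b c) → ¬ ¬ (∃[ s ] ∃[ t ] In (lineVec a b c s t))
  line a b c ok none = dependent (S⇒independent Y (proj₁ (rep₂ (S Y)) (proj₂ (rep₃ (S Y)) lin-ind)))
    where
    Y = among a b c
    Y≡ : ∀ x → lookup Y x ≡ point a x ∨ point b x ∨ point c x
    Y≡ = Vecₚ.lookup∘tabulate λ x → point a x ∨ point b x ∨ point c x
    t₁ = T-∧ {kernelᵇ (rows fano) Y} ok
    t₂ = T-∧ {indepᵇ (among b b c)} (proj₂ t₁)
    t₃ = T-∧ {indepᵇ (among a a c)} (proj₂ t₂)
    t₄ = T-∧ {indepᵇ (among a a b)} (proj₂ t₃)
    dependent : ¬ Independent (space fano) Y
    dependent ind = false≢true (trans (Y≡ a) (∨-left (point-refl a))) (ind Y (kernelᵇ⇒ (rows fano) Y (proj₁ t₁)) (λ _ e → e) a)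
    pair-off : ∀ d e f x → (∀ x → lookup Y x ≡ false → f x ≡ 𝟎) → (∀ x → lookup (among d d e) x ≡ false → lookup Y x ≡ true → f x ≡ 𝟎) →
      lookup (among d d e) x ≡ false → f x ≡ 𝟎
    pair-off d e f x h h′ q = at (bool-split (lookup Y x))
      where
      at : lookup Y x ≡ true ⊎ lookup Y x ≡ false → f x ≡ 𝟎
      at (inj₁ y) = h′ x q y
      at (inj₂ y) = h x y
    lin-ind : LinIndep F₃ A (S Y)
    lin-ind vc off′ eqs = LinIndep-S ⊥ ⊥-ind vc off-C eqs
      where
      v : FanoVec
      v = tabulate (vc ∘ ψ)
      a∈ : In v
      a∈ = record { vec = vc ; rel = eqs ; onψ = λ x → sym (Vecₚ.lookup∘tabulate (vc ∘ ψ) x) ; offψ = λ i ci ni → off′ i λ i∈ → ∨-elim (img ψ (lookup Y) i) (trans (sym (S≡ Y i)) (∈⇒true i∈))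
        (λ q → let (x , _ , r) = img⁻ ψ (lookup Y) i q in ni x r) (λ q → false≢true q ci) }
      v-off : ∀ x → lookup Y x ≡ false → lookup v x ≡ 𝟎
      v-off x y = trans (Vecₚ.lookup∘tabulate (vc ∘ ψ) x) (off′ (ψ x) λ i∈ → ∨-elim (img ψ (lookup Y) (ψ x)) (trans (sym (S≡ Y (ψ x))) (∈⇒true i∈))
        (λ q → let (x′ , y′ , r) = img⁻ ψ (lookup Y) (ψ x) q in false≢true (subst (λ z → lookup Y z ≡ true) (inj M r) y′) y) (λ q → false≢true q (off M x)))
      amongs : ∀ d e x → lookup (among d d e) x ≡ false → point d x ≡ false × point e x ≡ false
      amongs d e x q = not-true (λ r → false≢true (trans (Vecₚ.lookup∘tabulate (λ x → point d x ∨ point d x ∨ point e x) x) (∨-left r)) q)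
                     , not-true (λ r → false≢true (trans (Vecₚ.lookup∘tabulate (λ x → point d x ∨ point d x ∨ point e x) x) (∨-right {point d x} (∨-right {point d x} r))) q)
      only-point : ∀ d e f x → point d x ≡ false → point e x ≡ false → point f x ∨ point d x ∨ point e x ≡ true → x ≡ f
      only-point d e f x q r y = ∨-elim (point f x) y point⇒≡ λ y′ → ∨-elim (point d x) y′ (λ z → absurd (false≢true z q)) λ z → absurd (false≢true z r)
      vanishing : Dec (lookup v a ≡ 𝟎) → Dec (lookup v b ≡ 𝟎) → Dec (lookup v c ≡ 𝟎) → ∀ x → lookup v x ≡ 𝟎
      vanishing (yes va) _ _ = vanish (among b b c) (indepᵇ⇒ (among b b c) (proj₁ t₂)) a∈ λ x q → pair-off b c (lookup v) x v-off (λ x q y →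
        let (qb , qc) = amongs b c x q in trans (cong (lookup v) (only-point b c a x qb qc (trans (sym (Y≡ x)) y))) va) q
      vanishing (no _) (yes vb) _ = vanish (among a a c) (indepᵇ⇒ (among a a c) (proj₁ t₃)) a∈ λ x q → pair-off a c (lookup v) x v-off (λ x q y →
        let (qa , qc) = amongs a c x q in trans (cong (lookup v) (only-point a c b x qa qc (trans (rotate (point a x) (point b x) _) (trans (sym (Y≡ x)) y)))) vb) q
        where
        rotate : ∀ a b c → b ∨ a ∨ c ≡ a ∨ b ∨ c
        rotate a b c = bool-law (λ (a , b , c) → b ∨ a ∨ c) (λ (a , b , c) → a ∨ b ∨ c) (a , b , c)
      vanishing (no _) (no _) (yes vz) = vanish (among a a b) (indepᵇ⇒ (among a a b) (proj₁ t₄)) a∈ λ x q → pair-off a b (lookup v) x v-off (λ x q y →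
        let (qa , qb) = amongs a b x q in trans (cong (lookup v) (only-point a b c x qa qb (trans (rotate (point a x) (point b x) (point c x)) (trans (sym (Y≡ x)) y)))) vz) q
        where
        rotate : ∀ a b c → c ∨ a ∨ b ≡ a ∨ b ∨ c
        rotate a b c = bool-law (λ (a , b , c) → c ∨ a ∨ b) (λ (a , b , c) → a ∨ b ∨ c) (a , b , c)
      vanishing (no na) (no nb) (no nc) = absurd (none (s , t , subst In (ext′ same-entries) (scale k a∈)))
        where
        k = lookup v a
        s = proj₁ (nonzero (product-nonzero na nb))
        t = proj₁ (nonzero (product-nonzero na nc))
        ext′ : ∀ {u w : FanoVec} → (∀ x → lookup u x ≡ lookup w x) → u ≡ w
        ext′ {u} {w} e = trans (sym (Vecₚ.tabulate∘lookup u)) (trans (Vecₚ.tabulate-cong e) (Vecₚ.tabulate∘lookup w))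
        entry′ : ∀ x (qa qb qc : Bool) → point a x ≡ qa → point b x ≡ qb → point c x ≡ qc →
          k *₃ lookup v x ≡ (if qa then 𝟏 else (if qb then sign s else (if qc then sign t else 𝟎)))
        entry′ x true _ _ ea _ _ = trans (cong (λ z → k *₃ lookup v z) (point⇒≡ {g = a} {x} ea)) (square na)
        entry′ x false true _ _ eb _ = trans (cong (λ z → k *₃ lookup v z) (point⇒≡ {g = b} {x} eb)) (proj₂ (nonzero (product-nonzero na nb)))
        entry′ x false false true _ _ ec = trans (cong (λ z → k *₃ lookup v z) (point⇒≡ {g = c} {x} ec)) (proj₂ (nonzero (product-nonzero na nc)))
        entry′ x false false false ea eb ec = trans (cong (k *₃_) (v-off x (trans (Y≡ x) (cong₂ _∨_ ea (cong₂ _∨_ eb ec))))) (law (_*₃ 𝟎) (λ _ → 𝟎) k)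
        same-entries : ∀ x → lookup (Data.Vec.map (k *₃_) v) x ≡ lookup (lineVec a b c s t) x
        same-entries x = trans (Vecₚ.lookup-map x (k *₃_) v) (trans (entry′ x (point a x) (point b x) (point c x) refl refl refl)
          (sym (Vecₚ.lookup∘tabulate (λ x → if point a x then 𝟏 else (if point b x then sign s else (if point c x then sign t else 𝟎))) x)))
      ⊥-ind : Independent (space fano) ⊥
      ⊥-ind c _ h i = not-true λ e → false≢true (h i e) (lookup-⊥ i)
      off-C : ∀ j → j ∉ S ⊥ → vc j ≡ 𝟎
      off-C = off-S ⊥ a∈ λ x _ → vanishing (lookup v a ≟F 𝟎) (lookup v b ≟F 𝟎) (lookup v c ≟F 𝟎) x

  basis-vanish : ∀ v → In v → offBasis v ≡ true → zeroᵇ v ≡ true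
  basis-vanish v a e = zeroᵇ⇒ v (vanish (true ∷ true ∷ true ∷ ⊥) (indepᵇ⇒ (true ∷ true ∷ true ∷ ⊥) tt) a (zero-off v e))
    where
    zeroᵇ⇒o : ∀ {n} (v : Vec Z₃ n) → zeroᵇ v ≡ true → ∀ x → lookup v x ≡ 𝟎
    zeroᵇ⇒o (a ∷ v) e zero    = point⇒≡ (proj₁ (∧-true {does (a ≟F 𝟎)} e))
    zeroᵇ⇒o (a ∷ v) e (suc x) = zeroᵇ⇒o v (proj₂ (∧-true {does (a ≟F 𝟎)} e)) x
    zero-off : ∀ v → offBasis v ≡ true → ∀ x → lookup (true ∷ true ∷ true ∷ ⊥) x ≡ false → lookup v x ≡ 𝟎
    zero-off (_ ∷ _ ∷ _ ∷ v) e (suc (suc (suc x))) _ = zeroᵇ⇒o v e x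

  contradiction : Empty
  contradiction =
    line (# 0) (# 1) (# 3) tt λ (s₁ , t₁ , i₁) → line (# 0) (# 2) (# 4) tt λ (s₂ , t₂ , i₂) →
    line (# 1) (# 2) (# 5) tt λ (s₃ , t₃ , i₃) → line (# 0) (# 5) (# 6) tt λ (s₄ , t₄ , i₄) →
    line (# 1) (# 4) (# 6) tt λ (s₅ , t₅ , i₅) → line (# 2) (# 3) (# 6) tt λ (s₆ , t₆ , i₆) →
    line (# 3) (# 4) (# 5) tt λ (s₇ , t₇ , i₇) →
    let a₁ = (s₁ , t₁) , (s₂ , t₂) , (s₃ , t₃) , (s₇ , t₇)
        a₂ = (s₂ , t₂) , (s₃ , t₃) , (s₄ , t₄) , (s₅ , t₅)
        a₃ = (s₁ , t₁) , (s₃ , t₃) , (s₄ , t₄) , (s₆ , t₆)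
        e₁ = proj₂ (w₁-zero a₁) (basis-vanish (w₁ a₁) (In-eliminate (# 3) i₁ (In-eliminate (# 4) i₂ (In-eliminate (# 5) i₃ i₇))) (proj₁ (w₁-zero a₁)))
        e₂ = proj₂ (w₂-zero a₂) (basis-vanish (w₂ a₂) (In-eliminate (# 4) i₂ (In-eliminate (# 5) i₃ (In-eliminate (# 6) i₅ i₄))) (proj₁ (w₂-zero a₂)))
        e₃ = proj₂ (w₃-zero a₃) (basis-vanish (w₃ a₃) (In-eliminate (# 3) i₁ (In-eliminate (# 5) i₃ (In-eliminate (# 6) i₆ i₄))) (proj₁ (w₃-zero a₃)))
    in clash s₁ s₂ s₃ t₃ s₄ e₁ e₂ e₃
    where
    clash : ∀ a b c d e → a xor b xor c ≡ false → b xor c xor d xor e ≡ true → a xor d xor e ≡ false → Empty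
    clash a b c d e h₁ h₂ h₃ = false≢true (allTrue⇒ test tt (a , b , c , d , e)) (cong₂ _∨_ h₁ (cong₂ _∨_ (cong not h₂) h₃))
      where
      test : Bool × Bool × Bool × Bool × Bool → Bool
      test (a , b , c , d , e) = (a xor b xor c) ∨ not (b xor c xor d xor e) ∨ (a xor d xor e)

-- Graphs and their cycle matroids

∉-minus : ∀ {n} (p q : Subset n) {x} → x ∈ p ─ q → x ∉ q
∉-minus (a ∷ p) (true ∷ q) {zero} () Data.Vec.here
∉-minus (a ∷ p) (b ∷ q) {suc x} (Data.Vec.there m) (Data.Vec.there m′) = ∉-minus p q m m′

module Components (G : Graph) where

  -- Components by successive merging: the edge `e` moves the whole component of its first end to
  -- the representative of its second end. Equality of representatives then decides reachability.
  rep : List (Fin (nE G)) → Fin (nV G) → Fin (nV G)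
  rep []      v = v
  rep (e ∷ l) v = if does (rep l v ≟F rep l (end₁ G e)) then rep l (end₂ G e) else rep l v

  AdjVia-sym : ∀ {P u w} → AdjVia G P u w → AdjVia G P w u
  AdjVia-sym (e , pe , inj₁ q) = e , pe , inj₂ q
  AdjVia-sym (e , pe , inj₂ q) = e , pe , inj₁ q

  reach-sym : ∀ {P u w} → ReachVia G P u w → ReachVia G P w u
  reach-sym ε        = ε
  reach-sym (a ◅ as) = reach-sym as ◅◅ (AdjVia-sym a ◅ ε)

  reach-mono : ∀ {P Q : Fin (nE G) → Set} → (∀ e → P e → Q e) → ∀ {u w} → ReachVia G P u w → ReachVia G Q u w
  reach-mono f ε = ε
  reach-mono f ((e , pe , q) ◅ as) = (e , f e pe , q) ◅ reach-mono f as

  reach-rep : ∀ l v → ReachVia G (_∈ₗ l) v (rep l v)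
  reach-rep []      v = ε
  reach-rep (e ∷ l) v = go (rep l v ≟F rep l (end₁ G e))
    where
    weaken : ∀ {u w} → ReachVia G (_∈ₗ l) u w → ReachVia G (_∈ₗ (e ∷ l)) u w
    weaken = reach-mono λ _ → there
    go : (d : Dec (rep l v ≡ rep l (end₁ G e))) → ReachVia G (_∈ₗ (e ∷ l)) v (if does d then rep l (end₂ G e) else rep l v)
    go (yes q) = weaken (subst (ReachVia G (_∈ₗ l) v) q (reach-rep l v)) ◅◅ (weaken (reach-sym (reach-rep l (end₁ G e))) ◅◅
      ((e , here refl , inj₁ refl) ◅ weaken (reach-rep l (end₂ G e))))
    go (no _) = weaken (reach-rep l v)

  rep⇒reach : ∀ l {u w} → rep l u ≡ rep l w → ReachVia G (_∈ₗ l) u w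
  rep⇒reach l {u} {w} e = reach-rep l u ◅◅ subst (λ x → ReachVia G (_∈ₗ l) x w) (sym e) (reach-sym (reach-rep l w))

  rep-edge : ∀ l {e} → e ∈ₗ l → rep l (end₁ G e) ≡ rep l (end₂ G e)
  rep-edge (e ∷ l) (here refl) = trans (at-end₁ (rep l (end₁ G e) ≟F rep l (end₁ G e))) (sym (at-end₂ (rep l (end₂ G e) ≟F rep l (end₁ G e))))
    where
    at-end₁ : (d : Dec (rep l (end₁ G e) ≡ rep l (end₁ G e))) → (if does d then rep l (end₂ G e) else rep l (end₁ G e)) ≡ rep l (end₂ G e)
    at-end₁ (yes _) = refl
    at-end₁ (no ne) = absurd (ne refl)
    at-end₂ : (d : Dec (rep l (end₂ G e) ≡ rep l (end₁ G e))) → (if does d then rep l (end₂ G e) else rep l (end₂ G e)) ≡ rep l (end₂ G e)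
    at-end₂ (yes _) = refl
    at-end₂ (no _) = refl
  rep-edge (e ∷ l) (there m) = cong (λ v → if does (v ≟F rep l (end₁ G e)) then rep l (end₂ G e) else v) (rep-edge l m)

  reach⇒rep : ∀ l {u w} → ReachVia G (_∈ₗ l) u w → rep l u ≡ rep l w
  reach⇒rep l ε = refl
  reach⇒rep l ((e , m , inj₁ refl) ◅ as) = trans (rep-edge l m) (reach⇒rep l as)
  reach⇒rep l ((e , m , inj₂ refl) ◅ as) = trans (sym (rep-edge l m)) (reach⇒rep l as)

  rep-coarsen : ∀ l l′ → l ⊆ₗ l′ → ∀ {u w} → rep l u ≡ rep l w → rep l′ u ≡ rep l′ w
  rep-coarsen l l′ s e = reach⇒rep l′ (reach-mono (λ _ → s) (rep⇒reach l e))

-- The signed incidence matrix represents the cycle matroid over every field. Over `F₂` this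
-- identifies the cycle space, and over `F₃` it keeps the Fano plane out of graphs.
module Incidence (F : Field) (G : Graph) where
  open Field F hiding (refl; sym; trans; _-_; zero) renaming (_+_ to infixl 6 _⊹_; _*_ to infixl 7 _·_; -_ to infix 8 ⊖_; +-comm to ⊹-comm; +-assoc to ⊹-assoc; +-identityʳ to ⊹-identityʳ)
  open Field F using () renaming (refl to ≈-refl; sym to ≈-sym; trans to ≈-trans)
  open FieldSums F using (sum; sum-cong-≋; ∑-distrib-+; ∑-comm; *-distribˡ-sum)
  open import Algebra.Properties.Ring ring using (-0#≈0#; -‿distribˡ-*; -1*x≈-x)
  open Components G

  [_]ᶠ : Bool → Carrier
  [ true ]ᶠ  = 1#
  [ false ]ᶠ = 0#

  incidence : Fin (nV G) → Fin (nE G) → Carrier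
  incidence v e = [ does (v ≟F end₁ G e) ]ᶠ ⊹ ⊖ [ does (v ≟F end₂ G e) ]ᶠ

  private
    sum-zero : ∀ {n} (f : Fin n → Carrier) → (∀ j → f j ≈ 0#) → sum f ≈ 0#
    sum-zero {zero}  f h = ≈-refl
    sum-zero {suc n} f h = ≈-trans (+-cong (h zero) (sum-zero (f ∘ suc) (h ∘ suc))) (+-identityˡ 0#)

    sum-single : ∀ {n} (f : Fin n → Carrier) e → (∀ j → j ≢ e → f j ≈ 0#) → sum f ≈ f e
    sum-single {suc n} f zero h = ≈-trans (+-congˡ (sum-zero (f ∘ suc) λ j → h (suc j) λ ())) (⊹-identityʳ (f zero))
    sum-single {suc n} f (suc e) h = ≈-trans (+-cong (h zero λ ()) (sum-single (f ∘ suc) e λ j ne → h (suc j) λ q → ne (Finₚ.suc-injective q))) (+-identityˡ (f (suc e)))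

    ≡⇒≈ : ∀ {x y} → x ≡ y → x ≈ y
    ≡⇒≈ refl = ≈-refl

    at-self : ∀ {n} (w : Fin n) → [ does (w ≟F w) ]ᶠ ≡ 1#
    at-self w = cong [_]ᶠ (point-refl w)

    at-other : ∀ {n} {v w : Fin n} → v ≢ w → [ does (v ≟F w) ]ᶠ ≡ 0#
    at-other {v = v} {w} ne = cong [_]ᶠ (not-true {does (v ≟F w)} λ e → ne (point⇒≡ e))

    sum-delta : ∀ {n} (a : Fin n → Carrier) w → sum (λ v → a v · [ does (v ≟F w) ]ᶠ) ≈ a w
    sum-delta a w = ≈-trans (sum-single _ w λ v ne → ≈-trans (*-congˡ (≡⇒≈ (at-other ne))) (zeroʳ (a v)))
      (≈-trans (*-congˡ (≡⇒≈ (at-self w))) (*-identityʳ (a w)))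

    sum-neg : ∀ {n} (f : Fin n → Carrier) → sum (λ j → ⊖ f j) ≈ ⊖ sum f
    sum-neg f = ≈-trans (sum-cong-≋ λ j → ≈-sym (-1*x≈-x (f j))) (≈-trans (≈-sym (*-distribˡ-sum (⊖ 1#) f)) (-1*x≈-x (sum f)))

    cancel-self : ∀ {x y} → x ≡ y → x ⊹ ⊖ y ≈ 0#
    cancel-self {x} refl = -‿inverseʳ x

  -- Summing the vertex equations over a component of Y - e leaves only the
  -- coefficient of e.
  forest⇒independent : ∀ {Y} → Forest G Y → LinIndep F incidence Y
  forest⇒independent {Y} forest c off′ eqs e = decide (bool-split (lookup Y e))
    where
    decide : lookup Y e ≡ true ⊎ lookup Y e ≡ false → c e ≈ 0#
    decide (inj₂ f) = off′ e λ e∈ → false≢true (∈⇒true e∈) f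
    decide (inj₁ t) = ≈-trans (≈-sym total) (≈-trans exchange (sum-zero _ λ v → ≈-trans (*-congˡ (eqs v)) (zeroʳ (a v))))
      where
      l : List (Fin (nE G))
      l = elements (lookup (Y - e))
      a : Fin (nV G) → Carrier
      a v = [ does (rep l v ≟F rep l (end₁ G e)) ]ᶠ
      ends-apart : rep l (end₂ G e) ≢ rep l (end₁ G e)
      ends-apart q = forest e (true⇒∈ t) (reach-mono (λ _ m → true⇒∈ (∈-elements⁻ (lookup (Y - e)) m)) (rep⇒reach l (sym q)))
      column : ∀ j → sum (λ v → a v · incidence v j) ≈ a (end₁ G j) ⊹ ⊖ a (end₂ G j)
      column j = ≈-trans (sum-cong-≋ λ v → ≈-trans (distribˡ (a v) _ _) (+-congˡ (≈-sym (-x*y (a v) _))))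
        (≈-trans (∑-distrib-+ (λ v → a v · [ does (v ≟F end₁ G j) ]ᶠ) (λ v → ⊖ (a v · [ does (v ≟F end₂ G j) ]ᶠ)))
        (+-cong (sum-delta a (end₁ G j)) (≈-trans (sum-neg (λ v → a v · [ does (v ≟F end₂ G j) ]ᶠ)) (-‿cong (sum-delta a (end₂ G j))))))
        where
        open import Algebra.Properties.Ring ring using (-‿distribʳ-*)
        -x*y : ∀ x y → ⊖ (x · y) ≈ x · ⊖ y
        -x*y x y = -‿distribʳ-* x y
      term : ∀ j → j ≢ e → c j · (a (end₁ G j) ⊹ ⊖ a (end₂ G j)) ≈ 0#
      term j ne = at (bool-split (lookup Y j))
        where
        at : lookup Y j ≡ true ⊎ lookup Y j ≡ false → c j · (a (end₁ G j) ⊹ ⊖ a (end₂ G j)) ≈ 0#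
        at (inj₂ f) = ≈-trans (*-congʳ (off′ j λ j∈ → false≢true (∈⇒true j∈) f)) (zeroˡ _)
        at (inj₁ y) = ≈-trans (*-congˡ (cancel-self (cong (λ v → [ does (v ≟F rep l (end₁ G e)) ]ᶠ)
          (rep-edge l (∈-elements⁺ (lookup (Y - e)) (∈⇒true (Subₚ.x∈p∧x≢y⇒x∈p-y {p = Y} (true⇒∈ y) ne))))))) (zeroʳ (c j))
      total : sum (λ j → c j · (a (end₁ G j) ⊹ ⊖ a (end₂ G j))) ≈ c e
      total = ≈-trans (sum-single _ e term) (≈-trans (*-congˡ (≈-trans (+-cong (≡⇒≈ (at-self (rep l (end₁ G e)))) (≈-trans (-‿cong (≡⇒≈ (at-other ends-apart))) -0#≈0#)) (⊹-identityʳ 1#))) (*-identityʳ (c e)))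
      exchange : sum (λ j → c j · (a (end₁ G j) ⊹ ⊖ a (end₂ G j))) ≈ sum (λ v → a v · sum (λ j → c j · incidence v j))
      exchange = ≈-trans (sum-cong-≋ λ j → ≈-trans (*-congˡ (≈-sym (column j))) (*-distribˡ-sum (c j) (λ v → a v · incidence v j)))
        (≈-trans (∑-comm (λ j v → c j · (a v · incidence v j)))
        (sum-cong-≋ λ v → ≈-trans (sum-cong-≋ λ j → swap′ (c j) (a v) (incidence v j)) (≈-sym (*-distribˡ-sum (a v) (λ j → c j · incidence v j)))))
        where
        swap′ : ∀ x y z → x · (y · z) ≈ y · (x · z)
        swap′ x y z = ≈-trans (≈-sym (*-assoc x y z)) (≈-trans (*-congʳ (*-comm x y)) (*-assoc y x z))

  boundary : (Fin (nE G) → Carrier) → Fin (nV G) → Carrier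
  boundary c v = sum (λ j → c j · incidence v j)

  boundary-add : ∀ c k e v → boundary (λ j → c j ⊹ k · [ does (j ≟F e) ]ᶠ) v ≈ boundary c v ⊹ k · incidence v e
  boundary-add c k e v = ≈-trans (sum-cong-≋ λ j → ≈-trans (distribʳ (incidence v j) (c j) _) (+-congˡ (≈-trans (*-assoc k _ _) (*-congˡ (*-comm _ _)))))
    (≈-trans (∑-distrib-+ (λ j → c j · incidence v j) (λ j → k · (incidence v j · [ does (j ≟F e) ]ᶠ)))
    (+-congˡ (≈-trans (≈-sym (*-distribˡ-sum k (λ j → incidence v j · [ does (j ≟F e) ]ᶠ))) (*-congˡ (sum-delta (incidence v) e)))))

  -- Each edge is counted with the sign of the direction in which the path traverses it, so the
  -- boundaries telescope.
  path-vector : ∀ {P : Fin (nE G) → Set} {u w} → ReachVia G P u w →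
    ∃[ c ] ((∀ j → ¬ P j → c j ≈ 0#) × (∀ v → boundary c v ≈ [ does (v ≟F u) ]ᶠ ⊹ ⊖ [ does (v ≟F w) ]ᶠ))
  path-vector {u = u} ε = (λ _ → 0#) , (λ _ _ → ≈-refl) , λ v → ≈-trans (sum-zero _ λ j → zeroˡ (incidence v j)) (≈-sym (-‿inverseʳ [ does (v ≟F u) ]ᶠ))
  path-vector {P} {u} {w} (_◅_ {j = x} (e , pe , q) as) with path-vector as
  ... | c , sup , bd = (λ j → c j ⊹ k q · [ does (j ≟F e) ]ᶠ) , sup′ , λ v → ≈-trans (boundary-add c (k q) e v) (≈-trans (+-cong (bd v) (step q v)) (join _ _ _))
    where
    k : (ends G e ≡ (u , x)) ⊎ (ends G e ≡ (x , u)) → Carrier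
    k (inj₁ _) = 1#
    k (inj₂ _) = ⊖ 1#
    sup′ : ∀ j → ¬ P j → c j ⊹ k q · [ does (j ≟F e) ]ᶠ ≈ 0#
    sup′ j np = ≈-trans (+-cong (sup j np) (≈-trans (*-congˡ (≡⇒≈ (at-other λ r → np (subst P (sym r) pe)))) (zeroʳ (k q)))) (+-identityˡ 0#)
    step : ∀ q v → k q · incidence v e ≈ [ does (v ≟F u) ]ᶠ ⊹ ⊖ [ does (v ≟F x) ]ᶠ
    step (inj₁ r) v = ≈-trans (*-identityˡ _) (≡⇒≈ (cong (λ (a , b) → [ does (v ≟F a) ]ᶠ ⊹ ⊖ [ does (v ≟F b) ]ᶠ) r))
    step (inj₂ r) v = ≈-trans (-1*x≈-x _) (≈-trans (-‿cong (≡⇒≈ (cong (λ (a , b) → [ does (v ≟F a) ]ᶠ ⊹ ⊖ [ does (v ≟F b) ]ᶠ) r))) (flip′ _ _))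
      where
      open import Algebra.Properties.AbelianGroup +-abelianGroup using (⁻¹-anti-homo-//; ⁻¹-∙-comm; ⁻¹-involutive)
      flip′ : ∀ a b → ⊖ (a ⊹ ⊖ b) ≈ b ⊹ ⊖ a
      flip′ a b = ≈-trans (≈-sym (⁻¹-∙-comm a (⊖ b))) (≈-trans (+-congˡ (⁻¹-involutive b)) (⊹-comm (⊖ a) b))
    join : ∀ a b d → (b ⊹ ⊖ d) ⊹ (a ⊹ ⊖ b) ≈ a ⊹ ⊖ d
    join a b d = ≈-trans (⊹-comm _ _) (≈-trans (⊹-assoc a (⊖ b) _) (+-congˡ (≈-trans (≈-sym (⊹-assoc (⊖ b) b (⊖ d))) (≈-trans (+-congʳ (-‿inverseˡ b)) (+-identityˡ (⊖ d))))))

  -- The vector of a path in `Y - e` between the ends of `e`, with `e` subtracted, is a relation on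
  -- `Y` whose coefficient at `e` is minus one.
  independent⇒forest : ∀ {Y} → LinIndep F incidence Y → Forest G Y
  independent⇒forest {Y} ind e e∈Y reach = 1≉0 (≈-trans (≈-sym (-‿involutive′ 1#)) (≈-trans (-‿cong (≈-trans (≈-sym at-e) zero-at-e)) -0#≈0#))
    where
    open import Algebra.Properties.AbelianGroup +-abelianGroup using (⁻¹-involutive)
    -‿involutive′ : ∀ x → ⊖ (⊖ x) ≈ x
    -‿involutive′ = ⁻¹-involutive
    path = path-vector reach
    c = proj₁ path
    d : Fin (nE G) → Carrier
    d j = c j ⊹ ⊖ 1# · [ does (j ≟F e) ]ᶠ
    zero-at-e : d e ≈ 0#
    zero-at-e = ind d (λ j j∉ → ≈-trans (+-cong (proj₁ (proj₂ path) j λ j∈ → j∉ (Subₚ.p─q⊆p Y ⁅ e ⁆ j∈)) (≈-trans (*-congˡ (≡⇒≈ (at-other {v = j} {e} λ q → j∉ (subst (_∈ Y) (sym q) e∈Y)))) (zeroʳ _))) (+-identityˡ 0#))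
      (λ v → ≈-trans (boundary-add c (⊖ 1#) e v) (≈-trans (+-cong (proj₂ (proj₂ path) v) (-1*x≈-x _)) (-‿inverseʳ _))) e
    at-e : d e ≈ ⊖ 1#
    at-e = ≈-trans (+-cong (proj₁ (proj₂ path) e λ e∈ → ∉-minus Y ⁅ e ⁆ e∈ (Subₚ.x∈⁅x⁆ e)) (≈-trans (*-congˡ (≡⇒≈ (at-self e))) (*-identityʳ _))) (+-identityˡ _)

-- Connectivity of cycle matroids

represents-forest : ∀ G → Represents (Forest G) (cycleSpace G)
represents-forest G Y = (λ h → subst (λ rs → Independent (kernel rs) Y) same-rows (proj₁ (represents₂ incidence Y) (forest⇒independent h)))
                      , (λ h → independent⇒forest (proj₂ (represents₂ incidence Y) (subst (λ rs → Independent (kernel rs) Y) (sym same-rows) h)))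
  where
  open Incidence F₂ G
  difference : ∀ a b → [ a ]ᶠ xor [ b ]ᶠ ≡ a xor b
  difference a b = bool-law (λ (a , b) → [ a ]ᶠ xor [ b ]ᶠ) (λ (a , b) → a xor b) (a , b)
  same-rows : rowsOf incidence ≡ map (star G) (allFin (nV G))
  same-rows = Listₚ.map-cong (λ v → Vecₚ.tabulate-cong λ e → difference (does (v ≟F end₁ G e)) (does (v ≟F end₂ G e))) (allFin (nV G))

module _ {n} (K L : Binary n) (K⊆L : ∀ {c} → Cycle K c → Cycle L c) where
  private
    module K′ = Closure K
    module L′ = Closure L

  spans-⊆ : ∀ {l j} → K′.Spans l j → L′.Spans l j
  spans-⊆ (inj₁ m) = inj₁ m
  spans-⊆ (inj₂ (c , cc , cj , s)) = inj₂ (c , K⊆L cc , cj , s)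

  rk-⊆ : ∀ l → L′.rk l ≤ K′.rk l
  rk-⊆ []      = z≤n
  rk-⊆ (j ∷ l) = +-mono-≤ (K′.cost-anti (K′.spans? l j) (L′.spans? l j) spans-⊆) (rk-⊆ l)

  -- Every gain in `L` is at most the gain in `K`, so equal totals force equal gains. If a cycle of
  -- `L` passes through the head of the list, the head is also spanned in `K`, and a cycle of `K`
  -- reduces the given one to the tail.
  same-rank⇒⊇ : ∀ l → K′.rk l ≤ L′.rk l → ∀ c → Cycle L c → c ⊑ l → Cycle K c
  same-rank⇒⊇ [] h c cc s = subst (Cycle K) (sym (ext {c = c} {⊥} λ i → trans (not-true λ e → no-elem (s i e)) (sym (lookup-⊥ i)))) (cycle-⊥ K)
    where
    no-elem : ∀ {i : Fin n} → i ∈ₗ [] → Empty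
    no-elem ()
  same-rank⇒⊇ (j ∷ l) h c cc s = pick (bool-split (lookup c j))
    where
    gains : L′.gain l j ≤ K′.gain l j
    gains = K′.cost-anti (K′.spans? l j) (L′.spans? l j) spans-⊆
    rest : K′.rk l ≤ L′.rk l
    rest = +-cancelˡ-≤ (K′.gain l j) _ _ (≤-trans h (+-monoˡ-≤ (L′.rk l) gains))
    gain≤ : K′.gain l j ≤ L′.gain l j
    gain≤ = +-cancelʳ-≤ (K′.rk l) _ _ (≤-trans h (+-monoʳ-≤ (L′.gain l j) (rk-⊆ l)))
    below : ∀ c → lookup c j ≡ false → c ⊑ (j ∷ l) → c ⊑ l
    below c cj s i e = at (s i e)
      where
      at : i ∈ₗ (j ∷ l) → i ∈ₗ l
      at (here refl) = absurd (false≢true e cj)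
      at (there m)   = m
    pick : lookup c j ≡ true ⊎ lookup c j ≡ false → Cycle K c
    pick (inj₂ f) = same-rank⇒⊇ l rest c cc (below c f s)
    pick (inj₁ t) = use (K′.gain≡0⇒spans (n≤0⇒n≡0 (≤-trans gain≤ (≤-reflexive (L′.gain-spanned (inj₂ (c , cc , t , s)))))))
      where
      use : K′.Spans l j → Cycle K c
      use (inj₁ m) = same-rank⇒⊇ l rest c cc λ i e → at (s i e)
        where
        at : ∀ {i} → i ∈ₗ (j ∷ l) → i ∈ₗ l
        at (here refl) = m
        at (there m′)  = m′
      use (inj₂ (d , dc , dj , s′)) = subst (Cycle K) (sym (⊕-cancel c d)) (cycle-⊕ K dc (same-rank⇒⊇ l rest (c ⊕ d) (cycle-⊕ L cc (K⊆L dc))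
        (below (c ⊕ d) (trans (lookup-⊕ c d j) (cong₂ _xor_ t dj)) λ i e → either i (xor-true (lookup c i) (lookup d i) (trans (sym (lookup-⊕ c d i)) e)))))
        where
        either : ∀ i → lookup c i ≡ true ⊎ lookup d i ≡ true → i ∈ₗ (j ∷ l)
        either i (inj₁ e) = s i e
        either i (inj₂ e) = s′ i e

  rk-⊂ : ∀ l c → Cycle L c → c ⊑ l → ¬ Cycle K c → L′.rk l < K′.rk l
  rk-⊂ l c cc s nc = ≰⇒> λ h → nc (same-rank⇒⊇ l h c cc s)

adjoin : ∀ {n} → Binary n → Subset n → Binary n
adjoin K d = record
  { Cycle   = λ c → Cycle K c ⊎ Cycle K (c ⊕ d)
  ; cycle-⊥ = inj₁ (cycle-⊥ K)
  ; cycle-⊕ = add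
  ; cycle?  = λ c → cycle? K c ⊎-dec cycle? K (c ⊕ d)
  }
  where
  pointwise : ∀ c c′ (f g : Bool → Bool → Bool → Bool) → (∀ a b e → f a b e ≡ g a b e) → ∀ {u v} →
    (∀ i → lookup u i ≡ f (lookup c i) (lookup c′ i) (lookup d i)) → (∀ i → lookup v i ≡ g (lookup c i) (lookup c′ i) (lookup d i)) → u ≡ v
  pointwise c c′ f g h e e′ = ext λ i → trans (e i) (trans (h _ _ _) (sym (e′ i)))
  look : ∀ c c′ i → lookup ((c ⊕ c′) ⊕ d) i ≡ (lookup c i xor lookup c′ i) xor lookup d i
  look c c′ i = trans (lookup-⊕ (c ⊕ c′) d i) (cong (_xor lookup d i) (lookup-⊕ c c′ i))
  add : ∀ {c c′} → Cycle K c ⊎ Cycle K (c ⊕ d) → Cycle K c′ ⊎ Cycle K (c′ ⊕ d) → Cycle K (c ⊕ c′) ⊎ Cycle K ((c ⊕ c′) ⊕ d)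
  add (inj₁ a) (inj₁ b) = inj₁ (cycle-⊕ K a b)
  add {c} {c′} (inj₁ a) (inj₂ b) = inj₂ (subst (Cycle K) (pointwise c c′ (λ x y z → x xor (y xor z)) (λ x y z → (x xor y) xor z)
    (λ x y z → sym (Boolₚ.xor-assoc x y z)) (λ i → trans (lookup-⊕ c (c′ ⊕ d) i) (cong (lookup c i xor_) (lookup-⊕ c′ d i))) (look c c′)) (cycle-⊕ K a b))
  add {c} {c′} (inj₂ a) (inj₁ b) = inj₂ (subst (Cycle K) (pointwise c c′ (λ x y z → (x xor z) xor y) (λ x y z → (x xor y) xor z)
    (λ x y z → bool-law (λ (x , y , z) → (x xor z) xor y) (λ (x , y , z) → (x xor y) xor z) (x , y , z))
    (λ i → trans (lookup-⊕ (c ⊕ d) c′ i) (cong (_xor lookup c′ i) (lookup-⊕ c d i))) (look c c′)) (cycle-⊕ K a b))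
  add {c} {c′} (inj₂ a) (inj₂ b) = inj₁ (subst (Cycle K) (pointwise c c′ (λ x y z → (x xor z) xor (y xor z)) (λ x y z → x xor y)
    (λ x y z → bool-law (λ (x , y , z) → (x xor z) xor (y xor z)) (λ (x , y , z) → x xor y) (x , y , z))
    (λ i → trans (lookup-⊕ (c ⊕ d) (c′ ⊕ d) i) (cong₂ _xor_ (lookup-⊕ c d i) (lookup-⊕ c′ d i))) (λ i → lookup-⊕ c c′ i)) (cycle-⊕ K a b))

-- Cycles whose parts in p are not cycles bound the connectivity of p.
module Crossing {n} (K : Binary n) (p : Fin n → Bool) where
  open Closure K
  open Polymatroid (binary⇒polymatroid K)

  part : Subset n → Subset n
  part c = tabulate λ i → lookup c i ∧ p i

  lookup-part : ∀ c i → lookup (part c) i ≡ lookup c i ∧ p i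
  lookup-part c = Vecₚ.lookup∘tabulate λ i → lookup c i ∧ p i

  -- contraction of the complement of p
  K/ : Binary n
  K/ = record
    { Cycle   = λ y → ∃[ c ] (Cycle K c × (∀ i → p i ≡ true → lookup c i ≡ lookup y i))
    ; cycle-⊥ = ⊥ , cycle-⊥ K , λ _ _ → refl
    ; cycle-⊕ = λ {y} {y′} (c , cc , e) (c′ , cc′ , e′) → c ⊕ c′ , cycle-⊕ K cc cc′ , λ i pi →
        trans (lookup-⊕ c c′ i) (trans (cong₂ _xor_ (e i pi) (e′ i pi)) (sym (lookup-⊕ y y′ i)))
    ; cycle?  = λ y → Subₚ.anySubset? λ c → cycle? K c ×-dec Finₚ.all? λ i → (p i Boolₚ.≟ true) →-dec (lookup c i Boolₚ.≟ lookup y i)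
    }

  private
    module Q = Closure K/
    S = elements p
    T′ = elements (λ i → not (p i))

  part-in : ∀ c → Cycle K c → Cycle K/ (part c)
  part-in c cc = c , cc , λ i pi → sym (trans (lookup-part c i) (trans (cong (lookup c i ∧_) pi) (Boolₚ.∧-identityʳ _)))

  part⊑S : ∀ c → part c ⊑ S
  part⊑S c i e = ∈-elements⁺ p (proj₂ (∧-true {lookup c i} (trans (sym (lookup-part c i)) e)))

  rk-contract : ∀ l → (∀ {i} → i ∈ₗ l → p i ≡ true) → Q.rk l + rk T′ ≡ rk (l ++ T′)
  rk-contract [] h = refl
  rk-contract (j ∷ l) h = trans (+-assoc (Q.gain l j) _ _) (cong₂ _+_ (≤-antisym
      (cost-anti (spans? (l ++ T′) j) (Q.spans? l j) from) (cost-anti (Q.spans? l j) (spans? (l ++ T′) j) to)) (rk-contract l (h ∘ there)))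
    where
    to : Q.Spans l j → Spans (l ++ T′) j
    to (inj₁ m) = inj₁ (Memₚ.∈-++⁺ˡ m)
    to (inj₂ (y , (c , cc , e) , yj , s)) = inj₂ (c , cc , trans (e j (h (here refl))) yj , λ i ci → at i ci (bool-split (p i)))
      where
      at : ∀ i → lookup c i ≡ true → p i ≡ true ⊎ p i ≡ false → i ∈ₗ (j ∷ l ++ T′)
      at i ci (inj₂ f) = there (Memₚ.∈-++⁺ʳ l (∈-elements⁺ (λ i → not (p i)) (cong not f)))
      at i ci (inj₁ t) = widen (s i (trans (sym (e i t)) ci))
        where
        widen : i ∈ₗ (j ∷ l) → i ∈ₗ (j ∷ l ++ T′)
        widen (here q)  = here q
        widen (there m) = there (Memₚ.∈-++⁺ˡ m)
    in-S : ∀ {i} → p i ≡ true → i ∈ₗ (j ∷ l ++ T′) → i ∈ₗ (j ∷ l)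
    in-S pi (here q) = here q
    in-S {i} pi (there m) = at (Memₚ.∈-++⁻ l m)
      where
      at : i ∈ₗ l ⊎ i ∈ₗ T′ → i ∈ₗ (j ∷ l)
      at (inj₁ m′) = there m′
      at (inj₂ m′) = absurd (false≢true (∈-elements⁻ (λ i → not (p i)) m′) (cong not pi))
    from : Spans (l ++ T′) j → Q.Spans l j
    from (inj₁ m) = at (Memₚ.∈-++⁻ l m)
      where
      at : j ∈ₗ l ⊎ j ∈ₗ T′ → Q.Spans l j
      at (inj₁ m′) = inj₁ m′
      at (inj₂ m′) = absurd (false≢true (∈-elements⁻ (λ i → not (p i)) m′) (cong not (h (here refl))))
    from (inj₂ (c , cc , cj , s)) = inj₂ (part c , part-in c cc , trans (lookup-part c j) (∧-both cj (h (here refl))) ,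
      λ i e → let (ci , pi) = ∧-true {lookup c i} (trans (sym (lookup-part c i)) e) in in-S pi (s i ci))

  rank-split : Q.rk S + R (λ i → not (p i)) ≡ R (λ _ → true)
  rank-split = trans (rk-contract S (∈-elements⁻ p)) (≤-antisym (rk-mono {S ++ T′} {elements (λ _ → true)} λ _ → ∈-elements⁺ (λ _ → true) refl) (rk-mono {elements (λ _ → true)} {S ++ T′} λ {i} _ → at i (bool-split (p i))))
    where
    at : ∀ i → p i ≡ true ⊎ p i ≡ false → i ∈ₗ (S ++ T′)
    at i (inj₁ t) = Memₚ.∈-++⁺ˡ (∈-elements⁺ p t)
    at i (inj₂ f) = Memₚ.∈-++⁺ʳ S (∈-elements⁺ (λ i → not (p i)) (cong not f))

  K⊆K/ : ∀ {c} → Cycle K c → Cycle K/ c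
  K⊆K/ {c} cc = c , cc , λ _ _ → refl

  bound : ∀ k → k + Q.rk S ≤ R p → k + R (λ _ → true) ≤ R p + R (λ i → not (p i))
  bound k h = ≤-trans (≤-reflexive (trans (cong (k +_) (sym rank-split)) (sym (+-assoc k (Q.rk S) _)))) (+-monoˡ-≤ (R (λ i → not (p i))) h)

  one-crossing : ∀ c → Cycle K c → ¬ Cycle K (part c) → 1 + R (λ _ → true) ≤ R p + R (λ i → not (p i))
  one-crossing c cc n₁ = bound 1 (rk-⊂ K K/ K⊆K/ S (part c) (part-in c cc) (part⊑S c) n₁)

  -- The connectivity of `p` is the difference between its ranks in `K` and in `K/`. Adjoining the
  -- part of `c` gives a space strictly between the two within `p`, and each strict inclusion lowers
  -- the rank.
  two-crossings : ∀ c d → Cycle K c → Cycle K d → ¬ Cycle K (part c) → ¬ Cycle K (part d) → ¬ Cycle K (part d ⊕ part c) →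
    2 + R (λ _ → true) ≤ R p + R (λ i → not (p i))
  two-crossings c d cc cd n₁ n₂ n₃ = bound 2 (≤-trans (s≤s upper) lower)
    where
    K⁺ = adjoin K (part c)
    upper : Q.rk S < Closure.rk K⁺ S
    upper = rk-⊂ K⁺ K/ below S (part d) (part-in d cd) (part⊑S d) λ { (inj₁ h) → n₂ h ; (inj₂ h) → n₃ h }
      where
      below : ∀ {y} → Cycle K⁺ y → Cycle K/ y
      below (inj₁ h) = K⊆K/ h
      below {y} (inj₂ h) = subst (Cycle K/) (trans (cong (part c ⊕_) refl) (sym (⊕-cancel y (part c)))) (cycle-⊕ K/ {part c} {y ⊕ part c} (part-in c cc) (K⊆K/ h))
    lower : Closure.rk K⁺ S < R p
    lower = rk-⊂ K K⁺ inj₁ S (part c) (inj₂ (subst (Cycle K) (sym (⊕-self (part c))) (cycle-⊥ K))) (part⊑S c) n₁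

∣∪∣≤ : ∀ {n} (p q : Subset n) → ∣ p ∪ q ∣ ≤ ∣ p ∣ + ∣ q ∣
∣∪∣≤ []          []          = z≤n
∣∪∣≤ (false ∷ p) (false ∷ q) = ∣∪∣≤ p q
∣∪∣≤ (false ∷ p) (true ∷ q)  = ≤-trans (s≤s (∣∪∣≤ p q)) (≤-reflexive (sym (+-suc ∣ p ∣ ∣ q ∣)))
∣∪∣≤ (true ∷ p)  (false ∷ q) = s≤s (∣∪∣≤ p q)
∣∪∣≤ (true ∷ p)  (true ∷ q)  = s≤s (≤-trans (∣∪∣≤ p q) (+-monoʳ-≤ ∣ p ∣ (≤-trans (m≤n+m ∣ q ∣ 1) ≤-refl)))

boundary₂ : ∀ (G : Graph) → Subset (nE G) → Fin (nV G) → Bool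
boundary₂ G c v = dot (star G v) c

cycle⇒boundary : ∀ G {c} → Cycle (cycleSpace G) c → ∀ v → boundary₂ G c v ≡ false
cycle⇒boundary G cc v = All.lookup cc (Memₚ.∈-map⁺ (star G) (Memₚ.∈-allFin v))

boundary⇒cycle : ∀ G {c} → (∀ v → boundary₂ G c v ≡ false) → Cycle (cycleSpace G) c
boundary⇒cycle G h = Allₚ.map⁺ (All.universal h (allFin (nV G)))

star≡ : ∀ G v e → lookup (star G v) e ≡ does (v ≟F end₁ G e) xor does (v ≟F end₂ G e)
star≡ G v = Vecₚ.lookup∘tabulate λ e → does (v ≟F end₁ G e) xor does (v ≟F end₂ G e)

-- The statement about the support is doubly negated because `P` need not be decidable.
path₂ : ∀ G {P : Fin (nE G) → Set} {u w} → ReachVia G P u w →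
  ∃[ c ] ((∀ j → lookup c j ≡ true → ¬ ¬ P j) × (∀ v → boundary₂ G c v ≡ does (v ≟F u) xor does (v ≟F w)))
path₂ G {P} {u} {w} reach = tabulate c , (λ j e n → false≢true (trans (sym (Vecₚ.lookup∘tabulate c j)) e) (proj₁ (proj₂ found) j n)) , λ v →
    trans (dot-parity (star G v) (tabulate c)) (trans (parity-cong λ j → entry′ v j) (trans (parity-sum λ j → c j ∧ incidence v j) (trans (proj₂ (proj₂ found) v) (difference (does (v ≟F u)) (does (v ≟F w))))))
  where
  open Incidence F₂ G
  found = path-vector reach
  c = proj₁ found
  difference : ∀ a b → [ a ]ᶠ xor [ b ]ᶠ ≡ a xor b
  difference a b = bool-law (λ (a , b) → [ a ]ᶠ xor [ b ]ᶠ) (λ (a , b) → a xor b) (a , b)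
  entry′ : ∀ v j → lookup (star G v) j ∧ lookup (tabulate c) j ≡ c j ∧ incidence v j
  entry′ v j = trans (cong₂ _∧_ (trans (star≡ G v j) (sym (difference (does (v ≟F end₁ G j)) (does (v ≟F end₂ G j))))) (Vecₚ.lookup∘tabulate c j)) (Boolₚ.∧-comm (incidence v j) (c j))

xor-both : ∀ {a b} → a xor b ≡ true → a ≡ false → b ≡ true
xor-both e refl = e

parity-point : ∀ {n} (s : Fin n) → parity (point s) ≡ true
parity-point s = trans (parity-remove (point s) s) (cong₂ _xor_ (point-refl s) (parity-false _ λ i → Boolₚ.∧-inverseʳ (point s i)))

module GraphUnit (G : Graph) where

  unit : Fin (nE G) → Subset (nE G)
  unit e = tabulate (point e)

  boundary-unit : ∀ u e → boundary₂ G (unit e) u ≡ lookup (star G u) e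
  boundary-unit u e = trans (dot-parity (star G u) (unit e)) (trans (parity-remove _ e)
    (trans (cong₂ _xor_ (trans (cong (lookup (star G u) e ∧_) (trans (Vecₚ.lookup∘tabulate (point e) e) (point-refl e))) (Boolₚ.∧-identityʳ _))
      (parity-false _ λ i → trans (cong (λ b → (lookup (star G u) i ∧ b) ∧ not (point e i)) (Vecₚ.lookup∘tabulate (point e) i)) (cleared (lookup (star G u) i) (point e i))))
      (Boolₚ.xor-identityʳ _)))
    where
    cleared : ∀ a b → (a ∧ b) ∧ not b ≡ false
    cleared a b = bool-law (λ (a , b) → (a ∧ b) ∧ not b) (λ _ → false) (a , b)

module GraphConnectivity (G : Graph) (conn : ConnectedGraph 3 G) where

  simple : Simple G
  simple = proj₁ conn

  K = cycleSpace G

  Joins : Fin (nE G) → Fin (nV G) → Fin (nV G) → Set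
  Joins e v x = (ends G e ≡ (v , x)) ⊎ (ends G e ≡ (x , v))

  joins-≢ : ∀ {e v x} → Joins e v x → v ≢ x
  joins-≢ {e} (inj₁ q) r = proj₁ simple e (trans (cong proj₁ q) (trans r (sym (cong proj₂ q))))
  joins-≢ {e} (inj₂ q) r = proj₁ simple e (trans (cong proj₁ q) (trans (sym r) (sym (cong proj₂ q))))

  joins-parallel : ∀ {e f v x} → Joins e v x → Joins f v x → e ≡ f
  joins-parallel (inj₁ q) (inj₁ r) = proj₂ simple _ _ (inj₁ (trans q (sym r)))
  joins-parallel (inj₁ q) (inj₂ r) = proj₂ simple _ _ (inj₂ (trans q (sym (cong (λ (x , y) → y , x) r))))
  joins-parallel (inj₂ q) (inj₁ r) = proj₂ simple _ _ (inj₂ (trans q (sym (cong (λ (x , y) → y , x) r))))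
  joins-parallel (inj₂ q) (inj₂ r) = proj₂ simple _ _ (inj₁ (trans q (sym r)))

  star-joins : ∀ {e v x} → Joins e v x → ∀ u → lookup (star G u) e ≡ does (u ≟F v) xor does (u ≟F x)
  star-joins {e} (inj₁ q) u = trans (star≡ G u e) (cong (λ (a , b) → does (u ≟F a) xor does (u ≟F b)) q)
  star-joins {e} {v} {x} (inj₂ q) u = trans (star≡ G u e)
    (trans (cong (λ (a , b) → does (u ≟F a) xor does (u ≟F b)) q) (Boolₚ.xor-comm (does (u ≟F x)) (does (u ≟F v))))

  open GraphUnit G

  -- a cycle through two edges at v that otherwise avoids the set A ∋ v
  module CycleAt (A : Subset (nV G)) (A<3 : ∣ A ∣ < 3) {v x y s t} (v∈A : v ∈ A) (vx : Joins s v x) (vy : Joins t v y) (x∉A : x ∉ A) (y∉A : y ∉ A) where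
    private
      path = path₂ G (proj₂ (proj₂ conn) A A<3 x y x∉A y∉A)

    c : Subset (nE G)
    c = (proj₁ path ⊕ unit s) ⊕ unit t

    c≡ : ∀ e → lookup c e ≡ (lookup (proj₁ path) e xor point s e) xor point t e
    c≡ e = trans (lookup-⊕ (proj₁ path ⊕ unit s) (unit t) e) (cong₂ _xor_ (trans (lookup-⊕ (proj₁ path) (unit s) e) (cong (lookup (proj₁ path) e xor_) (Vecₚ.lookup∘tabulate (point s) e))) (Vecₚ.lookup∘tabulate (point t) e))

    is-cycle : Cycle K c
    is-cycle = boundary⇒cycle G λ u → trans (dot-⊕ (star G u) (proj₁ path ⊕ unit s) (unit t)) (trans (cong₂ _xor_
      (trans (dot-⊕ (star G u) (proj₁ path) (unit s)) (cong₂ _xor_ (proj₂ (proj₂ path) u) (trans (boundary-unit u s) (star-joins vx u))))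
      (trans (boundary-unit u t) (star-joins vy u))) (bool-law (λ (a , b , d) → ((a xor b) xor (d xor a)) xor (d xor b)) (λ _ → false) (does (u ≟F x) , does (u ≟F y) , does (u ≟F v))))

    path-avoids : ∀ {e w} → w ∈ A → lookup (star G w) e ≡ true → lookup (proj₁ path) e ≡ false
    path-avoids {e} {w} w∈A st = not-true λ h → proj₁ (proj₂ path) e h λ (n₁ , n₂) → at n₁ n₂ (xor-true (does (w ≟F end₁ G e)) (does (w ≟F end₂ G e)) (trans (sym (star≡ G w e)) st))
      where
      at : end₁ G e ∉ A → end₂ G e ∉ A → does (w ≟F end₁ G e) ≡ true ⊎ does (w ≟F end₂ G e) ≡ true → Empty
      at n₁ n₂ (inj₁ q) = n₁ (subst (_∈ A) (point⇒≡ q) w∈A)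
      at n₁ n₂ (inj₂ q) = n₂ (subst (_∈ A) (point⇒≡ q) w∈A)

    module _ (p : Fin (nE G) → Bool) (ps : p s ≡ true) (pt : p t ≡ false) where
      open Crossing K p

      -- the vertex v meets the part of the cycle in p exactly in s
      odd-at-v : boundary₂ G (part c) v ≡ true
      odd-at-v = trans (dot-parity (star G v) (part c)) (trans (parity-cong λ e → trans (cong (lookup (star G v) e ∧_) (trans (lookup-part c e) (cong (_∧ p e) (c≡ e)))) (only-s e (e ≟F s) (e ≟F t))) (parity-point s))
        where
        v-end : ∀ {f z} → Joins f v z → lookup (star G v) f ≡ true
        v-end {f} {z} j = trans (star-joins j v) (cong₂ _xor_ (point-refl v) (not-true {does (v ≟F z)} λ q → joins-≢ j (point⇒≡ q)))
        only-s : ∀ e → Dec (e ≡ s) → Dec (e ≡ t) → lookup (star G v) e ∧ (((lookup (proj₁ path) e xor point s e) xor point t e) ∧ p e) ≡ point s e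
        only-s e (yes refl) _ = trans (cong₂ _∧_ (v-end vx) (cong₂ _∧_ (cong₂ _xor_ (cong₂ _xor_ (path-avoids v∈A (v-end vx)) (point-refl s)) (not-true {point t s} λ q → false≢true (trans (cong p (sym (point⇒≡ {g = t} {s} q))) ps) pt)) ps)) (sym (point-refl s))
        only-s e (no ne) (yes refl) = trans (trans (cong (lookup (star G v) t ∧_) (trans (cong (_ ∧_) pt) (Boolₚ.∧-zeroʳ _))) (Boolₚ.∧-zeroʳ _)) (sym (not-true {point s t} λ q → ne (point⇒≡ q)))
        only-s e (no ns) (no nt) = trans (at (bool-split (lookup (star G v) e))) (sym s-off)
          where
          s-off : point s e ≡ false
          s-off = not-true λ q → ns (point⇒≡ q)
          at : lookup (star G v) e ≡ true ⊎ lookup (star G v) e ≡ false → lookup (star G v) e ∧ (((lookup (proj₁ path) e xor point s e) xor point t e) ∧ p e) ≡ false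
          at (inj₂ f) = cong (_∧ (((lookup (proj₁ path) e xor point s e) xor point t e) ∧ p e)) f
          at (inj₁ h) = trans (cong (lookup (star G v) e ∧_) (cong (_∧ p e) (cong₂ _xor_ (cong₂ _xor_ (path-avoids v∈A h) s-off) (not-true {point t e} λ q → nt (point⇒≡ q))))) (Boolₚ.∧-zeroʳ _)

      even-at : ∀ {w} → w ∈ A → w ≢ v → boundary₂ G (part c) w ≡ false
      even-at {w} w∈A w≢v = trans (dot-parity (star G w) (part c)) (parity-false _ λ e → trans (cong (lookup (star G w) e ∧_) (trans (lookup-part c e) (cong (_∧ p e) (c≡ e)))) (none e (bool-split (lookup (star G w) e))))
        where
        w-off : ∀ {f z} → Joins f v z → z ∉ A → lookup (star G w) f ≡ true → Empty
        w-off {f} {z} j z∉ h = at (xor-true (does (w ≟F v)) (does (w ≟F z)) (trans (sym (star-joins j w)) h))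
          where
          at : does (w ≟F v) ≡ true ⊎ does (w ≟F z) ≡ true → Empty
          at (inj₁ q) = w≢v (point⇒≡ q)
          at (inj₂ q) = z∉ (subst (_∈ A) (point⇒≡ q) w∈A)
        none : ∀ e → lookup (star G w) e ≡ true ⊎ lookup (star G w) e ≡ false → lookup (star G w) e ∧ (((lookup (proj₁ path) e xor point s e) xor point t e) ∧ p e) ≡ false
        none e (inj₂ f) = cong (_∧ (((lookup (proj₁ path) e xor point s e) xor point t e) ∧ p e)) f
        none e (inj₁ h) = trans (cong (lookup (star G w) e ∧_) (cong (_∧ p e) (cong₂ _xor_ (cong₂ _xor_ (path-avoids w∈A h)
          (not-true {point s e} λ q → w-off vx x∉A (subst (λ f → lookup (star G w) f ≡ true) (point⇒≡ q) h)))
          (not-true {point t e} λ q → w-off vy y∉A (subst (λ f → lookup (star G w) f ≡ true) (point⇒≡ q) h))))) (Boolₚ.∧-zeroʳ _)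

  module Partition (p : Fin (nE G) → Bool) where
    open Crossing K p
    open Polymatroid (binary⇒polymatroid K)

    At : Bool → Fin (nV G) → Set
    At b v = ∃[ e ] ∃[ x ] (p e ≡ b × Joins e v x)

    at? : ∀ b v → Dec (At b v)
    at? b v = Finₚ.any? λ e → Finₚ.any? λ x → (p e Boolₚ.≟ b) ×-dec (ends-≟ (ends G e) (v , x) ⊎-dec ends-≟ (ends G e) (x , v))
      where
      ends-≟ : (a c : Fin (nV G) × Fin (nV G)) → Dec (a ≡ c)
      ends-≟ (a , b) (c , d) = map′ (λ (q , r) → cong₂ _,_ q r) (λ q → cong proj₁ q , cong proj₂ q) ((a ≟F c) ×-dec (b ≟F d))

    Mixed : Fin (nV G) → Set
    Mixed v = At true v × At false v

    mixed? : ∀ v → Dec (Mixed v)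
    mixed? v = at? true v ×-dec at? false v

    -- Along a path the side of the edges can change only at a mixed vertex, and the path avoids all
    -- of these.
    no-passage : ∀ A → ∣ A ∣ < 3 → (∀ v → Mixed v → v ∈ A) → ∀ {u w} → u ∉ A → w ∉ A → At true u → At false w → Empty
    no-passage A A<3 mixed {u} {w} u∉ w∉ tu fw = walk (proj₂ (proj₂ conn) A A<3 u w u∉ w∉) u∉ tu
      where
      walk : ∀ {u} → ReachVia G (λ e → end₁ G e ∉ A × end₂ G e ∉ A) u w → u ∉ A → At true u → Empty
      walk ε u∉ tu = w∉ (mixed w (tu , fw))
      walk {u} (_◅_ {j = x} (e , (n₁ , n₂) , q) as) u∉ tu = step (bool-split (p e))
        where
        x∉ : Joins e u x → x ∉ A
        x∉ (inj₁ r) = subst (_∉ A) (cong proj₂ r) n₂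
        x∉ (inj₂ r) = subst (_∉ A) (cong proj₁ r) n₁
        back : Joins e u x → Joins e x u
        back (inj₁ r) = inj₂ r
        back (inj₂ r) = inj₁ r
        step : p e ≡ true ⊎ p e ≡ false → Empty
        step (inj₁ t) = walk as (x∉ q) (e , u , t , back q)
        step (inj₂ f) = u∉ (mixed u (tu , (e , x , f , q)))

    ∣pair∣<3 : ∀ (a b : Fin (nV G)) → ∣ ⁅ a ⁆ ∪ ⁅ b ⁆ ∣ < 3
    ∣pair∣<3 a b = s≤s (≤-trans (∣∪∣≤ ⁅ a ⁆ ⁅ b ⁆) (≤-reflexive (cong₂ _+_ (Subₚ.∣⁅x⁆∣≡1 a) (Subₚ.∣⁅x⁆∣≡1 b))))

    pairˡ : ∀ (a b : Fin (nV G)) → a ∈ ⁅ a ⁆ ∪ ⁅ b ⁆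
    pairˡ a b = Subₚ.x∈p∪q⁺ (inj₁ (Subₚ.x∈⁅x⁆ a))

    pairʳ : ∀ (a b : Fin (nV G)) → b ∈ ⁅ a ⁆ ∪ ⁅ b ⁆
    pairʳ a b = Subₚ.x∈p∪q⁺ (inj₂ (Subₚ.x∈⁅x⁆ b))

    ∉-pair : ∀ {x a b : Fin (nV G)} → x ≢ a → x ≢ b → x ∉ ⁅ a ⁆ ∪ ⁅ b ⁆
    ∉-pair {x} {a} {b} na nb m = at (Subₚ.x∈p∪q⁻ ⁅ a ⁆ ⁅ b ⁆ m)
      where
      at : x ∈ ⁅ a ⁆ ⊎ x ∈ ⁅ b ⁆ → Empty
      at (inj₁ q) = na (Subₚ.x∈⁅y⁆⇒x≡y a q)
      at (inj₂ q) = nb (Subₚ.x∈⁅y⁆⇒x≡y b q)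

    outside-end : ∀ a b {e f} → e ≢ f → ∀ v → p e ≡ v → p f ≡ v → ∃[ u ] (u ∉ ⁅ a ⁆ ∪ ⁅ b ⁆ × At v u)
    outside-end a b {e} {f} e≢f v pe pf = at (inside? (end₁ G e)) (inside? (end₂ G e)) (inside? (end₁ G f)) (inside? (end₂ G f))
      where
      inside? : ∀ u → Dec (u ≡ a ⊎ u ≡ b)
      inside? u = (u ≟F a) ⊎-dec (u ≟F b)
      out : ∀ {u} → ¬ (u ≡ a ⊎ u ≡ b) → u ∉ ⁅ a ⁆ ∪ ⁅ b ⁆
      out n = ∉-pair (n ∘ inj₁) (n ∘ inj₂)
      pairs : ∀ g → end₁ G g ≡ a ⊎ end₁ G g ≡ b → end₂ G g ≡ a ⊎ end₂ G g ≡ b → Joins g a b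
      pairs g (inj₁ q) (inj₁ r) = absurd (proj₁ simple g (trans q (sym r)))
      pairs g (inj₁ q) (inj₂ r) = inj₁ (cong₂ _,_ q r)
      pairs g (inj₂ q) (inj₁ r) = inj₂ (cong₂ _,_ q r)
      pairs g (inj₂ q) (inj₂ r) = absurd (proj₁ simple g (trans q (sym r)))
      at : Dec (end₁ G e ≡ a ⊎ end₁ G e ≡ b) → Dec (end₂ G e ≡ a ⊎ end₂ G e ≡ b) → Dec (end₁ G f ≡ a ⊎ end₁ G f ≡ b) → Dec (end₂ G f ≡ a ⊎ end₂ G f ≡ b) → ∃[ u ] (u ∉ ⁅ a ⁆ ∪ ⁅ b ⁆ × At v u)
      at (no n) _ _ _ = end₁ G e , out n , e , end₂ G e , pe , inj₁ refl
      at (yes _) (no n) _ _ = end₂ G e , out n , e , end₁ G e , pe , inj₂ refl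
      at (yes _) (yes _) (no n) _ = end₁ G f , out n , f , end₂ G f , pf , inj₁ refl
      at (yes _) (yes _) (yes _) (no n) = end₂ G f , out n , f , end₁ G f , pf , inj₂ refl
      at (yes q) (yes r) (yes q′) (yes r′) = absurd (e≢f (joins-parallel (pairs e q r) (pairs f q′ r′)))

    module _ {e f} (ef : e ≢ f) (pe : p e ≡ true) (pf : p f ≡ true) {g h} (gh : g ≢ h) (pg : p g ≡ false) (ph : p h ≡ false) where

      third-mixed : ∀ a b → ∃[ v ] (Mixed v × v ≢ a × v ≢ b)
      third-mixed a b = at (Finₚ.any? λ v → mixed? v ×-dec ¬? (v ≟F a) ×-dec ¬? (v ≟F b))
        where
        at : Dec (∃[ v ] (Mixed v × v ≢ a × v ≢ b)) → ∃[ v ] (Mixed v × v ≢ a × v ≢ b)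
        at (yes r) = r
        at (no n) = let (u , u∉ , tu) = outside-end a b ef true pe pf ; (w , w∉ , fw) = outside-end a b gh false pg ph in
          absurd (no-passage (⁅ a ⁆ ∪ ⁅ b ⁆) (∣pair∣<3 a b) (λ v m → inPair v m (v ≟F a) (v ≟F b)) u∉ w∉ tu fw)
          where
          inPair : ∀ v → Mixed v → Dec (v ≡ a) → Dec (v ≡ b) → v ∈ ⁅ a ⁆ ∪ ⁅ b ⁆
          inPair v m (yes refl) _ = pairˡ v b
          inPair v m (no _) (yes refl) = pairʳ a v
          inPair v m (no na) (no nb) = absurd (n (v , m , na , nb))

      -- v with edges s ∈ p and t ∉ p to x and y, and w off v, x, y, both mixed
      Spot : Set
      Spot = ∃[ v ] ∃[ x ] ∃[ y ] ∃[ s ] ∃[ t ] ∃[ w ] (p s ≡ true × p t ≡ false × Joins s v x × Joins t v y × Mixed w × w ≢ v × w ≢ x × w ≢ y)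

      some-vertex : Fin (nV G)
      some-vertex = end₁ G e

      neighbour-off : ∀ v x y → v ≢ x → v ≢ y → ∃[ r ] ∃[ q ] (Joins r v q × q ≢ x × q ≢ y)
      neighbour-off v x y vx vy = first-step (proj₂ (proj₂ conn) (⁅ x ⁆ ∪ ⁅ y ⁆) (∣pair∣<3 x y) v u (∉-pair vx vy) (∉-pair (proj₁ (proj₂ fourth)) (proj₁ (proj₂ (proj₂ fourth)))))
        where
        fourth : ∃[ u ] (u ≢ x × u ≢ y × u ≢ v)
        fourth = at (Finₚ.any? λ u → ¬? (u ≟F x) ×-dec ¬? (u ≟F y) ×-dec ¬? (u ≟F v))
          where
          A : Subset (nV G)
          A = (⁅ x ⁆ ∪ ⁅ y ⁆) ∪ ⁅ v ⁆
          at : Dec (∃[ u ] (u ≢ x × u ≢ y × u ≢ v)) → ∃[ u ] (u ≢ x × u ≢ y × u ≢ v)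
          at (yes r) = r
          at (no n) = absurd (<⇒≱ (proj₁ (proj₂ conn)) (≤-trans (≤-reflexive (sym (Subₚ.∣⊤∣≡n (nV G)))) (≤-trans (Subₚ.p⊆q⇒∣p∣≤∣q∣ {p = ⊤} {q = A} λ {u} _ → in-A u (u ≟F x) (u ≟F y) (u ≟F v))
            (≤-trans (∣∪∣≤ (⁅ x ⁆ ∪ ⁅ y ⁆) ⁅ v ⁆) (≤-trans (+-monoˡ-≤ ∣ ⁅ v ⁆ ∣ (≤-pred (∣pair∣<3 x y))) (≤-reflexive (cong (2 +_) (Subₚ.∣⁅x⁆∣≡1 v))))))))
            where
            in-A : ∀ u → Dec (u ≡ x) → Dec (u ≡ y) → Dec (u ≡ v) → u ∈ A
            in-A u (yes refl) _ _ = Subₚ.x∈p∪q⁺ (inj₁ (pairˡ u y))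
            in-A u (no _) (yes refl) _ = Subₚ.x∈p∪q⁺ (inj₁ (pairʳ x u))
            in-A u (no _) (no _) (yes refl) = Subₚ.x∈p∪q⁺ (inj₂ (Subₚ.x∈⁅x⁆ u))
            in-A u (no a) (no b) (no c) = absurd (n (u , a , b , c))
        u = proj₁ fourth
        first-step : ReachVia G (λ e → end₁ G e ∉ ⁅ x ⁆ ∪ ⁅ y ⁆ × end₂ G e ∉ ⁅ x ⁆ ∪ ⁅ y ⁆) v u → ∃[ r ] ∃[ q ] (Joins r v q × q ≢ x × q ≢ y)
        first-step as = go as refl
          where
          go : ∀ {w} → ReachVia G (λ e → end₁ G e ∉ ⁅ x ⁆ ∪ ⁅ y ⁆ × end₂ G e ∉ ⁅ x ⁆ ∪ ⁅ y ⁆) v w → w ≡ u → ∃[ r ] ∃[ q ] (Joins r v q × q ≢ x × q ≢ y)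
          go ε q = absurd (proj₂ (proj₂ (proj₂ fourth)) (sym q))
          go (_◅_ {j = q} (r , (n₁ , n₂) , j) _) _ = r , q , j , away j (λ { refl → pairˡ q y }) , away j (λ { refl → pairʳ x q })
            where
            away : ∀ {z} → Joins r v q → (q ≡ z → q ∈ ⁅ x ⁆ ∪ ⁅ y ⁆) → q ≢ z
            away (inj₁ k) f e = n₂ (subst (_∈ ⁅ x ⁆ ∪ ⁅ y ⁆) (sym (cong proj₂ k)) (f e))
            away (inj₂ k) f e = n₁ (subst (_∈ ⁅ x ⁆ ∪ ⁅ y ⁆) (sym (cong proj₁ k)) (f e))

      -- Three mixed vertices exist, as no two vertices cover them all. If the only candidates for
      -- `w` are the neighbours `x` and `y` of `v`, another neighbour of `v` replaces one of them,
      -- according to the side of its edge, and the replaced vertex serves as `w`.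
      spot : Spot
      spot = from (third-mixed some-vertex some-vertex)
        where
        distinct-ends : ∀ {v x y s t} → p s ≡ true → p t ≡ false → Joins s v x → Joins t v y → x ≢ y
        distinct-ends {v} {x} {y} {s} {t} ps pt j k refl = false≢true (trans (cong p (sym (joins-parallel j k))) ps) pt
        from : ∃[ v ] (Mixed v × v ≢ some-vertex × v ≢ some-vertex) → Spot
        from (v , mv@((s , x , ps , vx) , (t , y , pt , vy)) , _) = another (third-mixed v x)
          where
          x≢y = distinct-ends ps pt vx vy
          another : ∃[ w ] (Mixed w × w ≢ v × w ≢ x) → Spot
          another (w , mw , wv , wx) = cases (w ≟F y)
            where
            cases : Dec (w ≡ y) → Spot
            cases (no wy) = v , x , y , s , t , w , ps , pt , vx , vy , mw , wv , wx , wy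
            cases (yes refl) = third (third-mixed v w)
              where
              third : ∃[ u ] (Mixed u × u ≢ v × u ≢ w) → Spot
              third (u , mu , uv , uw) = cases′ (u ≟F x)
                where
                cases′ : Dec (u ≡ x) → Spot
                cases′ (no ux) = v , x , w , s , t , u , ps , pt , vx , vy , mu , uv , ux , uw
                cases′ (yes refl) = extra (neighbour-off v u w (uv ∘ sym) (wv ∘ sym))
                  where
                  extra : ∃[ r ] ∃[ q ] (Joins r v q × q ≢ u × q ≢ w) → Spot
                  extra (r , q , vq , qu , qw) = side (bool-split (p r))
                    where
                    side : p r ≡ true ⊎ p r ≡ false → Spot
                    side (inj₁ pr) = v , q , w , r , t , u , pr , pt , vq , vy , mu , uv , qu ∘ sym , uw
                    side (inj₂ pr) = v , u , q , s , r , w , ps , pr , vx , vq , mw , wv , wx , qw ∘ sym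

      two-connected : 2 + R (λ _ → true) ≤ R p + R (λ i → not (p i))
      two-connected = use spot
        where
        use : Spot → _
        use (v , x , y , s , t , w , ps , pt , vx , vy , ((s′ , x′ , ps′ , wx′) , (t′ , y′ , pt′ , wy′)) , wv , wx , wy) =
          -- The part of the first cycle is odd at `v`, and that of the second is odd at `w`. The
          -- first cycle avoids `w`, so the sum of the parts is odd at `w` as well.
          two-crossings C₁.c C₂.c C₁.is-cycle C₂.is-cycle (odd v (C₁.odd-at-v p ps pt)) (odd w (C₂.odd-at-v p ps′ pt′))
            (odd w (trans (dot-⊕ (star G w) (part C₂.c) (part C₁.c)) (cong₂ _xor_ (C₂.odd-at-v p ps′ pt′) (C₁.even-at p ps pt (pairʳ v w) wv))))
          where
          module C₁ = CycleAt (⁅ v ⁆ ∪ ⁅ w ⁆) (∣pair∣<3 v w) (pairˡ v w) vx vy (∉-pair (joins-≢ vx ∘ sym) (wx ∘ sym)) (∉-pair (joins-≢ vy ∘ sym) (wy ∘ sym))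
          module C₂ = CycleAt (⁅ w ⁆ ∪ ⁅ w ⁆) (∣pair∣<3 w w) (pairˡ w w) wx′ wy′ (∉-pair (joins-≢ wx′ ∘ sym) (joins-≢ wx′ ∘ sym)) (∉-pair (joins-≢ wy′ ∘ sym) (joins-≢ wy′ ∘ sym))
          odd : ∀ u {c} → boundary₂ G c u ≡ true → ¬ Cycle K c
          odd u b cc = false≢true b (cycle⇒boundary G cc u)

    one-connected : ∃[ e ] (p e ≡ true) → ∃[ g ] (p g ≡ false) → 1 + R (λ _ → true) ≤ R p + R (λ i → not (p i))
    one-connected (e , pe) (g , pg) = use (Finₚ.any? mixed?)
      where
      use : Dec (∃[ v ] Mixed v) → _
      use (no n) = absurd (no-passage ⊥ (s≤s (≤-trans (≤-reflexive (Subₚ.∣⊥∣≡0 (nV G))) z≤n)) (λ v m → absurd (n (v , m))) {end₁ G e} {end₁ G g} Subₚ.∉⊥ Subₚ.∉⊥ (e , end₂ G e , pe , inj₁ refl) (g , end₂ G g , pg , inj₁ refl))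
      use (yes (w , (s′ , x′ , ps′ , wx′) , (t′ , y′ , pt′ , wy′))) = one-crossing C₂.c C₂.is-cycle λ cc → false≢true (C₂.odd-at-v p ps′ pt′) (cycle⇒boundary G cc w)
        where
        module C₂ = CycleAt (⁅ w ⁆ ∪ ⁅ w ⁆) (∣pair∣<3 w w) (pairˡ w w) wx′ wy′ (∉-pair (joins-≢ wx′ ∘ sym) (joins-≢ wx′ ∘ sym)) (∉-pair (joins-≢ wy′ ∘ sym) (joins-≢ wy′ ∘ sym))

  connected₃ : Connected₃ K
  connected₃ p ab pa pb cd pc pd = Partition.two-connected p ab pa pb cd pc pd

  connectedMatroid : ConnectedMatroid 3 (Forest G)
  connectedMatroid = connected⇐ (represents-forest G) (λ p → Partition.one-connected p) connected₃

-- Minor models of graphs and minors of cycle matroids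

parity-swap : ∀ {a b} (f : Fin a → Fin b → Bool) → parity (λ i → parity (f i)) ≡ parity (λ j → parity (λ i → f i j))
parity-swap {zero}  {b} f = sym (parity-false {b} (λ _ → false) λ _ → refl)
parity-swap {suc a} {b} f = trans (cong (parity (f zero) xor_) (parity-swap (f ∘ suc))) (sym (parity-⊕ (f zero) (λ j → parity (λ i → f (suc i) j))))

parity-∧ : ∀ {n} b (f : Fin n → Bool) → b ∧ parity f ≡ parity (λ i → b ∧ f i)
parity-∧ true  f = refl
parity-∧ {n} false f = sym (parity-false {n} (λ _ → false) λ _ → refl)

parity-delta : ∀ {n} (f : Fin n → Bool) a → parity (λ v → f v ∧ does (v ≟F a)) ≡ f a
parity-delta f a = trans (parity-remove _ a) (trans (cong₂ _xor_ (trans (cong (f a ∧_) (point-refl a)) (Boolₚ.∧-identityʳ _))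
  (parity-false _ λ i → bool-law (λ (x , y) → (x ∧ y) ∧ not y) (λ _ → false) (f i , point a i))) (Boolₚ.xor-identityʳ _))

parity⇒∃ : ∀ {n} (f : Fin n → Bool) → parity f ≡ true → ∃[ i ] (f i ≡ true)
parity⇒∃ f e = at (Finₚ.any? λ i → f i Boolₚ.≟ true)
  where
  at : Dec (∃[ i ] (f i ≡ true)) → ∃[ i ] (f i ≡ true)
  at (yes h) = h
  at (no n) = absurd (false≢true e (parity-false f λ i → not-true λ h → n (i , h)))

parity-another : ∀ {n} (f : Fin n → Bool) → parity f ≡ false → ∀ i → f i ≡ true → ∃[ j ] (f j ≡ true × j ≢ i)
parity-another f e i fi = let (j , h) = parity⇒∃ (λ j → f j ∧ not (point i j)) (Boolₚ.not-injective (trans (sym (cong (_xor parity (λ j → f j ∧ not (point i j))) fi)) (trans (sym (parity-remove f i)) e))) in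
  j , proj₁ (∧-true h) , λ q → false≢true (proj₂ (∧-true {f j} h)) (cong not (subst (λ z → point i z ≡ true) (sym q) (point-refl i)))

cut-orthogonal : ∀ G (lab : Fin (nV G) → Bool) c → Cycle (cycleSpace G) c → parity (λ e → lookup c e ∧ (lab (end₁ G e) xor lab (end₂ G e))) ≡ false
cut-orthogonal G lab c cc = trans (parity-cong λ e → trans (cong (lookup c e ∧_) (sym (column e))) (parity-∧ (lookup c e) (λ v → lab v ∧ lookup (star G v) e)))
  (trans (parity-swap λ e v → lookup c e ∧ (lab v ∧ lookup (star G v) e)) (parity-false _ λ v → trans (parity-cong λ e → swap-and (lookup c e) (lab v) (lookup (star G v) e))
    (trans (sym (parity-∧ (lab v) (λ e → lookup (star G v) e ∧ lookup c e))) (trans (cong (lab v ∧_) (trans (sym (dot-parity (star G v) c)) (cycle⇒boundary G cc v))) (Boolₚ.∧-zeroʳ _)))))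
  where
  swap-and : ∀ a b d → a ∧ (b ∧ d) ≡ b ∧ (d ∧ a)
  swap-and a b d = bool-law (λ (a , b , d) → a ∧ (b ∧ d)) (λ (a , b , d) → b ∧ (d ∧ a)) (a , b , d)
  column : ∀ e → parity (λ v → lab v ∧ lookup (star G v) e) ≡ lab (end₁ G e) xor lab (end₂ G e)
  column e = trans (parity-cong λ v → trans (cong (lab v ∧_) (star≡ G v e)) (∧-distrib-xor (lab v) _ _))
    (trans (parity-⊕ (λ v → lab v ∧ does (v ≟F end₁ G e)) (λ v → lab v ∧ does (v ≟F end₂ G e))) (cong₂ _xor_ (parity-delta lab (end₁ G e)) (parity-delta lab (end₂ G e))))

module _ {G : Graph} {k} {C : Fin (nE G) → Bool} {ψ : Fin k → Fin (nE G)} (ψ-inj : Injective _≡_ _≡_ ψ) where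

  -- A labelling that is constant along contracted edges defines a cut disjoint from `C`;
  -- orthogonality to the lift becomes orthogonality to its trace.
  minor-cut : (lab : Fin (nV G) → Bool) → (∀ e → C e ≡ true → lab (end₁ G e) ≡ lab (end₂ G e)) → ∀ {y} → Lift (cycleSpace G) C ψ y →
    parity (λ x → lookup y x ∧ (lab (end₁ G (ψ x)) xor lab (end₂ G (ψ x)))) ≡ false
  minor-cut lab const {y} l = trans (parity-cong λ x → cong (_∧ (lab (end₁ G (ψ x)) xor lab (end₂ G (ψ x)))) (sym (extends l x)))
    (trans (sym (parity-reindex ψ ψ-inj f inside′)) (cut-orthogonal G lab (lift l) (cyc l)))
    where
    f : Fin (nE G) → Bool
    f e = lookup (lift l) e ∧ (lab (end₁ G e) xor lab (end₂ G e))
    inside′ : ∀ e → f e ≡ true → ∃[ x ] (ψ x ≡ e)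
    inside′ e h = let (ce , d) = ∧-true {lookup (lift l) e} h in at d (within l e ce)
      where
      at : lab (end₁ G e) xor lab (end₂ G e) ≡ true → C e ≡ true ⊎ (∃[ x ] (ψ x ≡ e)) → ∃[ x ] (ψ x ≡ e)
      at d (inj₂ h) = h
      at d (inj₁ h) = absurd (false≢true d (trans (cong (_xor lab (end₂ G e)) (const e h)) (Boolₚ.xor-same (lab (end₂ G e)))))

module FromModel (G H : Graph) (model : MinorModel G H) where
  open MinorModel model

  lab : Fin (nV H) → Fin (nV G) → Bool
  lab w g = is (β g)
    where
    is : Maybe (Fin (nV H)) → Bool
    is (just u) = does (w ≟F u)
    is nothing  = false

  lab-just : ∀ w {g u} → β g ≡ just u → lab w g ≡ does (w ≟F u)
  lab-just w {g} e rewrite e = refl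

  lab-cong : ∀ w {g g′} → β g ≡ β g′ → lab w g ≡ lab w g′
  lab-cong w {g} {g′} e rewrite e = refl

  off-C : ∀ x → lookup C (ψ x) ≡ false
  off-C x = ∉⇒false (ψ∉C x)

  down : ∀ y → Lift (cycleSpace G) (lookup C) ψ y → Cycle (cycleSpace H) y
  down y l = boundary⇒cycle H λ w → trans (dot-parity (star H w) y) (trans (parity-cong λ x → trans (Boolₚ.∧-comm _ (lookup y x)) (cong (lookup y x ∧_) (trans (star≡ H w x) (sym (ends-lab w x (ψ-ends x))))))
    (minor-cut {G} ψ-inj (lab w) (λ e h → lab-cong w (C-closed e (true⇒∈ h))) l))
    where
    ends-lab : ∀ w x → ((β (end₁ G (ψ x)) ≡ just (end₁ H x)) × (β (end₂ G (ψ x)) ≡ just (end₂ H x))) ⊎ ((β (end₁ G (ψ x)) ≡ just (end₂ H x)) × (β (end₂ G (ψ x)) ≡ just (end₁ H x))) →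
      lab w (end₁ G (ψ x)) xor lab w (end₂ G (ψ x)) ≡ does (w ≟F end₁ H x) xor does (w ≟F end₂ H x)
    ends-lab w x (inj₁ (a , b)) = cong₂ _xor_ (lab-just w a) (lab-just w b)
    ends-lab w x (inj₂ (a , b)) = trans (cong₂ _xor_ (lab-just w a) (lab-just w b)) (Boolₚ.xor-comm (does (w ≟F end₂ H x)) _)

  base : Fin (nV H) → Fin (nV G)
  base w = proj₁ (β-onto w)

  base-inj : ∀ {u w} → base u ≡ base w → u ≡ w
  base-inj {u} {w} e = just-injective (trans (sym (proj₂ (β-onto u))) (trans (cong β e) (proj₂ (β-onto w))))

  to-base : ∀ {g u} → β g ≡ just u → ∃[ c ] ((∀ j → lookup c j ≡ true → lookup C j ≡ true) × (∀ v → boundary₂ G c v ≡ does (v ≟F g) xor does (v ≟F base u)))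
  to-base {g} {u} e = let (c , s , b) = path₂ G (C-conn g (base u) u e (proj₂ (β-onto u))) in
    c , (λ j h → not-false λ f → s j h λ m → false≢true (∈⇒true m) f) , b

  -- ψ x completed inside C to a path between base points
  module Edge (x : Fin (nE H)) where
    both : ∃[ u ] ∃[ w ] (β (end₁ G (ψ x)) ≡ just u × β (end₂ G (ψ x)) ≡ just w × (∀ v → does (v ≟F base u) xor does (v ≟F base w) ≡ does (v ≟F base (end₁ H x)) xor does (v ≟F base (end₂ H x))))
    both = at (ψ-ends x)
      where
      at : _ → _
      at (inj₁ (a , b)) = end₁ H x , end₂ H x , a , b , λ _ → refl
      at (inj₂ (a , b)) = end₂ H x , end₁ H x , a , b , λ v → Boolₚ.xor-comm (does (v ≟F base (end₂ H x))) _
    p₁ = to-base (proj₁ (proj₂ (proj₂ both)))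
    p₂ = to-base (proj₁ (proj₂ (proj₂ (proj₂ both))))

    vec : Fin (nE G) → Bool
    vec e = (point (ψ x) e xor lookup (proj₁ p₁) e) xor lookup (proj₁ p₂) e

    vec-boundary : ∀ v → parity (λ e → lookup (star G v) e ∧ vec e) ≡ does (v ≟F base (end₁ H x)) xor does (v ≟F base (end₂ H x))
    vec-boundary v = trans (parity-cong λ e → trans (∧-distrib-xor (lookup (star G v) e) _ _) (cong (_xor (lookup (star G v) e ∧ lookup (proj₁ p₂) e)) (∧-distrib-xor (lookup (star G v) e) _ _)))
      (trans (parity-⊕ (λ e → (lookup (star G v) e ∧ point (ψ x) e) xor (lookup (star G v) e ∧ lookup (proj₁ p₁) e)) (λ e → lookup (star G v) e ∧ lookup (proj₁ p₂) e))
      (trans (cong₂ _xor_ (parity-⊕ (λ e → lookup (star G v) e ∧ point (ψ x) e) (λ e → lookup (star G v) e ∧ lookup (proj₁ p₁) e)) (trans (sym (dot-parity (star G v) (proj₁ p₂))) (proj₂ (proj₂ p₂) v)))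
      (trans (cong (_xor (does (v ≟F end₂ G (ψ x)) xor does (v ≟F base w))) (cong₂ _xor_ (trans (parity-delta (lookup (star G v)) (ψ x)) (star≡ G v (ψ x))) (trans (sym (dot-parity (star G v) (proj₁ p₁))) (proj₂ (proj₂ p₁) v))))
      (trans (bool-law (λ (a , b , c , d) → ((a xor b) xor (a xor c)) xor (b xor d)) (λ (a , b , c , d) → c xor d) (does (v ≟F end₁ G (ψ x)) , does (v ≟F end₂ G (ψ x)) , does (v ≟F base u) , does (v ≟F base w)))
        (proj₂ (proj₂ (proj₂ (proj₂ both))) v)))))
      where
      u = proj₁ both
      w = proj₁ (proj₂ both)

    vec-ψ : ∀ x′ → vec (ψ x′) ≡ does (x ≟F x′)
    vec-ψ x′ = trans (cong₂ _xor_ (trans (cong (point (ψ x) (ψ x′) xor_) (off-path p₁)) (Boolₚ.xor-identityʳ (point (ψ x) (ψ x′)))) (off-path p₂)) (trans (Boolₚ.xor-identityʳ (point (ψ x) (ψ x′))) same-point)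
      where
      off-path : ∀ {B : Subset (nE G) → Set} (q : ∃[ c ] ((∀ j → lookup c j ≡ true → lookup C j ≡ true) × B c)) → lookup (proj₁ q) (ψ x′) ≡ false
      off-path q = not-true λ h → false≢true (proj₁ (proj₂ q) (ψ x′) h) (off-C x′)
      same-point : point (ψ x) (ψ x′) ≡ does (x ≟F x′)
      same-point = bool-≡ (λ h → subst (λ z → does (x ≟F z) ≡ true) (sym (ψ-inj (point⇒≡ h))) (point-refl x)) (λ h → subst (λ z → point (ψ x) (ψ z) ≡ true) (point⇒≡ {g = x′} {x} h) (point-refl (ψ x)))

    vec-within : ∀ e → vec e ≡ true → lookup C e ≡ true ⊎ ψ x ≡ e
    vec-within e h = at (xor-true (point (ψ x) e xor lookup (proj₁ p₁) e) (lookup (proj₁ p₂) e) h)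
      where
      at : point (ψ x) e xor lookup (proj₁ p₁) e ≡ true ⊎ lookup (proj₁ p₂) e ≡ true → lookup C e ≡ true ⊎ ψ x ≡ e
      at (inj₂ q) = inj₁ (proj₁ (proj₂ p₂) e q)
      at (inj₁ q) = at′ (xor-true (point (ψ x) e) (lookup (proj₁ p₁) e) q)
        where
        at′ : point (ψ x) e ≡ true ⊎ lookup (proj₁ p₁) e ≡ true → lookup C e ≡ true ⊎ ψ x ≡ e
        at′ (inj₁ r) = inj₂ (sym (point⇒≡ r))
        at′ (inj₂ r) = inj₁ (proj₁ (proj₂ p₁) e r)

  up : ∀ y → Cycle (cycleSpace H) y → Lift (cycleSpace G) (lookup C) ψ y
  up y cy = mkLift (tabulate g) (boundary⇒cycle G bd) (λ x → trans (Vecₚ.lookup∘tabulate g (ψ x)) (trans (parity-cong λ x′ → cong (lookup y x′ ∧_) (Edge.vec-ψ x′ x)) (parity-delta (lookup y) x)))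
    λ e h → at e (parity⇒∃ (λ x → lookup y x ∧ Edge.vec x e) (trans (sym (Vecₚ.lookup∘tabulate g e)) h))
    where
    g : Fin (nE G) → Bool
    g e = parity (λ x → lookup y x ∧ Edge.vec x e)
    at : ∀ e → ∃[ x ] (lookup y x ∧ Edge.vec x e ≡ true) → lookup C e ≡ true ⊎ (∃[ x ] (ψ x ≡ e))
    at e (x , h) = at′ (Edge.vec-within x e (proj₂ (∧-true {lookup y x} h)))
      where
      at′ : lookup C e ≡ true ⊎ ψ x ≡ e → lookup C e ≡ true ⊎ (∃[ x ] (ψ x ≡ e))
      at′ (inj₁ q) = inj₁ q
      at′ (inj₂ q) = inj₂ (x , q)
    bd : ∀ v → boundary₂ G (tabulate g) v ≡ false
    bd v = trans (dot-parity (star G v) (tabulate g)) (trans (parity-cong λ e → trans (cong (lookup (star G v) e ∧_) (Vecₚ.lookup∘tabulate g e)) (trans (parity-∧ (lookup (star G v) e) (λ x → lookup y x ∧ Edge.vec x e)) (parity-cong λ x → swap-and (lookup (star G v) e) (lookup y x) (Edge.vec x e))))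
      (trans (parity-swap λ e x → lookup y x ∧ (lookup (star G v) e ∧ Edge.vec x e)) (trans (parity-cong λ x → trans (sym (parity-∧ (lookup y x) (λ e → lookup (star G v) e ∧ Edge.vec x e))) (cong (lookup y x ∧_) (Edge.vec-boundary x v)))
      (ends-even (Finₚ.any? λ w → base w ≟F v)))))
      where
      swap-and : ∀ a b d → a ∧ (b ∧ d) ≡ b ∧ (a ∧ d)
      swap-and a b d = bool-law (λ (a , b , d) → a ∧ (b ∧ d)) (λ (a , b , d) → b ∧ (a ∧ d)) (a , b , d)
      ends-even : Dec (∃[ w ] (base w ≡ v)) → parity (λ x → lookup y x ∧ (does (v ≟F base (end₁ H x)) xor does (v ≟F base (end₂ H x)))) ≡ false
      ends-even (no n) = parity-false _ λ x → trans (cong (lookup y x ∧_) (cong₂ _xor_ (away (end₁ H x)) (away (end₂ H x)))) (Boolₚ.∧-zeroʳ _)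
        where
        away : ∀ u → does (v ≟F base u) ≡ false
        away u = not-true λ h → n (u , sym (point⇒≡ h))
      ends-even (yes (w , refl)) = trans (parity-cong λ x → trans (cong (lookup y x ∧_) (trans (cong₂ _xor_ (at-base (end₁ H x)) (at-base (end₂ H x))) (sym (star≡ H w x)))) (Boolₚ.∧-comm (lookup y x) _))
        (trans (sym (dot-parity (star H w) y)) (cycle⇒boundary H cy w))
        where
        at-base : ∀ u → does (base w ≟F base u) ≡ does (w ≟F u)
        at-base u = bool-≡ (λ h → subst (λ z → does (w ≟F z) ≡ true) (base-inj (point⇒≡ h)) (point-refl w)) (λ h → subst (λ z → does (base w ≟F base z) ≡ true) (point⇒≡ h) (point-refl (base w)))

  model⇒minor : Minor (cycleSpace G) (lookup C) ψ (cycleSpace H)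
  model⇒minor = record { inj = ψ-inj ; off = off-C ; same = λ y → down y , up y }

-- Recognising vertices by their stars

-- Hamilton cycles, chosen so that every nonempty cut other than a star crosses one of them at least
-- three times, while a star meets each exactly twice. `stars-ok` checks the choice.
circuitCodes : Target → List ℕ
circuitCodes t33  = 427 ∷ 245 ∷ 350 ∷ []
circuitCodes t01  = 826 ∷ 476 ∷ 742 ∷ []
circuitCodes t02  = 1708 ∷ 980 ∷ 1400 ∷ []
circuitCodes t11  = 1671 ∷ 1400 ∷ 952 ∷ []
circuitCodes t5   = 789 ∷ 234 ∷ []
circuitCodes fano = []

circuits : (t : Target) → List (Subset (edges t))
circuits t = map (bits (edges t)) (circuitCodes t)

circuitᵇ : (t : Target) → Subset (edges t) → Bool
circuitᵇ t O = kernelᵇ (rows t) O ∧ all (λ s → let c = comb (basis t) s in not (subᵇ c O) ∨ eqᵇ c ⊥ ∨ eqᵇ c O) (boolLists (length (chords t)))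

crosses : ∀ {n} → Subset n → Subset n → Bool
crosses s O = 3 ≤ᵇ ∣ s ∩ O ∣

-- A cut that meets every circuit of the list at most twice is a star.
starᵇ : (t : Target) → Subset (edges t) → Bool
starᵇ t s = not (all (λ b → not (dot s b)) (basis t)) ∨ eqᵇ s ⊥ ∨ any (eqᵇ s) (rows t) ∨ any (crosses s) (circuits t)

circuits-ok : ∀ t → T (all (circuitᵇ t) (circuits t))
circuits-ok t33  = tt
circuits-ok t01  = tt
circuits-ok t02  = tt
circuits-ok t11  = tt
circuits-ok t5   = tt
circuits-ok fano = tt

stars-ok : ∀ t → isFano t ≡ false → T (all (starᵇ t) (subsets (edges t)))
stars-ok t33 _ = tt
stars-ok t01 _ = tt
stars-ok t02 _ = tt
stars-ok t11 _ = tt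
stars-ok t5  _ = tt

girth-ok : ∀ t → T (all (λ s → let c = comb (basis t) s in eqᵇ c ⊥ ∨ (3 ≤ᵇ ∣ c ∣)) (boolLists (length (chords t))))
girth-ok t33  = tt
girth-ok t01  = tt
girth-ok t02  = tt
girth-ok t11  = tt
girth-ok t5   = tt
girth-ok fano = tt

degrees-ok : ∀ t → T (all (λ r → 2 ≤ᵇ ∣ r ∣) (rows t))
degrees-ok t33  = tt
degrees-ok t01  = tt
degrees-ok t02  = tt
degrees-ok t11  = tt
degrees-ok t5   = tt
degrees-ok fano = tt

T-any : ∀ {A : Set} (p : A → Bool) xs → T (any p xs) → ∃[ a ] (a ∈ₗ xs × T (p a))
T-any p (x ∷ xs) t with T-∨ {p x} t
... | inj₁ h = x , here refl , h
... | inj₂ h = let (a , m , q) = T-any p xs h in a , there m , q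

cycle-coordinates : ∀ t c → Cycle (space t) c → ∃[ s ] (s ∈ₗ boolLists (length (chords t)) × c ≡ comb (basis t) s)
cycle-coordinates t c cc = coordinates t c , subst (λ k → coordinates t c ∈ₗ boolLists k) (Listₚ.length-map (nth c) (chords t)) (∈-boolLists (coordinates t c)) , basis-complete t c cc

circuit-minimal : ∀ t {O} → O ∈ₗ circuits t → ∀ c → Cycle (space t) c → (∀ i → lookup c i ≡ true → lookup O i ≡ true) → ∀ i → lookup c i ≡ true → c ≡ O
circuit-minimal t {O} O∈ c cc c⊆O i ci = let (s , s∈ , e) = cycle-coordinates t c cc in
  subst (_≡ O) (sym e) (at s e (T-all _ (boolLists (length (chords t))) (proj₂ (T-∧ {kernelᵇ (rows t) O} (T-all (circuitᵇ t) (circuits t) (circuits-ok t) O∈))) s∈))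
  where
  at : ∀ s → c ≡ comb (basis t) s → T (not (subᵇ (comb (basis t) s) O) ∨ eqᵇ (comb (basis t) s) ⊥ ∨ eqᵇ (comb (basis t) s) O) → comb (basis t) s ≡ O
  at s refl h with subᵇ c O | ⊆⇒subᵇ c O c⊆O
  ... | true | _ with T-∨ {eqᵇ c ⊥} h
  ... | inj₁ z = absurd (false≢true ci (trans (cong (λ v → lookup v i) (eqᵇ⇒≡ c ⊥ z)) (lookup-⊥ i)))
  ... | inj₂ z = eqᵇ⇒≡ c O z

girth : ∀ t c → Cycle (space t) c → ∀ i → lookup c i ≡ true → 3 ≤ ∣ c ∣
girth t c cc i ci = let (s , s∈ , e) = cycle-coordinates t c cc in at s e (T-all _ (boolLists (length (chords t))) (girth-ok t) s∈)
  where
  at : ∀ s → c ≡ comb (basis t) s → T (eqᵇ (comb (basis t) s) ⊥ ∨ (3 ≤ᵇ ∣ comb (basis t) s ∣)) → 3 ≤ ∣ c ∣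
  at s refl h with T-∨ {eqᵇ c ⊥} h
  ... | inj₁ z = absurd (false≢true ci (trans (cong (λ v → lookup v i) (eqᵇ⇒≡ c ⊥ z)) (lookup-⊥ i)))
  ... | inj₂ z = ≤ᵇ⇒≤ 3 ∣ c ∣ z

at-most-two : ∀ {n} (c : Subset n) a b → (∀ i → lookup c i ≡ true → i ≡ a ⊎ i ≡ b) → ∣ c ∣ ≤ 2
at-most-two c a b h = ≤-trans (Subₚ.p⊆q⇒∣p∣≤∣q∣ {p = c} {q = ⁅ a ⁆ ∪ ⁅ b ⁆} λ {i} m → at i (h i (∈⇒true m)))
  (≤-trans (∣∪∣≤ ⁅ a ⁆ ⁅ b ⁆) (≤-reflexive (cong₂ _+_ (Subₚ.∣⁅x⁆∣≡1 a) (Subₚ.∣⁅x⁆∣≡1 b))))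
  where
  at : ∀ i → i ≡ a ⊎ i ≡ b → i ∈ ⁅ a ⁆ ∪ ⁅ b ⁆
  at i (inj₁ refl) = Subₚ.x∈p∪q⁺ (inj₁ (Subₚ.x∈⁅x⁆ i))
  at i (inj₂ refl) = Subₚ.x∈p∪q⁺ (inj₂ (Subₚ.x∈⁅x⁆ i))

∣∣⇒∃ : ∀ {n k} (c : Subset n) → suc k ≤ ∣ c ∣ → ∃[ i ] (lookup c i ≡ true)
∣∣⇒∃ {n} c le = at (Finₚ.any? λ i → lookup c i Boolₚ.≟ true)
  where
  at : Dec (∃[ i ] (lookup c i ≡ true)) → ∃[ i ] (lookup c i ≡ true)
  at (yes h) = h
  at (no none) = absurd (<⇒≱ (≤-trans (s≤s z≤n) (≤-trans le (≤-reflexive (trans (cong ∣_∣ (ext {c = c} {⊥} λ i → trans (not-true λ e → none (i , e)) (sym (lookup-⊥ i)))) (Subₚ.∣⊥∣≡0 n))))) z≤n)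

module ToModel (G : Graph) (t : Target) (graph : isFano t ≡ false) {C : Fin (nE G) → Bool} {ψ : Fin (edges t) → Fin (nE G)}
  (M : Minor (cycleSpace G) C ψ (space t)) where

  H = graphOf t
  open Components G

  l₀ : List (Fin (nE G))
  l₀ = elements C

  with-edges : List (Fin (edges t)) → List (Fin (nE G))
  with-edges ys = map ψ ys ++ l₀

  ρ : Fin (nV G) → Fin (nV G)
  ρ = rep l₀

  ρ⁺ : List (Fin (edges t)) → Fin (nV G) → Fin (nV G)
  ρ⁺ ys = rep (with-edges ys)

  ρ-C : ∀ e → C e ≡ true → ρ (end₁ G e) ≡ ρ (end₂ G e)
  ρ-C e h = rep-edge l₀ (∈-elements⁺ C h)

  -- A path between the ends of `ψ x` inside `C` and the edges `ys`, completed by `ψ x`, is a cycle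
  -- of `G` whose trace in the minor passes through `x`. Facts about circuits of the target thus
  -- restrict which vertices of the contraction can be joined.
  closes : ∀ ys x → ¬ (x ∈ₗ ys) → ρ⁺ ys (end₁ G (ψ x)) ≡ ρ⁺ ys (end₂ G (ψ x)) →
    ∃[ y ] (Cycle (space t) y × lookup y x ≡ true × (∀ i → lookup y i ≡ true → i ≡ x ⊎ i ∈ₗ ys))
  closes ys x x∉ e = restrict c ψ , proj₁ (same M _) (mkLift c cc (λ x → sym (lookup-restrict c ψ x)) λ j h → in-minor j (c-at j h)) ,
    trans (lookup-restrict c ψ x) at-x , λ i h → where-is i (c-at (ψ i) (trans (sym (lookup-restrict c ψ i)) h))
    where
    path = path₂ G (rep⇒reach (with-edges ys) e)
    open GraphUnit G
    c : Subset (nE G)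
    c = proj₁ path ⊕ unit (ψ x)
    path-in : ∀ j → lookup (proj₁ path) j ≡ true → j ∈ₗ with-edges ys
    path-in j h = decidable-stable (j ∈ₗ? with-edges ys) (proj₁ (proj₂ path) j h)
    c≡ : ∀ j → lookup c j ≡ lookup (proj₁ path) j xor point (ψ x) j
    c≡ j = trans (lookup-⊕ (proj₁ path) (unit (ψ x)) j) (cong (lookup (proj₁ path) j xor_) (Vecₚ.lookup∘tabulate (point (ψ x)) j))
    cc : Cycle (cycleSpace G) c
    cc = boundary⇒cycle G λ v → trans (dot-⊕ (star G v) (proj₁ path) (unit (ψ x))) (trans (cong₂ _xor_ (proj₂ (proj₂ path) v) (trans (boundary-unit v (ψ x)) (star≡ G v (ψ x)))) (Boolₚ.xor-same (does (v ≟F end₁ G (ψ x)) xor does (v ≟F end₂ G (ψ x)))))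
    c-at : ∀ j → lookup c j ≡ true → j ≡ ψ x ⊎ j ∈ₗ with-edges ys
    c-at j h = at (xor-true (lookup (proj₁ path) j) (point (ψ x) j) (trans (sym (c≡ j)) h))
      where
      at : lookup (proj₁ path) j ≡ true ⊎ point (ψ x) j ≡ true → j ≡ ψ x ⊎ j ∈ₗ with-edges ys
      at (inj₁ q) = inj₂ (path-in j q)
      at (inj₂ q) = inj₁ (point⇒≡ q)
    in-minor : ∀ j → j ≡ ψ x ⊎ j ∈ₗ with-edges ys → C j ≡ true ⊎ (∃[ i ] (ψ i ≡ j))
    in-minor j (inj₁ q) = inj₂ (x , sym q)
    in-minor j (inj₂ m) = at (Memₚ.∈-++⁻ (map ψ ys) m)
      where
      at : j ∈ₗ map ψ ys ⊎ j ∈ₗ l₀ → C j ≡ true ⊎ (∃[ i ] (ψ i ≡ j))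
      at (inj₁ q) = let (i , _ , r) = Memₚ.∈-map⁻ ψ q in inj₂ (i , sym r)
      at (inj₂ q) = inj₁ (∈-elements⁻ C q)
    ψ-in : ∀ i → ψ i ∈ₗ with-edges ys → i ∈ₗ ys
    ψ-in i m = at (Memₚ.∈-++⁻ (map ψ ys) m)
      where
      at : ψ i ∈ₗ map ψ ys ⊎ ψ i ∈ₗ l₀ → i ∈ₗ ys
      at (inj₁ q) = let (j , j∈ , r) = Memₚ.∈-map⁻ ψ q in subst (_∈ₗ ys) (sym (inj M r)) j∈
      at (inj₂ q) = absurd (false≢true (∈-elements⁻ C q) (off M i))
    at-x : lookup c (ψ x) ≡ true
    at-x = trans (c≡ (ψ x)) (cong₂ _xor_ (not-true λ h → x∉ (ψ-in x (path-in (ψ x) h))) (point-refl (ψ x)))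
    where-is : ∀ i → ψ i ≡ ψ x ⊎ ψ i ∈ₗ with-edges ys → i ≡ x ⊎ i ∈ₗ ys
    where-is i (inj₁ q) = inj₁ (inj M q)
    where-is i (inj₂ m) = inj₂ (ψ-in i m)

  coarser : ∀ ys {u w} → ρ u ≡ ρ w → ρ⁺ ys u ≡ ρ⁺ ys w
  coarser ys = rep-coarsen l₀ (with-edges ys) (Memₚ.∈-++⁺ʳ (map ψ ys))

  end₁′ end₂′ : Fin (edges t) → Fin (nV G)
  end₁′ x = ρ (end₁ G (ψ x))
  end₂′ x = ρ (end₂ G (ψ x))

  no-loop : ∀ x → end₁′ x ≢ end₂′ x
  no-loop x e = let (y , cy , yx , s) = closes [] x (λ ()) e in
    <⇒≱ (girth t y cy x yx) (at-most-two y x x λ i h → only i (s i h))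
    where
    only : ∀ i → i ≡ x ⊎ i ∈ₗ [] → i ≡ x ⊎ i ≡ x
    only i (inj₁ q) = inj₁ q

  no-parallel : ∀ x x′ → x ≢ x′ → ρ⁺ (x′ ∷ []) (end₁ G (ψ x)) ≡ ρ⁺ (x′ ∷ []) (end₂ G (ψ x)) → Empty
  no-parallel x x′ ne e = let (y , cy , yx , s) = closes (x′ ∷ []) x (λ { (here q) → ne q }) e in
    <⇒≱ (girth t y cy x yx) (at-most-two y x x′ λ i h → only i (s i h))
    where
    only : ∀ i → i ≡ x ⊎ i ∈ₗ (x′ ∷ []) → i ≡ x ⊎ i ≡ x′
    only i (inj₁ q) = inj₁ q
    only i (inj₂ (here q)) = inj₂ q

  -- the star of the vertex v of the contracted graph
  local : Fin (nV G) → Fin (edges t) → Bool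
  local v x = does (end₁′ x ≟F v) xor does (end₂′ x ≟F v)

  localStar : Fin (nV G) → Subset (edges t)
  localStar v = tabulate (local v)

  local-orthogonal : ∀ v y → Cycle (space t) y → dot (localStar v) y ≡ false
  local-orthogonal v y cy = trans (dot-parity (localStar v) y) (trans (parity-cong λ x → trans (Boolₚ.∧-comm _ (lookup y x)) (cong (lookup y x ∧_) (Vecₚ.lookup∘tabulate (local v) x)))
    (minor-cut {G} (inj M) (λ g → does (ρ g ≟F v)) (λ e h → cong (λ g → does (g ≟F v)) (ρ-C e h)) (proj₂ (same M y) cy)))

  record Meets (v : Fin (nV G)) (x : Fin (edges t)) : Set where
    field
      inner outer : Fin (nV G)
      ends′       : (inner ≡ end₁ G (ψ x) × outer ≡ end₂ G (ψ x)) ⊎ (inner ≡ end₂ G (ψ x) × outer ≡ end₁ G (ψ x))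
      inner-v     : ρ inner ≡ v
      outer-v     : ρ outer ≢ v

  open Meets

  meets′ : ∀ v x → local v x ≡ true → Meets v x
  meets′ v x h = at (end₁′ x ≟F v) (end₂′ x ≟F v) h
    where
    at : (a : Dec (end₁′ x ≡ v)) (b : Dec (end₂′ x ≡ v)) → does a xor does b ≡ true → Meets v x
    at (yes p) (no n)  _ = record { inner = end₁ G (ψ x) ; outer = end₂ G (ψ x) ; ends′ = inj₁ (refl , refl) ; inner-v = p ; outer-v = n }
    at (no n)  (yes p) _ = record { inner = end₂ G (ψ x) ; outer = end₁ G (ψ x) ; ends′ = inj₂ (refl , refl) ; inner-v = p ; outer-v = n }

  joined : ∀ ys {v x} (m : Meets v x) → ρ⁺ ys (inner m) ≡ ρ⁺ ys (outer m) → ρ⁺ ys (end₁ G (ψ x)) ≡ ρ⁺ ys (end₂ G (ψ x))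
  joined ys m e = at (ends′ m)
    where
    at : _ ⊎ _ → _
    at (inj₁ (p , q)) = trans (cong (ρ⁺ ys) (sym p)) (trans e (cong (ρ⁺ ys) q))
    at (inj₂ (p , q)) = trans (cong (ρ⁺ ys) (sym q)) (trans (sym e) (cong (ρ⁺ ys) p))

  joins-ends : ∀ ys {v x} (m : Meets v x) → x ∈ₗ ys → ρ⁺ ys (inner m) ≡ ρ⁺ ys (outer m)
  joins-ends ys {v} {x} m x∈ = at (ends′ m)
    where
    edge : ρ⁺ ys (end₁ G (ψ x)) ≡ ρ⁺ ys (end₂ G (ψ x))
    edge = rep-edge (with-edges ys) (Memₚ.∈-++⁺ˡ (Memₚ.∈-map⁺ ψ x∈))
    at : _ ⊎ _ → _
    at (inj₁ (p , q)) = trans (cong (ρ⁺ ys) p) (trans edge (cong (ρ⁺ ys) (sym q)))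
    at (inj₂ (p , q)) = trans (cong (ρ⁺ ys) p) (trans (sym edge) (cong (ρ⁺ ys) (sym q)))

  -- A circuit passes through the vertex v at most once: by parity some other
  -- edge of it at v reaches the component of the outer end of the first.
  passes-once : ∀ v {O} → O ∈ₗ circuits t → ¬ T (crosses (localStar v) O)
  passes-once v {O} O∈ cr = start (∣∣⇒∃ (localStar v ∩ O) three)
    where
    three : 3 ≤ ∣ localStar v ∩ O ∣
    three = ≤ᵇ⇒≤ 3 _ cr
    cO : Cycle (space t) O
    cO = kernelᵇ⇒ (rows t) O (proj₁ (T-∧ {kernelᵇ (rows t) O} (T-all (circuitᵇ t) (circuits t) (circuits-ok t) O∈)))
    lookup-∩ : ∀ x → lookup (localStar v ∩ O) x ≡ local v x ∧ lookup O x
    lookup-∩ x = trans (Vecₚ.lookup-zipWith _∧_ x (localStar v) O) (cong (_∧ lookup O x) (Vecₚ.lookup∘tabulate (local v) x))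
    rest′ : Fin (edges t) → Bool
    rest′ x = lookup O x ∧ not (local v x)
    ts : List (Fin (edges t))
    ts = elements rest′
    impossible : ∀ x₁ x₂ y → Cycle (space t) y → lookup y x₁ ≡ true → lookup O x₁ ≡ true → lookup O x₂ ≡ true → (∀ i → lookup y i ≡ true → i ≡ x₁ ⊎ i ∈ₗ (x₂ ∷ ts)) → Empty
    impossible x₁ x₂ y cy yx o₁ o₂ s = <⇒≱ three (at-most-two (localStar v ∩ O) x₁ x₂ λ i h → let (li , oi) = ∧-true {local v i} (trans (sym (lookup-∩ i)) h) in pick i li (s i (trans (cong (λ w → lookup w i) y≡O) oi)))
      where
      inO : ∀ i → i ≡ x₁ ⊎ i ∈ₗ (x₂ ∷ ts) → lookup O i ≡ true
      inO i (inj₁ refl) = o₁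
      inO i (inj₂ (here refl)) = o₂
      inO i (inj₂ (there m)) = proj₁ (∧-true (∈-elements⁻ rest′ m))
      y≡O : y ≡ O
      y≡O = circuit-minimal t O∈ y cy (λ i h → inO i (s i h)) x₁ yx
      pick : ∀ i → local v i ≡ true → i ≡ x₁ ⊎ i ∈ₗ (x₂ ∷ ts) → i ≡ x₁ ⊎ i ≡ x₂
      pick i li (inj₁ q) = inj₁ q
      pick i li (inj₂ (here q)) = inj₂ q
      pick i li (inj₂ (there m)) = absurd (false≢true (proj₂ (∧-true {lookup O i} (∈-elements⁻ rest′ m))) (cong not li))
    start : ∃[ x ] (lookup (localStar v ∩ O) x ≡ true) → Empty
    start (x₁ , h) = compare (ρ⁺ ts (inner m₁) ≟F ρ⁺ ts (outer m₁))
      where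
      l₁′ : local v x₁ ≡ true
      l₁′ = proj₁ (∧-true (trans (sym (lookup-∩ x₁)) h))
      o₁ : lookup O x₁ ≡ true
      o₁ = proj₂ (∧-true {local v x₁} (trans (sym (lookup-∩ x₁)) h))
      m₁ = meets′ v x₁ l₁′
      x₁∉ts : ¬ (x₁ ∈ₗ ts)
      x₁∉ts m = false≢true (proj₂ (∧-true {lookup O x₁} (∈-elements⁻ rest′ m))) (cong not l₁′)
      compare : Dec (ρ⁺ ts (inner m₁) ≡ ρ⁺ ts (outer m₁)) → Empty
      compare (yes e) = let (y , cy , yx , s) = closes ts x₁ x₁∉ts (joined ts m₁ e) in
        impossible x₁ x₁ y cy yx o₁ o₁ λ i q → weaken (s i q)
        where
        weaken : ∀ {i} → i ≡ x₁ ⊎ i ∈ₗ ts → i ≡ x₁ ⊎ i ∈ₗ (x₁ ∷ ts)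
        weaken (inj₁ q) = inj₁ q
        weaken (inj₂ q) = inj₂ (there q)
      compare (no apart) = found (parity-another (λ x → lookup O x ∧ (lab (end₁ G (ψ x)) xor lab (end₂ G (ψ x))))
          (minor-cut {G} (inj M) lab (λ e q → cong (λ g → does (g ≟F ρ⁺ ts (outer m₁))) (coarser ts (ρ-C e q))) (proj₂ (same M O) cO)) x₁ (∧-both o₁ (cut-at m₁ lab-outer lab-inner)))
        where
        lab : Fin (nV G) → Bool
        lab g = does (ρ⁺ ts g ≟F ρ⁺ ts (outer m₁))
        lab-outer : lab (outer m₁) ≡ true
        lab-outer = point-refl (ρ⁺ ts (outer m₁))
        lab-inner : lab (inner m₁) ≡ false
        lab-inner = not-true λ q → apart (point⇒≡ q)
        cut-at : ∀ {x} (m : Meets v x) → lab (outer m) ≡ true → lab (inner m) ≡ false → lab (end₁ G (ψ x)) xor lab (end₂ G (ψ x)) ≡ true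
        cut-at m a b = at (ends′ m)
          where
          at : _ ⊎ _ → _
          at (inj₁ (p , q)) = cong₂ _xor_ (trans (cong lab (sym p)) b) (trans (cong lab (sym q)) a)
          at (inj₂ (p , q)) = cong₂ _xor_ (trans (cong lab (sym q)) a) (trans (cong lab (sym p)) b)
        found : ∃[ x₂ ] (lookup O x₂ ∧ (lab (end₁ G (ψ x₂)) xor lab (end₂ G (ψ x₂))) ≡ true × x₂ ≢ x₁) → Empty
        found (x₂ , q , x₂≢x₁) = let (y , cy , yx , s) = closes (x₂ ∷ ts) x₁ x₁∉ (joined (x₂ ∷ ts) m₁ chain) in impossible x₁ x₂ y cy yx o₁ o₂ s
          where
          o₂ : lookup O x₂ ≡ true
          o₂ = proj₁ (∧-true q)
          cut₂ : lab (end₁ G (ψ x₂)) xor lab (end₂ G (ψ x₂)) ≡ true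
          cut₂ = proj₂ (∧-true {lookup O x₂} q)
          x₁∉ : ¬ (x₁ ∈ₗ (x₂ ∷ ts))
          x₁∉ (here r)  = x₂≢x₁ (sym r)
          x₁∉ (there r) = x₁∉ts r
          l₂′ : local v x₂ ≡ true
          l₂′ = not-false λ r → false≢true cut₂ (trans (cong (_xor lab (end₂ G (ψ x₂))) (cong (λ g → does (g ≟F ρ⁺ ts (outer m₁))) (rep-edge (with-edges ts) (Memₚ.∈-++⁺ˡ (Memₚ.∈-map⁺ ψ (∈-elements⁺ rest′ (∧-both o₂ (cong not r)))))))) (Boolₚ.xor-same (lab (end₂ G (ψ x₂)))))
          m₂ = meets′ v x₂ l₂′
          inner₂ : lab (inner m₂) ≡ false
          inner₂ = trans (cong (λ g → does (g ≟F ρ⁺ ts (outer m₁))) (coarser ts (trans (inner-v m₂) (sym (inner-v m₁))))) lab-inner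
          outer₂ : lab (outer m₂) ≡ true
          outer₂ = at (ends′ m₂)
            where
            at : (inner m₂ ≡ end₁ G (ψ x₂) × outer m₂ ≡ end₂ G (ψ x₂)) ⊎ (inner m₂ ≡ end₂ G (ψ x₂) × outer m₂ ≡ end₁ G (ψ x₂)) → lab (outer m₂) ≡ true
            at (inj₁ (a , b)) = trans (cong lab b) (xor-both cut₂ (trans (cong lab (sym a)) inner₂))
            at (inj₂ (a , b)) = trans (cong lab b) (xor-both (trans (Boolₚ.xor-comm (lab (end₂ G (ψ x₂))) _) cut₂) (trans (cong lab (sym a)) inner₂))
          chain : ρ⁺ (x₂ ∷ ts) (inner m₁) ≡ ρ⁺ (x₂ ∷ ts) (outer m₁)
          chain = trans (coarser (x₂ ∷ ts) (trans (inner-v m₁) (sym (inner-v m₂)))) (trans (joins-ends (x₂ ∷ ts) m₂ (here refl))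
            (rep-coarsen (with-edges ts) (with-edges (x₂ ∷ ts)) there (point⇒≡ outer₂)))

  star-or-empty : ∀ v → localStar v ≡ ⊥ ⊎ localStar v ∈ₗ rows t
  star-or-empty v = at (T-all (starᵇ t) (subsets (edges t)) (stars-ok t graph) (∈-subsets (localStar v)))
    where
    orthogonal : T (all (λ b → not (dot (localStar v) b)) (basis t))
    orthogonal = all-T (basis t) (basis-sound t)
      where
      all-T : ∀ bs → All.All (Cycle (space t)) bs → T (all (λ b → not (dot (localStar v) b)) bs)
      all-T [] _ = tt
      all-T (b ∷ bs) (c All.∷ cs) rewrite local-orthogonal v b c = all-T bs cs
    fire : ∀ {a b} → T (not a ∨ b) → T a → T b
    fire {true} h _ = h
    at : T (starᵇ t (localStar v)) → localStar v ≡ ⊥ ⊎ localStar v ∈ₗ rows t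
    at h = cases (T-∨ {eqᵇ (localStar v) ⊥} (fire {all (λ b → not (dot (localStar v) b)) (basis t)} h orthogonal))
      where
      cases : T (eqᵇ (localStar v) ⊥) ⊎ T (any (eqᵇ (localStar v)) (rows t) ∨ any (crosses (localStar v)) (circuits t)) → localStar v ≡ ⊥ ⊎ localStar v ∈ₗ rows t
      cases (inj₁ q) = inj₁ (eqᵇ⇒≡ _ _ q)
      cases (inj₂ q) = cases′ (T-∨ {any (eqᵇ (localStar v)) (rows t)} q)
        where
        cases′ : T (any (eqᵇ (localStar v)) (rows t)) ⊎ T (any (crosses (localStar v)) (circuits t)) → localStar v ≡ ⊥ ⊎ localStar v ∈ₗ rows t
        cases′ (inj₁ r) = let (a , a∈ , e) = T-any (eqᵇ (localStar v)) (rows t) r in inj₂ (subst (_∈ₗ rows t) (sym (eqᵇ⇒≡ _ _ e)) a∈)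
        cases′ (inj₂ r) = let (O , O∈ , e) = T-any (crosses (localStar v)) (circuits t) r in absurd (passes-once v O∈ e)

  local-true : ∀ v x → lookup (localStar v) x ≡ local v x
  local-true v = Vecₚ.lookup∘tabulate (local v)

  -- Distinct vertices have distinct stars, since parallel edges are excluded.
  same-star : ∀ v v′ {r} → r ∈ₗ rows t → localStar v ≡ r → localStar v′ ≡ r → v ≡ v′
  same-star v v′ {r} r∈ e e′ = decide (v ≟F v′)
    where
    two : 2 ≤ ∣ r ∣
    two = ≤ᵇ⇒≤ 2 ∣ r ∣ (T-all (λ r → 2 ≤ᵇ ∣ r ∣) (rows t) (degrees-ok t) r∈)
    at-v : ∀ {x} → lookup r x ≡ true → local v x ≡ true
    at-v {x} h = trans (sym (local-true v x)) (trans (cong (λ w → lookup w x) e) h)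
    at-v′ : ∀ {x} → lookup r x ≡ true → local v′ x ≡ true
    at-v′ {x} h = trans (sym (local-true v′ x)) (trans (cong (λ w → lookup w x) e′) h)
    decide : Dec (v ≡ v′) → v ≡ v′
    decide (yes q) = q
    decide (no ne) = absurd (first-edge (∣∣⇒∃ r two))
      where
      outer-v′ : ∀ {x} (m : Meets v x) → Meets v′ x → ρ (outer m) ≡ v′
      outer-v′ {x} m m′ = at (ends′ m) (ends′ m′)
        where
        at : _ ⊎ _ → _ ⊎ _ → ρ (outer m) ≡ v′
        at (inj₁ (a , b)) (inj₁ (c , d)) = absurd (ne (trans (sym (inner-v m)) (trans (cong ρ (trans a (sym c))) (inner-v m′))))
        at (inj₁ (a , b)) (inj₂ (c , d)) = trans (cong ρ (trans b (sym c))) (inner-v m′)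
        at (inj₂ (a , b)) (inj₁ (c , d)) = trans (cong ρ (trans b (sym c))) (inner-v m′)
        at (inj₂ (a , b)) (inj₂ (c , d)) = absurd (ne (trans (sym (inner-v m)) (trans (cong ρ (trans a (sym c))) (inner-v m′))))
      first-edge : ∃[ x ] (lookup r x ≡ true) → Empty
      first-edge (x , h) = another (Finₚ.any? λ x′ → (lookup r x′ Boolₚ.≟ true) ×-dec ¬? (x ≟F x′))
        where
        another : Dec (∃[ x′ ] (lookup r x′ ≡ true × x ≢ x′)) → Empty
        another (no n) = <⇒≱ (s≤s (s≤s z≤n)) (≤-trans two (≤-trans (Subₚ.p⊆q⇒∣p∣≤∣q∣ {p = r} {q = ⁅ x ⁆} λ {i} m → single′ i (x ≟F i) m) (≤-reflexive (Subₚ.∣⁅x⁆∣≡1 x))))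
          where
          single′ : ∀ i → Dec (x ≡ i) → i ∈ r → i ∈ ⁅ x ⁆
          single′ i (yes refl) _ = Subₚ.x∈⁅x⁆ i
          single′ i (no q) m = absurd (n (i , ∈⇒true m , q))
        another (yes (x′ , h′ , x≢x′)) = no-parallel x x′ x≢x′ (joined (x′ ∷ []) m (trans (coarser (x′ ∷ []) (trans (inner-v m) (sym (inner-v n))))
            (trans (joins-ends (x′ ∷ []) n (here refl)) (coarser (x′ ∷ []) (trans (outer-v′ n (meets′ v′ x′ (at-v′ h′))) (sym (outer-v′ m (meets′ v′ x (at-v′ h)))))))))
          where
          m = meets′ v x (at-v h)
          n = meets′ v x′ (at-v h′)

  Named : Fin (nV G) → Set
  Named v = ∃[ w ] (localStar v ≡ star H w)

  named? : ∀ v → Dec (Named v)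
  named? v = Finₚ.any? λ w → Vecₚ.≡-dec Boolₚ._≟_ (localStar v) (star H w)

  name : ∀ {v} → Dec (Named v) → Maybe (Fin (nV H))
  name (yes (w , _)) = just w
  name (no _)        = nothing

  -- Vertices of the contraction with empty local star receive `nothing`; every other one has the
  -- star of a vertex of `H`.
  β : Fin (nV G) → Maybe (Fin (nV H))
  β g = name (named? (ρ g))

  name-just : ∀ {v u} (d : Dec (Named v)) → name d ≡ just u → localStar v ≡ star H u
  name-just (yes (w , q)) refl = q

  β-just : ∀ {g u} → β g ≡ just u → localStar (ρ g) ≡ star H u
  β-just {g} = name-just (named? (ρ g))

  name-defined : ∀ {v} (d : Dec (Named v)) → localStar v ∈ₗ rows t → ∃[ u ] (name d ≡ just u)
  name-defined (yes (w , q)) _ = w , refl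
  name-defined {v} (no n) r∈ = let (w , _ , q) = Memₚ.∈-map⁻ (star H) (subst (localStar v ∈ₗ_) (graph-rows t graph) r∈) in absurd (n (w , q))

  β-defined : ∀ {g} → localStar (ρ g) ∈ₗ rows t → ∃[ u ] (β g ≡ just u)
  β-defined {g} = name-defined (named? (ρ g))

  star∈rows : ∀ u → star H u ∈ₗ rows t
  star∈rows u = subst (star H u ∈ₗ_) (sym (graph-rows t graph)) (Memₚ.∈-map⁺ (star H) (Memₚ.∈-allFin u))

  β-ρ : ∀ {g g′} → ρ g ≡ ρ g′ → β g ≡ β g′
  β-ρ = cong (λ v → name (named? v))

  at-end : ∀ g x → local (ρ g) x ≡ true → ∃[ u ] (β g ≡ just u × (u ≡ end₁ H x ⊎ u ≡ end₂ H x))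
  at-end g x h = at (star-or-empty (ρ g))
    where
    at : localStar (ρ g) ≡ ⊥ ⊎ localStar (ρ g) ∈ₗ rows t → _
    at (inj₁ q) = absurd (false≢true (trans (sym (cong (λ w → lookup w x) q)) (trans (local-true (ρ g) x) h)) (lookup-⊥ x))
    at (inj₂ q) = let (u , e) = β-defined {g} q in u , e , ends-of u (xor-true (does (u ≟F end₁ H x)) (does (u ≟F end₂ H x)) (trans (sym (star≡ H u x)) (trans (cong (λ w → lookup w x) (sym (β-just e))) (trans (local-true (ρ g) x) h))))
      where
      ends-of : ∀ u → does (u ≟F end₁ H x) ≡ true ⊎ does (u ≟F end₂ H x) ≡ true → u ≡ end₁ H x ⊎ u ≡ end₂ H x
      ends-of u (inj₁ q) = inj₁ (point⇒≡ q)
      ends-of u (inj₂ q) = inj₂ (point⇒≡ q)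

  local-end₁ : ∀ x → local (end₁′ x) x ≡ true
  local-end₁ x = cong₂ _xor_ (point-refl (end₁′ x)) (not-true {does (end₂′ x ≟F end₁′ x)} λ q → no-loop x (sym (point⇒≡ q)))

  local-end₂ : ∀ x → local (end₂′ x) x ≡ true
  local-end₂ x = cong₂ _xor_ (not-true {does (end₁′ x ≟F end₂′ x)} λ q → no-loop x (point⇒≡ q)) (point-refl (end₂′ x))

  separate : ∀ x {u w} → β (end₁ G (ψ x)) ≡ just u → β (end₂ G (ψ x)) ≡ just w → u ≢ w
  separate x {u} e e′ refl = no-loop x (same-star (end₁′ x) (end₂′ x) (star∈rows u) (β-just e) (β-just e′))

  Ends : Fin (edges t) → Set
  Ends x = ((β (end₁ G (ψ x)) ≡ just (end₁ H x)) × (β (end₂ G (ψ x)) ≡ just (end₂ H x))) ⊎ ((β (end₁ G (ψ x)) ≡ just (end₂ H x)) × (β (end₂ G (ψ x)) ≡ just (end₁ H x)))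

  ψ-ends : ∀ x → Ends x
  ψ-ends x = at (at-end (end₁ G (ψ x)) x (local-end₁ x)) (at-end (end₂ G (ψ x)) x (local-end₂ x))
    where
    at : ∃[ u ] (β (end₁ G (ψ x)) ≡ just u × (u ≡ end₁ H x ⊎ u ≡ end₂ H x)) → ∃[ w ] (β (end₂ G (ψ x)) ≡ just w × (w ≡ end₁ H x ⊎ w ≡ end₂ H x)) → _
    at (_ , e , inj₁ refl) (_ , e′ , inj₂ refl) = inj₁ (e , e′)
    at (_ , e , inj₂ refl) (_ , e′ , inj₁ refl) = inj₂ (e , e′)
    at (_ , e , inj₁ refl) (_ , e′ , inj₁ refl) = absurd (separate x e e′ refl)
    at (_ , e , inj₂ refl) (_ , e′ , inj₂ refl) = absurd (separate x e e′ refl)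

  β-onto : ∀ u → ∃[ g ] (β g ≡ just u)
  β-onto u = at (∣∣⇒∃ (star H u) (≤ᵇ⇒≤ 2 _ (T-all (λ r → 2 ≤ᵇ ∣ r ∣) (rows t) (degrees-ok t) (star∈rows u))))
    where
    at : ∃[ x ] (lookup (star H u) x ≡ true) → ∃[ g ] (β g ≡ just u)
    at (x , h) = pick (xor-true (does (u ≟F end₁ H x)) (does (u ≟F end₂ H x)) (trans (sym (star≡ H u x)) h)) (ψ-ends x)
      where
      pick : does (u ≟F end₁ H x) ≡ true ⊎ does (u ≟F end₂ H x) ≡ true → Ends x → ∃[ g ] (β g ≡ just u)
      pick (inj₁ q) (inj₁ (a , b)) = end₁ G (ψ x) , trans a (cong just (sym (point⇒≡ q)))
      pick (inj₁ q) (inj₂ (a , b)) = end₂ G (ψ x) , trans b (cong just (sym (point⇒≡ q)))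
      pick (inj₂ q) (inj₁ (a , b)) = end₂ G (ψ x) , trans b (cong just (sym (point⇒≡ q)))
      pick (inj₂ q) (inj₂ (a , b)) = end₁ G (ψ x) , trans a (cong just (sym (point⇒≡ q)))

  model : MinorModel G H
  model = record
    { C        = tabulate C
    ; β        = β
    ; ψ        = ψ
    ; ψ-inj    = inj M
    ; ψ∉C      = λ x m → false≢true (trans (sym (Vecₚ.lookup∘tabulate C (ψ x))) (∈⇒true m)) (off M x)
    ; β-onto   = β-onto
    ; C-closed = λ c c∈ → β-ρ (ρ-C c (trans (sym (Vecₚ.lookup∘tabulate C c)) (∈⇒true c∈)))
    ; C-conn   = λ g g′ u e e′ → reach-mono (λ i m → true⇒∈ (trans (Vecₚ.lookup∘tabulate C i) (∈-elements⁻ C m))) (rep⇒reach l₀ (same-star (ρ g) (ρ g′) (star∈rows u) (β-just e) (β-just e′)))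
    ; ψ-ends   = ψ-ends
    }

-- Rerooting minors at a given edge

record Root : Set where
  constructor root
  field
    start                    : Start
    mapCode liftCode coCode : ℕ

roots33 : List Root
roots33 =
    root s33 0x876543210 0x8421 0x2489224F007007
  ∷ root s33 0x867534201 0xC431 0x24849497007007
  ∷ root s33 0x768435102 0xC832 0x12449927007007
  ∷ root s33 0x825714603 0xA251 0x380071C4912449
  ∷ root s33 0x825603714 0xF351 0x380071C4909292
  ∷ root s33 0x714603825 0xF3A2 0x380071C2489324
  ∷ root s33 0x528417306 0xA854 0x7007E04912449
  ∷ root s33 0x528306417 0xFC54 0x7007E04909292
  ∷ root s33 0x417306528 0xFCA8 0x7007E02489324
  ∷ []

roots01 : List Root
roots01 =
    root s01 0x9876543210 0x1041041 0x9212524F801C00E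
  ∷ root s33 0x987654321 0x82483 0x9212524F801C00E
  ∷ root s33 0x978645312 0xCA4E3 0x92093497801C00E
  ∷ root s33 0x879546213 0xCC0E4 0x49493923801C00E
  ∷ root s33 0x936825714 0xA1143 0xE000E1C24849493
  ∷ root s33 0x936714825 0xF1D43 0xE000E1C24824D25
  ∷ root s33 0x825714936 0xF1E84 0xE000E1C12524E48
  ∷ root s33 0x639528417 0xA4149 0x1C00EE024849493
  ∷ root s33 0x639417528 0xF6549 0x1C00EE024824D25
  ∷ root s33 0x528417639 0xF6690 0x1C00EE012524E48
  ∷ []

roots02 : List Root
roots02 =
    root s01 0xA987654320 0x2240A101 0x24924B24BC007001C
  ∷ root s01 0x8A95762431 0x11C05303 0x92C92497C007001C
  ∷ root s33 0xA98765432 0x891285 0x24924B24BC007001C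
  ∷ root s33 0xA89756423 0xCD13C5 0x249125497C007001C
  ∷ root s33 0x98A657324 0xCE23CA 0x125925925C007001C
  ∷ root s33 0xA47936825 0xA0A505 0x38001C1C124925925
  ∷ root s33 0xA47825936 0xF0F505 0x38001C1C124892A4B
  ∷ root s33 0x936825A47 0xF0FA0A 0x38001C1C092C92C92
  ∷ root s33 0x74A639528 0xA22511 0x7001CE0124925925
  ∷ root s33 0x74A528639 0xF33511 0x7001CE0124892A4B
  ∷ root s33 0x63952874A 0xF33A22 0x7001CE0092C92C92
  ∷ []

roots11 : List Root
roots11 =
    root s01 0xA749638520 0x20211142 0x3800E103B24125126
  ∷ root s01 0xA987654321 0x2040A181 0x24824A24DC007081D
  ∷ root s33 0xA98765432 0x811287 0x24824A24DC007081D
  ∷ root s33 0xA89756423 0xC51347 0x248126495C007081D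
  ∷ root s33 0x98A657324 0xC6034A 0x125126921C007081D
  ∷ root s33 0xA47936825 0xA8A587 0x38001D1C324125126
  ∷ root s33 0xA47825936 0xF0D587 0x38001D1C32409324A
  ∷ root s33 0x936825A47 0xF0DA8A 0x38001D1C292893490
  ∷ root s33 0x74A639528 0xAA0591 0x7081DE0124125126
  ∷ root s33 0x74A528639 0xF31591 0x7081DE012409324A
  ∷ root s33 0x63952874A 0xF31AA0 0x7081DE0092893490
  ∷ []

roots5 : List Root
roots5 =
    root s5 0x9876543210 0x810204081 0x348A91921C40F
  ∷ root s5 0x9658743201 0x804090201 0x348A90716480F
  ∷ root s5 0x8649753102 0x404060202 0x34864871A900F
  ∷ root s5 0x7549862103 0x202060404 0x2A464871D200F
  ∷ root s5 0x9328716504 0x9840952C1 0x348A900F64871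
  ∷ root s5 0x8319726405 0x5440662C2 0x3486480FA9071
  ∷ root s5 0x7219835406 0x2C2066544 0x2A46480FD2071
  ∷ root s5 0x6309528417 0x5500782C8 0x3481C40FA9192
  ∷ root s5 0x5209637418 0x2C8078550 0x2A41C40FD2192
  ∷ root s5 0x4108637529 0x2C80B89A0 0x1921C40FD22A4
  ∷ []

-- Defined by cases because the number of edges becomes a successor only when `s` is known.
zeroEdge : ∀ s → Fin (edges (targetOf s))
zeroEdge s33 = zero
zeroEdge s01 = zero
zeroEdge s5  = zero

isFiveStart : Start → Bool
isFiveStart s5 = true
isFiveStart _  = false

-- The start has the same rank as the graph that contains it, so the contracted set is empty.
rootOK : ∀ {M} → List (Subset (suc M)) → Fin (suc M) → Root → Bool
rootOK {M} gens x (root s a c d) = does (lookup ψ (zeroEdge s) ≟F x) ∧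
  minorOK gens ψ ⊥ (basis t) (rows t) (bitLists (length (basisCodes t)) (length gens) c) (bitVectors (length (rowCodes t)) d)
  where
  t = targetOf s
  ψ : Vec (Fin (suc M)) (edges t)
  ψ = digits (edges t) a

Rooted : ∀ {n} → Binary n → Fin n → Bool → Set
Rooted K e five = ∃[ s ] ∃[ C ] ∃[ ψ ] (Minor K C ψ (space (targetOf s)) × ψ (zeroEdge s) ≡ e × T (five ∨ not (isFiveStart s)))

rootOK⇒ : ∀ {M} (L : Binary (suc M)) gens → All.All (Cycle L) gens → (∀ c → Cycle L c → Spanned gens c) → ∀ five x r →
  T (rootOK gens x r ∧ (five ∨ not (isFiveStart (Root.start r)))) → Rooted L x five
rootOK⇒ {M} L gens in-L spanned five x (root s a c d) ok = s , lookup ⊥ , lookup ψ ,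
  minorOK⇒ gens ψ ⊥ L in-L spanned (basis t) (rows t) ss qs (proj₂ t₂) (basis-spans t) , point⇒≡ (T⇒≡ (proj₁ t₂)) , proj₂ t₁
  where
  t = targetOf s
  ψ : Vec (Fin (suc M)) (edges t)
  ψ = digits (edges t) a
  ss = bitLists (length (basisCodes t)) (length gens) c
  qs : List (Subset (suc M))
  qs = bitVectors (length (rowCodes t)) d
  t₁ = T-∧ {rootOK gens x (root s a c d)} ok
  t₂ = T-∧ {does (lookup ψ (zeroEdge s) ≟F x)} (proj₁ t₁)

rooted : ∀ t → isFano t ≡ false → ∀ x → Rooted (space t) x (isFive t)
rooted t33 _ x = let (r , ok) = allZip-∈ (λ x r → rootOK (basis t33) x r ∧ (false ∨ not (isFiveStart (Root.start r)))) (allFin 9) roots33 tt (Memₚ.∈-allFin x) in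
  rootOK⇒ (space t33) (basis t33) (basis-sound t33) (basis-spans t33) false x r ok
rooted t01 _ x = let (r , ok) = allZip-∈ (λ x r → rootOK (basis t01) x r ∧ (false ∨ not (isFiveStart (Root.start r)))) (allFin 10) roots01 tt (Memₚ.∈-allFin x) in
  rootOK⇒ (space t01) (basis t01) (basis-sound t01) (basis-spans t01) false x r ok
rooted t02 _ x = let (r , ok) = allZip-∈ (λ x r → rootOK (basis t02) x r ∧ (false ∨ not (isFiveStart (Root.start r)))) (allFin 11) roots02 tt (Memₚ.∈-allFin x) in
  rootOK⇒ (space t02) (basis t02) (basis-sound t02) (basis-spans t02) false x r ok
rooted t11 _ x = let (r , ok) = allZip-∈ (λ x r → rootOK (basis t11) x r ∧ (false ∨ not (isFiveStart (Root.start r)))) (allFin 11) roots11 tt (Memₚ.∈-allFin x) in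
  rootOK⇒ (space t11) (basis t11) (basis-sound t11) (basis-spans t11) false x r ok
rooted t5 _ x = let (r , ok) = allZip-∈ (λ x r → rootOK (basis t5) x r ∧ (true ∨ not (isFiveStart (Root.start r)))) (allFin 10) roots5 tt (Memₚ.∈-allFin x) in
  rootOK⇒ (space t5) (basis t5) (basis-sound t5) (basis-spans t5) true x r ok

-- Two prescribed elements in one minor.

no-loop-at : ∀ t (z : Fin (edges t)) (Y : Subset (edges t)) → (∀ i → lookup Y i ≡ true → i ≡ z) → Independent (space t) Y
no-loop-at t z Y h c cc s i = not-true λ e → <⇒≱ (girth t c cc i e) (at-most-two c z z λ j q → inj₁ (h j (s j q)))

e₀-only : ∀ {m} (i : Fin (suc m)) → lookup e₀ i ≡ true → i ≡ zero
e₀-only zero    _ = refl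
e₀-only (suc i) e = absurd (false≢true e (lookup-⊥ i))

bring : ∀ s {n} (K : Binary n) → Connected₃ K → ∀ {C ψ} → Minor K C ψ (space (targetOf s)) → ∀ f → (∀ x → ψ x ≢ f) → Result K (ψ (zeroEdge s) ∷ f ∷ []) (isFiveStart s)
bring s33 K conn M f f∉ = Step.both-ends (space t33) (basis t33) (basis-sound t33) (basis-spans t33) (tree s33) (decompose s33) false
  colK33 rowK33 triadK33 triK33 colTable-K33 rowTable-K33 triadTable-K33 triTable-K33
  -- The witness that `zero` is not a coloop is the first basis cycle of the target; the same choice
  -- is made for the other two starts.
  (no-loop-at t33 zero e₀ e₀-only) (bits 9 27 , kernelᵇ⇒ (rows t33) (bits 9 27) tt , refl) K conn M f f∉
bring s01 K conn M f f∉ = Step.both-ends (space t01) (basis t01) (basis-sound t01) (basis-spans t01) (tree s01) (decompose s01) false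
  colK33⁰¹ rowK33⁰¹ triadK33⁰¹ triK33⁰¹ colTable-K33⁰¹ rowTable-K33⁰¹ triadTable-K33⁰¹ triTable-K33⁰¹
  (no-loop-at t01 zero e₀ e₀-only) (bits 10 7 , kernelᵇ⇒ (rows t01) (bits 10 7) tt , refl) K conn M f f∉
bring s5 K conn M f f∉ = Step.both-ends (space t5) (basis t5) (basis-sound t5) (basis-spans t5) (tree s5) (decompose s5) true
  colK5 rowK5 triadK5 triK5 colTable-K5 rowTable-K5 triadTable-K5 triTable-K5
  (no-loop-at t5 zero e₀ e₀-only) (bits 10 19 , kernelᵇ⇒ (rows t5) (bits 10 19) tt , refl) K conn M f f∉

module Core {n} (K : Binary n) (conn : Connected₃ K) (no-fano : ∀ {C ψ} → Minor K C ψ (space fano) → Empty) (five : Bool) where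

  Allowed : Target → Set
  Allowed t = isFano t ≡ false × T (five ∨ not (isFive t))

  HasMinor : List (Fin n) → Set
  HasMinor l = ∃[ t ] ∃[ C ] ∃[ ψ ] (Allowed t × Minor K C ψ (space t) × (∀ i → i ∈ₗ l → ∃[ x ] (ψ x ≡ i)))

  private
    weaken : ∀ {a b} → T (five ∨ not a) → T (a ∨ not b) → T (five ∨ not b)
    weaken {a} {b} h k = go five a b h k
      where
      go : ∀ f a b → T (f ∨ not a) → T (a ∨ not b) → T (f ∨ not b)
      go true  a b _ _ = tt
      go false false b _ k = k

    -- A step from `K33` or `K33⁰¹` never ends in `K5`, as its result carries the flag of its start.
    -- This lets one argument serve the families with and without `K5`.
    found : ∀ {l s} → T (five ∨ not (isFiveStart s)) → Result K l (isFiveStart s) → HasMinor l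
    found {l} {s} h (result t C ψ M g k) = go (bool-split (isFano t)) g
      where
      go : isFano t ≡ true ⊎ isFano t ≡ false → isFano t ≡ true ⊎ (∀ i → i ∈ₗ l → ∃[ x ] (ψ x ≡ i)) → HasMinor l
      go (inj₂ f) (inj₂ g) = t , C , ψ , (f , weaken {isFiveStart s} {isFive t} h k) , M , g
      go (inj₂ f) (inj₁ e) = absurd (false≢true e f)
      go (inj₁ e) _ = absurd (fano-case t e M)
        where
        fano-case : ∀ t → isFano t ≡ true → ∀ {C ψ} → Minor K C ψ (space t) → Empty
        fano-case fano _ M = no-fano M

    reroot : ∀ {t C ψ} → Allowed t → Minor K C ψ (space t) → ∀ x → Σ (Rooted K (ψ x) five) λ r → ∀ y → ∃[ z ] (ψ z ≡ proj₁ (proj₂ (proj₂ r)) y)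
    reroot {t} {C} {ψ} (f , a) M x = let (s , C′ , ψ′ , M′ , e , k) = rooted t f x in
      (s , _ , ψ ∘ ψ′ , compose M M′ , cong ψ e , weaken {isFive t} {isFiveStart s} a k) , λ y → ψ′ y , refl

    some-edge : ∀ t → isFano t ≡ false → Fin (edges t)
    some-edge t33 _ = zero
    some-edge t01 _ = zero
    some-edge t02 _ = zero
    some-edge t11 _ = zero
    some-edge t5  _ = zero

    -- If `e` is outside the minor, rerooting at an arbitrary edge first yields one of the starts,
    -- because only those have tables. Its image lies in the old one, so `e` is still outside and
    -- can be brought in; the result is then rerooted at `e`.
    anchor : ∀ {t C ψ} → Allowed t → Minor K C ψ (space t) → ∀ e → Rooted K e five
    anchor {t} {C} {ψ} al M e = go (Finₚ.any? λ x → ψ x ≟F e)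
      where
      go : Dec (∃[ x ] (ψ x ≡ e)) → Rooted K e five
      go (yes (x , refl)) = proj₁ (reroot al M x)
      go (no n) = next (reroot al M (some-edge t (proj₁ al)))
        where
        next : Σ (Rooted K (ψ (some-edge t (proj₁ al))) five) (λ r → ∀ y → ∃[ z ] (ψ z ≡ proj₁ (proj₂ (proj₂ r)) y)) → Rooted K e five
        next ((s , C′ , ψ′ , M′ , q , k) , im) = last (found {s = s} k (bring s K conn M′ e λ y r → n (proj₁ (im y) , trans (proj₂ (im y)) r)))
          where
          last : HasMinor (ψ′ (zeroEdge s) ∷ e ∷ []) → Rooted K e five
          last (t″ , C″ , ψ″ , al″ , M″ , g) = let (x , r) = g e (there (here refl)) in subst (λ z → Rooted K z five) r (proj₁ (reroot al″ M″ x))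

  both : ∀ {t C ψ} → Allowed t → Minor K C ψ (space t) → ∀ e f → HasMinor (e ∷ f ∷ [])
  both al M e f = go (anchor al M e)
    where
    start-allowed : ∀ s → T (five ∨ not (isFiveStart s)) → Allowed (targetOf s)
    start-allowed s33 k = refl , k
    start-allowed s01 k = refl , k
    start-allowed s5  k = refl , k
    go : Rooted K e five → HasMinor (e ∷ f ∷ [])
    go (s , C′ , ψ′ , M′ , refl , k) = decide (Finₚ.any? λ x → ψ′ x ≟F f)
      where
      decide : Dec (∃[ x ] (ψ′ x ≡ f)) → HasMinor (ψ′ (zeroEdge s) ∷ f ∷ [])
      decide (yes (x , q)) = targetOf s , C′ , ψ′ , start-allowed s k , M′ , at
        where
        at : ∀ i → i ∈ₗ (ψ′ (zeroEdge s) ∷ f ∷ []) → ∃[ x ] (ψ′ x ≡ i)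
        at i (here r) = zeroEdge s , sym r
        at i (there (here r)) = x , trans q (sym r)
      decide (no n) = found {s = s} k (bring s K conn M′ f λ x q → n (x , q))

two-members : ∀ {n} (X : Subset n) → ∣ X ∣ ≡ 2 → ∃[ e ] ∃[ f ] (∀ g → g ∈ X → g ∈ₗ (e ∷ f ∷ []))
two-members X h = go (elements (lookup X)) (trans (length-elements X) h) λ g m → ∈-elements⁺ (lookup X) (∈⇒true m)
  where
  go : ∀ l → length l ≡ 2 → (∀ g → g ∈ X → g ∈ₗ l) → ∃[ e ] ∃[ f ] (∀ g → g ∈ X → g ∈ₗ (e ∷ f ∷ []))
  go (e ∷ f ∷ []) _ k = e , f , k

graph-space : ∀ t → isFano t ≡ false → space t ≡ cycleSpace (graphOf t)
graph-space t f = cong kernel (graph-rows t f)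

familyOf : Bool → List Target
familyOf false = t33 ∷ t01 ∷ t02 ∷ t11 ∷ []
familyOf true  = t33 ∷ t01 ∷ t02 ∷ t11 ∷ t5 ∷ []

member-allowed : ∀ five {t} → t ∈ₗ familyOf five → isFano t ≡ false × T (five ∨ not (isFive t))
member-allowed five m = go five m
  where
  go : ∀ five {t} → t ∈ₗ familyOf five → isFano t ≡ false × T (five ∨ not (isFive t))
  go true  (here refl) = refl , tt
  go true  (there (here refl)) = refl , tt
  go true  (there (there (here refl))) = refl , tt
  go true  (there (there (there (here refl)))) = refl , tt
  go true  (there (there (there (there (here refl))))) = refl , tt
  go false (here refl) = refl , tt
  go false (there (here refl)) = refl , tt
  go false (there (there (here refl))) = refl , tt
  go false (there (there (there (here refl)))) = refl , tt

allowed-member : ∀ five t → isFano t ≡ false → T (five ∨ not (isFive t)) → t ∈ₗ familyOf five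
allowed-member true  t33 _ _ = here refl
allowed-member true  t01 _ _ = there (here refl)
allowed-member true  t02 _ _ = there (there (here refl))
allowed-member true  t11 _ _ = there (there (there (here refl)))
allowed-member true  t5  _ _ = there (there (there (there (here refl))))
allowed-member false t33 _ _ = here refl
allowed-member false t01 _ _ = there (here refl)
allowed-member false t02 _ _ = there (there (here refl))
allowed-member false t11 _ _ = there (there (there (here refl)))

no-fano-minor : ∀ {n r} (A : Fin r → Fin n → Z₃) {I : IndepPred n} {K : Binary n} → Represents I K →
  (∀ X → (I X → LinIndep F₃ A X) × (LinIndep F₃ A X → I X)) → ∀ {C ψ} → Minor K C ψ (space fano) → Empty
no-fano-minor A rep₂ rep₃ {C} M = let (C′ , M′ , ind) = independent-contraction ∣ tabulate C ∣ C ≤-refl M in NoFano.contradiction A rep₂ rep₃ M′ ind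

-- 3-connectivity of the graphs in the families

module Search (G : Graph) (A : Subset (nV G)) where

  avoids′ : Fin (nE G) → Bool
  avoids′ e = not (lookup A (end₁ G e)) ∧ not (lookup A (end₂ G e))

  grow : Subset (nV G) → Subset (nV G)
  grow S = tabulate λ w → lookup S w ∨ anyFin λ e → avoids′ e ∧ ((does (end₁ G e ≟F w) ∧ lookup S (end₂ G e)) ∨ (does (end₂ G e ≟F w) ∧ lookup S (end₁ G e)))

  reached : ℕ → Fin (nV G) → Subset (nV G)
  reached zero    u = ⁅ u ⁆
  reached (suc k) u = grow (reached k u)

  Ok : Fin (nE G) → Set
  Ok e = end₁ G e ∉ A × end₂ G e ∉ A

  reached⇒ : ∀ k u w → lookup (reached k u) w ≡ true → ReachVia G Ok u w
  reached⇒ zero u w h = subst (ReachVia G Ok u) (sym (Subₚ.x∈⁅y⁆⇒x≡y u (true⇒∈ h))) ε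
  reached⇒ (suc k) u w h = ∨-elim (lookup S w) (trans (sym (Vecₚ.lookup∘tabulate f w)) h) (reached⇒ k u w) λ q →
    let (e , r) = anyFin⁻ (g w) q ; (av , r′) = ∧-true {avoids′ e} r ; (a , b) = ∧-true {not (lookup A (end₁ G e))} av in
    step e (outside′ a , outside′ b) (∨-true {does (end₁ G e ≟F w) ∧ lookup S (end₂ G e)} r′)
    where
    S = reached k u
    g : Fin (nV G) → Fin (nE G) → Bool
    g w e = avoids′ e ∧ ((does (end₁ G e ≟F w) ∧ lookup S (end₂ G e)) ∨ (does (end₂ G e ≟F w) ∧ lookup S (end₁ G e)))
    f : Fin (nV G) → Bool
    f w = lookup S w ∨ anyFin (g w)
    outside′ : ∀ {v} → not (lookup A v) ≡ true → v ∉ A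
    outside′ q m = false≢true (∈⇒true m) (Boolₚ.not-injective q)
    step : ∀ e → Ok e → does (end₁ G e ≟F w) ∧ lookup S (end₂ G e) ≡ true ⊎ does (end₂ G e ≟F w) ∧ lookup S (end₁ G e) ≡ true → ReachVia G Ok u w
    step e ok (inj₁ q) = let (a , b) = ∧-true {does (end₁ G e ≟F w)} q in
      reached⇒ k u (end₂ G e) b ◅◅ ((e , ok , inj₂ (cong (_, end₂ G e) (point⇒≡ {g = w} {end₁ G e} a))) ◅ ε)
    step e ok (inj₂ q) = let (a , b) = ∧-true {does (end₂ G e ≟F w)} q in
      reached⇒ k u (end₁ G e) b ◅◅ ((e , ok , inj₁ (cong (end₁ G e ,_) (point⇒≡ {g = w} {end₂ G e} a))) ◅ ε)

-- Three rounds of growth reach all remaining vertices in the graphs at hand, whichever set of at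
-- most two vertices has been deleted.
connectedᵇ : Graph → Bool
connectedᵇ G = all (λ A → (3 ≤ᵇ ∣ A ∣) ∨ all (λ u → lookup A u ∨ all (λ w → lookup A w ∨ lookup (Search.reached G A 3 u) w) (allFin (nV G))) (allFin (nV G))) (subsets (nV G))

connectedᵇ⇒ : ∀ G → T (connectedᵇ G) → ∀ A → ∣ A ∣ < 3 → ConnectedAvoiding G A
connectedᵇ⇒ G ok A lt u w u∉ w∉ = at (T-∨ {3 ≤ᵇ ∣ A ∣} (T-all _ (subsets (nV G)) ok (∈-subsets A)))
  where
  at : T (3 ≤ᵇ ∣ A ∣) ⊎ T (all (λ u → lookup A u ∨ all (λ w → lookup A w ∨ lookup (Search.reached G A 3 u) w) (allFin (nV G))) (allFin (nV G))) → ReachVia G (Search.Ok G A) u w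
  at (inj₁ h) = absurd (<⇒≱ lt (≤ᵇ⇒≤ 3 ∣ A ∣ h))
  at (inj₂ h) = at-u (T-∨ {lookup A u} (T-all _ (allFin (nV G)) h (Memₚ.∈-allFin u)))
    where
    at-u : T (lookup A u) ⊎ T (all (λ w → lookup A w ∨ lookup (Search.reached G A 3 u) w) (allFin (nV G))) → ReachVia G (Search.Ok G A) u w
    at-u (inj₁ q) = absurd (u∉ (true⇒∈ (T⇒≡ q)))
    at-u (inj₂ q) = at-w (T-∨ {lookup A w} (T-all _ (allFin (nV G)) q (Memₚ.∈-allFin w)))
      where
      at-w : T (lookup A w) ⊎ T (lookup (Search.reached G A 3 u) w) → ReachVia G (Search.Ok G A) u w
      at-w (inj₁ r) = absurd (w∉ (true⇒∈ (T⇒≡ r)))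
      at-w (inj₂ r) = Search.reached⇒ G A 3 u w (T⇒≡ r)

simple? : ∀ G → Dec (Simple G)
simple? G = Finₚ.all? (λ e → ¬? (end₁ G e ≟F end₂ G e)) ×-dec Finₚ.all? λ e → Finₚ.all? λ f → (same? (ends G e) (ends G f) ⊎-dec same? (ends G e) (end₂ G f , end₁ G f)) →-dec (e ≟F f)
  where
  same? : (a c : Fin (nV G) × Fin (nV G)) → Dec (a ≡ c)
  same? (a , b) (c , d) = map′ (λ (q , r) → cong₂ _,_ q r) (λ q → cong proj₁ q , cong proj₂ q) ((a ≟F c) ×-dec (b ≟F d))

target-connected : ∀ t → isFano t ≡ false → ConnectedGraph 3 (graphOf t)
target-connected t33 _ = from-yes (simple? K33) , from-yes (3 <? 6) , connectedᵇ⇒ K33 tt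
target-connected t01 _ = from-yes (simple? K33⁰¹) , from-yes (3 <? 6) , connectedᵇ⇒ K33⁰¹ tt
target-connected t02 _ = from-yes (simple? K33⁰²) , from-yes (3 <? 6) , connectedᵇ⇒ K33⁰² tt
target-connected t11 _ = from-yes (simple? K33¹¹) , from-yes (3 <? 6) , connectedᵇ⇒ K33¹¹ tt
target-connected t5  _ = from-yes (simple? K5) , from-yes (3 <? 5) , connectedᵇ⇒ K5 tt

-- Roundedness of the families.

graph-rounded : ∀ five → GraphRounded 2 (map graphOf (familyOf five))
graph-rounded five = members , rounded
  where
  members : ∀ H → H ∈ₗ map graphOf (familyOf five) → ConnectedGraph 3 H
  members H m = let (t , t∈ , e) = Memₚ.∈-map⁻ graphOf m in subst (ConnectedGraph 3) (sym e) (target-connected t (proj₁ (member-allowed five t∈)))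
  rounded : ∀ G → ConnectedGraph 3 G → HasFamilyMinor G (map graphOf (familyOf five)) → ∀ X → ∣ X ∣ ≡ 2 → HasFamilyMinorContaining G (map graphOf (familyOf five)) X
  rounded G conn (H , m , model , _) X two = finish (Core.both (cycleSpace G) (GraphConnectivity.connected₃ G conn) no-fano five (member-allowed five t∈) minor′ e f)
    where
    no-fano : ∀ {C ψ} → Minor (cycleSpace G) C ψ (space fano) → Empty
    -- For graphs no regularity hypothesis is available, and the incidence matrix over `F₃` takes
    -- its place.
    no-fano = no-fano-minor (Incidence.incidence F₃ G) (represents-forest G) λ Y → Incidence.forest⇒independent F₃ G , Incidence.independent⇒forest F₃ G
    target = Memₚ.∈-map⁻ graphOf m
    t = proj₁ target
    t∈ = proj₁ (proj₂ target)
    minor′ : Minor (cycleSpace G) (lookup (MinorModel.C (subst (MinorModel G) (proj₂ (proj₂ target)) model))) (MinorModel.ψ (subst (MinorModel G) (proj₂ (proj₂ target)) model)) (space t)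
    minor′ = subst (Minor _ _ _) (sym (graph-space t (proj₁ (member-allowed five t∈)))) (FromModel.model⇒minor G (graphOf t) (subst (MinorModel G) (proj₂ (proj₂ target)) model))
    pair = two-members X two
    e = proj₁ pair
    f = proj₁ (proj₂ pair)
    finish : Core.HasMinor (cycleSpace G) (GraphConnectivity.connected₃ G conn) no-fano five (e ∷ f ∷ []) → HasFamilyMinorContaining G (map graphOf (familyOf five)) X
    finish (t′ , C′ , ψ′ , (nf , al) , M′ , g) = graphOf t′ , Memₚ.∈-map⁺ graphOf (allowed-member five t′ nf al) , ToModel.model G t′ nf M′ , λ i i∈ → g i (proj₂ (proj₂ pair) i i∈)

matroid-rounded : ∀ five → MatroidRounded 2 Regular (map (λ t → M[ graphOf t ]) (familyOf five))
matroid-rounded five = members , rounded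
  where
  members : ∀ N → N ∈ₗ map (λ t → M[ graphOf t ]) (familyOf five) → ConnectedMatroid 3 (proj₂ N)
  members N m = let (t , t∈ , e) = Memₚ.∈-map⁻ (λ t → M[ graphOf t ]) m in
    subst (λ N → ConnectedMatroid 3 (proj₂ N)) (sym e) (GraphConnectivity.connectedMatroid (graphOf t) (target-connected t (proj₁ (member-allowed five t∈))))
  rounded : ∀ n (M : Matroid n) → Regular M → ConnectedMatroid 3 (Matroid.Indep M) →
    HasMatroidFamilyMinorContaining (Matroid.Indep M) (map (λ t → M[ graphOf t ]) (familyOf five)) ⊥ →
    ∀ X → ∣ X ∣ ≡ 2 → HasMatroidFamilyMinorContaining (Matroid.Indep M) (map (λ t → M[ graphOf t ]) (familyOf five)) X
  rounded n M regular conn (N , m , has) X two = finish (Core.both K connK no-fano five (member-allowed five t∈) (proj₁ (proj₂ (proj₂ found))) e f)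
    where
    -- Regularity enters through two fields: `F₂` provides the cycle space in which the whole
    -- argument takes place, and `F₃` excludes the Fano plane.
    A₂ = proj₁ (proj₂ (regular F₂))
    iff₂ = proj₂ (proj₂ (regular F₂))
    A₃ = proj₁ (proj₂ (regular F₃))
    iff₃ = proj₂ (proj₂ (regular F₃))
    K : Binary n
    K = kernel (rowsOf A₂)
    rep : Represents (Matroid.Indep M) K
    rep Y = (λ i → proj₁ (represents₂ A₂ Y) (Equivalence.to (iff₂ Y) i)) , (λ i → Equivalence.from (iff₂ Y) (proj₂ (represents₂ A₂ Y) i))
    connK : Connected₃ K
    connK = connected⇒ rep conn
    no-fano : ∀ {C ψ} → Minor K C ψ (space fano) → Empty
    no-fano = no-fano-minor A₃ rep λ Y → Equivalence.to (iff₃ Y) , Equivalence.from (iff₃ Y)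
    target = Memₚ.∈-map⁻ (λ t → M[ graphOf t ]) m
    t = proj₁ target
    t∈ = proj₁ (proj₂ target)
    forest-space : ∀ t → isFano t ≡ false → Represents (Forest (graphOf t)) (space t)
    forest-space t nf = subst (Represents (Forest (graphOf t))) (sym (graph-space t nf)) (represents-forest (graphOf t))
    has′ : HasMatroidMinorContaining (Matroid.Indep M) (Forest (graphOf t)) ⊥
    has′ = subst (λ N → HasMatroidMinorContaining (Matroid.Indep M) (proj₂ N) ⊥) (proj₂ (proj₂ target)) has
    found = matroid-minor⇒ rep (forest-space t (proj₁ (member-allowed five t∈))) has′
    pair = two-members X two
    e = proj₁ pair
    f = proj₁ (proj₂ pair)
    finish : Core.HasMinor K connK no-fano five (e ∷ f ∷ []) → HasMatroidFamilyMinorContaining (Matroid.Indep M) (map (λ t → M[ graphOf t ]) (familyOf five)) X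
    finish (t′ , C′ , ψ′ , (nf , al) , M′ , g) = M[ graphOf t′ ] , Memₚ.∈-map⁺ (λ t → M[ graphOf t ]) (allowed-member five t′ nf al) ,
      matroid-minor⇐ rep (forest-space t′ nf) M′ λ i i∈ → g i (proj₂ (proj₂ pair) i i∈)

theorem1 : GraphRounded 2 (K33 ∷ K33⁰¹ ∷ K33⁰² ∷ K33¹¹ ∷ []) ×
    GraphRounded 2 (K33 ∷ K33⁰¹ ∷ K33⁰² ∷ K33¹¹ ∷ K5 ∷ []) ×
    MatroidRounded 2 Regular (M[ K33 ] ∷ M[ K33⁰¹ ] ∷ M[ K33⁰² ] ∷ M[ K33¹¹ ] ∷ []) ×
    MatroidRounded 2 Regular (M[ K33 ] ∷ M[ K33⁰¹ ] ∷ M[ K33⁰² ] ∷ M[ K33¹¹ ] ∷ M[ K5 ] ∷ [])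
theorem1 = graph-rounded false , graph-rounded true , matroid-rounded false , matroid-rounded true
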